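{- Let $n\geq 3$ and let $r,s\in\mathbb{N}$ with $r+s=n$. Let $\mathcal{S}_{r,s}$ be the set of nondegenerate $n$-ary quadratic forms $f\in\mathbb{Z}[t_1,\dots,t_n]$ of signature $(r,s)$. Then the set $\mathcal{D}_{r,s}\coloneqq\{\delta(f)\mid f\in\mathcal{S}_{r,s}\}$ is dense in $[0,1]$.
   Context: A form $f$ has signature $(r,s)$ if over $\mathbb{R}$ it is equivalent to $x_1^2+\dots+x_r^2-x_{r+1}^2-\dots-x_{r+s}^2$. $D_f\coloneqq f(\mathbb{Z}^n)\setminus\{0\}$. For $S\subset\mathbb{Z}$: $S$ is positive if it contains no negative integers, negative if it contains no positive integers, indefinite otherwise. The density of $S$ is $\lim_{N\to\infty}\#(S\cap[1,N])/N$, $\lim_{N\to\infty}\#(S\cap[-N,-1])/N$, or $\lim_{N\to\infty}\#(S\cap[-N,N])/(2N)$ according as $S$ is positive, negative or indefinite. $\delta(f)$ denotes the density of $D_f$. -}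

module Defs where

open import Data.Nat as ℕ using (ℕ; zero; suc)
open import Data.Fin using (Fin; toℕ)
import Data.Fin as Fin
open import Data.Integer as ℤ using (ℤ; +_)
open import Data.Rational as ℚ using (ℚ; _/_; _<_; _≤_; ∣_∣; _-_; 0ℚ; 1ℚ)
open import Data.Product using (Σ; ∃; _×_; _,_)
open import Data.Sum using (_⊎_)
open import Relation.Nullary using (¬_)
open import Relation.Binary.PropositionalEquality using (_≡_; _≢_)

sumℤ : ∀ {n} → (Fin n → ℤ) → ℤ
sumℤ {zero}  f = + 0
sumℤ {suc n} f = f Fin.zero ℤ.+ sumℤ (λ i → f (Fin.suc i))

sumℚ : ∀ {n} → (Fin n → ℚ) → ℚ
sumℚ {zero}  f = 0ℚ
sumℚ {suc n} f = f Fin.zero ℚ.+ sumℚ (λ i → f (Fin.suc i))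

-- An n-ary integral quadratic form f = Σ_{i,j} a i j t_i t_j ∈ ℤ[t_1..t_n],
-- given by its (not necessarily symmetric) coefficient array.

QForm : ℕ → Set
QForm n = Fin n → Fin n → ℤ

eval : ∀ {n} → QForm n → (Fin n → ℤ) → ℤ
eval a x = sumℤ (λ i → sumℤ (λ j → a i j ℤ.* (x i ℤ.* x j)))

evalℚ : ∀ {n} → QForm n → (Fin n → ℚ) → ℚ
evalℚ a x = sumℚ (λ i → sumℚ (λ j → (a i j / 1) ℚ.* (x i ℚ.* x j)))

-- Gram matrix (twice the symmetric matrix of f): b i j = a i j + a j i.
-- f is nondegenerate iff the associated bilinear form has trivial radical,
-- i.e. (A + Aᵀ) x = 0 has only the zero solution (over ℤ, equivalently ℚ).
Nondegenerate : ∀ {n} → QForm n → Set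
Nondegenerate {n} a =
  (x : Fin n → ℤ) →
  (∀ i → sumℤ (λ j → (a i j ℤ.+ a j i) ℤ.* x j) ≡ + 0) →
  ∀ i → x i ≡ + 0

Invertible : ∀ {n} → (Fin n → Fin n → ℚ) → Set
Invertible {n} P = Σ (Fin n → Fin n → ℚ) λ Q →
  ∀ i j → sumℚ (λ k → P i k ℚ.* Q k j) ≡ (if⁼ i j)
  where
  if⁼ : Fin n → Fin n → ℚ
  if⁼ i j with i Fin.≟ j
  ... | Relation.Nullary.yes _ = 1ℚ
  ... | Relation.Nullary.no  _ = 0ℚ

-- Signature (r , s): f is equivalent (by an invertible rational, hence real,
-- change of variables) to Σ d_i y_i² with d_i > 0 for the first r indices and
-- d_i < 0 for the remaining s indices (n = r + s).  By rational diagonalisation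
-- and Sylvester's law of inertia this is equivalent to real equivalence with
-- x_1²+…+x_r²-x_{r+1}²-…-x_{r+s}².
HasSignature : ∀ {n} → QForm n → ℕ → ℕ → Set
HasSignature {n} a r s =
  (r ℕ.+ s ≡ n) ×
  Σ (Fin n → Fin n → ℚ) λ P → Invertible P ×
  Σ (Fin n → ℚ) λ d →
    (∀ i → toℕ i ℕ.< r → 0ℚ < d i) ×
    (∀ i → r ℕ.≤ toℕ i → d i < 0ℚ) ×
    (∀ (y : Fin n → ℚ) →
       evalℚ a (λ i → sumℚ (λ k → P i k ℚ.* y k))
         ≡ sumℚ (λ i → d i ℚ.* (y i ℚ.* y i)))

InS : ∀ {n} → ℕ → ℕ → QForm n → Set
InS r s a = Nondegenerate a × HasSignature a r s

D : ∀ {n} → QForm n → ℤ → Set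
D {n} a m = (m ≢ + 0) × ∃ λ (x : Fin n → ℤ) → eval a x ≡ m

data Count (g : ℕ → Set) : ℕ → ℕ → Set where
  c0   : Count g 0 0
  cyes : ∀ {L k} → g L → Count g L k → Count g (suc L) (suc k)
  cno  : ∀ {L k} → ¬ g L → Count g L k → Count g (suc L) k

Positive Negative Indefinite : (ℤ → Set) → Set
Positive S = ∀ m → S m → ¬ (m ℤ.< + 0)
Negative S = ∀ m → S m → ¬ (+ 0 ℤ.< m)
Indefinite S = ¬ Positive S × ¬ Negative S

-- Ratio sequences, as relations "q is the N-th ratio" (for N = suc M ≥ 1).
-- positive:   #(S ∩ [1,N]) / N
PosRatio : (ℤ → Set) → ℕ → ℚ → Set
PosRatio S M q = ∃ λ k → Count (λ i → S (+ suc i)) (suc M) k × q ≡ (+ k) / suc M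
NegRatio : (ℤ → Set) → ℕ → ℚ → Set
NegRatio S M q = ∃ λ k → Count (λ i → S (ℤ.- (+ suc i))) (suc M) k × q ≡ (+ k) / suc M
IndRatio : (ℤ → Set) → ℕ → ℚ → Set
IndRatio S M q = ∃ λ k →
  Count (λ i → S (+ i ℤ.- + suc M)) (suc (2 ℕ.* suc M)) k × q ≡ (+ k) / (2 ℕ.* suc M)

-- The (relationally given) sequence R converges to a real limit lying in the
-- open interval (a , b): it is Cauchy, and eventually stays in some [c , d]
-- with a < c ≤ d < b.
LimitIn : (ℕ → ℚ → Set) → ℚ → ℚ → Set
LimitIn R a b =
  (∀ ε → 0ℚ < ε → ∃ λ M₀ → ∀ M M' q q' → M₀ ℕ.≤ M → M₀ ℕ.≤ M' →
       R M q → R M' q' → ∣ q - q' ∣ < ε) ×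
  Σ ℚ λ c → Σ ℚ λ d → (a < c) × (d < b) ×
    ∃ λ M₀ → ∀ M q → M₀ ℕ.≤ M → R M q → (c ≤ q) × (q ≤ d)

DensityIn : (ℤ → Set) → ℚ → ℚ → Set
DensityIn S a b =
  (Positive S × LimitIn (PosRatio S) a b) ⊎
  (Negative S × LimitIn (NegRatio S) a b) ⊎
  (Indefinite S × LimitIn (IndRatio S) a b)

{-# OPTIONS --safe #-}
module Submission where

-- Fix a large prime ℓ ≡ 3 (mod 4), put K = (ℓ + 1)/4 and let P be a product of primes p > ℓ. Every form below is
-- built so that modulo P it factors through a binary form that is anisotropic at each p ∣ P; hence its values m lie
-- in L = { m : v_p(m) ≠ 1 for all p ∣ P }, a periodic set of density ∏ (1 - 1/p + 1/p²).
-- Indefinite case: y (P k + w y) + z², with w = ℓ (4 s² + 1), represents all of L.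
-- Definite case: x² + y² + y z + K z² restricted to x ≡ s (2 y + z) mod P represents almost every m ∈ L prime to ℓ.
-- This is a second moment estimate in each residue class; the multiples of ℓ are reached by descent, in steps of ℓ².
-- Further variables are added with coefficient P², which does not leave L.
-- By Erdős' count of smooth numbers the product tends to 0 over the primes p > ℓ, with factors ≥ 1 - 1/ℓ, so that
-- its partial products enter every subinterval of [0 , 1] that is long compared with 1/ℓ.

open import Defs
open import Data.Nat
open import Data.Nat.Properties
open import Data.Nat.Divisibility
open import Data.Nat.DivMod
open import Data.Nat.GCD
open import Data.Nat.Coprimality using (Coprime; coprime-divisor; coprime?)
import Data.Nat.Coprimality as Coprimality
open import Data.Product using (Σ; ∃; _×_; _,_; proj₁; proj₂)
open import Data.Sum using (_⊎_; inj₁; inj₂)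
open import Data.Empty using (⊥; ⊥-elim)
open import Relation.Nullary using (¬_; Dec; yes; no; contradiction)
open import Relation.Binary.PropositionalEquality hiding (J)
open import Data.Nat.Tactic.RingSolver using (solve-∀)
open import Data.Integer using (ℤ; +_; 0ℤ) renaming (_+_ to _+z_; _*_ to _*z_; _-_ to _-z_; -_ to -z_; ∣_∣ to abs)
import Data.Integer as ℤ
import Data.Integer.Properties as ℤₚ
open import Data.Integer.Divisibility.Signed using () renaming (_∣_ to _∣z_; divides to dividesz)
import Data.Integer.Divisibility.Signed as ℤ∣
open import Data.Integer.Tactic.RingSolver using () renaming (solve-∀ to solve-∀z)
open import Data.Nat.Primality using (Prime; prime?; euclidsLemma; prime⇒nonZero; prime⇒nonTrivial; prime⇒irreducible; ¬prime⇒composite; irreducible⇒prime; composite)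
open import Data.Nat.Induction using (<-rec)
open import Data.Fin using (Fin; toℕ; fromℕ<)
import Data.Fin as Fin
import Data.Fin.Properties as Finₚ
import Data.Integer.DivMod as ℤ/
open import Data.Rational using (ℚ; 0ℚ; 1ℚ)
import Data.Rational as ℚ
import Data.Rational.Properties as ℚₚ
open import Data.Rational.Unnormalised using (mkℚᵘ; *≡*; *<*; *≤*)
import Data.Rational.Unnormalised.Properties as ℚᵘₚ
open import Relation.Nullary.Decidable using (decidable-stable; dec⇒maybe; map′; _×-dec_; _⊎-dec_; ¬?)
import Tactic.RingSolver as RingSolver
open import Tactic.RingSolver.Core.AlmostCommutativeRing using (AlmostCommutativeRing; fromCommutativeRing)
open import Algebra.Properties.AbelianGroup ℚₚ.+-0-abelianGroup using (xyx⁻¹≈y; ⁻¹-anti-homo‿-; ⁻¹-involutive)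
open import Data.Fin.Patterns using (0F; 1F; 2F)

-- Polynomial identities

-- A positive definite ternary form may miss integers that it represents everywhere locally, without
-- any congruence to explain it; hence the definite case argues about almost all m and never about a
-- single m. The second moment helps only if it agrees to leading order with the prediction from
-- independence. This shapes the boxes: x runs over an interval that is long compared with those of
-- y and z, and congruences modulo H remove all common divisors up to a bound Q. With exactly three
-- variables the values divisible by ℓ do not fill L, because for odd ℓ-adic valuation the part of m
-- prime to ℓ must satisfy a square condition modulo ℓ. That density is therefore shown to exist by
-- approximating the set of values by periodic sets, and it is located only up to 1/ℓ; this is why ℓ
-- must be large compared with the denominators of a and b. In the indefinite case y is sought in
-- the shape a² - m b², a norm from ℚ(√m). Then m is automatically a square modulo y, which is what
-- the divisibility of m - z² by y asks for.

ring1 : ∀ a b c d → a * (b * c) + a * (b * d) ≡ a * (b * (d + c))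
ring1 = solve-∀

ring2 : ∀ a b c → a + b + c ≡ b + c + a
ring2 = solve-∀

ring3 : ∀ a b → (a + suc b) * (a + suc b) ≡ suc b * (2 * a) + suc b * b + (a * a + suc b)
ring3 = solve-∀

ring4 : ∀ a b c → 2 * (a * (b + c)) ≡ 2 * a * b + 2 * a * c
ring4 = solve-∀

ringz1 : ∀ a b c d → b *z (d -z a *z c) +z a *z (b *z c -z + 1) ≡ b *z d -z a
ringz1 = solve-∀z

ringz2 : ∀ a b c d e → a *z a *z (+ 1 *z (c *z c) +z d *z d +z d *z e +z b *z (e *z e)) ≡ + 1 *z ((c *z a) *z (c *z a)) +z (d *z a) *z (d *z a) +z (d *z a) *z (e *z a) +z b *z ((e *z a) *z (e *z a))
ringz2 = solve-∀z

ringz3 : ∀ a b c d e → c *z a -z b *z (+ 2 *z (d *z a) +z e *z a) ≡ a *z (c -z b *z (+ 2 *z d +z e))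
ringz3 = solve-∀z

ring5 : ∀ a b → 1 * (a * b) ≡ b * (1 * a)
ring5 = solve-∀

ring6 : ∀ a b c d → a + b * (c + d) ≡ a + b * c + b * d
ring6 = solve-∀

ringz4 : ∀ a b → b -z a ≡ (a +z b) -z + 2 *z a
ringz4 = solve-∀z

ringz5 : ∀ a b c → (a -z + 2 *z b) -z (a -z + 2 *z c) ≡ + 2 *z (c -z b)
ringz5 = solve-∀z

ring7 : ∀ a b c d → a * (b * c + d) ≡ b * (a * c) + d * a
ring7 = solve-∀

ring8 : ∀ a b c d → a * a * (a * a) * (b * (c * d)) + a * a * (a * a) * (b * (c * d)) ≡ b * (2 * (a * a * c * (a * (d * a))))
ring8 = solve-∀

ring9 : ∀ a b c d e → a * (b * c + d * d * e) ≡ a * b * c + d * (a * (d * e))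
ring9 = solve-∀

ring10 : ∀ a b c d e → a * b * c + d * (suc a * (b * e)) ≡ b * (a * c + d * e) + b * (a * (d * e))
ring10 = solve-∀

ring11 : ∀ a b c → a * (b * (2 * c + c)) ≡ b * (c * (3 * a))
ring11 = solve-∀

ring12 : ∀ a b → a * (suc b * suc b) ≡ a * (b * b) + a * (2 * b + 1)
ring12 = solve-∀

ring13 : ∀ a b c → a * (b * c) ≡ b * a * c
ring13 = solve-∀

ringz6 : ∀ a b c → (c *z a +z b) -z c *z a ≡ b
ringz6 = solve-∀z

ringz7 : ∀ a b → (+ 2 *z a +z b) -z b ≡ + 2 *z a
ringz7 = solve-∀z

ring14 : ∀ a b c → a * (b * (c + 1)) ≡ a * b * c + a * b
ring14 = solve-∀

ring15 : ∀ a → 1 * (a * (1 * 1)) ≡ a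
ring15 = solve-∀

ringz8 : ∀ a b c → b -z a ≡ (b -z c) -z (a -z c)
ringz8 = solve-∀z

ring16 : ∀ a b c d → a * (b * (c * d)) ≡ b * (a * d * c)
ring16 = solve-∀

ring17 : ∀ a b c d e f → 2 * (a + b * (2 * c + d)) + (e + b * f) ≡ (2 * (a + b * (2 * c)) + (e + b * f)) + 2 * b * d
ring17 = solve-∀

ring18 : ∀ a b c → a + b + c ≡ b + (a + c)
ring18 = solve-∀

ring19 : ∀ a b c d e f g h → (c + c) * ((c + c) * (2 * a * b * ((c + c) * c) + d * e * (c + c))) + d * (a * f * g) * h ≡ a * b * ((c + c) * (c + c) * ((c + c) * (c + c))) + (c + c) * (c + c) * (c + c) * (d * e) + d * a * (f * g * h)
ring19 = solve-∀

ring20 : ∀ a b c d e → a * b + d + (a * c + e) ≡ a * (b + c) + (d + e)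
ring20 = solve-∀

ring21 : ∀ a → 0 + 2 * (a + 0) ≡ 1 * (2 * a) + 1 * 0
ring21 = solve-∀

ring22 : ∀ a b → suc b * (2 * a) + suc b * b + 2 * (a + suc b) ≡ suc (suc b) * (2 * a) + suc (suc b) * suc b
ring22 = solve-∀

ring23 : ∀ a b c d → a * (b * b) * (c * c) * (d * d) ≡ a * (b * (d * c) * (b * (d * c)))
ring23 = solve-∀

ring24 : ∀ a b c d → a * (b * b) * (c * c) * d ≡ a * b * c * b * (c * d)
ring24 = solve-∀

ring25 : ∀ a b c d e → b * (a * b * c * d * e) ≡ a * b * c * b * (d * e)
ring25 = solve-∀

ring26 : ∀ a b c → a * (2 * (2 * b) * c) + c ≡ (a * (2 * (2 * b)) + 1) * c
ring26 = solve-∀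

ring27 : ∀ a b c d e → a * (b * (c * (d * (e + e))) * (b * (c * (d * (e + e))))) ≡ a * (b * (c * (d * 2)) * (b * (c * (d * 2)))) * (e * e)
ring27 = solve-∀

ring28 : ∀ a → 3 + a * 4 ≡ suc (2 * (1 + a * 2))
ring28 = solve-∀

ringz9 : ∀ a b → (b *z b +z + 1) +z a *z (a -z + 2 *z b) ≡ (a -z b) *z (a -z b) +z + 1
ringz9 = solve-∀z

ringz10 : ∀ a b c → (a *z a -z b *z (c *z c)) -z a *z a ≡ -z b *z c *z c
ringz10 = solve-∀z

ring29 : ∀ a b c d e f → (a + (b + c)) * d * f + (a + (b + c)) * e * f ≡ (a + b + c) * (d + e) * f
ring29 = solve-∀

ring30 : ∀ a b c d → a * (b * c) * d ≡ a * c * (b * d)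
ring30 = solve-∀

ring31 : ∀ a b c d e f → (a * b + c * d) * (e * f) ≡ a * e * f * b + c * (e * d) * f
ring31 = solve-∀

ring32 : ∀ a b c d → a * b * c * d ≡ a * (b * d) * c
ring32 = solve-∀

ring33 : ∀ a b → 4 * a * b ≡ 2 * (2 * a * b)
ring33 = solve-∀

ring34 : ∀ a b → a * (2 * b) ≡ 2 * (a * b)
ring34 = solve-∀

ringz11 : ∀ a b → 0ℤ -z (a -z b) ≡ b -z a
ringz11 = solve-∀z

ringz12 : ∀ a b → (a +z b) -z a ≡ b
ringz12 = solve-∀z

ringz13 : ∀ a b c → (a -z b) +z (b -z c) ≡ a -z c
ringz13 = solve-∀z

ringz14 : ∀ a b c d e f g h → (c -z d) -z a *z (b *z (e -z f) +z (g -z h)) +z (d -z a *z (b *z f +z h)) ≡ c -z a *z (b *z e +z g)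
ringz14 = solve-∀z

ringz15 : ∀ a b c d → + 4 *z (+ 1 *z ((a *z d) *z (a *z d))) +z (b *z d) *z (b *z d) +z d *z (c *z c) ≡ d *z (d *z (+ 4 *z (a *z a) +z b *z b) +z c *z c)
ringz15 = solve-∀z

ringz16 : ∀ a b → + 4 *z (a *z b) ≡ a *z (+ 4 *z b)
ringz16 = solve-∀z

ringz17 : ∀ a b c → a *z a -z (c *z b +z a *z a) ≡ c *z (-z b)
ringz17 = solve-∀z

ring35 : ∀ a b c → b * (a * (c * a)) ≡ a * a * b * c
ring35 = solve-∀

ringz18 : ∀ a b c → + 4 *z (a +z b *z c) ≡ + 4 *z a +z + 4 *z (b *z c)
ringz18 = solve-∀z

ringz19 : ∀ a b c → (a *z b +z c) -z c ≡ b *z a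
ringz19 = solve-∀z

ringz20 : ∀ a b → a -z b +z b ≡ a
ringz20 = solve-∀z

ringz21 : ∀ a b c d → a *z b +z (c +z a *z d) ≡ c +z a *z (b +z d)
ringz21 = solve-∀z

ring36 : ∀ a → suc (3 + a * 4) ≡ 4 * suc a
ring36 = solve-∀

ring37 : ∀ a b c d e → a * a * (b * b * (c * d * e)) ≡ a * c * (b * d) * (a * b * e)
ring37 = solve-∀

ring38 : ∀ a → 2 * a * (2 * a) * (2 * a) ≡ 8 * (a * a * a)
ring38 = solve-∀

ring39 : ∀ a b c d e → 1 * (a * b * (c * (d * e))) ≡ a * c * (b * d) * e
ring39 = solve-∀

ring40 : ∀ a b c d e f → a * (b * ((c + d * e) * f)) ≡ c * (a * (b * f)) + d * (a * (b * (e * f)))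
ring40 = solve-∀

ringz22 : ∀ a b c → b -z a ≡ (c +z b) -z c -z a
ringz22 = solve-∀z

ringz23 : ∀ a b c → (a +z b) -z c -z a ≡ b -z c
ringz23 = solve-∀z

ringz24 : ∀ a b → (a -z b) +z b ≡ a
ringz24 = solve-∀z

ringz25 : ∀ a b c → a ≡ (a +z b +z c) -z (b +z c)
ringz25 = solve-∀z

ringz26 : ∀ a b c d e f → a *z (c -z b) *z f ≡ (a *z (c -z d) *z f -z a *z (b -z d) *z e) +z a *z (b -z d) *z (e -z f)
ringz26 = solve-∀z

ring41 : ∀ a b c → 2 * (a + 2 * b * c) ≡ 2 * a + 4 * b * c
ring41 = solve-∀

ringz27 : ∀ a b → + 2 *z (a *z b) ≡ a *z (+ 2 *z b)
ringz27 = solve-∀z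

ring42 : ∀ a → suc (suc (1 + 2 * a)) ≡ 1 + 2 * suc a
ring42 = solve-∀

ring43 : ∀ a b c d → 2 * a + (1 + 2 * b + c * 2 * d) ≡ 1 + 2 * (a + b + c * d)
ring43 = solve-∀

ring44 : ∀ a b c d e → a + b * 2 * c + 2 * d * e ≡ a + 2 * (b * c + d * e)
ring44 = solve-∀

ring45 : ∀ a b c → 2 * a + 2 * b * c ≡ 2 * (a + b * c)
ring45 = solve-∀

ring46 : ∀ a b c → a * b + a * c ≡ (b + c) * (1 * a)
ring46 = solve-∀

ring47 : ∀ a b c → a * (1 + b) * c ≡ a * (c + c * b)
ring47 = solve-∀

ring48 : ∀ a b c → a * (b * c) ≡ b * (a * c)
ring48 = solve-∀

ring49 : ∀ a b c d → a * (b * (c + d)) ≡ b * (a * c) + b * (a * d)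
ring49 = solve-∀

ring50 : ∀ a b c d e f g → a * (2 * b * c * d + e + f) + a * (f * g) ≡ d * (2 * b * a * c) + a * (e + f + f * g)
ring50 = solve-∀

ring51 : ∀ a b c d e f g h → a * (2 * b * c * d) + e * a * (f + g + g * h) ≡ a * (1 * (2 * b * c * d + e * (f + g)) + e * g * h)
ring51 = solve-∀

ring52 : ∀ a b c → a * b * c ≡ b * c * a
ring52 = solve-∀

ring53 : ∀ a b c → a * b * c ≡ 1 * (b * (c * a))
ring53 = solve-∀

ring54 : ∀ a b → suc a + 1 + b ≡ suc (a + suc b)
ring54 = solve-∀

ring55 : ∀ a b c d e → a * (b * c * (b * c)) + b * (d + d) * (b * (d + d)) + b * (d + d) * (b * d) + e * (b * d * (b * d)) ≡ a * (b * c * (b * c)) + b * b * (d * ((6 + e) * d))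
ring55 = solve-∀

ring56 : ∀ a b c d → a * (b * c * (b * c)) + a * (b * b * (d * (2 * c + d))) ≡ a * (b * (c + d) * (b * (c + d)))
ring56 = solve-∀

ring57 : ∀ a b c d e f → a * (2 * b * ((c + d) * e)) * f ≡ a * b * e * f * (2 * (c + d))
ring57 = solve-∀

ringz28 : ∀ a b c → a *z (c *z c) -z (a *z (c *z c) -z b) ≡ b
ringz28 = solve-∀z

ringz29 : ∀ a → a -z (a -z + 1) ≡ + 1
ringz29 = solve-∀z

ringz30 : ∀ a → 0ℤ -z (-z a) ≡ a
ringz30 = solve-∀z

ringz31 : ∀ a b → (b *z b +z a *z (+ 4 *z (0ℤ *z 0ℤ) +z + 1)) -z b *z b ≡ a
ringz31 = solve-∀z

ringz32 : ∀ a b c d e f g → e *z e *z ((g *z g +z a *z (+ 4 *z ((b *z d) *z (b *z d)) +z + 1)) -z (f *z f +z a *z (+ 4 *z (0ℤ *z 0ℤ) +z + 1)) *z (+ 4 *z ((b *z d) *z (b *z d)) +z + 1)) +z ((f *z e) *z (f *z e) *z (b *z b *z ((+ 2 *z d) *z (+ 2 *z d) -z + 1 *z + 1))) +z (b *z b +z + 1) *z ((f *z e) *z (f *z e) -z + 1 *z + 1) +z (b *z b -z c) ≡ (g *z e) *z (g *z e) -z (+ 1 +z c)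
ringz32 = solve-∀z

ringz33 : ∀ a b → (a +z + 1) -z (a -z b) ≡ b +z + 1
ringz33 = solve-∀z

ring58 : ∀ a → 2 * a * (2 * a) + 1 ≡ 1 + a * a * 4
ring58 = solve-∀

ring59 : ∀ a → suc (1 + 2 * a) ≡ 2 * suc a
ring59 = solve-∀

ringz34 : ∀ a b c d → a *z (b *z b) +z c *z c -z d ≡ a *z (b *z b) -z (d -z c *z c)
ringz34 = solve-∀z

ringz35 : ∀ a b c → 0ℤ -z (a *z (b *z b) -z c *z b) ≡ b *z (c -z a *z b)
ringz35 = solve-∀z

ring60 : ∀ a b c → (2 * a + 0) * b * c ≡ 2 * a * c * b
ring60 = solve-∀

ring61 : ∀ a b → 4 * (suc a * b) ≡ (4 + 4 * a) * b
ring61 = solve-∀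

ring62 : ∀ a b c d e f → a * (b * (suc c * suc c)) * d + e * (f * suc c) * d ≡ a * b * (c * suc c * d) + (e * f * (suc c * d) + a * (b * suc c) * d)
ring62 = solve-∀

ring63 : ∀ a b c d e → a * b * (c * suc c * d) + (a * b * (suc c * d) + a * (e * suc c) * suc c) + a * b * d ≡ a * (b * (suc c * suc c + 1)) * d + a * (e * (suc c * suc c))
ring63 = solve-∀

ring64 : ∀ a b c d e → a * (b + c) * d + e ≡ a * b * d + e + a * c * d
ring64 = solve-∀

ring65 : ∀ a b → (2 * (a * b) + 1) * a + a ≡ 2 * a * suc (a * b)
ring65 = solve-∀

ring66 : ∀ a b c → 2 * a * (b * c) ≡ b * (2 * a * c)
ring66 = solve-∀

ring67 : ∀ a b c d → 2 * a * (b * suc c + d) ≡ 2 * (a * b) * c + 2 * a * (b + d)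
ring67 = solve-∀

ring68 : ∀ a b → a * b + b ≡ (a + 1) * b
ring68 = solve-∀

ring69 : ∀ a b c d → a * (4 * (b * c * d)) + b ≡ (4 * (a * c * d) + 1) * b
ring69 = solve-∀

ring70 : ∀ a b c → (4 * a + 1) * c + (3 * c + 4 * b * c) ≡ 4 * (suc (a + b) * c)
ring70 = solve-∀

ring71 : ∀ a b c d → 4 * (a * b * c * d) ≡ 4 * (a * c) * (b * d)
ring71 = solve-∀

ring72 : ∀ a b c d e → 4 * (a * b) * (c * (d + e + 1) + c * c) ≡ 4 * (a * c * b) * d + 4 * (a * c) * (b * e) + 4 * (a * b * (c + c * c))
ring72 = solve-∀

ring73 : ∀ a b c → a + 2 * b + c + b ≡ a + (3 * b + c)
ring73 = solve-∀

ringz36 : ∀ a b → (a *z b) *z (a *z b) ≡ a *z a *z (b *z b)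
ringz36 = solve-∀z

ringz37 : ∀ a b → a +z b *z b *z 0ℤ ≡ a
ringz37 = solve-∀z

ringz38 : ∀ a b c → (a -z + 4 *z b) -z + 4 *z c ≡ a -z + 4 *z (b +z c)
ringz38 = solve-∀z

ringz39 : ∀ a b c → (a -z + 4 *z (b +z c)) +z + 4 *z c ≡ a -z + 4 *z b
ringz39 = solve-∀z

ring74 : ∀ a b → a * b * (a * b) ≡ a * a * (b * b)
ring74 = solve-∀

ring75 : ∀ a b → a * a * b ≡ a * (b * a)
ring75 = solve-∀

ring76 : ∀ a b c d → a * (suc a * (b * (c + 1 * d))) ≡ suc a * (a * (b * c)) + b * (a * (suc a * d))
ring76 = solve-∀

ring77 : ∀ a b c → suc (a + b) * (c * a) + b * c ≡ (a + b) * (c * suc a)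
ring77 = solve-∀

ring78 : ∀ a → 2 * (8 * a) + 2 * (8 * a) ≡ 32 * a
ring78 = solve-∀

ring79 : ∀ a b → 2 * (4 * (a * b)) ≡ 8 * a * b
ring79 = solve-∀

ring80 : ∀ a b → 8 * a * b ≡ 8 * b * a
ring80 = solve-∀

ring81 : ∀ a b → 8 * (2 * a * b) * (2 * a * b) ≡ 32 * (a * a * (b * b))
ring81 = solve-∀

ring82 : ∀ a b c → a * (b * c) ≡ a * c * b
ring82 = solve-∀

ring83 : ∀ a b → 2 * (2 * a * (2 * a)) * b * (2 * a * b) ≡ 16 * (a * a * a * (b * b))
ring83 = solve-∀

ring84 : ∀ a b c → (a + 1) * ((b + 1) * (c + 1)) ≡ a * b * c + ((a + 1) * (b + 1) + (c * a + c * b + c))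
ring84 = solve-∀

ring85 : ∀ a b → (a + 1) * (b + 1) + (b * a + a * b + a) + (a + a + 3 * b + 3 + a * b) ≡ 4 * ((a + 1) * (b + 1))
ring85 = solve-∀

ring86 : ∀ a b c d e f → a * (b * (d + e) + c * f) ≡ b * (a * d) + a * (b * e + c * f)
ring86 = solve-∀

ring87 : ∀ a b c → a * a + b * c * (b * c) ≡ a * a * 1 + b * b * (c * c)
ring87 = solve-∀

ring88 : ∀ a b c d e f → 2 * (b + a * (2 * d + f)) + (c + a * e) ≡ (2 * b + c) + a * (2 * (2 * d + f) + e)
ring88 = solve-∀

ringz40 : ∀ a b c d e → (+ 2 *z a +z b *z (+ 2 *z c +z d)) -z (+ 2 *z a +z b *z (+ 2 *z c +z e)) ≡ b *z (d -z e)
ringz40 = solve-∀z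

ringz41 : ∀ a b c d e f g → a -z b ≡ (a +z (c -z + 2 *z e) *z f +z g) -z (b +z (c -z + 2 *z d) *z f +z g) +z + 2 *z ((e -z d) *z f)
ringz41 = solve-∀z

ringz42 : ∀ a b c d e f → + 2 *z (a *z b *z c *z (e -z d) -z f) ≡ a *z b *z (c *z ((e +z (b +z e)) -z (d +z (b +z d)))) -z + 2 *z f
ringz42 = solve-∀z

ringz43 : ∀ a b c → a *z (b -z c) ≡ a *z b -z a *z c
ringz43 = solve-∀z

ring89 : ∀ a b c d → a * b * (c * d) ≡ a * c * b * d
ring89 = solve-∀

ring90 : ∀ a b → 2 * a * b ≡ a * (2 * b)
ring90 = solve-∀

ring91 : ∀ a b c d → 2 * a + a * (2 * b + (c + d)) ≡ 2 * a * b + a * (suc c + suc d)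
ring91 = solve-∀

ring92 : ∀ a b c → 2 * a * b + a * (c + c) ≡ 2 * a * b + 2 * a * c
ring92 = solve-∀

ring93 : ∀ a b → 2 * a * b + a * (2 * b + 2 * b) ≡ 3 * (2 * a * b)
ring93 = solve-∀

ring94 : ∀ a b → 2 * a * b + a * (2 * b) ≡ 2 * (2 * a * b)
ring94 = solve-∀

ring95 : ∀ a → 2 * (3 * a) + 2 * a ≡ 8 * a
ring95 = solve-∀

ring96 : ∀ a b → 2 * (2 * a) * b ≡ 2 * (a * (2 * b))
ring96 = solve-∀

ring97 : ∀ a b → 3 * b + 2 * a * (2 * b) ≡ (3 + 4 * a) * b
ring97 = solve-∀

ring98 : ∀ a b c → a * (8 * (b * a)) + a * ((3 + 4 * c) * (b * a)) ≡ (11 + 4 * c) * (b * a * a)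
ring98 = solve-∀

ring99 : ∀ a b c d → a * b * c * d ≡ a * (b * d * c)
ring99 = solve-∀

ring100 : ∀ a b c d e f → a * (2 * (b * c) + d * (2 * e * f)) ≡ 2 * a * b * c + d * (2 * e * (a * f))
ring100 = solve-∀

ring101 : ∀ a b c d → a * b * (d + c) ≡ a * c * b + a * d * b
ring101 = solve-∀

ringz44 : ∀ a b c d e f g h i j → d +z (g +z h) *z i ≡ (a *z b *z (+ 2 *z c) +z (d -z + 2 *z e) *z (+ 1 +z + 2 *z f) +z (h -z g) *z (i +z + 2 *z j)) +z (e +z + 2 *z e *z f -z a *z b *z c -z d *z f +z g *z i -z (h -z g) *z j) *z + 2
ringz44 = solve-∀z

ring102 : ∀ a b → a + b + b ≡ a + 2 * b
ring102 = solve-∀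

ring103 : ∀ a b c → a * b + (b + a * c) ≡ a * (b + c) + b
ring103 = solve-∀

ring104 : ∀ a b c → a + b + c ≡ a + c + b
ring104 = solve-∀

ring105 : ∀ a b c → a * (b * (c * c)) ≡ b * a * (c * c)
ring105 = solve-∀

ring106 : ∀ a b → suc (a + suc b) + 3 ≡ a + 5 + b
ring106 = solve-∀

ring107 : ∀ a b c d e → 5 * (a * b * (c * (8 * (d * e)) * (e * e * (e * e)))) ≡ c * b * (e * e * (e * e)) * (2 * (d * e)) * (20 * a)
ring107 = solve-∀

ring108 : ∀ a b c d e → a * b * (c * c * (c * c)) * (2 * (d * c)) * e ≡ a * b * (c * c * (c * c) * (e * (2 * d * c)))
ring108 = solve-∀

ring109 : ∀ a b c d e f → 5 * (a * b * (c * c * c * (d * (e * (f * c * c))))) ≡ b * (c * c * c) * (f * c * c) * (5 * a * e * d)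
ring109 = solve-∀

ring110 : ∀ a b c d e → b * (c * c * c) * (d * c * c) * (a * (2 * e)) ≡ a * b * (c * c * (c * c) * (e * (2 * d * c)))
ring110 = solve-∀

ring111 : ∀ a b c d e f g h → 5 * (a * b * (c * c * c * (d * (e * f * (2 * g * h))))) ≡ e * b * (c * c * c) * (10 * a * f * g) * (d * h)
ring111 = solve-∀

ring112 : ∀ a b c d e f g h → a * b * (c * c * c) * (10 * d * e * f) * (2 * g * (h * c)) ≡ a * b * (c * c * c * c) * (2 * f * g) * (10 * d * e * h)
ring112 = solve-∀

ring113 : ∀ a b c d e → a * b * (c * c * c * c) * (2 * d * e) * c ≡ a * b * (c * c * (c * c) * (e * (2 * d * c)))
ring113 = solve-∀

ring114 : ∀ a b c d e f → 5 * (a * b * c * (2 * (d * (e * f * f)) * (32 * (f * f * f)))) ≡ c * (f * f * f) * (e * f * f) * (320 * a * d * b)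
ring114 = solve-∀

ring115 : ∀ a b c d e → a * (c * c * c) * (d * c * c) * (b * (2 * e)) ≡ a * b * (c * c * (c * c) * (e * (2 * d * c)))
ring115 = solve-∀

ring116 : ∀ a b c d e f → 2 * (a * (b * c * c)) * (32 * (8 * (b * c) * (8 * (b * c)) * d)) + e * (2 * b * (f * c)) * (16 * (8 * (b * c) * (8 * (b * c)) * (8 * (b * c)) * d)) ≡ c * c * (c * c) * ((4096 * a * (b * b * b) + 16384 * e * f * (b * b * b * b)) * d)
ring116 = solve-∀

ring117 : ∀ a b c d e → 5 * (a * b * c * (d * e)) ≡ c * d * (5 * a) * (b * e)
ring117 = solve-∀

ring118 : ∀ a b c d e f g → a * b * (5 * c) * (2 * d * (e * (f * g))) ≡ a * b * (2 * d * e) * (5 * c * f * g)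
ring118 = solve-∀

ring119 : ∀ a b c d e f → a * b * (2 * e * c) * (d * f) ≡ a * b * (c * (e * (2 * d * f)))
ring119 = solve-∀

ring120 : ∀ a b c d e → 5 * (a + b + c + d + e) ≡ 5 * a + 5 * b + 5 * c + 5 * d + 5 * e
ring120 = solve-∀

ring121 : ∀ a → a + a + a + a + a ≡ 5 * a
ring121 = solve-∀

ringz45 : ∀ a → + 1 +z a -z + 1 ≡ a
ringz45 = solve-∀z

ringz46 : ∀ a b → a *z (-z b) -z + 1 ≡ -z (+ 1 +z b *z a)
ringz46 = solve-∀z

ringz47 : ∀ a b → (-z a) *z b -z + 1 ≡ a *z (-z b) -z + 1
ringz47 = solve-∀z

ringz48 : ∀ a b c → 0ℤ -z (a *z (b *z b) -z a *z (c *z c)) ≡ a *z ((c -z b) *z (b +z c))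
ringz48 = solve-∀z

ringz49 : ∀ a b c → a -z (c -z b) ≡ a +z b -z c
ringz49 = solve-∀z

ringz50 : ∀ a b c → 0ℤ -z ((a -z b) -z (a -z c)) ≡ b -z c
ringz50 = solve-∀z

ringz51 : ∀ a b → (a +z b *z (+ 2 *z + 2)) -z (a +z b *z (+ 1 *z + 1)) ≡ + 3 *z b
ringz51 = solve-∀z

ring122 : ∀ a → 3 + a * 4 + 1 ≡ 4 * (1 + a)
ring122 = solve-∀

ringz52 : ∀ a b c d e → (a +z b +z c -z + 4 *z d) +z (e -z b) ≡ a +z e +z c -z + 4 *z d
ringz52 = solve-∀z

ringz53 : ∀ a b → + 4 *z a -z + 4 *z b ≡ + 4 *z (a -z b)
ringz53 = solve-∀z

ringz54 : ∀ a b c d e → (b -z c) -z a *z (d -z e) ≡ (b -z a *z d) -z (c -z a *z e)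
ringz54 = solve-∀z

ringz55 : ∀ a b c d e f → a *z (c -z d) +z (e -z f) +z (a *z d +z f -z b) ≡ a *z c +z e -z b
ringz55 = solve-∀z

ringz56 : ∀ a b c d → (-z a) *z (c *z c) +z + 1 *z (b *z b) -z d ≡ (b *z b -z a *z (c *z c)) -z d
ringz56 = solve-∀z

ringz57 : ∀ a b c d → a *z (b *z b) +z + 1 *z (c *z c) -z d ≡ a *z (b *z b) +z c *z c -z d
ringz57 = solve-∀z

ringz58 : ∀ a b c d → (b *z b -z a *z (c *z c)) *z -z (+ 1) -z ((c *z d) *z (c *z d) -z b *z b) ≡ (c *z c) *z (a -z d *z d)
ringz58 = solve-∀z

ringz59 : ∀ a b c d e f → (a *z e) *z (a *z b *z c +z d *z (a *z e)) +z (a *z f) *z (a *z f) ≡ a *z a *z (e *z (b *z c +z d *z e) +z f *z f)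
ringz59 = solve-∀z

ringz60 : ∀ a b c d e f → (d *z (a *z b +z c *z d) +z e *z e +z a *z a *z f) -z a *z (b *z d +z a *z f) ≡ c *z (d *z d) +z + 1 *z (e *z e)
ringz60 = solve-∀z

ringz61 : ∀ a b c d e f → a *z d *z b +z c *z (d *z d) +z e *z e +z a *z a *z f ≡ d *z (a *z b +z c *z d) +z e *z e +z a *z a *z f
ringz61 = solve-∀z

ringz62 : ∀ a b c → (a *z c) *z (b *z c) ≡ a *z b *z (c *z c)
ringz62 = solve-∀z

ring123 : ∀ a b → a * b * (a * b) ≡ b * b * (a * a)
ring123 = solve-∀

ring124 : ∀ a b c → a + b * c + b * c ≡ a + 2 * b * c
ring124 = solve-∀

ring125 : ∀ a b c → a * b * c + c * b ≡ suc a * b * c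
ring125 = solve-∀

ring126 : ∀ a b c → a * (b + (c + 1)) ≡ a * c + (a * b + a)
ring126 = solve-∀

ring127 : ∀ a b c d → a * (b * c * d) ≡ b * a * c * d
ring127 = solve-∀

ring128 : ∀ a b c d → (a * c + b * c) * d ≡ a * d * c + b * (c * d)
ring128 = solve-∀

ring129 : ∀ a b c d e → (a * b * c + b * e) * d + b * (d * e) ≡ b * (a * c * d + 2 * (d * e))
ring129 = solve-∀

ring130 : ∀ a b c → a * b * c ≡ a * c * b
ring130 = solve-∀

ring131 : ∀ a → suc (2 * a) ≡ a + suc a
ring131 = solve-∀

ring132 : ∀ a b → (a + a) * b ≡ a * (2 * b)
ring132 = solve-∀

ringz63 : ∀ a b c → (-z a +z -z b) *z c ≡ -z ((a +z b) *z c)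
ringz63 = solve-∀z

ringz64 : ∀ a b c d e f → (a *z a +z a *z a) *z d +z ((+ 4 *z (a *z b) +z + 0) *z e +z ((+ 2 *z (a *z b) +z + 0) *z f +z + 0)) ≡ + 2 *z (a *z (a *z d +z b *z (+ 2 *z e +z f)))
ringz64 = solve-∀z

ringz65 : ∀ a b c d e f → (+ 0 +z + 4 *z (a *z b)) *z d +z (((+ 4 *z (b *z b) +z + 1) +z (+ 4 *z (b *z b) +z + 1)) *z e +z (((+ 4 *z (b *z b) +z + 1) +z + 0) *z f +z + 0)) ≡ + 4 *z b *z (a *z d +z b *z (+ 2 *z e +z f)) +z (+ 2 *z e +z f)
ringz65 = solve-∀z

ringz66 : ∀ a b c d e f → (+ 0 +z + 2 *z (a *z b)) *z d +z ((+ 0 +z (+ 4 *z (b *z b) +z + 1)) *z e +z (((b *z b +z c) +z (b *z b +z c)) *z f +z + 0)) ≡ + 2 *z b *z (a *z d +z b *z (+ 2 *z e +z f)) +z (e +z + 2 *z c *z f)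
ringz66 = solve-∀z

ringz67 : ∀ a b c d e → (a +z a) *z c +z (+ 0 *z d +z ((b +z + 0) *z e +z + 0)) ≡ + 2 *z a *z c +z b *z e
ringz67 = solve-∀z

ringz68 : ∀ a b c → + 0 *z a +z (+ 2 *z b +z (+ 0 *z c +z + 0)) ≡ + 2 *z b
ringz68 = solve-∀z

ringz69 : ∀ a b c d → (+ 0 +z a) *z b +z (+ 0 *z c +z (+ 0 *z d +z + 0)) ≡ a *z b
ringz69 = solve-∀z

ringz70 : ∀ a b → a ≡ a +z b *z b *z 0ℤ
ringz70 = solve-∀z

ringz71 : ∀ a b c d → a *z a *z b +z (c +z a *z a *z d) ≡ c +z a *z a *z (d +z b)
ringz71 = solve-∀z

ringz72 : ∀ a b c → -z (a *z a *z b +z c) ≡ -z c -z a *z a *z b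
ringz72 = solve-∀z

ringz73 : ∀ a b c d → (c +z a *z a *z d) -z a *z a *z b ≡ c +z a *z a *z (d -z b)
ringz73 = solve-∀z

ringz74 : ∀ a b c d e f → (a *z (d *z d) +z e *z e +z e -z f) -z (c -z b -z f) ≡ (a *z (d *z d) +z e *z e +z e *z + 1 +z b *z (+ 1 *z + 1)) -z c
ringz74 = solve-∀z

ringz75 : ∀ a → a *z (0ℤ *z 0ℤ) +z 0ℤ *z 0ℤ +z 0ℤ -z 0ℤ ≡ 0ℤ
ringz75 = solve-∀z

ringz76 : ∀ a → a *z (0ℤ *z 0ℤ) +z + 1 *z + 1 +z + 1 -z + 2 ≡ 0ℤ
ringz76 = solve-∀z

ringz77 : ∀ a → a -z + 1 ≡ a *z (+ 1 *z + 1) +z 0ℤ *z 0ℤ +z 0ℤ -z + 1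
ringz77 = solve-∀z

ringz78 : ∀ a → a +z + 1 ≡ a *z (+ 1 *z + 1) +z + 1 *z + 1 +z + 1 -z + 1
ringz78 = solve-∀z

ringz79 : ∀ a → a -z + 1 ≡ a *z (+ 1 *z + 1) +z + 1 *z + 1 +z + 1 -z + 3
ringz79 = solve-∀z

ringz80 : ∀ a → (a +z + 1) -z + 4 ≡ a *z (+ 1 *z + 1) +z 0ℤ *z 0ℤ +z 0ℤ -z + 3
ringz80 = solve-∀z

ringz81 : ∀ a b c d → + 1 *z (a *z a) +z + 4 *z (b *z b) -z + 4 *z c ≡ + 4 *z (+ 1 *z (b *z b)) +z a *z a +z d *z (0ℤ *z 0ℤ) -z + 4 *z c
ringz81 = solve-∀z

ringz82 : ∀ a b c → a *z a -z + 4 *z b ≡ + 4 *z (c *z (0ℤ *z 0ℤ)) +z a *z a +z c *z (0ℤ *z 0ℤ) -z + 4 *z b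
ringz82 = solve-∀z

ringz83 : ∀ a b → a *z a -z (a *z a -z + 4 *z b) ≡ + 4 *z b
ringz83 = solve-∀z

ringz84 : ∀ a b c d e → (+ 4 *z (a *z a) +z + 1) *z (b *z b) +z e *z (c *z c) -z + 4 *z d ≡ + 4 *z (+ 1 *z ((a *z b) *z (a *z b))) +z b *z b +z e *z (c *z c) -z + 4 *z d
ringz84 = solve-∀z

ringz85 : ∀ a b c d → (-z a) *z ((+ 2 *z c +z d) -z b) ≡ a *z b -z a *z (+ 2 *z c +z d)
ringz85 = solve-∀z

ringz86 : ∀ a b c d e → + 1 *z (b *z b) +z e *z (+ 4 *z (a *z a) +z + 1) *z (c *z c) -z + 4 *z d ≡ + 4 *z (e *z ((a *z c) *z (a *z c))) +z b *z b +z e *z (c *z c) -z + 4 *z d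
ringz86 = solve-∀z

ringz87 : ∀ a b c → 0ℤ ≡ a *z c -z a *z (0ℤ *z b +z c)
ringz87 = solve-∀z

ringz88 : ∀ a b c d e → + 4 *z a *z (b *z b) +z e *z (c *z c) -z (+ 4 *z d -z + 1) ≡ + 4 *z (a *z (b *z b)) +z + 1 *z + 1 +z e *z (c *z c) -z + 4 *z d
ringz88 = solve-∀z

ringz89 : ∀ a → a ≡ (+ 1 +z a) -z + 1
ringz89 = solve-∀z

ringz90 : ∀ a b c d e f → b *z ((a *z d) *z (a *z d)) +z (a *z e) *z (a *z e) +z (a *z e) *z (a *z f) +z c *z ((a *z f) *z (a *z f)) ≡ a *z a *z (b *z (d *z d) +z e *z e +z e *z f +z c *z (f *z f))
ringz90 = solve-∀z

ringz91 : ∀ a b c d e f → a *z d -z b *z (c *z (a *z e) +z a *z f) ≡ a *z (d -z b *z (c *z e +z f))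
ringz91 = solve-∀z

ringz92 : ∀ a b c → a *z (b *z c) ≡ b *z (a *z c)
ringz92 = solve-∀z

ringz93 : ∀ a b c d → + 1 *z (((+ 4 *z a -z + 1) *z b) *z ((+ 4 *z a -z + 1) *z b)) +z ((+ 2 *z a -z + 1) *z d -z c) *z ((+ 2 *z a -z + 1) *z d -z c) +z ((+ 2 *z a -z + 1) *z d -z c) *z (+ 2 *z c +z d) +z a *z ((+ 2 *z c +z d) *z (+ 2 *z c +z d)) ≡ (+ 4 *z a -z + 1) *z ((+ 4 *z a -z + 1) *z (b *z b) +z c *z c +z c *z d +z a *z (d *z d))
ringz93 = solve-∀z

ringz94 : ∀ a b c d e → (+ 4 *z a -z + 1) *z c -z b *z (+ 2 *z ((+ 2 *z a -z + 1) *z e -z d) +z (+ 2 *z d +z e)) ≡ (+ 4 *z a -z + 1) *z (c -z b *z (0ℤ *z d +z e))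
ringz94 = solve-∀z

ringz95 : ∀ a b c d → (+ 4 *z (+ 1 *z (a *z a)) +z b *z b +z d *z (c *z c)) -z d *z (c *z c) ≡ (+ 2 *z a) *z (+ 2 *z a) +z b *z b
ringz95 = solve-∀z

ringz96 : ∀ a b c d e f → (+ 4 *z (+ 1 *z (b *z b)) +z c *z c +z e *z (d *z d) +z f) -z f -z + 4 *z (b *z b -z (a *z c) *z (a *z c)) ≡ (+ 4 *z (a *z a) +z + 1) *z (c *z c) +z e *z (d *z d)
ringz96 = solve-∀z

ringz97 : ∀ a b c → (a -z c) -z (a -z b) ≡ b -z c
ringz97 = solve-∀z

ringz98 : ∀ a b c d → c *z c *z (a *z a -z + 4 *z (b *z b *z d)) +z + 4 *z d *z ((b *z c) *z (b *z c) -z + 1 *z + 1) ≡ (a *z c) *z (a *z c) -z + 4 *z d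
ringz98 = solve-∀z

ring133 : ∀ a b c d → a + b + (c + d) ≡ a + c + (b + d)
ring133 = solve-∀

ring134 : ∀ a b c → a + b * (c + 1) ≡ a + b * c + b
ring134 = solve-∀

ring135 : ∀ a b → 2 * (a * (a + b)) + b * b ≡ a * a + (a + b) * (a + b)
ring135 = solve-∀

ring136 : ∀ a b → 2 * ((a + b) * a) + b * b ≡ (a + b) * (a + b) + a * a
ring136 = solve-∀

ring137 : ∀ a b c → 2 * a * b + 2 * c ≡ 2 * (a * b + c)
ring137 = solve-∀

ring138 : ∀ a b c d → b * (a * d + c) ≡ a * (b * d) + b * c
ring138 = solve-∀

ring139 : ∀ a → (5 + a) * (5 + a) * (5 + a) + (2 + 21 * a + 9 * (a * a) + a * a * a + 1) ≡ 2 * ((4 + a) * (4 + a) * (4 + a))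
ring139 = solve-∀

ring140 : ∀ a b c d e f → a * b * (c * (d * e * f)) ≡ c * b * (a * d * e * f)
ring140 = solve-∀

ring141 : ∀ a b c d e f g h i j k l → a * b * (c * (d + e) * (f * f * (f * f)) + f * f * f * (g * (h + c * k * l)) + g * c * (i * j)) ≡ a * (c * b * (f * f * (f * f) * d)) + (a * b * (c * e * (f * f * (f * f))) + a * b * (f * f * f * (g * h)) + a * b * (f * f * f * (g * (c * k * l))) + a * g * c * (b * (i * j)))
ring141 = solve-∀

ring142 : ∀ a b c d e → a * (b * c * (d * d * (d * d) * e)) + b * c * (d * d * (d * d) * e) ≡ b * c * (suc a * (d * d * (d * d) * e))
ring142 = solve-∀

ringz99 : ∀ a b c → a +z b *z c -z a ≡ c *z b
ringz99 = solve-∀z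

ringz100 : ∀ a b c d → a +z c *z (d *z (b -z a)) -z b ≡ (c *z d -z + 1) *z (b -z a)
ringz100 = solve-∀z

ringz101 : ∀ a b c → a *z b *z c ≡ a *z c *z b
ringz101 = solve-∀z

ringz102 : ∀ a b → a +z b -z a ≡ b
ringz102 = solve-∀z

ringz103 : ∀ a b c → (a -z c) -z (b -z c) ≡ a -z b
ringz103 = solve-∀z

ringz104 : ∀ a b c d e f → + 4 *z (b *z b) *z (d *z d) *z e *z (f *z f) *z ((a +z b *z (d *z d)) *z e -z + 1) +z (b *z (f *z f) -z c) ≡ a *z (-z (+ 2 *z b *z d *z e *z f) *z -z (+ 2 *z b *z d *z e *z f)) +z b *z ((f -z + 2 *z b *z (d *z d) *z e *z f) *z (f -z + 2 *z b *z (d *z d) *z e *z f)) -z c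
ringz104 = solve-∀z

ringz105 : ∀ a b c d e → (a *z (d *z d) +z b *z (e *z e) -z c) -z a *z (d *z d) ≡ b *z (e *z e) -z c
ringz105 = solve-∀z

ringz106 : ∀ a b → (a +z b) *z (a -z b) ≡ a *z a -z b *z b
ringz106 = solve-∀z

ringz107 : ∀ a b c → (a -z b) *z (a -z b) -z c *z c ≡ (a -z + 2 *z b) *z a -z (c *z c -z b *z b)
ringz107 = solve-∀z

ringz108 : ∀ a b c d e → (b -z d +z (a -z b)) -z (c -z e +z (a -z c)) ≡ e -z d
ringz108 = solve-∀z

ringz109 : ∀ a b c d e → (d *z d +z a *z (+ 4 *z (b *z b) +z + 1)) -z ((d *z d -z e *z e) +z a *z + 4 *z (b *z b -z c *z c)) ≡ e *z e +z a *z (+ 4 *z (c *z c) +z + 1)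
ringz109 = solve-∀z

ringz110 : ∀ a b c → (a *z a +z b *z b) *z (c *z c) -z ((a *z c) *z (a *z c) -z + 1 *z + 1) ≡ (b *z c) *z (b *z c) +z + 1
ringz110 = solve-∀z

ringz111 : ∀ a b → a *z (+ 4 *z (b *z b) +z + 1) ≡ 0ℤ *z 0ℤ +z a *z (+ 4 *z (b *z b) +z + 1)
ringz111 = solve-∀z

ringz112 : ∀ a b c d e → b *z (e *z e) *z (a *z (c *z c) +z b *z (d *z d)) -z b *z a *z ((c *z e) *z (c *z e) -z + 1 *z + 1) ≡ (b *z d *z e) *z (b *z d *z e) +z b *z a
ringz112 = solve-∀z

ringz113 : ∀ a b c d → (a *z (c *z c) +z b *z (d *z d)) -z a *z (c *z c) ≡ b *z (d *z d)
ringz113 = solve-∀z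

ringz114 : ∀ a b c d e → + 4 *z (a *z (c *z c) +z d *z d +z d *z e +z b *z (e *z e)) ≡ + 4 *z (a *z (c *z c)) +z (+ 4 *z (d *z d) +z + 4 *z (d *z e)) +z + 4 *z b *z (e *z e)
ringz114 = solve-∀z

ringz115 : ∀ a b c d e → + 4 *z (a *z (c *z c)) +z (+ 4 *z (d *z d) +z + 4 *z (d *z e)) +z (+ 1 +z b) *z (e *z e) ≡ + 4 *z (a *z (c *z c)) +z (+ 2 *z d +z e) *z (+ 2 *z d +z e) +z b *z (e *z e)
ringz115 = solve-∀z

ringz116 : ∀ a b c d e f g h → a *z (c +z d) *z (c -z d) +z (e +z f +z g) *z (e -z f) +z (f +z b *z (g +z h)) *z (g -z h) ≡ (a *z (c *z c) +z e *z e +z e *z g +z b *z (g *z g)) -z (a *z (d *z d) +z f *z f +z f *z h +z b *z (h *z h))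
ringz116 = solve-∀z

ringz117 : ∀ a b → a -z (a -z b) ≡ b
ringz117 = solve-∀z

ringz118 : ∀ a b c d → + 2 *z (a -z b) +z (c -z d) ≡ (+ 2 *z a +z c) -z (+ 2 *z b +z d)
ringz118 = solve-∀z

ringz119 : ∀ a b c → (+ 2 *z a -z + 1) *z (b -z c) ≡ (+ 2 *z (a *z (b -z c)) +z c) -z b
ringz119 = solve-∀z

ringz120 : ∀ a b c d → (a -z b) -z (a -z c) +z (b -z d) ≡ c -z d
ringz120 = solve-∀z

ringz121 : ∀ a b c → (b -z c) -z (a -z c) ≡ b -z a
ringz121 = solve-∀z

ringz122 : ∀ a b c d e → ((a *z c +z d) -z e) -z ((b *z c +z d) -z e) ≡ c *z (a -z b)
ringz122 = solve-∀z

ring143 : ∀ a → (a + 1) + a * a + suc a ≡ suc a * suc a + 1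
ring143 = solve-∀

ring144 : ∀ a → a + a ≡ 2 * a
ring144 = solve-∀

ring145 : ∀ a → 8 * ((8 * a + 16) * a + 2) + 240 + 128 * a ≡ (8 * a + 16) * (8 * a + 16)
ring145 = solve-∀

ring146 : ∀ a b c → (a + b) * (suc (suc c) * suc (suc c) + 1) + b * (c * c + c + c + c + 1) ≡ a * (suc (suc c) * suc (suc c)) + (a + b * suc (suc c)) + suc c * (2 * (suc (suc c) * b))
ring146 = solve-∀

ring147 : ∀ a b c → a * (suc (suc c) * suc (suc c)) + (a + b * suc (suc c)) + suc c * a ≡ a * (suc (suc c) * suc (suc c)) + (a + b) * suc (suc c)
ring147 = solve-∀

ring148 : ∀ a b c → a * (5 * (b * c)) ≡ (4 * a + a) * b * c
ring148 = solve-∀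

ring149 : ∀ a b c d → (4 * a + 2 * b) * c * d ≡ 2 * ((2 * a + b) * c * d)
ring149 = solve-∀

ring150 : ∀ a b c → 2 * (2 * a * b * c) ≡ a * (4 * (b * c))
ring150 = solve-∀

ring151 : ∀ a b c → 5 * a * b * c ≡ a * (5 * (b * c))
ring151 = solve-∀

ring152 : ∀ a b c → a * (4 * (b * c)) ≡ 4 * (a * c) * b
ring152 = solve-∀

ring153 : ∀ a b c → 4 * (a * b) * c ≡ 4 * a * c * b
ring153 = solve-∀

ring154 : ∀ a b → (4 + suc a) * (4 * b) + a * b ≡ 5 * ((4 + a) * b)
ring154 = solve-∀

ring155 : ∀ a → 5 * (4 * a) ≡ 4 * (5 * a)
ring155 = solve-∀

ring156 : ∀ a b c → a * (suc b * c) ≡ c * (b * a) + a * c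
ring156 = solve-∀

ring157 : ∀ a b c → c * (suc b * a) ≡ a * (b * c) + c * a
ring157 = solve-∀

ring158 : ∀ a b c d → 4 * (a * b * (c + d)) ≡ 4 * a * (b * c) + b * (4 * a * d)
ring158 = solve-∀

ring159 : ∀ a b c d → 4 * a * (b * suc c + d * d) + d * c ≡ 4 * a * b * c + (4 * a * (b + d * d) + d * c)
ring159 = solve-∀

ring160 : ∀ a b c d → 4 * a * b * c + (4 * a * (d + d * d) + d * c) ≡ 4 * a * b * c + (d * (4 * a * suc d) + d * c)
ring160 = solve-∀

ring161 : ∀ a b c d → 4 * a * b * c + (d * c + d * c) + 2 * (d * c) ≡ 4 * (a * b * c + d * c)
ring161 = solve-∀

ring162 : ∀ a b c → 4 * (a * b * c) ≡ 4 * a * (b * c)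
ring162 = solve-∀

ring163 : ∀ a b c → 4 * a * (b * c + b * b) ≡ b * (4 * a * c) + b * (4 * a * b)
ring163 = solve-∀

ring164 : ∀ a b c d → b * (4 * a * c + 2 * d) + b * d + b * d ≡ 4 * (a * b * c + b * d)
ring164 = solve-∀

ring165 : ∀ a b c d → a * (b * (c * d)) ≡ a * b * c * d
ring165 = solve-∀

ring166 : ∀ a b c d e → (a * b * c + 2 * (c * d)) * e ≡ a * b * c * e + 2 * e * (c * d)
ring166 = solve-∀

ring167 : ∀ a b c d e f → a * b * c * d + a * (e * (c * f)) ≡ a * ((b * d + e * f) * c)
ring167 = solve-∀

ringz123 : ∀ a b → (a *z + 1 +z b *z + 1) *z + 1 ≡ (a +z b) *z + 1
ringz123 = solve-∀z

ringz124 : ∀ a b c d e f g h i → (a *z (g *z g) +z (b *z (g *z h) +z (c *z (g *z i) +z + 0))) +z ((+ 0 *z (h *z g) +z (d *z (h *z h) +z (e *z (h *z i) +z + 0))) +z ((+ 0 *z (i *z g) +z (+ 0 *z (i *z h) +z (f *z (i *z i) +z + 0))) +z + 0)) ≡ a *z (g *z g) +z b *z (g *z h) +z c *z (g *z i) +z d *z (h *z h) +z e *z (h *z i) +z f *z (i *z i)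
ringz124 = solve-∀z

ringz125 : ∀ a b c d e f → a *z a *z (d *z d) +z + 4 *z (a *z b) *z (d *z e) +z + 2 *z (a *z b) *z (d *z f) +z (+ 4 *z (b *z b) +z + 1) *z (e *z e) +z (+ 4 *z (b *z b) +z + 1) *z (e *z f) +z (b *z b +z c) *z (f *z f) ≡ + 1 *z ((a *z d +z b *z (+ 2 *z e +z f)) *z (a *z d +z b *z (+ 2 *z e +z f))) +z e *z e +z e *z f +z c *z (f *z f)
ringz125 = solve-∀z

ringz126 : ∀ a b c d e → a *z (c *z c) +z + 0 *z (c *z d) +z b *z (c *z e) +z + 1 *z (d *z d) +z + 0 *z (d *z e) +z + 0 *z (e *z e) ≡ c *z (b *z e +z a *z c) +z d *z d
ringz126 = solve-∀z

-- Finite sums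

infix 5 ∑
∑ : ℕ → (ℕ → ℕ) → ℕ
∑ zero f = 0
∑ (suc n) f = ∑ n f + f n

syntax ∑ n (λ i → e) = ∑[ i < n ] e

𝟙 : ∀ {p} {P : Set p} → Dec P → ℕ
𝟙 (yes _) = 1
𝟙 (no _) = 0

𝟙≤1 : ∀ {p} {P : Set p} (d : Dec P) → 𝟙 d ≤ 1
𝟙≤1 (yes _) = ≤-refl
𝟙≤1 (no _) = z≤n

𝟙-yes : ∀ {p} {P : Set p} (d : Dec P) → P → 𝟙 d ≡ 1
𝟙-yes (yes _) _ = refl
𝟙-yes (no ¬p) p = contradiction p ¬p

𝟙-no : ∀ {p} {P : Set p} (d : Dec P) → ¬ P → 𝟙 d ≡ 0
𝟙-no (yes p) ¬p = contradiction p ¬p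
𝟙-no (no _) _ = refl

𝟙-pos : ∀ {p} {P : Set p} (d : Dec P) → 0 < 𝟙 d → P
𝟙-pos (yes p) _ = p

*-pos : ∀ m n → 0 < m * n → 0 < m × 0 < n
*-pos (suc m) zero h = ⊥-elim (<-irrefl (sym (*-zeroʳ m)) h)
*-pos (suc m) (suc n) h = z<s , z<s

pos-* : ∀ {m n} → 0 < m → 0 < n → 0 < m * n
pos-* {suc m} {suc n} _ _ = z<s

∑-mono : ∀ n {f g} → (∀ i → i < n → f i ≤ g i) → ∑ n f ≤ ∑ n g
∑-mono zero h = z≤n
∑-mono (suc n) h = +-mono-≤ (∑-mono n (λ i i<n → h i (m<n⇒m<1+n i<n))) (h n ≤-refl)

∑-cong : ∀ n {f g} → (∀ i → i < n → f i ≡ g i) → ∑ n f ≡ ∑ n g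
∑-cong zero h = refl
∑-cong (suc n) h = cong₂ _+_ (∑-cong n (λ i i<n → h i (m<n⇒m<1+n i<n))) (h n ≤-refl)

∑-zero : ∀ n {f} → (∀ i → i < n → f i ≡ 0) → ∑ n f ≡ 0
∑-zero zero h = refl
∑-zero (suc n) h = cong₂ _+_ (∑-zero n (λ i i<n → h i (m<n⇒m<1+n i<n))) (h n ≤-refl)

∑-const : ∀ n c → ∑ n (λ _ → c) ≡ n * c
∑-const zero c = refl
∑-const (suc n) c = trans (+-comm (∑ n (λ _ → c)) c) (cong (_+_ c) (∑-const n c))

∑-+ : ∀ n f g → ∑ n (λ i → f i + g i) ≡ ∑ n f + ∑ n g
∑-+ zero f g = refl
∑-+ (suc n) f g = trans (cong (_+ (f n + g n)) (∑-+ n f g)) (ring133 (∑ n f) (∑ n g) (f n) (g n))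

∑-*ˡ : ∀ n c f → ∑ n (λ i → c * f i) ≡ c * ∑ n f
∑-*ˡ zero c f = sym (*-zeroʳ c)
∑-*ˡ (suc n) c f = trans (cong (_+ c * f n) (∑-*ˡ n c f)) (sym (*-distribˡ-+ c (∑ n f) (f n)))

∑-swap : ∀ m n (f : ℕ → ℕ → ℕ) → ∑[ i < m ] ∑[ j < n ] f i j ≡ ∑[ j < n ] ∑[ i < m ] f i j
∑-swap zero n f = sym (∑-zero n (λ _ _ → refl))
∑-swap (suc m) n f = trans (cong (_+ ∑ n (f m)) (∑-swap m n f))
 (sym (∑-+ n (λ j → ∑[ i < m ] f i j) (f m)))

∑-split : ∀ m n f → ∑ (m + n) f ≡ ∑ m f + (∑[ i < n ] f (m + i))
∑-split m zero f = trans (cong (λ k → ∑ k f) (+-identityʳ m)) (sym (+-identityʳ _))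
∑-split m (suc n) f = begin
 ∑ (m + suc n) f ≡⟨ cong (λ k → ∑ k f) (+-suc m n) ⟩
 ∑ (m + n) f + f (m + n) ≡⟨ cong (_+ f (m + n)) (∑-split m n f) ⟩
 ∑ m f + (∑[ i < n ] f (m + i)) + f (m + n) ≡⟨ +-assoc (∑ m f) _ _ ⟩
 ∑ m f + ((∑[ i < n ] f (m + i)) + f (m + n)) ∎
 where open ≡-Reasoning

∑-blocks : ∀ m n f → ∑ (m * n) f ≡ ∑[ i < m ] ∑[ j < n ] f (i * n + j)
∑-blocks zero n f = refl
∑-blocks (suc m) n f = begin
 ∑ (n + m * n) f ≡⟨ cong (λ k → ∑ k f) (+-comm n (m * n)) ⟩
 ∑ (m * n + n) f ≡⟨ ∑-split (m * n) n f ⟩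
 ∑ (m * n) f + (∑[ j < n ] f (m * n + j)) ≡⟨ cong (_+ (∑[ j < n ] f (m * n + j))) (∑-blocks m n f) ⟩
 (∑[ i < m ] ∑[ j < n ] f (i * n + j)) + (∑[ j < n ] f (m * n + j)) ∎
 where open ≡-Reasoning

∑-mono-range : ∀ {m n} f → m ≤ n → ∑ m f ≤ ∑ n f
∑-mono-range {m} {n} f m≤n = subst (λ k → ∑ m f ≤ ∑ k f) (m+[n∸m]≡n m≤n)
 (subst (∑ m f ≤_) (sym (∑-split m (n ∸ m) f)) (m≤m+n _ _))

∑-term : ∀ n f {i} → i < n → f i ≤ ∑ n f
∑-term (suc n) f {i} i<1+n with m≤n⇒m<n∨m≡n (s≤s⁻¹ i<1+n)
... | inj₁ i<n = ≤-trans (∑-term n f i<n) (m≤m+n _ _)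
... | inj₂ refl = m≤n+m _ _

∑-pos : ∀ n f → 0 < ∑ n f → ∃ λ i → i < n × 0 < f i
∑-pos (suc n) f h with f n in eq
... | suc _ = n , ≤-refl , subst (0 <_) (sym eq) z<s
... | zero with ∑-pos n f (subst (0 <_) (+-identityʳ (∑ n f)) h)
... | i , i<n , p = i , m<n⇒m<1+n i<n , p

∑≤n : ∀ n {f} → (∀ i → i < n → f i ≤ 1) → ∑ n f ≤ n
∑≤n n h = ≤-trans (∑-mono n h) (≤-reflexive (trans (∑-const n 1) (*-identityʳ n)))

∑-𝟙-hit : ∀ n c → c < n → ∑[ i < n ] 𝟙 (c ≟ i) ≡ 1
∑-𝟙-hit (suc n) c c<1+n with c ≟ n
... | yes refl = cong (_+ 1) (∑-zero n (λ i i<n → 𝟙-no (c ≟ i) (λ { refl → <-irrefl refl i<n })))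
... | no c≢n = trans (+-identityʳ _) (∑-𝟙-hit n c (≤∧≢⇒< (s≤s⁻¹ c<1+n) c≢n))

∑-unique : ∀ n f → (∀ i → i < n → f i ≤ 1) →
 (∀ i j → i < n → j < n → 0 < f i → 0 < f j → i ≡ j) → ∑ n f ≤ 1
∑-unique zero f b u = z≤n
∑-unique (suc n) f b u with f n in eq
... | zero = subst (_≤ 1) (sym (+-identityʳ _)) (∑-unique n f (λ i h → b i (m<n⇒m<1+n h))
        (λ i j h h' → u i j (m<n⇒m<1+n h) (m<n⇒m<1+n h')))
... | suc k = subst (λ s → s + suc k ≤ 1) (sym (∑-zero n none)) (subst (_≤ 1) eq (b n ≤-refl))
 where
 none : ∀ i → i < n → f i ≡ 0
 none i i<n with f i in eqi
 ... | zero = refl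
 ... | suc _ = contradiction (u i n (m<n⇒m<1+n i<n) ≤-refl (subst (0 <_) (sym eqi) z<s) (subst (0 <_) (sym eq) z<s))
         (<⇒≢ i<n)

∑-𝟙* : ∀ n c (g : ℕ) → c < n → ∑[ i < n ] 𝟙 (c ≟ i) * g ≡ g
∑-𝟙* n c g c<n = begin
 ∑[ i < n ] 𝟙 (c ≟ i) * g ≡⟨ ∑-cong n (λ i _ → *-comm (𝟙 (c ≟ i)) g) ⟩
 ∑[ i < n ] g * 𝟙 (c ≟ i) ≡⟨ ∑-*ˡ n g _ ⟩
 g * (∑[ i < n ] 𝟙 (c ≟ i)) ≡⟨ cong (g *_) (∑-𝟙-hit n c c<n) ⟩
 g * 1 ≡⟨ *-identityʳ g ⟩
 g ∎
 where open ≡-Reasoning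

spread-ends : ∀ n f q → (∀ i → i < n → f i ≤ 1) →
 (∀ i j → i < j → j < n → 0 < f i → 0 < f j → q ∣ j ∸ i) →
 ∑ n f ≡ 0 ⊎ Σ ℕ λ a → Σ ℕ λ b → a ≤ b × b < n × 0 < f a × 0 < f b × a + q * ∑ n f ≤ b + q
spread-ends zero f q b d = inj₁ refl
spread-ends (suc n) f q b d with f n in eq | spread-ends n f q (λ i h → b i (m<n⇒m<1+n h))
                 (λ i j h h' → d i j h (m<n⇒m<1+n h'))
... | zero | inj₁ z = inj₁ (trans (+-identityʳ _) z)
... | zero | inj₂ (a , c , a≤c , c<n , fa , fc , le) =
   inj₂ (a , c , a≤c , m<n⇒m<1+n c<n , fa , fc , subst (λ s → a + q * s ≤ c + q) (sym (+-identityʳ _)) le)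
... | suc k | inj₁ z = inj₂ (n , n , ≤-refl , ≤-refl , fn , fn , ≤-reflexive (cong (_+_ n) one))
 where
 fn : 0 < f n
 fn = subst (0 <_) (sym eq) z<s
 k≡0 : k ≡ 0
 k≡0 = n≤0⇒n≡0 (s≤s⁻¹ (subst (_≤ 1) eq (b n ≤-refl)))
 one : q * (∑ n f + suc k) ≡ q
 one = trans (cong₂ (λ u v → q * (u + suc v)) z k≡0) (*-identityʳ q)
... | suc k | inj₂ (a , c , a≤c , c<n , fa , fc , le) =
   inj₂ (a , n , ≤-trans a≤c (<⇒≤ c<n) , ≤-refl , fa , fn , (begin
    a + q * (∑ n f + suc k) ≡⟨ cong (λ v → a + q * (∑ n f + suc v)) k≡0 ⟩
    a + q * (∑ n f + 1) ≡⟨ ring134 a q (∑ n f) ⟩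
    (a + q * ∑ n f) + q ≤⟨ +-monoˡ-≤ q le ⟩
    c + q + q ≤⟨ +-monoˡ-≤ q (≤-trans (+-monoʳ-≤ c q≤) (≤-reflexive (m+[n∸m]≡n (<⇒≤ c<n)))) ⟩
    n + q ∎))
 where
 open ≤-Reasoning
 fn : 0 < f n
 fn = subst (0 <_) (sym eq) z<s
 k≡0 : k ≡ 0
 k≡0 = n≤0⇒n≡0 (s≤s⁻¹ (subst (_≤ 1) eq (b n ≤-refl)))
 q≤ : q ≤ n ∸ c
 q≤ = ∣⇒≤ {{>-nonZero (m<n⇒0<n∸m c<n)}} (d c n c<n ≤-refl fc fn)

-- Only the two extreme points of the support matter: their distance is at most `L / c`, and all
-- points lie in one class modulo `q`. In the applications the divisibility comes from arithmetic
-- and the bound on distances from the sizes of the variables.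
∑-spread : ∀ n f q c L → (∀ i → i < n → f i ≤ 1) →
 (∀ i j → i < j → j < n → 0 < f i → 0 < f j → (q ∣ j ∸ i) × (c * (j ∸ i) ≤ L)) →
 c * (q * ∑ n f) ≤ L + c * q
∑-spread n f q c L b d with spread-ends n f q b (λ i j i<j j<n p p' → proj₁ (d i j i<j j<n p p'))
... | inj₁ z = ≤-trans (≤-reflexive (trans (cong (λ s → c * (q * s)) z) (trans (cong (c *_) (*-zeroʳ q)) (*-zeroʳ c)))) z≤n
... | inj₂ (a , b' , a≤b , b<n , fa , fb , le) = begin
  c * (q * ∑ n f) ≤⟨ *-monoʳ-≤ c q∑≤ ⟩
  c * ((b' ∸ a) + q) ≡⟨ *-distribˡ-+ c (b' ∸ a) q ⟩
  c * (b' ∸ a) + c * q ≤⟨ +-monoˡ-≤ (c * q) c≤ ⟩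
  L + c * q ∎
 where
 open ≤-Reasoning
 q∑≤ : q * ∑ n f ≤ (b' ∸ a) + q
 q∑≤ = +-cancelˡ-≤ a _ _ (≤-trans le (≤-reflexive (trans (cong (_+ q) (sym (m+[n∸m]≡n a≤b))) (+-assoc a _ q))))
 c≤ : c * (b' ∸ a) ≤ L
 c≤ with m≤n⇒m<n∨m≡n a≤b
 ... | inj₁ a<b = proj₂ (d a b' a<b b<n fa fb)
 ... | inj₂ refl = ≤-trans (≤-reflexive (trans (cong (c *_) (n∸n≡0 a)) (*-zeroʳ c))) z≤n

∑-progression : ∀ n f q → (∀ i → i < n → f i ≤ 1) →
 (∀ i j → i < j → j < n → 0 < f i → 0 < f j → q ∣ j ∸ i) → q * ∑ n f ≤ n + q
∑-progression n f q b d = subst₂ _≤_ (*-identityˡ _) (cong (_+_ n) (*-identityˡ q))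
 (∑-spread n f q 1 n b (λ i j i<j j<n p p' → d i j i<j j<n p p' ,
  ≤-trans (≤-reflexive (*-identityˡ _)) (≤-trans (m∸n≤m j i) (<⇒≤ j<n))))

∑-interval : ∀ n f a b → a ≤ b → b < n → (∀ i → a ≤ i → i ≤ b → 1 ≤ f i) → b ∸ a < ∑ n f
∑-interval n f a b a≤b b<n h = begin
 suc (b ∸ a) ≡⟨ sym (trans (∑-const (suc (b ∸ a)) 1) (*-identityʳ _)) ⟩
 ∑ (suc (b ∸ a)) (λ _ → 1) ≤⟨ ∑-mono (suc (b ∸ a)) (λ i i< → h (a + i) (m≤m+n a i)
                         (≤-trans (+-monoʳ-≤ a (s≤s⁻¹ i<)) (≤-reflexive (m+[n∸m]≡n a≤b)))) ⟩
 ∑[ i < suc (b ∸ a) ] f (a + i) ≤⟨ m≤n+m _ (∑ a f) ⟩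
 ∑ a f + (∑[ i < suc (b ∸ a) ] f (a + i)) ≡⟨ sym (∑-split a (suc (b ∸ a)) f) ⟩
 ∑ (a + suc (b ∸ a)) f ≤⟨ ∑-mono-range f (≤-trans (≤-reflexive (trans (+-suc a _) (cong suc (m+[n∸m]≡n a≤b)))) b<n) ⟩
 ∑ n f ∎
 where open ≤-Reasoning

/-bound : ∀ {m n} d .{{_ : NonZero d}} → d * m ≤ n → m ≤ n / d
/-bound {m} {n} d h = ≤-trans (≤-reflexive (sym (m*n/m≡n' d m))) (/-monoˡ-≤ d h)
 where
 m*n/m≡n' : ∀ d m .{{_ : NonZero d}} → (d * m) / d ≡ m
 m*n/m≡n' d m = trans (cong (_/ d) (*-comm d m)) (m*n/n≡m m d)

d*[n/d]≤n : ∀ n d .{{_ : NonZero d}} → d * (n / d) ≤ n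
d*[n/d]≤n n d = ≤-trans (≤-reflexive (*-comm d (n / d))) (m/n*n≤m n d)

private
 tail : ℕ → ℕ → ℕ → ℕ
 tail Q N d = 𝟙 (Q <? suc d) * (N / (suc d * suc d))

 -- Telescoping 1/d² ≤ 1/(d-1) - 1/d over Q < d ≤ n gives 1/Q - 1/n. Multiplied by `n * Q * N` this
 -- is free of fractions and can be proved by induction on `n`.
 tail-telescope : ∀ Q N n → n * (Q * ∑ n (tail Q N)) ≤ N * (n ∸ Q)
 tail-telescope Q N zero = z≤n
 tail-telescope Q N (suc n) with Q <? suc n
 ... | no Q≮ = subst (_≤ N * (suc n ∸ Q)) (sym zero-sum) z≤n
  where
  none : ∀ i → i < n → tail Q N i ≡ 0
  none i i<n = cong (_* (N / (suc i * suc i)))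
   (𝟙-no (Q <? suc i) (λ h → Q≮ (<-trans h (s≤s i<n))))
  zero-sum : suc n * (Q * (∑ n (tail Q N) + 0)) ≡ 0
  zero-sum = trans (cong (λ v → suc n * (Q * v)) (trans (+-identityʳ _) (∑-zero n none)))
         (trans (cong (suc n *_) (*-zeroʳ Q)) (*-zeroʳ n))
 tail-telescope zero N (suc n) | yes _ = subst (_≤ N * suc n) (sym (*-zeroʳ n)) z≤n
 tail-telescope (suc Q') N (suc zero) | yes (s≤s ())
 tail-telescope (suc Q') N (suc n@(suc _)) | yes Q<n = *-cancelˡ-≤ n (begin
   n * (suc n * (Q * (s + 1 * f))) ≡⟨ ring76 n Q s f ⟩
   suc n * (n * (Q * s)) + Q * (n * (suc n * f)) ≤⟨ +-mono-≤ (*-monoʳ-≤ (suc n) (tail-telescope Q N n))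
                         (*-monoʳ-≤ Q (≤-trans (*-monoˡ-≤ (suc n * f) (n≤1+n n))
                          (≤-trans (≤-reflexive (sym (*-assoc (suc n) (suc n) f))) (d*[n/d]≤n N (suc n * suc n))))) ⟩
   suc n * (N * (n ∸ Q)) + Q * N ≡⟨ cong (λ v → suc v * (N * (n ∸ Q)) + Q * N) (sym (m∸n+n≡m Q≤n)) ⟩
   suc (r + Q) * (N * r) + Q * N ≡⟨ ring77 r Q N ⟩
   (r + Q) * (N * suc r) ≡⟨ cong₂ (λ u v → u * (N * v)) (m∸n+n≡m Q≤n) (sym (+-∸-assoc 1 Q≤n)) ⟩
   n * (N * (suc n ∸ Q)) ∎)
  where
  open ≤-Reasoning
  Q = suc Q'
  Q≤n : Q ≤ n
  Q≤n = s≤s⁻¹ Q<n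
  s = ∑ n (tail Q N)
  f = N / (suc n * suc n)
  r = n ∸ Q

∑-recip²-tail : ∀ Q N n → Q * (∑[ d < n ] 𝟙 (Q <? suc d) * (N / (suc d * suc d))) ≤ N
∑-recip²-tail Q N zero = ≤-trans (≤-reflexive (*-zeroʳ Q)) z≤n
∑-recip²-tail Q N n@(suc _) = *-cancelˡ-≤ n (≤-trans (tail-telescope Q N n)
 (≤-trans (*-monoʳ-≤ N (m∸n≤m n Q)) (≤-reflexive (*-comm N n))))

∑-recip² : ∀ N n → ∑[ d < n ] N / (suc d * suc d) ≤ 2 * N
∑-recip² N zero = z≤n
∑-recip² N (suc n) = begin
 ∑[ d < suc n ] N / (suc d * suc d)
  ≡⟨ ∑-split 1 n (λ d → N / (suc d * suc d)) ⟩
 N / 1 + (∑[ d < n ] N / (suc (suc d) * suc (suc d)))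
  ≡⟨ cong₂ _+_ (n/1≡n N) (∑-cong n (λ d _ → sym (trans (cong (_* (N / (suc (suc d) * suc (suc d)))) (𝟙-yes (1 <? suc (suc d)) (s≤s z<s))) (*-identityˡ _)))) ⟩
 N + (∑[ d < n ] t (suc d))
  ≤⟨ +-monoʳ-≤ N (≤-trans (m≤n+m _ (t 0)) (≤-reflexive (sym (∑-split 1 n t)))) ⟩
 N + ∑ (suc n) t
  ≤⟨ +-monoʳ-≤ N (≤-trans (≤-reflexive (sym (*-identityˡ _))) (∑-recip²-tail 1 N (suc n))) ⟩
 N + N
  ≡⟨ cong (_+_ N) (sym (+-identityʳ N)) ⟩
 2 * N ∎
 where
 open ≤-Reasoning
 t : ℕ → ℕ
 t d = 𝟙 (1 <? suc d) * (N / (suc d * suc d))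

-- Dyadic blocks: each of the 2^h terms with 2^h < d ≤ 2^(h+1) is at most N / 2^h, so that every
-- block contributes at most N.
∑-recip : ∀ N n h → n ≤ 2 ^ h → ∑[ d < n ] N / suc d ≤ N * suc h
∑-recip N n h n≤ = ≤-trans (∑-mono-range (λ d → N / suc d) n≤) (dyadic h)
 where
 open ≤-Reasoning
 dyadic : ∀ h → ∑[ d < 2 ^ h ] N / suc d ≤ N * suc h
 dyadic zero = ≤-reflexive (trans (n/1≡n N) (sym (*-identityʳ N)))
 dyadic (suc h) = begin
  ∑[ d < 2 ^ suc h ] N / suc d
   ≡⟨ cong (λ k → ∑ k (λ d → N / suc d)) (cong (_+_ (2 ^ h)) (+-identityʳ (2 ^ h))) ⟩
  ∑[ d < 2 ^ h + 2 ^ h ] N / suc d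
   ≡⟨ ∑-split (2 ^ h) (2 ^ h) _ ⟩
  (∑[ d < 2 ^ h ] N / suc d) + (∑[ d < 2 ^ h ] N / suc (2 ^ h + d))
   ≤⟨ +-mono-≤ (dyadic h) (∑-mono (2 ^ h) (λ d _ → /-monoʳ-≤ N {{_}} {{nz}} (≤-trans (m≤m+n (2 ^ h) d) (n≤1+n _)))) ⟩
  N * suc h + (∑[ d < 2 ^ h ] (N / 2 ^ h) {{nz}})
   ≡⟨ cong (_+_ (N * suc h)) (∑-const (2 ^ h) _) ⟩
  N * suc h + 2 ^ h * (N / 2 ^ h) {{nz}}
   ≤⟨ +-monoʳ-≤ (N * suc h) (d*[n/d]≤n N (2 ^ h) {{nz}}) ⟩
  N * suc h + N
   ≡⟨ trans (+-comm _ N) (sym (*-suc N (suc h))) ⟩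
  N * suc (suc h) ∎
  where
  nz : NonZero (2 ^ h)
  nz = m^n≢0 2 h

∑-swap₂ : ∀ m p q (f : ℕ → ℕ → ℕ → ℕ) →
 ∑[ i < m ] ∑[ a < p ] ∑[ b < q ] f i a b ≡ ∑[ a < p ] ∑[ b < q ] ∑[ i < m ] f i a b
∑-swap₂ m p q f = trans (∑-swap m p (λ i a → ∑[ b < q ] f i a b))
 (∑-cong p (λ a _ → ∑-swap m q (λ i b → f i a b)))

even-count : ∀ n c → ∑[ i < n + n ] 𝟙 (2 ∣? i + c) ≡ n
even-count zero c = refl
even-count (suc n) c = begin
 ∑ (suc n + suc n) t ≡⟨ cong (λ k → ∑ (suc k) t) (+-suc n n) ⟩
 ∑ (n + n) t + t (n + n) + t (suc (n + n)) ≡⟨ +-assoc (∑ (n + n) t) _ _ ⟩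
 ∑ (n + n) t + (t (n + n) + t (suc (n + n))) ≡⟨ cong₂ _+_ (even-count n c) (pair (n + n + c)) ⟩
 n + 1 ≡⟨ +-comm n 1 ⟩
 suc n ∎
 where
 open ≡-Reasoning
 t : ℕ → ℕ
 t i = 𝟙 (2 ∣? i + c)
 pair : ∀ m → 𝟙 (2 ∣? m) + 𝟙 (2 ∣? suc m) ≡ 1
 pair m with 2 ∣? m | 2 ∣? suc m
 ... | yes p | yes q = contradiction (∣⇒≤ (∣m+n∣m⇒∣n (subst (2 ∣_) (+-comm 1 m) q) p)) λ { (s≤s ()) }
 ... | yes p | no _ = refl
 ... | no _ | yes _ = refl
 ... | no ¬p | no ¬q = ⊥-elim (neither m ¬p ¬q)
  where
  neither : ∀ m → ¬ 2 ∣ m → ¬ 2 ∣ suc m → ⊥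
  neither zero ¬p ¬q = ¬p (divides 0 refl)
  neither (suc zero) ¬p ¬q = ¬q (divides 1 refl)
  neither (suc (suc m)) ¬p ¬q = neither m (λ d → ¬p (∣m∣n⇒∣m+n ∣-refl d)) (λ d → ¬q (∣m∣n⇒∣m+n ∣-refl d))

-- Second moment of the number of representations

cancel-zero : ∀ c {x} → .{{_ : NonZero c}} → + c *z x ≡ 0ℤ → x ≡ 0ℤ
cancel-zero (suc c) h with ℤₚ.i*j≡0⇒i≡0∨j≡0 (+ suc c) h
... | inj₂ x≡0 = x≡0

-z-≥ : ∀ {m n} → n ≤ m → + m -z + n ≡ + (m ∸ n)
-z-≥ {m} {n} n≤m = trans (ℤₚ.m-n≡m⊖n m n) (ℤₚ.⊖-≥ n≤m)

abs-between : ∀ {lo c m n} → lo ≤ m → m ≤ lo + c → lo ≤ n → n ≤ lo + c → abs (+ m -z + n) ≤ c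
abs-between {lo} {c} {m} {n} lm mu ln nu with ≤-total n m
... | inj₁ n≤m = subst (_≤ c) (sym (cong abs (-z-≥ n≤m))) (m≤n+o⇒m∸n≤o m n (≤-trans mu (+-monoˡ-≤ c ln)))
... | inj₂ m≤n = subst (_≤ c) (sym (trans (ℤₚ.∣i-j∣≡∣j-i∣ (+ m) (+ n)) (cong abs (-z-≥ m≤n))))
          (m≤n+o⇒m∸n≤o n m (≤-trans nu (+-monoˡ-≤ c lm)))

abs-pos-* : ∀ m i → abs (+ m *z i) ≡ m * abs i
abs-pos-* m i = ℤₚ.abs-* (+ m) i

coprime-∣ˡ : ∀ {d m n} → d ∣ m → Coprime m n → Coprime d n
coprime-∣ˡ d∣m c (p , q) = c (∣-trans p d∣m , q)

coprime-∣ʳ : ∀ {d m n} → d ∣ n → Coprime m n → Coprime m d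
coprime-∣ʳ d∣n c (p , q) = c (p , ∣-trans q d∣n)

coprime-*ʳ : ∀ {m n o} → Coprime m n → Coprime m o → Coprime m (n * o)
coprime-*ʳ {m} {n} {o} c c' {d} (d∣m , d∣no) = c' (d∣m , coprime-divisor (coprime-∣ˡ d∣m c) d∣no)

-- For a quadratic form the mean value theorem is exact at the midpoint: F(v') - F(v) is the
-- gradient at (v + v')/2 applied to v' - v. Here `η` and `w` are the midpoint values of y and z and
-- `b` is twice that of x, so `A b`, `2 η + w` and `η + 2 K w` are the three partial derivatives;
-- the step v' - v is a multiple of M = 2H.
key-identity : ∀ A K H x₀ y₀ z₀ X J i i' j j' k k' →
 let M = + 2 *z H ; x = x₀ +z M *z (X +z i) ; y = y₀ +z M *z (J +z j) ; z = z₀ +z M *z k ; x' = x₀ +z M *z (X +z i') ; y' = y₀ +z M *z (J +z j') ; z' = z₀ +z M *z k' ; η = y₀ +z H *z (+ 2 *z J +z (j +z j')) ; w = z₀ +z H *z (k +z k') ; b = + 2 *z x₀ +z M *z (+ 2 *z X +z (i +z i')) in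
 (A *z (x' *z x') +z y' *z y' +z y' *z z' +z K *z (z' *z z'))
  -z (A *z (x *z x) +z y *z y +z y *z z +z K *z (z *z z))
 ≡ M *z (A *z (i' -z i) *z b +z (j' -z j) *z (+ 2 *z η +z w) +z (k' -z k) *z (η +z + 2 *z K *z w))
key-identity = solve-∀z

form : ℕ → ℕ → ℕ → ℕ → ℕ → ℕ
form A K x y z = A * (x * x) + y * y + y * z + K * (z * z)

cast-* : ∀ m n → + (m * n) ≡ + m *z + n
cast-* = ℤₚ.pos-*

cast-form : ∀ A K x y z →
 + form A K x y z ≡ + A *z (+ x *z + x) +z + y *z + y +z + y *z + z +z + K *z (+ z *z + z)
cast-form A K x y z = cong₂ _+z_ (cong₂ _+z_ (cong₂ _+z_ (trip A x) (cast-* y y)) (cast-* y z)) (trip K z)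
 where
 trip : ∀ a b → + (a * (b * b)) ≡ + a *z (+ b *z + b)
 trip a b = trans (cast-* a (b * b)) (cong (+ a *z_) (cast-* b b))

sg : ℕ → ℕ
sg zero = 0
sg (suc _) = 1

sg≤1 : ∀ n → sg n ≤ 1
sg≤1 zero = z≤n
sg≤1 (suc n) = ≤-refl

sg-pos : ∀ n → 0 < sg n → 0 < n
sg-pos (suc n) _ = z<s

n≤c*sg : ∀ {n c d} → (0 < n → d * n ≤ c) → d * n ≤ c * sg n
n≤c*sg {zero} {c} {d} h = ≤-trans (≤-reflexive (*-zeroʳ d)) z≤n
n≤c*sg {suc n} {c} h = ≤-trans (h z<s) (≤-reflexive (sym (*-identityʳ c)))

∑-𝟙-unique : ∀ n {P : ℕ → Set} (d : ∀ i → Dec (P i)) c → c < n → P c → (∀ i → P i → i ≡ c) → ∑[ i < n ] 𝟙 (d i) ≡ 1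
∑-𝟙-unique n {P} d c c<n pc u = trans (∑-cong n (λ i _ → same i)) (∑-𝟙-hit n c c<n)
 where
 same : ∀ i → 𝟙 (d i) ≡ 𝟙 (c ≟ i)
 same i with d i | c ≟ i
 ... | yes _ | yes _ = refl
 ... | no _ | no _ = refl
 ... | yes p | no c≢i = contradiction (sym (u i p)) c≢i
 ... | no ¬p | yes refl = contradiction pc ¬p

∑-scale : ∀ n {P : ℕ → Set} (d : ∀ i → Dec (P i)) g → ∑[ i < n ] 𝟙 (d i) ≡ 1 → ∑[ i < n ] 𝟙 (d i) * g ≡ g
∑-scale n d g one = begin
 ∑[ i < n ] 𝟙 (d i) * g ≡⟨ ∑-cong n (λ i _ → *-comm (𝟙 (d i)) g) ⟩
 ∑[ i < n ] g * 𝟙 (d i) ≡⟨ ∑-*ˡ n g _ ⟩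
 g * (∑[ i < n ] 𝟙 (d i)) ≡⟨ cong (g *_) one ⟩
 g * 1 ≡⟨ *-identityʳ g ⟩
 g ∎
 where open ≡-Reasoning

count≤ : ∀ n d m .{{_ : NonZero d}} → d * m ≤ n + d → m ≤ n / d + 1
count≤ n d zero h = z≤n
count≤ n d (suc m) h = subst (suc m ≤_) (+-comm 1 (n / d)) (s≤s (/-bound d (+-cancelʳ-≤ d (d * m) n
 (≤-trans (≤-reflexive (trans (+-comm (d * m) d) (sym (*-suc d m)))) h))))

split-divisor : ∀ γ u v → 0 < γ → γ ∣ u * v → Σ ℕ λ δ₁ → Σ ℕ λ δ₂ → γ ≡ δ₁ * δ₂ × δ₁ ∣ u × δ₂ ∣ v
split-divisor γ u v γ>0 γ∣uv = δ₁ , q , γ≡ , gcd[m,n]∣n γ u , coprime-divisor cop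
  (*-cancelˡ-∣ δ₁ (subst₂ _∣_ γ≡ (trans (cong (_* v) u≡) (*-assoc δ₁ r v)) γ∣uv))
 where
 δ₁ = gcd γ u
 instance
  δ₁≢0 : NonZero δ₁
  δ₁≢0 = ≢-nonZero (gcd[m,n]≢0 γ u (inj₁ (>⇒≢ γ>0)))
 q = quotient (gcd[m,n]∣m γ u)
 r = quotient (gcd[m,n]∣n γ u)
 γ≡ : γ ≡ δ₁ * q
 γ≡ = trans (_∣_.equality (gcd[m,n]∣m γ u)) (*-comm q δ₁)
 u≡ : u ≡ δ₁ * r
 u≡ = trans (_∣_.equality (gcd[m,n]∣n γ u)) (*-comm r δ₁)
 cop : Coprime q r
 cop {d} (d∣q , d∣r) = ∣1⇒≡1 (*-cancelˡ-∣ δ₁ (subst (δ₁ * d ∣_) (sym (*-identityʳ δ₁))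
  (gcd-greatest (subst (δ₁ * d ∣_) (sym γ≡) (*-monoʳ-∣ δ₁ d∣q)) (subst (δ₁ * d ∣_) (sym u≡) (*-monoʳ-∣ δ₁ d∣r)))))

-- Sums over the factorisations of a common divisor

module DivisorSums (J N Q h : ℕ) (2J≤N : 2 * J ≤ N) (N≤ : N ≤ 2 ^ h) where

 -- A weight that is at least 1 as soon as one of the divisors `suc d₁`, `suc d₂` exceeds Q; being a
 -- sum of two terms it splits the double sum into two sums with one restricted variable each.
 W : ℕ → ℕ → ℕ
 W d₁ d₂ = 𝟙 (Q <? suc d₁) + 𝟙 (Q <? suc d₂)

 W≤2 : ∀ d₁ d₂ → W d₁ d₂ ≤ 2
 W≤2 d₁ d₂ = +-mono-≤ (𝟙≤1 (Q <? suc d₁)) (𝟙≤1 (Q <? suc d₂))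

 c : ℕ → ℕ
 c d = 2 * J / suc d

 c₂ : ℕ → ℕ → ℕ
 c₂ d₁ d₂ = 2 * J / (suc d₁ * suc d₂)

 -- Three congruences, modulo δ₁, δ₂ and δ₁ δ₂ with δ = `suc d`, are imposed on three variables with
 -- ranges of length at most 2J; `V` bounds the number of solutions, with a rounding error of 1 in
 -- each factor.
 V : ℕ → ℕ → ℕ
 V d₁ d₂ = (c d₁ + 1) * ((c d₂ + 1) * (c₂ d₁ d₂ + 1))

 h₁ : ℕ
 h₁ = suc h

 private
  J³ = J * J * J

  cube-bound : ∀ d₁ d₂ → c d₁ * c d₂ * c₂ d₁ d₂ ≤ 8 * J³ / (suc d₁ * suc d₁) / (suc d₂ * suc d₂)
  cube-bound d₁ d₂ = /-bound (suc d₂ * suc d₂) (/-bound (suc d₁ * suc d₁) (begin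
   suc d₁ * suc d₁ * (suc d₂ * suc d₂ * (c d₁ * c d₂ * c₂ d₁ d₂))
    ≡⟨ ring37 (suc d₁) (suc d₂) (c d₁) (c d₂) (c₂ d₁ d₂) ⟩
   suc d₁ * c d₁ * (suc d₂ * c d₂) * (suc d₁ * suc d₂ * c₂ d₁ d₂)
    ≤⟨ *-mono-≤ (*-mono-≤ (d*[n/d]≤n (2 * J) (suc d₁)) (d*[n/d]≤n (2 * J) (suc d₂))) (d*[n/d]≤n (2 * J) (suc d₁ * suc d₂)) ⟩
   2 * J * (2 * J) * (2 * J)
    ≡⟨ ring38 J ⟩
   8 * (J * J * J) ∎))
   where
   open ≤-Reasoning

 -- Without the rounding errors `V` is at most 8 J³ / (δ₁ δ₂)², whose sum converges; the tail with
 -- one of the divisors above Q is smaller by a factor Q.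
 cubes : Q * (∑[ d₁ < N ] ∑[ d₂ < N ] W d₁ d₂ * (c d₁ * c d₂ * c₂ d₁ d₂)) ≤ 32 * J³
 cubes = begin
  Q * (∑[ d₁ < N ] ∑[ d₂ < N ] W d₁ d₂ * (c d₁ * c d₂ * c₂ d₁ d₂))
   ≤⟨ *-monoʳ-≤ Q (∑-mono N (λ d₁ _ → ∑-mono N (λ d₂ _ → *-monoʳ-≤ (W d₁ d₂) (cube-bound d₁ d₂)))) ⟩
  Q * (∑[ d₁ < N ] ∑[ d₂ < N ] W d₁ d₂ * t d₁ d₂)
   ≡⟨ cong (Q *_) (∑-cong N (λ d₁ _ → trans (∑-cong N (λ d₂ _ → *-distribʳ-+ (t d₁ d₂) (p d₁) (p d₂))) (∑-+ N _ _))) ⟩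
  Q * (∑[ d₁ < N ] ((∑[ d₂ < N ] p d₁ * t d₁ d₂) + (∑[ d₂ < N ] p d₂ * t d₁ d₂)))
   ≡⟨ trans (cong (Q *_) (∑-+ N _ _)) (*-distribˡ-+ Q _ _) ⟩
  Q * (∑[ d₁ < N ] ∑[ d₂ < N ] p d₁ * t d₁ d₂) + Q * (∑[ d₁ < N ] ∑[ d₂ < N ] p d₂ * t d₁ d₂)
   ≤⟨ +-mono-≤ first second ⟩
  2 * (8 * J³) + 2 * (8 * J³)
   ≡⟨ ring78 J³ ⟩
  32 * J³ ∎
  where
  open ≤-Reasoning
  p : ℕ → ℕ
  p d = 𝟙 (Q <? suc d)
  t₁ : ℕ → ℕ
  t₁ d = 8 * J³ / (suc d * suc d)
  t : ℕ → ℕ → ℕ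
  t d₁ d₂ = t₁ d₁ / (suc d₂ * suc d₂)
  first : Q * (∑[ d₁ < N ] ∑[ d₂ < N ] p d₁ * t d₁ d₂) ≤ 2 * (8 * J³)
  first = begin
   Q * (∑[ d₁ < N ] ∑[ d₂ < N ] p d₁ * t d₁ d₂)
    ≡⟨ cong (Q *_) (∑-cong N (λ d₁ _ → ∑-*ˡ N (p d₁) _)) ⟩
   Q * (∑[ d₁ < N ] p d₁ * (∑[ d₂ < N ] t d₁ d₂))
    ≤⟨ *-monoʳ-≤ Q (∑-mono N (λ d₁ _ → *-monoʳ-≤ (p d₁) (∑-recip² (t₁ d₁) N))) ⟩
   Q * (∑[ d₁ < N ] p d₁ * (2 * t₁ d₁))
    ≡⟨ cong (Q *_) (trans (∑-cong N (λ d₁ _ → ring34 (p d₁) (t₁ d₁))) (∑-*ˡ N 2 _)) ⟩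
   Q * (2 * (∑[ d₁ < N ] p d₁ * t₁ d₁))
    ≡⟨ ring34 Q _ ⟩
   2 * (Q * (∑[ d₁ < N ] p d₁ * t₁ d₁))
    ≤⟨ *-monoʳ-≤ 2 (∑-recip²-tail Q (8 * J³) N) ⟩
   2 * (8 * J³) ∎
  second : Q * (∑[ d₁ < N ] ∑[ d₂ < N ] p d₂ * t d₁ d₂) ≤ 2 * (8 * J³)
  second = begin
   Q * (∑[ d₁ < N ] ∑[ d₂ < N ] p d₂ * t d₁ d₂)
    ≡⟨ sym (∑-*ˡ N Q _) ⟩
   ∑[ d₁ < N ] Q * (∑[ d₂ < N ] p d₂ * t d₁ d₂)
    ≤⟨ ∑-mono N (λ d₁ _ → ∑-recip²-tail Q (t₁ d₁) N) ⟩
   ∑[ d₁ < N ] t₁ d₁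
    ≤⟨ ∑-recip² (8 * J³) N ⟩
   2 * (8 * J³) ∎

 c+1≤ : ∀ d → d < N → c d + 1 ≤ 2 * N / suc d
 c+1≤ d d<N = /-bound (suc d) (begin
  suc d * (c d + 1) ≡⟨ trans (*-distribˡ-+ (suc d) (c d) 1) (cong (_+_ (suc d * c d)) (*-identityʳ (suc d))) ⟩
  suc d * c d + suc d ≤⟨ +-mono-≤ (≤-trans (d*[n/d]≤n (2 * J) (suc d)) 2J≤N) d<N ⟩
  N + N ≡⟨ cong (_+_ N) (sym (+-identityʳ N)) ⟩
  2 * N ∎)
  where open ≤-Reasoning

 squares : ∑[ d₁ < N ] ∑[ d₂ < N ] W d₁ d₂ * (4 * ((c d₁ + 1) * (c d₂ + 1))) ≤ 32 * (N * N * (h₁ * h₁))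
 squares = begin
  ∑[ d₁ < N ] ∑[ d₂ < N ] W d₁ d₂ * (4 * ((c d₁ + 1) * (c d₂ + 1)))
   ≤⟨ ∑-mono N (λ d₁ d₁< → ∑-mono N (λ d₂ d₂< → *-mono-≤ (W≤2 d₁ d₂) (*-monoʳ-≤ 4 (*-mono-≤ (c+1≤ d₁ d₁<) (c+1≤ d₂ d₂<))))) ⟩
  ∑[ d₁ < N ] ∑[ d₂ < N ] 2 * (4 * (r d₁ * r d₂))
   ≡⟨ ∑-cong N (λ d₁ _ → trans (∑-cong N (λ d₂ _ → ring79 (r d₁) (r d₂))) (∑-*ˡ N (8 * r d₁) r)) ⟩
  ∑[ d₁ < N ] 8 * r d₁ * ∑ N r
   ≤⟨ ∑-mono N (λ d₁ _ → *-monoʳ-≤ (8 * r d₁) (∑-recip (2 * N) N h N≤)) ⟩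
  ∑[ d₁ < N ] 8 * r d₁ * (2 * N * h₁)
   ≡⟨ trans (∑-cong N (λ d₁ _ → ring80 (r d₁) (2 * N * h₁))) (∑-*ˡ N (8 * (2 * N * h₁)) r) ⟩
  8 * (2 * N * h₁) * ∑ N r
   ≤⟨ *-monoʳ-≤ (8 * (2 * N * h₁)) (∑-recip (2 * N) N h N≤) ⟩
  8 * (2 * N * h₁) * (2 * N * h₁)
   ≡⟨ ring81 N h₁ ⟩
  32 * (N * N * (h₁ * h₁)) ∎
  where
  open ≤-Reasoning
  r : ℕ → ℕ
  r d = 2 * N / suc d

 -- The weight δ₁ δ₂ is spent on the first two factors of `V`, which become at most 2N each. The
 -- third is at most 2N / (δ₁ δ₂), where the truncation δ₁ δ₂ ≤ N pays for the rounding, and two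
 -- harmonic sums remain.
 weighted : ∑[ d₁ < N ] ∑[ d₂ < N ] W d₁ d₂ * (𝟙 (suc d₁ * suc d₂ ≤? N) * (suc d₁ * suc d₂ * V d₁ d₂)) ≤ 16 * (N * N * N * (h₁ * h₁))
 weighted = begin
  ∑[ d₁ < N ] ∑[ d₂ < N ] W d₁ d₂ * (𝟙 (suc d₁ * suc d₂ ≤? N) * (suc d₁ * suc d₂ * V d₁ d₂))
   ≤⟨ ∑-mono N (λ d₁ d₁< → ∑-mono N (λ d₂ d₂< → *-mono-≤ (W≤2 d₁ d₂) (term d₁ d₂ d₁< d₂<))) ⟩
  ∑[ d₁ < N ] ∑[ d₂ < N ] 2 * (2 * N * (2 * N) * (r d₁ / suc d₂))
   ≡⟨ ∑-cong N (λ d₁ _ → trans (∑-cong N (λ d₂ _ → sym (*-assoc 2 (2 * N * (2 * N)) (r d₁ / suc d₂)))) (∑-*ˡ N (2 * (2 * N * (2 * N))) _)) ⟩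
  ∑[ d₁ < N ] 2 * (2 * N * (2 * N)) * (∑[ d₂ < N ] r d₁ / suc d₂)
   ≤⟨ ∑-mono N (λ d₁ _ → *-monoʳ-≤ (2 * (2 * N * (2 * N))) (∑-recip (r d₁) N h N≤)) ⟩
  ∑[ d₁ < N ] 2 * (2 * N * (2 * N)) * (r d₁ * h₁)
   ≡⟨ trans (∑-cong N (λ d₁ _ → ring82 (2 * (2 * N * (2 * N))) (r d₁) h₁)) (∑-*ˡ N (2 * (2 * N * (2 * N)) * h₁) r) ⟩
  2 * (2 * N * (2 * N)) * h₁ * ∑ N r
   ≤⟨ *-monoʳ-≤ (2 * (2 * N * (2 * N)) * h₁) (∑-recip (2 * N) N h N≤) ⟩
  2 * (2 * N * (2 * N)) * h₁ * (2 * N * h₁)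
   ≡⟨ ring83 N h₁ ⟩
  16 * (N * N * N * (h₁ * h₁)) ∎
  where
  open ≤-Reasoning
  r : ℕ → ℕ
  r d = 2 * N / suc d
  d*[c+1]≤ : ∀ d → d < N → suc d * (c d + 1) ≤ 2 * N
  d*[c+1]≤ d d< = ≤-trans (*-monoʳ-≤ (suc d) (c+1≤ d d<)) (d*[n/d]≤n (2 * N) (suc d))
  term : ∀ d₁ d₂ → d₁ < N → d₂ < N → 𝟙 (suc d₁ * suc d₂ ≤? N) * (suc d₁ * suc d₂ * V d₁ d₂) ≤ 2 * N * (2 * N) * (r d₁ / suc d₂)
  term d₁ d₂ d₁< d₂< with suc d₁ * suc d₂ ≤? N
  ... | no _ = z≤n
  ... | yes δ≤N = begin
   1 * (suc d₁ * suc d₂ * V d₁ d₂) ≡⟨ ring39 (suc d₁) (suc d₂) (c d₁ + 1) (c d₂ + 1) (c₂ d₁ d₂ + 1) ⟩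
   suc d₁ * (c d₁ + 1) * (suc d₂ * (c d₂ + 1)) * (c₂ d₁ d₂ + 1) ≤⟨ *-mono-≤ (*-mono-≤ (d*[c+1]≤ d₁ d₁<) (d*[c+1]≤ d₂ d₂<)) last ⟩
   2 * N * (2 * N) * (r d₁ / suc d₂) ∎
   where
   last : c₂ d₁ d₂ + 1 ≤ r d₁ / suc d₂
   last = /-bound (suc d₂) (/-bound (suc d₁) (begin
    suc d₁ * (suc d₂ * (c₂ d₁ d₂ + 1)) ≡⟨ ring14 (suc d₁) (suc d₂) (c₂ d₁ d₂) ⟩
    suc d₁ * suc d₂ * c₂ d₁ d₂ + suc d₁ * suc d₂ ≤⟨ +-mono-≤ (≤-trans (d*[n/d]≤n (2 * J) (suc d₁ * suc d₂)) 2J≤N) δ≤N ⟩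
    N + N ≡⟨ cong (_+_ N) (sym (+-identityʳ N)) ⟩
    2 * N ∎))

 V≤ : ∀ d₁ d₂ → V d₁ d₂ ≤ c d₁ * c d₂ * c₂ d₁ d₂ + 4 * ((c d₁ + 1) * (c d₂ + 1))
 V≤ d₁ d₂ = begin
  V d₁ d₂ ≡⟨ ring84 x y z ⟩
  x * y * z + ((x + 1) * (y + 1) + (z * x + z * y + z)) ≤⟨ +-monoʳ-≤ (x * y * z) (+-monoʳ-≤ ((x + 1) * (y + 1))
                               (+-mono-≤ (+-mono-≤ (*-monoˡ-≤ x z≤y) (*-monoˡ-≤ y z≤x)) z≤x)) ⟩
  x * y * z + ((x + 1) * (y + 1) + (y * x + x * y + x)) ≤⟨ +-monoʳ-≤ (x * y * z) (≤-trans (m≤m+n _ (x + x + 3 * y + 3 + x * y)) (≤-reflexive (ring85 x y))) ⟩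
  x * y * z + 4 * ((x + 1) * (y + 1)) ∎
  where
  open ≤-Reasoning
  x = c d₁
  y = c d₂
  z = c₂ d₁ d₂
  z≤x : z ≤ x
  z≤x = /-monoʳ-≤ (2 * J) (≤-trans (≤-reflexive (sym (*-identityʳ (suc d₁)))) (*-monoʳ-≤ (suc d₁) {1} {suc d₂} (s≤s z≤n)))
  z≤y : z ≤ y
  z≤y = /-monoʳ-≤ (2 * J) (≤-trans (≤-reflexive (sym (*-identityˡ (suc d₂)))) (*-monoˡ-≤ (suc d₂) {1} {suc d₁} (s≤s z≤n)))

 -- The two ranges of divisors: the cubes are controlled by Q, everything else is of lower order in J.
 divisor-sum : ∀ u v → Q * (∑[ d₁ < N ] ∑[ d₂ < N ] W d₁ d₂ * (𝟙 (suc d₁ * suc d₂ ≤? N) * ((u + v * (suc d₁ * suc d₂)) * V d₁ d₂)))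
  ≤ u * (32 * J³) + Q * (u * (32 * (N * N * (h₁ * h₁))) + v * (16 * (N * N * N * (h₁ * h₁))))
 divisor-sum u v = begin
  Q * (∑[ d₁ < N ] ∑[ d₂ < N ] W d₁ d₂ * (𝟙 (suc d₁ * suc d₂ ≤? N) * ((u + v * (suc d₁ * suc d₂)) * V d₁ d₂)))
   ≤⟨ *-monoʳ-≤ Q (∑-mono N (λ d₁ _ → ∑-mono N (λ d₂ _ → term d₁ d₂))) ⟩
  Q * (∑[ d₁ < N ] ∑[ d₂ < N ] (u * (f₁ d₁ d₂ + f₂ d₁ d₂) + v * f₃ d₁ d₂))
   ≡⟨ cong (Q *_) split ⟩
  Q * (u * (F₁ + F₂) + v * F₃)
   ≡⟨ ring86 Q u v F₁ F₂ F₃ ⟩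
  u * (Q * F₁) + Q * (u * F₂ + v * F₃)
   ≤⟨ +-mono-≤ (*-monoʳ-≤ u cubes) (*-monoʳ-≤ Q (+-mono-≤ (*-monoʳ-≤ u squares) (*-monoʳ-≤ v weighted))) ⟩
  u * (32 * J³) + Q * (u * (32 * (N * N * (h₁ * h₁))) + v * (16 * (N * N * N * (h₁ * h₁)))) ∎
  where
  open ≤-Reasoning
  f₁ f₂ f₃ : ℕ → ℕ → ℕ
  f₁ d₁ d₂ = W d₁ d₂ * (c d₁ * c d₂ * c₂ d₁ d₂)
  f₂ d₁ d₂ = W d₁ d₂ * (4 * ((c d₁ + 1) * (c d₂ + 1)))
  f₃ d₁ d₂ = W d₁ d₂ * (𝟙 (suc d₁ * suc d₂ ≤? N) * (suc d₁ * suc d₂ * V d₁ d₂))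
  F₁ = ∑[ d₁ < N ] ∑[ d₂ < N ] f₁ d₁ d₂
  F₂ = ∑[ d₁ < N ] ∑[ d₂ < N ] f₂ d₁ d₂
  F₃ = ∑[ d₁ < N ] ∑[ d₂ < N ] f₃ d₁ d₂
  split : ∑[ d₁ < N ] ∑[ d₂ < N ] (u * (f₁ d₁ d₂ + f₂ d₁ d₂) + v * f₃ d₁ d₂) ≡ u * (F₁ + F₂) + v * F₃
  split = trans (∑-cong N (λ d₁ _ → trans (∑-+ N _ _) (cong₂ _+_ (trans (∑-*ˡ N u _) (cong (u *_) (∑-+ N _ _))) (∑-*ˡ N v _))))
   (trans (∑-+ N _ _) (cong₂ _+_ (trans (∑-*ˡ N u _) (cong (u *_) (∑-+ N _ _))) (∑-*ˡ N v _)))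
  term : ∀ d₁ d₂ → W d₁ d₂ * (𝟙 (suc d₁ * suc d₂ ≤? N) * ((u + v * (suc d₁ * suc d₂)) * V d₁ d₂)) ≤ u * (f₁ d₁ d₂ + f₂ d₁ d₂) + v * f₃ d₁ d₂
  term d₁ d₂ = begin
   ω * (ψ * ((u + v * δ) * V d₁ d₂)) ≡⟨ ring40 ω ψ u v δ (V d₁ d₂) ⟩
   u * (ω * (ψ * V d₁ d₂)) + v * (ω * (ψ * (δ * V d₁ d₂))) ≤⟨ +-monoˡ-≤ _ (*-monoʳ-≤ u (*-monoʳ-≤ ω (≤-trans (*-monoˡ-≤ (V d₁ d₂) (𝟙≤1 (δ ≤? N))) (≤-trans (≤-reflexive (*-identityˡ _)) (V≤ d₁ d₂))))) ⟩
   u * (ω * (c d₁ * c d₂ * c₂ d₁ d₂ + 4 * ((c d₁ + 1) * (c d₂ + 1)))) + v * f₃ d₁ d₂ ≡⟨ cong (λ s → u * s + v * f₃ d₁ d₂) (*-distribˡ-+ ω _ _) ⟩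
   u * (f₁ d₁ d₂ + f₂ d₁ d₂) + v * f₃ d₁ d₂ ∎
   where
   ω = W d₁ d₂
   δ = suc d₁ * suc d₂
   ψ = 𝟙 (δ ≤? N)

∑-prod : ∀ m n f g → ∑ m f * ∑ n g ≡ ∑[ i < m ] ∑[ j < n ] f i * g j
∑-prod m n f g = begin
 ∑ m f * ∑ n g ≡⟨ *-comm (∑ m f) (∑ n g) ⟩
 ∑ n g * ∑ m f ≡⟨ sym (∑-*ˡ m (∑ n g) f) ⟩
 ∑[ i < m ] ∑ n g * f i ≡⟨ ∑-cong m (λ i _ → trans (*-comm (∑ n g) (f i)) (sym (∑-*ˡ n (f i) g))) ⟩
 ∑[ i < m ] ∑[ j < n ] f i * g j ∎
 where open ≡-Reasoning

2ab≤a²+b² : ∀ a b → 2 * (a * b) ≤ a * a + b * b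
2ab≤a²+b² a b with ≤-total a b
... | inj₁ a≤b = subst (λ b → 2 * (a * b) ≤ a * a + b * b) (m+[n∸m]≡n a≤b)
          (≤-trans (m≤m+n _ ((b ∸ a) * (b ∸ a))) (≤-reflexive (ring135 a (b ∸ a))))
... | inj₂ b≤a = subst (λ a → 2 * (a * b) ≤ a * a + b * b) (m+[n∸m]≡n b≤a)
          (≤-trans (m≤m+n _ ((a ∸ b) * (a ∸ b))) (≤-reflexive (ring136 b (a ∸ b))))

-- The inequality 2 c (q r) ≤ c² + (q r)², summed over those m for which r = `ρ m` is positive. With
-- c / q the expected multiplicity it bounds the size of the support from below, and it is sharp if
-- the multiplicities concentrate there.
chebyshev : ∀ n ρ c q → 2 * (c * q * ∑ n ρ) ≤ c * c * (∑[ m < n ] sg (ρ m)) + q * q * (∑[ m < n ] ρ m * ρ m)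
chebyshev n ρ c q = begin
 2 * (c * q * ∑ n ρ) ≡⟨ trans (cong (2 *_) (sym (∑-*ˡ n (c * q) ρ))) (sym (∑-*ˡ n 2 _)) ⟩
 ∑[ m < n ] 2 * (c * q * ρ m) ≤⟨ ∑-mono n (λ m _ → term (ρ m)) ⟩
 ∑[ m < n ] (c * c * sg (ρ m) + q * q * (ρ m * ρ m)) ≡⟨ trans (∑-+ n _ _) (cong₂ _+_ (∑-*ˡ n (c * c) _) (∑-*ˡ n (q * q) _)) ⟩
 c * c * (∑[ m < n ] sg (ρ m)) + q * q * (∑[ m < n ] ρ m * ρ m) ∎
 where
 open ≤-Reasoning
 term : ∀ r → 2 * (c * q * r) ≤ c * c * sg r + q * q * (r * r)
 term zero = ≤-trans (≤-reflexive (trans (cong (2 *_) (*-zeroʳ (c * q))) refl)) z≤n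
 term (suc r) = begin
  2 * (c * q * suc r) ≡⟨ cong (2 *_) (*-assoc c q (suc r)) ⟩
  2 * (c * (q * suc r)) ≤⟨ 2ab≤a²+b² c (q * suc r) ⟩
  c * c + q * suc r * (q * suc r) ≡⟨ ring87 c q (suc r) ⟩
  c * c * 1 + q * q * (suc r * suc r) ∎

-- A residue class of points modulo 2H. By `cop` the partial derivative 2y + z is prime to H on the
-- whole class; by `dense` every prime up to Q divides H. Together they force each divisor > 1 of
-- that derivative to exceed Q. The divisibilities of H by 2, A and L allow these factors to be
-- cancelled against it.
record Admissible (A K L H Q x₀ y₀ z₀ : ℕ) : Set where
 field
  H>0 : 0 < H
  A>0 : 0 < A
  2∣H : 2 ∣ H
  A∣H : A ∣ H
  L∣H : L ∣ H
  4K : suc L ≡ 4 * K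
  cop : Coprime (2 * y₀ + z₀) H
  x₀≤ : x₀ ≤ 2 * H
  y₀≤ : y₀ ≤ 2 * H
  z₀≤ : z₀ ≤ 2 * H
  dense : ∀ q → 2 ≤ q → q ≤ Q → ¬ Coprime q H

module SecondMoment (A K L H Q x₀ y₀ z₀ J X I : ℕ) (adm : Admissible A K L H Q x₀ y₀ z₀) where
 open Admissible adm

 M : ℕ
 M = 2 * H

 -- The box has 0 ≤ i < I and 0 ≤ j, k < J. The offset X makes the derivative in x dominate; the
 -- offset J in y keeps the derivative `E` in y at least 2MJ, of the same order as its maximum.
 Φ : ℕ → ℕ → ℕ → ℕ
 Φ i j k = form A K (x₀ + M * (X + i)) (y₀ + M * (J + j)) (z₀ + M * k)

 w : ℕ → ℕ
 w s = z₀ + H * s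

 η : ℕ → ℕ
 η σ = y₀ + H * (2 * J + σ)

 E : ℕ → ℕ → ℕ
 E s σ = 2 * η σ + w s

 θ : ℕ → ℕ → ℕ
 θ s σ = η σ + 2 * K * w s

 b : ℕ → ℕ → ℕ
 b i i' = 2 * x₀ + M * (2 * X + (i + i'))

 cast-M : + M ≡ + 2 *z + H
 cast-M = cast-* 2 H

 cast-coord : ∀ c m n → + (c + M * (m + n)) ≡ + c +z (+ 2 *z + H) *z (+ m +z + n)
 cast-coord c m n = cong (+ c +z_) (trans (cast-* M (m + n)) (cong (_*z (+ m +z + n)) cast-M))

 cast-w : ∀ k k' → + w (k + k') ≡ + z₀ +z + H *z (+ k +z + k')
 cast-w k k' = cong (+ z₀ +z_) (cast-* H (k + k'))

 cast-η : ∀ j j' → + η (j + j') ≡ + y₀ +z + H *z (+ 2 *z + J +z (+ j +z + j'))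
 cast-η j j' = cong (+ y₀ +z_) (trans (cast-* H (2 * J + (j + j')))
  (cong (λ v → + H *z (v +z (+ j +z + j'))) (cast-* 2 J)))

 cast-E : ∀ j j' k k' → + E (k + k') (j + j') ≡ + 2 *z + η (j + j') +z + w (k + k')
 cast-E j j' k k' = cong (_+z + w (k + k')) (cast-* 2 (η (j + j')))

 cast-θ : ∀ s σ → + θ s σ ≡ + η σ +z + 2 *z + K *z + w s
 cast-θ s σ = cong (+ η σ +z_) (trans (cast-* (2 * K) (w s)) (cong (_*z + w s) (cast-* 2 K)))

 cast-b : ∀ i i' → + b i i' ≡ + 2 *z + x₀ +z (+ 2 *z + H) *z (+ 2 *z + X +z (+ i +z + i'))
 cast-b i i' = cong₂ _+z_ (cast-* 2 x₀) (trans (cast-* M (2 * X + (i + i')))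
  (cong₂ (λ u v → u *z (v +z (+ i +z + i'))) cast-M (cast-* 2 X)))

 cast-Φ : ∀ i j k → let x = + x₀ +z (+ 2 *z + H) *z (+ X +z + i) ; y = + y₀ +z (+ 2 *z + H) *z (+ J +z + j) ; z = + z₀ +z (+ 2 *z + H) *z + k in
      + Φ i j k ≡ + A *z (x *z x) +z y *z y +z y *z z +z + K *z (z *z z)
 cast-Φ i j k = trans (cast-form A K (x₀ + M * (X + i)) (y₀ + M * (J + j)) (z₀ + M * k))
  (cong₃ (λ x y z → + A *z (x *z x) +z y *z y +z y *z z +z + K *z (z *z z))
   (cast-coord x₀ X i) (cast-coord y₀ J j)
   (cong (+ z₀ +z_) (trans (cast-* M k) (cong (_*z + k) cast-M))))
  where
  cong₃ : ∀ {P : Set} (f : P → P → P → P) {a a' b b' c c'} → a ≡ a' → b ≡ b' → c ≡ c' → f a b c ≡ f a' b' c'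
  cong₃ f refl refl refl = refl

 key : .{{_ : NonZero H}} → ∀ {i i' j j' k k'} → Φ i j k ≡ Φ i' j' k' →
  + A *z (+ i' -z + i) *z + b i i' +z (+ j' -z + j) *z + E (k + k') (j + j')
   +z (+ k' -z + k) *z + θ (k + k') (j + j') ≡ 0ℤ
 key {i} {i'} {j} {j'} {k} {k'} eq = cancel-zero M {{m*n≢0 2 H}} (begin
  + M *z (+ A *z (+ i' -z + i) *z + b i i' +z (+ j' -z + j) *z + E (k + k') (j + j')
   +z (+ k' -z + k) *z + θ (k + k') (j + j'))
    ≡⟨ cong₂ _*z_ cast-M (cong₂ _+z_ (cong₂ _+z_ (cong (+ A *z (+ i' -z + i) *z_) (cast-b i i'))
       (cong ((+ j' -z + j) *z_) (trans (cast-E j j' k k') (cong₂ (λ u v → + 2 *z u +z v) (cast-η j j') (cast-w k k')))))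
       (cong ((+ k' -z + k) *z_) (trans (cast-θ (k + k') (j + j')) (cong₂ (λ u v → u +z + 2 *z + K *z v) (cast-η j j') (cast-w k k'))))) ⟩
  _ ≡⟨ sym (key-identity (+ A) (+ K) (+ H) (+ x₀) (+ y₀) (+ z₀) (+ X) (+ J) (+ i) (+ i') (+ j) (+ j') (+ k) (+ k')) ⟩
  _ ≡⟨ sym (cong₂ _-z_ (cast-Φ i' j' k') (cast-Φ i j k)) ⟩
  + Φ i' j' k' -z + Φ i j k ≡⟨ cong (λ v → + Φ i' j' k' -z + v) eq ⟩
  + Φ i' j' k' -z + Φ i' j' k' ≡⟨ ℤₚ.+-inverseʳ (+ Φ i' j' k') ⟩
  0ℤ ∎)
  where open ≡-Reasoning

 -- Pairs of points with the same value are sorted by k, k', σ = j + j' and α = I + i' - i, where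
 -- the shift by I keeps α natural and `a` = α - I is the true difference. For fixed k, k' and σ the
 -- derivatives `E` and `θ` at the midpoint are constant, and the equation is linear in j.
 record Solution (k k' σ α i : ℕ) : Set where
  constructor solution
  field
   {i' j j'} : ℕ
   i<I : i < I
   i'<I : i' < I
   j<J : j < J
   j'<J : j' < J
   j+j' : j + j' ≡ σ
   i+α : i + α ≡ I + i'
   Φ≡ : Φ i j k ≡ Φ i' j' k'

  a : ℤ
  a = + α -z + I

  i'-i : + i' -z + i ≡ a
  i'-i = begin
   + i' -z + i ≡⟨ ringz22 (+ i) (+ i') (+ I) ⟩
   (+ I +z + i') -z + I -z + i ≡⟨ cong (λ v → + v -z + I -z + i) (sym i+α) ⟩
   (+ i +z + α) -z + I -z + i ≡⟨ ringz23 (+ i) (+ α) (+ I) ⟩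
   a ∎
   where
   open ≡-Reasoning

  j'-j : + j' -z + j ≡ + σ -z + 2 *z + j
  j'-j = trans (ringz4 (+ j) (+ j')) (cong (λ v → + v -z + 2 *z + j) j+j')

  equation : .{{_ : NonZero H}} → + A *z a *z + b i i' +z (+ σ -z + 2 *z + j) *z + E (k + k') σ
   +z (+ k' -z + k) *z + θ (k + k') σ ≡ 0ℤ
  equation = subst (λ τ → + A *z a *z + b i i' +z (+ τ -z + 2 *z + j) *z + E (k + k') τ
         +z (+ k' -z + k) *z + θ (k + k') τ ≡ 0ℤ) j+j'
   (subst₂ (λ u v → + A *z u *z + b i i' +z v *z + E (k + k') (j + j') +z (+ k' -z + k) *z + θ (k + k') (j + j') ≡ 0ℤ)
    i'-i (trans j'-j (cong (λ v → + v -z + 2 *z + j) (sym j+j'))) (key Φ≡))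

 open Solution

 instance
  H≢0 : NonZero H
  H≢0 = >-nonZero H>0

 E-expand : ∀ s σ → E s σ ≡ (2 * y₀ + z₀) + H * (2 * (2 * J + σ) + s)
 E-expand s σ = ring88 H y₀ z₀ J s σ

 E-coprime : ∀ s σ → Coprime (E s σ) H
 E-coprime s σ {d} (d∣E , d∣H) = cop (∣m+n∣m⇒∣n (subst (d ∣_) (trans (E-expand s σ) (+-comm (2 * y₀ + z₀) _)) d∣E)
                     (∣m⇒∣m*n _ d∣H) , d∣H)

 E-coprime-M : ∀ s σ → Coprime (E s σ) M
 E-coprime-M s σ = coprime-*ʳ (coprime-∣ʳ 2∣H (E-coprime s σ)) (E-coprime s σ)

 b-diff : ∀ i₁ i₁' i₂ i₂' → + b i₁ i₁' -z + b i₂ i₂' ≡ + M *z ((+ i₁ +z + i₁') -z (+ i₂ +z + i₂'))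
 b-diff i₁ i₁' i₂ i₂' = trans (cong₂ _-z_ (cast-b i₁ i₁') (cast-b i₂ i₂'))
  (trans (ringz40 (+ x₀) (+ 2 *z + H) (+ X) (+ i₁ +z + i₁') (+ i₂ +z + i₂')) (cong (_*z ((+ i₁ +z + i₁') -z (+ i₂ +z + i₂'))) (sym cast-M)))

 -- Subtracting the key equations of two solutions with the same k, k' and σ.
 difference : ∀ {k k' σ α₁ α₂ i₁ i₂} (S₁ : Solution k k' σ α₁ i₁) (S₂ : Solution k k' σ α₂ i₂) →
  + A *z a S₂ *z + b i₂ (i' S₂) -z + A *z a S₁ *z + b i₁ (i' S₁) ≡ + 2 *z ((+ j S₂ -z + j S₁) *z + E (k + k') σ)
 difference {k} {k'} {σ} S₁ S₂ =
  trans (ringz41 (+ A *z a S₂ *z + b _ (i' S₂)) (+ A *z a S₁ *z + b _ (i' S₁)) (+ σ) (+ j S₁) (+ j S₂) (+ E (k + k') σ) ((+ k' -z + k) *z + θ (k + k') σ))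
   (trans (cong₂ (λ u v → u -z v +z + 2 *z ((+ j S₂ -z + j S₁) *z + E (k + k') σ)) (equation S₂) (equation S₁))
    (ℤₚ.+-identityˡ _))

 -- With α fixed as well, only `b` and j still vary with i, and `b` grows by 2M for each unit of i.
 -- This yields the congruence modulo `E` that restricts i.
 same-α : ∀ {k k' σ α i₁ i₂} (S₁ : Solution k k' σ α i₁) (S₂ : Solution k k' σ α i₂) →
  + A *z (+ α -z + I) *z + M *z (+ i₂ -z + i₁) ≡ (+ j S₂ -z + j S₁) *z + E (k + k') σ
 same-α {k} {k'} {σ} {α} {i₁} {i₂} S₁ S₂ = ℤₚ.i-j≡0⇒i≡j _ _ (cancel-zero 2 (begin
  + 2 *z (+ A *z a₀ *z + M *z (+ i₂ -z + i₁) -z Z)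
   ≡⟨ ringz42 (+ A) a₀ (+ M) (+ i₁) (+ i₂) Z ⟩
  + A *z a₀ *z (+ M *z ((+ i₂ +z (a₀ +z + i₂)) -z (+ i₁ +z (a₀ +z + i₁)))) -z + 2 *z Z
   ≡⟨ cong₂ (λ u v → + A *z a₀ *z (+ M *z ((+ i₂ +z u) -z (+ i₁ +z v))) -z + 2 *z Z) (shift S₂) (shift S₁) ⟩
  + A *z a₀ *z (+ M *z ((+ i₂ +z + i' S₂) -z (+ i₁ +z + i' S₁))) -z + 2 *z Z
   ≡⟨ cong (λ v → + A *z a₀ *z v -z + 2 *z Z) (sym (b-diff i₂ (i' S₂) i₁ (i' S₁))) ⟩
  + A *z a₀ *z (+ b i₂ (i' S₂) -z + b i₁ (i' S₁)) -z + 2 *z Z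
   ≡⟨ cong (_-z + 2 *z Z) (trans (ringz43 (+ A *z a₀) (+ b i₂ (i' S₂)) (+ b i₁ (i' S₁))) (difference S₁ S₂)) ⟩
  + 2 *z Z -z + 2 *z Z
   ≡⟨ ℤₚ.+-inverseʳ (+ 2 *z Z) ⟩
  0ℤ ∎))
  where
  open ≡-Reasoning
  a₀ = + α -z + I
  Z = (+ j S₂ -z + j S₁) *z + E (k + k') σ
  shift : ∀ {i} (S : Solution k k' σ α i) → a₀ +z + i ≡ + i' S
  shift {i} S = trans (cong (_+z + i) (sym (i'-i S))) (ringz24 (+ i' S) (+ i))

 dist : ℕ → ℕ
 dist α = abs (+ α -z + I)

 E∣dist*step : ∀ {k k' σ α i₁ i₂} → i₁ < i₂ → Solution k k' σ α i₁ → Solution k k' σ α i₂ →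
  E (k + k') σ ∣ dist α * (i₂ ∸ i₁)
 E∣dist*step {k} {k'} {σ} {α} {i₁} {i₂} i₁<i₂ S₁ S₂ =
  coprime-divisor (coprime-*ʳ (coprime-∣ʳ A∣H (E-coprime (k + k') σ)) (E-coprime-M (k + k') σ))
   (divides (abs (+ j S₂ -z + j S₁)) (begin
    A * M * (dist α * (i₂ ∸ i₁)) ≡⟨ ring89 A M (dist α) (i₂ ∸ i₁) ⟩
    A * dist α * M * (i₂ ∸ i₁) ≡⟨ cong (A * dist α * M *_) (cong abs (sym (-z-≥ (<⇒≤ i₁<i₂)))) ⟩
    A * dist α * M * abs (+ i₂ -z + i₁) ≡⟨ cong (_* abs (+ i₂ -z + i₁)) (cong (_* M) (sym (abs-pos-* A _))) ⟩
    abs (+ A *z (+ α -z + I)) * M * abs (+ i₂ -z + i₁) ≡⟨ cong (_* abs (+ i₂ -z + i₁)) (sym (ℤₚ.abs-* (+ A *z (+ α -z + I)) (+ M))) ⟩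
    abs (+ A *z (+ α -z + I) *z + M) * abs (+ i₂ -z + i₁) ≡⟨ sym (ℤₚ.abs-* (+ A *z (+ α -z + I) *z + M) _) ⟩
    abs (+ A *z (+ α -z + I) *z + M *z (+ i₂ -z + i₁)) ≡⟨ cong abs (same-α S₁ S₂) ⟩
    abs ((+ j S₂ -z + j S₁) *z + E (k + k') σ) ≡⟨ ℤₚ.abs-* (+ j S₂ -z + j S₁) _ ⟩
    abs (+ j S₂ -z + j S₁) * E (k + k') σ ∎))
  where
  open ≡-Reasoning

 E>0 : 0 < J → ∀ s σ → 0 < E s σ
 E>0 J>0 s σ = ≤-trans (pos-* {2} z<s (≤-trans (pos-* H>0 (≤-trans (pos-* {2} z<s J>0) (m≤m+n (2 * J) σ))) (m≤n+m _ y₀))) (m≤m+n _ (w s))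

 j-unique : 0 < J → ∀ {k k' σ α i} (S₁ S₂ : Solution k k' σ α i) → j S₁ ≡ j S₂
 j-unique J>0 {k} {k'} {σ} {α} {i} S₁ S₂ = sym (ℤₚ.+-injective (ℤₚ.i-j≡0⇒i≡j _ _
  (cancel-zero (E (k + k') σ) {{>-nonZero (E>0 J>0 (k + k') σ)}} (begin
   + E (k + k') σ *z (+ j S₂ -z + j S₁) ≡⟨ ℤₚ.*-comm (+ E (k + k') σ) _ ⟩
   (+ j S₂ -z + j S₁) *z + E (k + k') σ ≡⟨ sym (same-α S₁ S₂) ⟩
   + A *z (+ α -z + I) *z + M *z (+ i -z + i) ≡⟨ cong (+ A *z (+ α -z + I) *z + M *z_) (ℤₚ.+-inverseʳ (+ i)) ⟩
   + A *z (+ α -z + I) *z + M *z 0ℤ ≡⟨ ℤₚ.*-zeroʳ (+ A *z (+ α -z + I) *z + M) ⟩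
   0ℤ ∎))))
  where open ≡-Reasoning

 b₀ : ℕ
 b₀ = 2 * M * X

 Nm : ℕ
 Nm = 8 * (M * J)

 G : ℕ
 G = (11 + 4 * K) * (M * J * J)

 b₀≤b : ∀ i i' → b₀ ≤ b i i'
 b₀≤b i i' = begin
  2 * M * X ≡⟨ ring90 M X ⟩
  M * (2 * X) ≤⟨ *-monoʳ-≤ M (m≤m+n (2 * X) (i + i')) ⟩
  M * (2 * X + (i + i')) ≤⟨ m≤n+m _ (2 * x₀) ⟩
  b i i' ∎
  where
  open ≤-Reasoning

 b≤ : ∀ {i i'} → i < I → i' < I → b i i' ≤ b₀ + 2 * M * I
 b≤ {i} {i'} i<I i'<I = begin
  2 * x₀ + M * (2 * X + (i + i')) ≤⟨ +-monoˡ-≤ _ (*-monoʳ-≤ 2 x₀≤) ⟩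
  2 * M + M * (2 * X + (i + i')) ≡⟨ ring91 M X i i' ⟩
  2 * M * X + M * (suc i + suc i') ≤⟨ +-monoʳ-≤ (2 * M * X) (*-monoʳ-≤ M (+-mono-≤ i<I i'<I)) ⟩
  2 * M * X + M * (I + I) ≡⟨ ring92 M X I ⟩
  2 * M * X + 2 * M * I ∎
  where
  open ≤-Reasoning

 M≤MJ : 0 < J → M ≤ M * J
 M≤MJ J>0 = ≤-trans (≤-reflexive (sym (*-identityʳ M))) (*-monoʳ-≤ M J>0)

 η≤ : 0 < J → ∀ {σ} → σ ≤ 2 * J → η σ ≤ 3 * (M * J)
 η≤ J>0 {σ} σ≤ = begin
  y₀ + H * (2 * J + σ) ≤⟨ +-mono-≤ (≤-trans y₀≤ (M≤MJ J>0)) (*-monoʳ-≤ H (+-monoʳ-≤ (2 * J) σ≤)) ⟩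
  M * J + H * (2 * J + 2 * J) ≡⟨ ring93 H J ⟩
  3 * (M * J) ∎
  where
  open ≤-Reasoning

 w≤ : 0 < J → ∀ {s} → s ≤ 2 * J → w s ≤ 2 * (M * J)
 w≤ J>0 {s} s≤ = begin
  z₀ + H * s ≤⟨ +-mono-≤ (≤-trans z₀≤ (M≤MJ J>0)) (*-monoʳ-≤ H s≤) ⟩
  M * J + H * (2 * J) ≡⟨ ring94 H J ⟩
  2 * (M * J) ∎
  where
  open ≤-Reasoning

 E≤Nm : 0 < J → ∀ {s σ} → s ≤ 2 * J → σ ≤ 2 * J → E s σ ≤ Nm
 E≤Nm J>0 {s} {σ} s≤ σ≤ = begin
  2 * η σ + w s ≤⟨ +-mono-≤ (*-monoʳ-≤ 2 (η≤ J>0 σ≤)) (w≤ J>0 s≤) ⟩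
  2 * (3 * (M * J)) + 2 * (M * J) ≡⟨ ring95 (M * J) ⟩
  8 * (M * J) ∎
  where
  open ≤-Reasoning

 2MJ≤E : ∀ s σ → 2 * M * J ≤ E s σ
 2MJ≤E s σ = begin
  2 * M * J ≡⟨ ring96 H J ⟩
  2 * (H * (2 * J)) ≤⟨ *-monoʳ-≤ 2 (≤-trans (*-monoʳ-≤ H (m≤m+n (2 * J) σ)) (m≤n+m _ y₀)) ⟩
  2 * η σ ≤⟨ m≤m+n _ (w s) ⟩
  E s σ ∎
  where
  open ≤-Reasoning

 θ≤ : 0 < J → ∀ {s σ} → s ≤ 2 * J → σ ≤ 2 * J → θ s σ ≤ (3 + 4 * K) * (M * J)
 θ≤ J>0 {s} {σ} s≤ σ≤ = begin
  η σ + 2 * K * w s ≤⟨ +-mono-≤ (η≤ J>0 σ≤) (*-monoʳ-≤ (2 * K) (w≤ J>0 s≤)) ⟩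
  3 * (M * J) + 2 * K * (2 * (M * J)) ≡⟨ ring97 K (M * J) ⟩
  (3 + 4 * K) * (M * J) ∎
  where
  open ≤-Reasoning

 <⇒+≤2J : ∀ {k k'} → k < J → k' < J → k + k' ≤ 2 * J
 <⇒+≤2J k<J k'<J = ≤-trans (+-mono-≤ (<⇒≤ k<J) (<⇒≤ k'<J)) (≤-reflexive (cong (_+_ J) (sym (+-identityʳ J))))

 abs-diff≤ : ∀ {k k'} → k < J → k' < J → abs (+ k' -z + k) ≤ J
 abs-diff≤ k<J k'<J = abs-between {0} z≤n (<⇒≤ k'<J) z≤n (<⇒≤ k<J)

 -- The large derivative in x must be balanced by the other two terms of the equation, so the
 -- difference of the i's is small. The constant 11 + 4K in `G` is 8 from `E≤Nm` plus 3 + 4K from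
 -- `θ≤`.
 a-bound : ∀ {k k' σ α i} → k < J → k' < J → Solution k k' σ α i → A * dist α * b₀ ≤ G
 a-bound {k} {k'} {σ} {α} {i} k<J k'<J S = begin
  A * dist α * b₀ ≤⟨ *-monoʳ-≤ (A * dist α) (b₀≤b i (i' S)) ⟩
  A * dist α * b i (i' S) ≡⟨ cong (_* b i (i' S)) (sym (abs-pos-* A _)) ⟩
  abs (+ A *z a S) * b i (i' S) ≡⟨ sym (ℤₚ.abs-* (+ A *z a S) (+ b i (i' S))) ⟩
  abs (+ A *z a S *z + b i (i' S)) ≡⟨ trans (cong abs rearranged) (ℤₚ.∣-i∣≡∣i∣ ((+ σ -z + 2 *z + j S) *z + e +z (+ k' -z + k) *z + t)) ⟩
  abs ((+ σ -z + 2 *z + j S) *z + e +z (+ k' -z + k) *z + t) ≤⟨ ℤₚ.∣i+j∣≤∣i∣+∣j∣ ((+ σ -z + 2 *z + j S) *z + e) _ ⟩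
  abs ((+ σ -z + 2 *z + j S) *z + e) + abs ((+ k' -z + k) *z + t)
   ≡⟨ cong₂ _+_ (trans (ℤₚ.abs-* (+ σ -z + 2 *z + j S) (+ e)) (cong (λ v → abs v * e) (sym (j'-j S)))) (ℤₚ.abs-* (+ k' -z + k) (+ t)) ⟩
  abs (+ j' S -z + j S) * e + abs (+ k' -z + k) * t
   ≤⟨ +-mono-≤ (*-mono-≤ (abs-diff≤ (j<J S) (j'<J S)) (E≤Nm J>0 s≤ σ≤)) (*-mono-≤ (abs-diff≤ k<J k'<J) (θ≤ J>0 s≤ σ≤)) ⟩
  J * Nm + J * ((3 + 4 * K) * (M * J)) ≡⟨ ring98 J M K ⟩
  G ∎
  where
  open ≤-Reasoning
  e = E (k + k') σ
  t = θ (k + k') σ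
  J>0 : 0 < J
  J>0 = ≤-<-trans z≤n k<J
  s≤ = <⇒+≤2J k<J k'<J
  σ≤ : σ ≤ 2 * J
  σ≤ = subst (_≤ 2 * J) (j+j' S) (<⇒+≤2J (j<J S) (j'<J S))
  rearranged : + A *z a S *z + b i (i' S) ≡ -z ((+ σ -z + 2 *z + j S) *z + e +z (+ k' -z + k) *z + t)
  rearranged = trans (ringz25 (+ A *z a S *z + b i (i' S)) ((+ σ -z + 2 *z + j S) *z + e) ((+ k' -z + k) *z + t))
   (trans (cong (_-z ((+ σ -z + 2 *z + j S) *z + e +z (+ k' -z + k) *z + t)) (equation S)) (ℤₚ.+-identityˡ _))

 -- Any bound n for the differences of the j's bounds the differences of the α's.
 α-spread : ∀ κ n → κ * I ≤ X → ∀ {k k' σ α₁ α₂ i₁ i₂} → k < J → k' < J → α₁ < α₂ →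
  (S₁ : Solution k k' σ α₁ i₁) (S₂ : Solution k k' σ α₂ i₂) → abs (+ j S₂ -z + j S₁) ≤ n →
  κ * A * b₀ * (α₂ ∸ α₁) ≤ 2 * κ * n * E (k + k') σ + G
 α-spread κ n κI≤X {k} {k'} {σ} {α₁} {α₂} {i₁} {i₂} k<J k'<J α₁<α₂ S₁ S₂ ≤n = begin
  κ * A * b₀ * (α₂ ∸ α₁) ≤⟨ *-monoˡ-≤ (α₂ ∸ α₁) (*-monoʳ-≤ (κ * A) (b₀≤b i₂ (i' S₂))) ⟩
  κ * A * b₂ * (α₂ ∸ α₁) ≡⟨ ring99 κ A b₂ (α₂ ∸ α₁) ⟩
  κ * (A * (α₂ ∸ α₁) * b₂) ≡⟨ cong (λ v → κ * v) (sym abs-lhs) ⟩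
  κ * abs (+ A *z (+ α₂ -z + α₁) *z + b₂) ≡⟨ cong (λ v → κ * abs v) split ⟩
  κ * abs (+ 2 *z (δj *z + e) +z + A *z a S₁ *z (+ b₁ -z + b₂)) ≤⟨ *-monoʳ-≤ κ (ℤₚ.∣i+j∣≤∣i∣+∣j∣ (+ 2 *z (δj *z + e)) _) ⟩
  κ * (abs (+ 2 *z (δj *z + e)) + abs (+ A *z a S₁ *z (+ b₁ -z + b₂)))
   ≡⟨ cong (κ *_) (cong₂ _+_ (trans (abs-pos-* 2 (δj *z + e)) (cong (2 *_) (ℤₚ.abs-* δj (+ e))))
      (trans (ℤₚ.abs-* (+ A *z a S₁) (+ b₁ -z + b₂)) (cong (_* abs (+ b₁ -z + b₂)) (abs-pos-* A (a S₁))))) ⟩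
  κ * (2 * (abs δj * e) + A * dist α₁ * abs (+ b₁ -z + b₂))
   ≤⟨ *-monoʳ-≤ κ (+-mono-≤ (*-monoʳ-≤ 2 (*-monoˡ-≤ e ≤n)) (*-monoʳ-≤ (A * dist α₁) b-close)) ⟩
  κ * (2 * (n * e) + A * dist α₁ * (2 * M * I)) ≡⟨ ring100 κ n e (A * dist α₁) M I ⟩
  2 * κ * n * e + A * dist α₁ * (2 * M * (κ * I)) ≤⟨ +-monoʳ-≤ (2 * κ * n * e) (*-monoʳ-≤ (A * dist α₁) (*-monoʳ-≤ (2 * M) κI≤X)) ⟩
  2 * κ * n * e + A * dist α₁ * b₀ ≤⟨ +-monoʳ-≤ (2 * κ * n * e) (a-bound k<J k'<J S₁) ⟩
  2 * κ * n * e + G ∎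
  where
  open ≤-Reasoning
  e = E (k + k') σ
  b₁ = b i₁ (i' S₁)
  b₂ = b i₂ (i' S₂)
  δj = + j S₂ -z + j S₁
  b-close : abs (+ b₁ -z + b₂) ≤ 2 * M * I
  b-close = abs-between {b₀} (b₀≤b i₁ (i' S₁)) (b≤ (i<I S₁) (i'<I S₁)) (b₀≤b i₂ (i' S₂)) (b≤ (i<I S₂) (i'<I S₂))
  abs-lhs : abs (+ A *z (+ α₂ -z + α₁) *z + b₂) ≡ A * (α₂ ∸ α₁) * b₂
  abs-lhs = trans (ℤₚ.abs-* (+ A *z (+ α₂ -z + α₁)) (+ b₂)) (cong (_* b₂)
   (trans (abs-pos-* A _) (cong (A *_) (cong abs (-z-≥ (<⇒≤ α₁<α₂))))))
  split : + A *z (+ α₂ -z + α₁) *z + b₂ ≡ + 2 *z (δj *z + e) +z + A *z a S₁ *z (+ b₁ -z + b₂)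
  split = trans (ringz26 (+ A) (+ α₁) (+ α₂) (+ I) (+ b₁) (+ b₂)) (cong (_+z + A *z a S₁ *z (+ b₁ -z + b₂)) (difference S₁ S₂))

 α-spread-total : ∀ {k k' σ α₁ α₂ i₁ i₂} → k < J → k' < J → α₁ < α₂ →
  Solution k k' σ α₁ i₁ → Solution k k' σ α₂ i₂ → A * b₀ * (α₂ ∸ α₁) ≤ 2 * G
 α-spread-total {α₁ = α₁} {α₂} k<J k'<J α₁<α₂ S₁ S₂ = begin
  A * b₀ * (α₂ ∸ α₁) ≤⟨ *-monoʳ-≤ (A * b₀) tri ⟩
  A * b₀ * (dist α₂ + dist α₁) ≡⟨ ring101 A b₀ (dist α₁) (dist α₂) ⟩
  A * dist α₁ * b₀ + A * dist α₂ * b₀ ≤⟨ +-mono-≤ (a-bound k<J k'<J S₁) (a-bound k<J k'<J S₂) ⟩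
  G + G ≡⟨ cong (_+_ G) (sym (+-identityʳ G)) ⟩
  2 * G ∎
  where
  open ≤-Reasoning
  tri : α₂ ∸ α₁ ≤ dist α₂ + dist α₁
  tri = begin
   α₂ ∸ α₁ ≡⟨ cong abs (sym (-z-≥ (<⇒≤ α₁<α₂))) ⟩
   abs (+ α₂ -z + α₁) ≡⟨ cong abs (ringz8 (+ α₁) (+ α₂) (+ I)) ⟩
   abs ((+ α₂ -z + I) -z (+ α₁ -z + I)) ≤⟨ ℤₚ.∣i-j∣≤∣i∣+∣j∣ (+ α₂ -z + I) (+ α₁ -z + I) ⟩
   dist α₂ + dist α₁ ∎

 -- 2θ = E + L w, so a common divisor of E and a divides L u w, where u = k' − k.
 common-divisor : ∀ {k k' σ α i δ} → Solution k k' σ α i → δ ∣ E (k + k') σ → δ ∣ dist α →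
  δ ∣ abs (+ k' -z + k) * w (k + k')
 common-divisor {k} {k'} {σ} {α} {i} {δ} S δ∣E δ∣a =
  coprime-divisor {n = L} (coprime-∣ˡ δ∣E (coprime-∣ʳ L∣H (E-coprime (k + k') σ)))
   (subst (δ ∣_) (trans (ℤₚ.abs-* u (+ L *z + w s)) (trans (cong (abs u *_) (abs-pos-* L (+ w s))) (ring48 (abs u) L (w s))))
    (ℤ∣.∣⇒∣ᵤ uLw))
  where
  s = k + k'
  u = + k' -z + k
  δ∣zE : + δ ∣z + E s σ
  δ∣zE = ℤ∣.∣ᵤ⇒∣ δ∣E
  δ∣za : + δ ∣z a S
  δ∣za = ℤ∣.∣ᵤ⇒∣ δ∣a
  2θ : + 2 *z + θ s σ ≡ + E s σ +z + L *z + w s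
  2θ = begin
   + 2 *z + θ s σ ≡⟨ sym (cast-* 2 (θ s σ)) ⟩
   + (2 * θ s σ) ≡⟨ cong +_ (ring41 (η σ) K (w s)) ⟩
   + (2 * η σ + 4 * K * w s) ≡⟨ cong (λ v → + (2 * η σ + v * w s)) (sym 4K) ⟩
   + (2 * η σ + suc L * w s) ≡⟨ cong +_ (sym (+-assoc (2 * η σ) (w s) (L * w s))) ⟩
   + E s σ +z + (L * w s) ≡⟨ cong (+ E s σ +z_) (cast-* L (w s)) ⟩
   + E s σ +z + L *z + w s ∎
   where
   open ≡-Reasoning
  uθ : + δ ∣z u *z + θ s σ
  uθ = ℤ∣.∣m+n∣m⇒∣n (subst (+ δ ∣z_) (sym (equation S)) (dividesz 0ℤ refl))
      (ℤ∣.∣m∣n⇒∣m+n (ℤ∣.∣m⇒∣m*n (+ b i (i' S)) (ℤ∣.∣n⇒∣m*n (+ A) δ∣za)) (ℤ∣.∣n⇒∣m*n (+ σ -z + 2 *z + j S) δ∣zE))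
  uLw : + δ ∣z u *z (+ L *z + w s)
  uLw = ℤ∣.∣m+n∣m⇒∣n (subst (+ δ ∣z_) (trans (ringz27 u (+ θ s σ)) (trans (cong (u *z_) 2θ) (ℤₚ.*-distribˡ-+ u (+ E s σ) _)))
            (ℤ∣.∣n⇒∣m*n (+ 2) uθ)) (ℤ∣.∣n⇒∣m*n u δ∣zE)

 z₀-odd : ∃ λ z' → z₀ ≡ 1 + 2 * z'
 z₀-odd = odd z₀ (λ 2∣z₀ → 1<2⇒ (cop (∣m∣n⇒∣m+n (m∣m*n {2} y₀) 2∣z₀ , 2∣H)))
  where
  1<2⇒ : 2 ≡ 1 → ⊥
  1<2⇒ ()
  odd : ∀ n → ¬ 2 ∣ n → ∃ λ m → n ≡ 1 + 2 * m
  odd zero ¬p = ⊥-elim (¬p (divides 0 refl))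
  odd (suc zero) ¬p = 0 , refl
  odd (suc (suc n)) ¬p with odd n (λ d → ¬p (∣m∣n⇒∣m+n ∣-refl d))
  ... | m , eq = suc m , trans (cong (λ v → suc (suc v)) eq) (ring42 m)

 -- Since H is even, `b` is even, `E` is odd and `θ` ≡ y₀ modulo 2, so the equation fixes the parity
 -- of σ. The factor 2 saved here is what makes the second moment asymptotically equal to its
 -- expected value; with twice that value the method would only reach about half of the integers.
 σ-parity : ∀ {k k' σ α i} → Solution k k' σ α i → 2 ∣ σ + (k + k') * y₀
 σ-parity {k} {k'} {σ} {α} {i} S with 2∣H | z₀-odd
 ... | divides H' H≡ | z' , z₀≡ = subst (2 ∣_) refl (ℤ∣.∣⇒∣ᵤ 2∣z)
  where
  open ≡-Reasoning
  s = k + k'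
  E≡ : + E s σ ≡ + 1 +z + 2 *z (+ η σ +z + z' +z + H' *z + s)
  E≡ = begin
   + (2 * η σ + (z₀ + H * s)) ≡⟨ cong₂ (λ u v → + (2 * η σ + (u + v * s))) z₀≡ H≡ ⟩
   + (2 * η σ + (1 + 2 * z' + H' * 2 * s)) ≡⟨ cong +_ (ring43 (η σ) z' H' s) ⟩
   + (1 + 2 * (η σ + z' + H' * s)) ≡⟨ cong (+ 1 +z_) (cast-* 2 (η σ + z' + H' * s)) ⟩
   + 1 +z + 2 *z (+ (η σ + z' + H' * s)) ≡⟨ cong (λ v → + 1 +z + 2 *z (+ η σ +z + z' +z v)) (cast-* H' s) ⟩
   _ ∎
  θ' = H' * (2 * J + σ) + K * w s
  θ≡ : + θ s σ ≡ + y₀ +z + 2 *z + θ'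
  θ≡ = begin
   + (y₀ + H * (2 * J + σ) + 2 * K * w s) ≡⟨ cong (λ v → + (y₀ + v * (2 * J + σ) + 2 * K * w s)) H≡ ⟩
   + (y₀ + H' * 2 * (2 * J + σ) + 2 * K * w s) ≡⟨ cong +_ (ring44 y₀ H' (2 * J + σ) K (w s)) ⟩
   + (y₀ + 2 * θ') ≡⟨ cong (+ y₀ +z_) (cast-* 2 θ') ⟩
   _ ∎
  b' = x₀ + H * (2 * X + (i + i' S))
  b≡ : + b i (i' S) ≡ + 2 *z + b'
  b≡ = trans (cong +_ (ring45 x₀ H (2 * X + (i + i' S)))) (cast-* 2 b')
  e = + η σ +z + z' +z + H' *z + s
  2∣z : + 2 ∣z + (σ + s * y₀)
  2∣z = dividesz q (begin
   + σ +z + (s * y₀) ≡⟨ cong (+ σ +z_) (cast-* s y₀) ⟩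
   + σ +z (+ k +z + k') *z + y₀ ≡⟨ ringz44 (+ A) (a S) (+ b') (+ σ) (+ j S) e (+ k) (+ k') (+ y₀) (+ θ') ⟩
   P +z q *z + 2 ≡⟨ cong (_+z q *z + 2) (trans (sym (cong₃ (λ p q r → + A *z a S *z p +z (+ σ -z + 2 *z + j S) *z q +z (+ k' -z + k) *z r) b≡ E≡ θ≡)) (equation S)) ⟩
   0ℤ +z q *z + 2 ≡⟨ ℤₚ.+-identityˡ (q *z + 2) ⟩
   q *z + 2 ∎)
   where
   q = + j S +z + 2 *z + j S *z e -z + A *z a S *z + b' -z + σ *z e +z + k *z + y₀ -z (+ k' -z + k) *z + θ'
   P = + A *z a S *z (+ 2 *z + b') +z (+ σ -z + 2 *z + j S) *z (+ 1 +z + 2 *z e) +z (+ k' -z + k) *z (+ y₀ +z + 2 *z + θ')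
   cong₃ : ∀ {P : Set} (f : P → P → P → P) {a a' b b' c c'} → a ≡ a' → b ≡ b' → c ≡ c' → f a b c ≡ f a' b' c'
   cong₃ f refl refl refl = refl

 χ : ℕ → ℕ → ℕ → ℕ → ℕ → ℕ → ℕ → ℕ → ℕ
 χ k k' σ α i i' j j' = 𝟙 (j + j' ≟ σ) * (𝟙 (i + α ≟ I + i') * 𝟙 (Φ i j k ≟ Φ i' j' k'))

 cell : ℕ → ℕ → ℕ → ℕ → ℕ → ℕ
 cell k k' σ α i = ∑[ i' < I ] ∑[ j < J ] ∑[ j' < J ] χ k k' σ α i i' j j'

 line : ℕ → ℕ → ℕ → ℕ → ℕ
 line k k' σ α = ∑[ i < I ] cell k k' σ α i

 χ≤1 : ∀ k k' σ α i i' j j' → χ k k' σ α i i' j j' ≤ 1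
 χ≤1 k k' σ α i i' j j' = *-mono-≤ (𝟙≤1 (j + j' ≟ σ)) (*-mono-≤ (𝟙≤1 (i + α ≟ I + i')) (𝟙≤1 (Φ i j k ≟ Φ i' j' k')))

 χ-sol : ∀ {k k' σ α i i' j j'} → i < I → i' < I → j < J → j' < J → 0 < χ k k' σ α i i' j j' → Solution k k' σ α i
 χ-sol {k} {k'} {σ} {α} {i} {i'} {j} {j'} i<I i'<I j<J j'<J h with *-pos (𝟙 (j + j' ≟ σ)) _ h
 ... | h₁ , h₂ with *-pos (𝟙 (i + α ≟ I + i')) _ h₂
 ... | h₃ , h₄ = solution {i' = i'} {j = j} {j' = j'} i<I i'<I j<J j'<J (𝟙-pos (j + j' ≟ σ) h₁) (𝟙-pos (i + α ≟ I + i') h₃) (𝟙-pos (Φ i j k ≟ Φ i' j' k') h₄)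

 cell-sol : ∀ {k k' σ α i} → i < I → 0 < cell k k' σ α i → Solution k k' σ α i
 cell-sol i<I h with ∑-pos I _ h
 ... | i' , i'<I , h₁ with ∑-pos J _ h₁
 ... | j , j<J , h₂ with ∑-pos J _ h₂
 ... | j' , j'<J , h₃ = χ-sol i<I i'<I j<J j'<J h₃

 line-sol : ∀ {k k' σ α} → 0 < line k k' σ α → Σ ℕ (Solution k k' σ α)
 line-sol h with ∑-pos I _ h
 ... | i , i<I , h₁ = i , cell-sol i<I h₁

 module _ (J>0 : 0 < J) where

  cell≤1 : ∀ k k' σ α i → i < I → cell k k' σ α i ≤ 1
  cell≤1 k k' σ α i i<I = ∑-unique I _ (λ i' i'<I → inner i' i'<I) (λ i₁ i₂ i₁< i₂< h₁ h₂ → i'-unique i₁ i₂ (wit i₁ i₁< h₁) (wit i₂ i₂< h₂))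
   where
   i'-unique : ∀ i₁ i₂ → i + α ≡ I + i₁ → i + α ≡ I + i₂ → i₁ ≡ i₂
   i'-unique i₁ i₂ p q = +-cancelˡ-≡ I i₁ i₂ (trans (sym p) q)
   wit : ∀ i' → i' < I → 0 < (∑[ j < J ] ∑[ j' < J ] χ k k' σ α i i' j j') → i + α ≡ I + i'
   wit i' i'<I h with ∑-pos J _ h
   ... | j , j<J , h₁ with ∑-pos J _ h₁
   ... | j' , j'<J , h₂ = i+α (χ-sol {k} {k'} {σ} {α} {i} {i'} {j} {j'} i<I i'<I j<J j'<J h₂)
   row≤1 : ∀ i' j → (∑[ j' < J ] χ k k' σ α i i' j j') ≤ 1
   row≤1 i' j = ∑-unique J _ (λ j' _ → χ≤1 k k' σ α i i' j j')
    (λ j₁ j₂ _ _ h₁ h₂ → +-cancelˡ-≡ j j₁ j₂ (trans (𝟙-pos (j + j₁ ≟ σ) (proj₁ (*-pos (𝟙 (j + j₁ ≟ σ)) _ h₁))) (sym (𝟙-pos (j + j₂ ≟ σ) (proj₁ (*-pos (𝟙 (j + j₂ ≟ σ)) _ h₂))))))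
   inner : ∀ i' → i' < I → (∑[ j < J ] ∑[ j' < J ] χ k k' σ α i i' j j') ≤ 1
   inner i' i'<I = ∑-unique J _ (λ j _ → row≤1 i' j) uniq
    where
    uniq : ∀ j₁ j₂ → j₁ < J → j₂ < J → 0 < (∑[ j' < J ] χ k k' σ α i i' j₁ j') → 0 < (∑[ j' < J ] χ k k' σ α i i' j₂ j') → j₁ ≡ j₂
    uniq j₁ j₂ j₁< j₂< h₁ h₂ with ∑-pos J _ h₁ | ∑-pos J _ h₂
    ... | j₁' , j₁'< , p₁ | j₂' , j₂'< , p₂ = j-unique J>0 (χ-sol {k} {k'} {σ} {α} {i} {i'} {j₁} {j₁'} i<I i'<I j₁< j₁'< p₁)
                               (χ-sol {k} {k'} {σ} {α} {i} {i'} {j₂} {j₂'} i<I i'<I j₂< j₂'< p₂)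

  g : ℕ → ℕ → ℕ → ℕ
  g s σ α = gcd (E s σ) (dist α)

  g>0 : ∀ s σ α → 0 < g s σ α
  g>0 s σ α = n≢0⇒n>0 (gcd[m,n]≢0 (E s σ) (dist α) (inj₁ (>⇒≢ (E>0 J>0 s σ))))

  -- By `E∣dist*step` all i on the line lie in one class modulo E / γ, where γ = gcd(E, a). Hence
  -- there are at most γ I / E + 1 of them.
  line-bound : ∀ k k' σ α → E (k + k') σ * line k k' σ α ≤ (g (k + k') σ α * I + E (k + k') σ) * sg (line k k' σ α)
  line-bound k k' σ α = n≤c*sg {d = E s σ} (λ _ → begin
    E s σ * line k k' σ α ≡⟨ cong (_* line k k' σ α) E≡ ⟩
    γ * q * line k k' σ α ≡⟨ *-assoc γ q _ ⟩
    γ * (q * line k k' σ α) ≤⟨ *-monoʳ-≤ γ (∑-progression I (cell k k' σ α) q (cell≤1 k k' σ α) steps) ⟩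
    γ * (I + q) ≡⟨ *-distribˡ-+ γ I q ⟩
    γ * I + γ * q ≡⟨ cong (_+_ (γ * I)) (sym E≡) ⟩
    γ * I + E s σ ∎)
   where
   open ≤-Reasoning
   s = k + k'
   γ = g s σ α
   instance
    γ≢0 : NonZero γ
    γ≢0 = >-nonZero (g>0 s σ α)
   q = quotient (gcd[m,n]∣m (E s σ) (dist α))
   r = quotient (gcd[m,n]∣n (E s σ) (dist α))
   E≡ : E s σ ≡ γ * q
   E≡ = trans (_∣_.equality (gcd[m,n]∣m (E s σ) (dist α))) (*-comm q γ)
   a≡ : dist α ≡ γ * r
   a≡ = trans (_∣_.equality (gcd[m,n]∣n (E s σ) (dist α))) (*-comm r γ)
   coprime-qr : Coprime q r
   coprime-qr {d} (d∣q , d∣r) = ∣1⇒≡1 (*-cancelˡ-∣ γ (subst (γ * d ∣_) (sym (*-identityʳ γ))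
    (gcd-greatest (subst (γ * d ∣_) (sym E≡) (*-monoʳ-∣ γ d∣q)) (subst (γ * d ∣_) (sym a≡) (*-monoʳ-∣ γ d∣r)))))
   steps : ∀ i₁ i₂ → i₁ < i₂ → i₂ < I → 0 < cell k k' σ α i₁ → 0 < cell k k' σ α i₂ → q ∣ i₂ ∸ i₁
   steps i₁ i₂ i₁<i₂ i₂<I h₁ h₂ = coprime-divisor coprime-qr (*-cancelˡ-∣ γ (subst₂ _∣_ E≡ (trans (cong (_* (i₂ ∸ i₁)) a≡) (*-assoc γ r _))
    (E∣dist*step i₁<i₂ (cell-sol (<-trans i₁<i₂ i₂<I) h₁) (cell-sol i₂<I h₂))))

  -- The main term belongs to γ = 1. Larger γ are set apart, because they exceed Q and can be
  -- bounded on average over k, k' and σ.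
  ex : ℕ → ℕ → ℕ → ℕ
  ex s σ α = 𝟙 (1 <? g s σ α) * g s σ α

  g*I≤ : ∀ s σ α → g s σ α * I + E s σ ≤ (I + E s σ) * (1 + ex s σ α)
  g*I≤ s σ α with 1 <? g s σ α
  ... | no ¬p = ≤-trans (+-monoˡ-≤ (E s σ) (≤-trans (*-monoˡ-≤ I (≮⇒≥ ¬p)) (≤-reflexive (*-identityˡ I)))) (≤-reflexive (sym (*-identityʳ _)))
  ... | yes p = begin
   γ * I + e ≤⟨ +-monoʳ-≤ (γ * I) (≤-trans (≤-reflexive (sym (*-identityˡ e))) (*-monoˡ-≤ e (<⇒≤ p))) ⟩
   γ * I + γ * e ≡⟨ ring46 γ I e ⟩
   (I + e) * (1 * γ) ≤⟨ *-monoʳ-≤ (I + e) (n≤1+n (1 * γ)) ⟩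
   (I + e) * (1 + 1 * γ) ∎
   where
   open ≤-Reasoning
   γ = g s σ α
   e = E s σ

  row : ℕ → ℕ → ℕ → ℕ
  row k k' σ = ∑[ α < 2 * I ] line k k' σ α

  hits : ℕ → ℕ → ℕ → ℕ
  hits k k' σ = ∑[ α < 2 * I ] sg (line k k' σ α)

  excess : ℕ → ℕ → ℕ → ℕ
  excess k k' σ = ∑[ α < 2 * I ] sg (line k k' σ α) * ex (k + k') σ α

  row-bound : ∀ k k' σ → E (k + k') σ * row k k' σ ≤ (I + E (k + k') σ) * (hits k k' σ + excess k k' σ)
  row-bound k k' σ = begin
   e * row k k' σ ≡⟨ sym (∑-*ˡ (2 * I) e _) ⟩
   ∑[ α < 2 * I ] e * line k k' σ α ≤⟨ ∑-mono (2 * I) (λ α _ → ≤-trans (line-bound k k' σ α) (*-monoˡ-≤ (sg (line k k' σ α)) (g*I≤ (k + k') σ α))) ⟩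
   ∑[ α < 2 * I ] (I + e) * (1 + ex (k + k') σ α) * sg (line k k' σ α) ≡⟨ ∑-cong (2 * I) (λ α _ → ring47 (I + e) (ex (k + k') σ α) (sg (line k k' σ α))) ⟩
   ∑[ α < 2 * I ] (I + e) * (sg (line k k' σ α) + sg (line k k' σ α) * ex (k + k') σ α) ≡⟨ ∑-*ˡ (2 * I) (I + e) _ ⟩
   (I + e) * (∑[ α < 2 * I ] (sg (line k k' σ α) + sg (line k k' σ α) * ex (k + k') σ α)) ≡⟨ cong ((I + e) *_) (∑-+ (2 * I) _ _) ⟩
   (I + e) * (hits k k' σ + excess k k' σ) ∎
   where
   open ≤-Reasoning
   e = E (k + k') σ

  fibre : ℕ → ℕ
  fibre σ = ∑[ j < J ] ∑[ j' < J ] 𝟙 (j + j' ≟ σ)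

  -- The j for which both j and σ - j lie in the box form an interval of length `fibre σ`. Using
  -- this length instead of J keeps the leading constant, as the sum of `fibre` over σ is known
  -- exactly.
  j-gap : ∀ {k k' σ α₁ α₂ i₁ i₂} (S₁ : Solution k k' σ α₁ i₁) (S₂ : Solution k k' σ α₂ i₂) → abs (+ j S₂ -z + j S₁) ≤ fibre σ
  j-gap {σ = σ} S₁ S₂ with ≤-total (j S₁) (j S₂)
  ... | inj₁ le = subst (_≤ fibre σ) (sym (cong abs (-z-≥ le))) (gap S₁ S₂ le)
   where
   gap : ∀ {k k' α₁ α₂ i₁ i₂} (S₁ : Solution k k' σ α₁ i₁) (S₂ : Solution k k' σ α₂ i₂) → j S₁ ≤ j S₂ → j S₂ ∸ j S₁ ≤ fibre σ
   gap S₁ S₂ le = <⇒≤ (∑-interval J _ (j S₁) (j S₂) le (j<J S₂) (λ m l u →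
    let m≤σ = ≤-trans u (≤-trans (m≤m+n (j S₂) (j' S₂)) (≤-reflexive (j+j' S₂))) ; σ∸m<J = ≤-<-trans (≤-trans (∸-monoʳ-≤ σ l) (≤-reflexive (trans (cong (_∸ j S₁) (sym (j+j' S₁))) (m+n∸m≡n (j S₁) (j' S₁))))) (j'<J S₁) in ≤-trans (≤-reflexive (sym (𝟙-yes (m + (σ ∸ m) ≟ σ) (m+[n∸m]≡n m≤σ)))) (∑-term J (λ j' → 𝟙 (m + j' ≟ σ)) σ∸m<J)))
  ... | inj₂ le = subst (_≤ fibre σ) (sym (trans (ℤₚ.∣i-j∣≡∣j-i∣ (+ j S₂) (+ j S₁)) (cong abs (-z-≥ le)))) (gap S₂ S₁ le)
   where
   gap : ∀ {k k' α₁ α₂ i₁ i₂} (S₁ : Solution k k' σ α₁ i₁) (S₂ : Solution k k' σ α₂ i₂) → j S₁ ≤ j S₂ → j S₂ ∸ j S₁ ≤ fibre σ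
   gap S₁ S₂ le = <⇒≤ (∑-interval J _ (j S₁) (j S₂) le (j<J S₂) (λ m l u →
    let m≤σ = ≤-trans u (≤-trans (m≤m+n (j S₂) (j' S₂)) (≤-reflexive (j+j' S₂))) ; σ∸m<J = ≤-<-trans (≤-trans (∸-monoʳ-≤ σ l) (≤-reflexive (trans (cong (_∸ j S₁) (sym (j+j' S₁))) (m+n∸m≡n (j S₁) (j' S₁))))) (j'<J S₁) in ≤-trans (≤-reflexive (sym (𝟙-yes (m + (σ ∸ m) ≟ σ) (m+[n∸m]≡n m≤σ)))) (∑-term J (λ j' → 𝟙 (m + j' ≟ σ)) σ∸m<J)))

  hits-bound : ∀ κ → κ * I ≤ X → ∀ {k k'} σ → k < J → k' < J →
   κ * A * b₀ * hits k k' σ ≤ 2 * κ * fibre σ * E (k + k') σ + G + κ * A * b₀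
  hits-bound κ κI≤X {k} {k'} σ k<J k'<J = subst₂ _≤_ (cong (κ * A * b₀ *_) (*-identityˡ _)) (cong (_+_ L') (*-identityʳ _))
   (∑-spread (2 * I) (λ α → sg (line k k' σ α)) 1 (κ * A * b₀) L' (λ α _ → sg≤1 _) (λ α₁ α₂ α₁<α₂ _ h₁ h₂ →
    1∣ _ , spread α₁<α₂ (line-sol (sg-pos _ h₁)) (line-sol (sg-pos _ h₂))))
   where
   L' = 2 * κ * fibre σ * E (k + k') σ + G
   spread : ∀ {α₁ α₂} → α₁ < α₂ → Σ ℕ (Solution k k' σ α₁) → Σ ℕ (Solution k k' σ α₂) → κ * A * b₀ * (α₂ ∸ α₁) ≤ L'
   spread α₁<α₂ (_ , S₁) (_ , S₂) = α-spread κ (fibre σ) κI≤X k<J k'<J α₁<α₂ S₁ S₂ (j-gap S₁ S₂)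

  even : ℕ → ℕ → ℕ → ℕ
  even k k' σ = 𝟙 (2 ∣? σ + (k + k') * y₀)

  -- About 2 · fibre · E / (A b₀) values of α occur, each with about (I + E) / E values of i: the
  -- factor E cancels, so that the main term depends on σ through `fibre` alone. In the error terms
  -- (I + E) / E is replaced by ι + 1, since I = ι · 2MJ ≤ ι E.
  row-total : ∀ κ ι → κ * I ≤ X → I ≡ ι * (2 * M * J) → ∀ {k k' σ} → k < J → k' < J → σ < 2 * J →
   κ * A * b₀ * row k k' σ ≤ even k k' σ * (2 * κ * (I + Nm) * fibre σ + suc ι * (G + κ * A * b₀)) + suc ι * (κ * A * b₀) * excess k k' σ
  row-total κ ι κI≤X I≡ {k} {k'} {σ} k<J k'<J σ<2J with 2 ∣? σ + (k + k') * y₀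
  ... | no ¬p = ≤-trans (≤-reflexive (trans (cong (κ * A * b₀ *_) empty) (*-zeroʳ (κ * A * b₀)))) z≤n
   where
   empty : row k k' σ ≡ 0
   empty = ∑-zero (2 * I) (λ α _ → n≤0⇒n≡0 (≮⇒≥ (λ h → ¬p (σ-parity (proj₂ (line-sol {k} {k'} {σ} {α} h))))))
  ... | yes _ = *-cancelˡ-≤ e {{>-nonZero (E>0 J>0 (k + k') σ)}} (begin
   e * (c * row k k' σ) ≡⟨ ring48 e c (row k k' σ) ⟩
   c * (e * row k k' σ) ≤⟨ *-monoʳ-≤ c (row-bound k k' σ) ⟩
   c * ((I + e) * (h + x)) ≡⟨ ring49 c (I + e) h x ⟩
   (I + e) * (c * h) + (I + e) * (c * x) ≤⟨ +-monoˡ-≤ _ (*-monoʳ-≤ (I + e) (hits-bound κ κI≤X σ k<J k'<J)) ⟩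
   (I + e) * (2 * κ * f * e + G + c) + (I + e) * (c * x) ≡⟨ ring50 (I + e) κ f e G c x ⟩
   e * (2 * κ * (I + e) * f) + (I + e) * (G + c + c * x) ≤⟨ +-mono-≤ (*-monoʳ-≤ e (*-monoˡ-≤ f (*-monoʳ-≤ (2 * κ) (+-monoʳ-≤ I (E≤Nm J>0 (<⇒+≤2J k<J k'<J) (<⇒≤ σ<2J))))))
                                        (*-monoˡ-≤ (G + c + c * x) I+e≤) ⟩
   e * (2 * κ * (I + Nm) * f) + suc ι * e * (G + c + c * x) ≡⟨ ring51 e κ (I + Nm) f (suc ι) G c x ⟩
   e * (1 * (2 * κ * (I + Nm) * f + suc ι * (G + c)) + suc ι * c * x) ∎)
   where
   open ≤-Reasoning
   e = E (k + k') σ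
   c = κ * A * b₀
   h = hits k k' σ
   x = excess k k' σ
   f = fibre σ
   I+e≤ : I + e ≤ suc ι * e
   I+e≤ = ≤-trans (≤-reflexive (+-comm I e)) (+-monoʳ-≤ e (≤-trans (≤-reflexive I≡) (*-monoʳ-≤ ι (2MJ≤E (k + k') σ))))

 pairs : ℕ → ℕ → ℕ
 pairs k k' = ∑[ i < I ] ∑[ i' < I ] ∑[ j < J ] ∑[ j' < J ] 𝟙 (Φ i j k ≟ Φ i' j' k')

 pairs≡ : ∀ k k' → pairs k k' ≡ ∑[ σ < 2 * J ] ∑[ α < 2 * I ] line k k' σ α
 pairs≡ k k' = begin
  pairs k k'
   ≡⟨ ∑-cong I (λ i i< → ∑-cong I (λ i' i'< → ∑-cong J (λ j j< → ∑-cong J (λ j' j'< → sym (insert i i' j j' i< i'< j< j'<))))) ⟩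
  ∑[ i < I ] ∑[ i' < I ] ∑[ j < J ] ∑[ j' < J ] ∑[ σ < 2 * J ] ∑[ α < 2 * I ] χ k k' σ α i i' j j'
   ≡⟨ ∑-cong I (λ i _ → ∑-cong I (λ i' _ → ∑-cong J (λ j _ → ∑-swap₂ J (2 * J) (2 * I) _))) ⟩
  ∑[ i < I ] ∑[ i' < I ] ∑[ j < J ] ∑[ σ < 2 * J ] ∑[ α < 2 * I ] ∑[ j' < J ] χ k k' σ α i i' j j'
   ≡⟨ ∑-cong I (λ i _ → ∑-cong I (λ i' _ → ∑-swap₂ J (2 * J) (2 * I) _)) ⟩
  ∑[ i < I ] ∑[ i' < I ] ∑[ σ < 2 * J ] ∑[ α < 2 * I ] ∑[ j < J ] ∑[ j' < J ] χ k k' σ α i i' j j'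
   ≡⟨ ∑-cong I (λ i _ → ∑-swap₂ I (2 * J) (2 * I) _) ⟩
  ∑[ i < I ] ∑[ σ < 2 * J ] ∑[ α < 2 * I ] cell k k' σ α i
   ≡⟨ ∑-swap₂ I (2 * J) (2 * I) _ ⟩
  ∑[ σ < 2 * J ] ∑[ α < 2 * I ] line k k' σ α ∎
  where
  open ≡-Reasoning
  <2 : ∀ {n m m'} → m < n → m' < n → m + m' < 2 * n
  <2 {n} p q = <-≤-trans (+-mono-< p q) (≤-reflexive (cong (_+_ n) (sym (+-identityʳ n))))
  insert : ∀ i i' j j' → i < I → i' < I → j < J → j' < J →
   (∑[ σ < 2 * J ] ∑[ α < 2 * I ] χ k k' σ α i i' j j') ≡ 𝟙 (Φ i j k ≟ Φ i' j' k')
  insert i i' j j' i< i'< j< j'< = begin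
   ∑[ σ < 2 * J ] ∑[ α < 2 * I ] χ k k' σ α i i' j j'
    ≡⟨ ∑-cong (2 * J) (λ σ _ → trans (∑-*ˡ (2 * I) (𝟙 (j + j' ≟ σ)) _) (cong (𝟙 (j + j' ≟ σ) *_)
       (∑-scale (2 * I) (λ α → i + α ≟ I + i') _ (∑-𝟙-unique (2 * I) (λ α → i + α ≟ I + i') (I + i' ∸ i) α< α≡ α-unique)))) ⟩
   ∑[ σ < 2 * J ] 𝟙 (j + j' ≟ σ) * 𝟙 (Φ i j k ≟ Φ i' j' k')
    ≡⟨ ∑-scale (2 * J) (λ σ → j + j' ≟ σ) _ (∑-𝟙-hit (2 * J) (j + j') (<2 j< j'<)) ⟩
   𝟙 (Φ i j k ≟ Φ i' j' k') ∎
   where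
   i≤ : i ≤ I + i'
   i≤ = ≤-trans (<⇒≤ i<) (m≤m+n I i')
   α≡ : i + (I + i' ∸ i) ≡ I + i'
   α≡ = m+[n∸m]≡n i≤
   α< : I + i' ∸ i < 2 * I
   α< = ≤-<-trans (m∸n≤m (I + i') i) (<-≤-trans (+-monoʳ-< I i'<) (≤-reflexive (cong (_+_ I) (sym (+-identityʳ I)))))
   α-unique : ∀ α → i + α ≡ I + i' → α ≡ I + i' ∸ i
   α-unique α p = sym (trans (cong (_∸ i) (sym p)) (m+n∸m≡n i α))

 -- The contribution of nontrivial common divisors

 module Excess (h : ℕ) (J>0 : 0 < J) (2J≤Nm : 2 * J ≤ 8 * (2 * H * J)) (Nm≤ : 8 * (2 * H * J) ≤ 2 ^ h) where
  open DivisorSums J Nm Q h 2J≤Nm Nm≤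

  u : ℕ → ℕ → ℕ
  u k k' = abs (+ k' -z + k)

  cond : ℕ → ℕ → ℕ → ℕ → ℕ → ℕ
  cond d₁ d₂ k k' σ = 𝟙 (suc d₁ ∣? u k k') * (𝟙 (suc d₂ ∣? w (k + k')) * 𝟙 (suc d₁ * suc d₂ ∣? E (k + k') σ))

  cnt : ℕ → ℕ → ℕ → ℕ → ℕ → ℕ
  cnt δ k k' σ α = 𝟙 (δ ∣? dist α) * sg (line k k' σ α)

  -- By `common-divisor` γ divides (k' - k) w, so it factors as δ₁ δ₂ with δ₁ dividing k' - k and δ₂
  -- dividing w, and γ is charged to this factorisation. Since γ > 1, one factor is > 1; it is prime
  -- to H and therefore exceeds Q, which makes `W` at least 1.
  excess-term : ∀ {k k' σ} → k < J → k' < J → σ < 2 * J → ∀ α →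
   sg (line k k' σ α) * ex J>0 (k + k') σ α ≤
   ∑[ d₁ < Nm ] ∑[ d₂ < Nm ] W d₁ d₂ * (cond d₁ d₂ k k' σ * (suc d₁ * suc d₂ * cnt (suc d₁ * suc d₂) k k' σ α))
  excess-term {k} {k'} {σ} k<J k'<J σ<2J α with line k k' σ α in eq | 1 <? g J>0 (k + k') σ α
  ... | zero | _ = z≤n
  ... | suc _ | no _ = z≤n
  ... | suc _ | yes γ>1 = found (split-divisor γ (u k k') (w s) (<⇒≤ γ>1)
               (common-divisor (proj₂ S) (gcd[m,n]∣m (E s σ) (dist α)) (gcd[m,n]∣n (E s σ) (dist α))))
   where
   s = k + k'
   γ = g J>0 s σ α
   S : Σ ℕ (Solution k k' σ α)
   S = line-sol {k} {k'} {σ} {α} (subst (0 <_) (sym eq) z<s)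
   γ∣E : γ ∣ E s σ
   γ∣E = gcd[m,n]∣m (E s σ) (dist α)
   γ≤Nm : γ ≤ Nm
   γ≤Nm = ≤-trans (∣⇒≤ {{>-nonZero (E>0 J>0 s σ)}} γ∣E) (E≤Nm J>0 (<⇒+≤2J k<J k'<J) (<⇒≤ σ<2J))
   found : (Σ ℕ λ δ₁ → Σ ℕ λ δ₂ → γ ≡ δ₁ * δ₂ × δ₁ ∣ u k k' × δ₂ ∣ w s) →
    1 * (1 * γ) ≤ ∑[ d₁ < Nm ] ∑[ d₂ < Nm ] W d₁ d₂ * (cond d₁ d₂ k k' σ * (suc d₁ * suc d₂ * (𝟙 (suc d₁ * suc d₂ ∣? dist α) * 1)))
   found (zero , δ₂ , γ≡ , _) = contradiction (subst (1 <_) γ≡ γ>1) λ ()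
   found (suc d₁ , zero , γ≡ , _) = contradiction (subst (1 <_) (trans γ≡ (*-zeroʳ d₁)) γ>1) λ ()
   found (suc d₁ , suc d₂ , γ≡ , δ₁∣u , δ₂∣w) = begin
    1 * (1 * γ) ≡⟨ trans (*-identityˡ _) (*-identityˡ _) ⟩
    γ ≡⟨ γ≡ ⟩
    δ ≡⟨ sym (trans (cong₂ (λ p q → p * (δ * (q * 1))) cond≡1 (𝟙-yes (δ ∣? dist α) δ∣a)) (ring15 δ)) ⟩
    cond d₁ d₂ k k' σ * (δ * (𝟙 (δ ∣? dist α) * 1)) ≤⟨ ≤-trans (≤-reflexive (sym (*-identityˡ _))) (*-monoˡ-≤ _ W≥1) ⟩
    W d₁ d₂ * (cond d₁ d₂ k k' σ * (δ * (𝟙 (δ ∣? dist α) * 1))) ≤⟨ ∑-term Nm (f d₁) d₂<Nm ⟩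
    ∑ Nm (f d₁) ≤⟨ ∑-term Nm (λ d₁ → ∑ Nm (f d₁)) d₁<Nm ⟩
    ∑[ d₁ < Nm ] ∑ Nm (f d₁) ∎
    where
    open ≤-Reasoning
    f : ℕ → ℕ → ℕ
    f d₁ d₂ = W d₁ d₂ * (cond d₁ d₂ k k' σ * (suc d₁ * suc d₂ * (𝟙 (suc d₁ * suc d₂ ∣? dist α) * 1)))
    δ = suc d₁ * suc d₂
    δ∣E : δ ∣ E s σ
    δ∣E = subst (_∣ E s σ) γ≡ γ∣E
    δ∣a : δ ∣ dist α
    δ∣a = subst (_∣ dist α) γ≡ (gcd[m,n]∣n (E s σ) (dist α))
    cond≡1 : cond d₁ d₂ k k' σ ≡ 1
    cond≡1 = cong₂ _*_ (𝟙-yes (suc d₁ ∣? u k k') δ₁∣u) (cong₂ _*_ (𝟙-yes (suc d₂ ∣? w s) δ₂∣w) (𝟙-yes (δ ∣? E s σ) δ∣E))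
    d₁<Nm : d₁ < Nm
    d₁<Nm = ≤-trans (≤-trans (m≤m*n (suc d₁) (suc d₂)) (≤-reflexive (sym γ≡))) γ≤Nm
    d₂<Nm : d₂ < Nm
    d₂<Nm = ≤-trans (≤-trans (m≤n*m (suc d₂) (suc d₁)) (≤-reflexive (sym γ≡))) γ≤Nm
    big : ∀ {δ'} → δ' ∣ δ → 1 < δ' → Q < δ'
    big {δ'} δ'∣δ 1<δ' = ≰⇒> (λ δ'≤Q → dense δ' 1<δ' δ'≤Q (coprime-∣ˡ (∣-trans δ'∣δ δ∣E) (E-coprime s σ)))
    W≥1 : 1 ≤ W d₁ d₂
    W≥1 with d₁ ≟ 0
    ... | no d₁≢0 = ≤-trans (≤-reflexive (sym (𝟙-yes (Q <? suc d₁) (big (m∣m*n (suc d₂)) (s≤s (n≢0⇒n>0 d₁≢0)))))) (m≤m+n _ _)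
    ... | yes d₁≡0 = ≤-trans (≤-reflexive (sym (𝟙-yes (Q <? suc d₂) (big (n∣m*n (suc d₁)) 1<δ₂)))) (m≤n+m _ _)
     where
     1<δ₂ : 1 < suc d₂
     1<δ₂ = subst (1 <_) (trans γ≡ (trans (cong (λ v → suc v * suc d₂) d₁≡0) (*-identityˡ (suc d₂)))) γ>1

  cnt-bound : ∀ {k k'} σ δ → k < J → k' < J → A * b₀ * (δ * (∑[ α < 2 * I ] cnt δ k k' σ α)) ≤ 2 * G + A * b₀ * δ
  cnt-bound {k} {k'} σ δ k<J k'<J = ∑-spread (2 * I) (cnt δ k k' σ) δ (A * b₀) (2 * G)
   (λ α _ → *-mono-≤ (𝟙≤1 (δ ∣? dist α)) (sg≤1 (line k k' σ α)))
   (λ α₁ α₂ α₁<α₂ _ h₁ h₂ → step α₁<α₂ (*-pos (𝟙 (δ ∣? dist α₁)) _ h₁) (*-pos (𝟙 (δ ∣? dist α₂)) _ h₂))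
   where
   step : ∀ {α₁ α₂} → α₁ < α₂ → 0 < 𝟙 (δ ∣? dist α₁) × 0 < sg (line k k' σ α₁) → 0 < 𝟙 (δ ∣? dist α₂) × 0 < sg (line k k' σ α₂) →
    (δ ∣ α₂ ∸ α₁) × (A * b₀ * (α₂ ∸ α₁) ≤ 2 * G)
   step {α₁} {α₂} α₁<α₂ (p₁ , q₁) (p₂ , q₂) =
    subst (δ ∣_) (cong abs (trans (sym (ringz8 (+ α₁) (+ α₂) (+ I))) (-z-≥ (<⇒≤ α₁<α₂))))
     (ℤ∣.∣⇒∣ᵤ (ℤ∣.∣m∣n⇒∣m-n {+ δ} {+ α₂ -z + I} {+ α₁ -z + I} (ℤ∣.∣ᵤ⇒∣ (𝟙-pos (δ ∣? dist α₂) p₂)) (ℤ∣.∣ᵤ⇒∣ (𝟙-pos (δ ∣? dist α₁) p₁)))) ,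
    α-spread-total k<J k'<J α₁<α₂ (proj₂ (line-sol {k} {k'} {σ} {α₁} (sg-pos _ q₁))) (proj₂ (line-sol {k} {k'} {σ} {α₂} (sg-pos _ q₂)))

  excess-bound : ∀ {k k' σ} → k < J → k' < J → σ < 2 * J →
   A * b₀ * excess J>0 k k' σ ≤ ∑[ d₁ < Nm ] ∑[ d₂ < Nm ] W d₁ d₂ * ((2 * G + A * b₀ * (suc d₁ * suc d₂)) * cond d₁ d₂ k k' σ)
  excess-bound {k} {k'} {σ} k<J k'<J σ<2J = begin
   A * b₀ * excess J>0 k k' σ
    ≤⟨ *-monoʳ-≤ (A * b₀) (∑-mono (2 * I) (λ α _ → excess-term k<J k'<J σ<2J α)) ⟩
   A * b₀ * (∑[ α < 2 * I ] ∑[ d₁ < Nm ] ∑[ d₂ < Nm ] t d₁ d₂ α)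
    ≡⟨ cong (A * b₀ *_) (∑-swap₂ (2 * I) Nm Nm (λ α d₁ d₂ → t d₁ d₂ α)) ⟩
   A * b₀ * (∑[ d₁ < Nm ] ∑[ d₂ < Nm ] ∑[ α < 2 * I ] t d₁ d₂ α)
    ≡⟨ trans (sym (∑-*ˡ Nm (A * b₀) _)) (∑-cong Nm (λ d₁ _ → sym (∑-*ˡ Nm (A * b₀) _))) ⟩
   ∑[ d₁ < Nm ] ∑[ d₂ < Nm ] A * b₀ * (∑[ α < 2 * I ] t d₁ d₂ α)
    ≤⟨ ∑-mono Nm (λ d₁ _ → ∑-mono Nm (λ d₂ _ → inner d₁ d₂)) ⟩
   ∑[ d₁ < Nm ] ∑[ d₂ < Nm ] W d₁ d₂ * ((2 * G + A * b₀ * (suc d₁ * suc d₂)) * cond d₁ d₂ k k' σ) ∎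
   where
   open ≤-Reasoning
   t : ℕ → ℕ → ℕ → ℕ
   t d₁ d₂ α = W d₁ d₂ * (cond d₁ d₂ k k' σ * (suc d₁ * suc d₂ * cnt (suc d₁ * suc d₂) k k' σ α))
   inner : ∀ d₁ d₂ → A * b₀ * (∑[ α < 2 * I ] t d₁ d₂ α) ≤ W d₁ d₂ * ((2 * G + A * b₀ * (suc d₁ * suc d₂)) * cond d₁ d₂ k k' σ)
   inner d₁ d₂ = begin
    A * b₀ * (∑[ α < 2 * I ] t d₁ d₂ α)
     ≡⟨ cong (A * b₀ *_) (trans (∑-*ˡ (2 * I) ω _) (cong (ω *_) (trans (∑-*ˡ (2 * I) ψ _) (cong (ψ *_) (∑-*ˡ (2 * I) δ _))))) ⟩
    A * b₀ * (ω * (ψ * (δ * ∑ (2 * I) (cnt δ k k' σ))))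
     ≡⟨ ring16 (A * b₀) ω ψ _ ⟩
    ω * (A * b₀ * (δ * ∑ (2 * I) (cnt δ k k' σ)) * ψ)
     ≤⟨ *-monoʳ-≤ ω (*-monoˡ-≤ ψ (cnt-bound σ δ k<J k'<J)) ⟩
    ω * ((2 * G + A * b₀ * δ) * ψ) ∎
    where
    ω = W d₁ d₂
    ψ = cond d₁ d₂ k k' σ
    δ = suc d₁ * suc d₂

  T : ℕ → ℕ → ℕ
  T d₁ d₂ = ∑[ k < J ] ∑[ k' < J ] ∑[ σ < 2 * J ] cond d₁ d₂ k k' σ

  cond-E : ∀ d₁ d₂ k k' σ → 0 < cond d₁ d₂ k k' σ → suc d₁ * suc d₂ ∣ E (k + k') σ
  cond-E d₁ d₂ k k' σ h = 𝟙-pos (suc d₁ * suc d₂ ∣? E (k + k') σ)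
   (proj₂ (*-pos (𝟙 (suc d₂ ∣? w (k + k'))) _ (proj₂ (*-pos (𝟙 (suc d₁ ∣? u k k')) _ h))))

  -- Introducing s = k + k' decouples the conditions: δ₂ ∣ w restricts s; given s, δ₁ ∣ s - 2k
  -- restricts k and δ₁ δ₂ ∣ E restricts σ, each to one residue class because the divisors are prime
  -- to H. If δ₁ δ₂ is not prime to H or exceeds Nm, no E in the range is divisible by it.
  T-bound : ∀ d₁ d₂ → T d₁ d₂ ≤ 𝟙 (suc d₁ * suc d₂ ≤? Nm) * V d₁ d₂
  T-bound d₁ d₂ with suc d₁ * suc d₂ ≤? Nm | coprime? (suc d₁ * suc d₂) H
  ... | no δ≰Nm | _ = ≤-reflexive (∑-zero J (λ k k<J → ∑-zero J (λ k' k'<J → ∑-zero (2 * J) (λ σ σ<2J →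
     n≤0⇒n≡0 (≮⇒≥ (λ h → δ≰Nm (≤-trans (∣⇒≤ {{>-nonZero (E>0 J>0 (k + k') σ)}} (cond-E d₁ d₂ k k' σ h)) (E≤Nm J>0 (<⇒+≤2J k<J k'<J) (<⇒≤ σ<2J)))))))))
  ... | yes _ | no ¬cop = ≤-trans (≤-reflexive (∑-zero J (λ k k<J → ∑-zero J (λ k' k'<J → ∑-zero (2 * J) (λ σ σ<2J →
     n≤0⇒n≡0 (≮⇒≥ (λ h → ¬cop (coprime-∣ˡ (cond-E d₁ d₂ k k' σ h) (E-coprime (k + k') σ))))))))) z≤n
  ... | yes _ | yes cop-δ = begin
    T d₁ d₂
     ≡⟨ ∑-cong J (λ k k<J → ∑-cong J (λ k' k'<J → pull k k' k<J k'<J)) ⟩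
    ∑[ k < J ] ∑[ k' < J ] ∑[ s < 2 * J ] R s * (𝟙 (k + k' ≟ s) * P₁ k k')
     ≡⟨ ∑-cong J (λ k _ → ∑-swap J (2 * J) _) ⟩
    ∑[ k < J ] ∑[ s < 2 * J ] ∑[ k' < J ] R s * (𝟙 (k + k' ≟ s) * P₁ k k')
     ≡⟨ ∑-swap J (2 * J) _ ⟩
    ∑[ s < 2 * J ] ∑[ k < J ] ∑[ k' < J ] R s * (𝟙 (k + k' ≟ s) * P₁ k k')
     ≡⟨ ∑-cong (2 * J) (λ s _ → trans (∑-cong J (λ k _ → ∑-*ˡ J (R s) _)) (∑-*ˡ J (R s) _)) ⟩
    ∑[ s < 2 * J ] R s * (∑[ k < J ] ∑[ k' < J ] 𝟙 (k + k' ≟ s) * P₁ k k')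
     ≤⟨ ∑-mono (2 * J) (λ s _ → *-mono-≤ (*-monoʳ-≤ (P₂ s) (σ-count s)) (k-count s)) ⟩
    ∑[ s < 2 * J ] P₂ s * (c₂ d₁ d₂ + 1) * (c d₁ + 1)
     ≡⟨ trans (∑-cong (2 * J) (λ s _ → ring52 (P₂ s) (c₂ d₁ d₂ + 1) (c d₁ + 1))) (∑-*ˡ (2 * J) ((c₂ d₁ d₂ + 1) * (c d₁ + 1)) P₂) ⟩
    (c₂ d₁ d₂ + 1) * (c d₁ + 1) * ∑ (2 * J) P₂
     ≤⟨ *-monoʳ-≤ ((c₂ d₁ d₂ + 1) * (c d₁ + 1)) s-count ⟩
    (c₂ d₁ d₂ + 1) * (c d₁ + 1) * (c d₂ + 1)
     ≡⟨ ring53 (c₂ d₁ d₂ + 1) (c d₁ + 1) (c d₂ + 1) ⟩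
    1 * V d₁ d₂ ∎
   where
   open ≤-Reasoning
   δ₁ = suc d₁
   δ₂ = suc d₂
   δ = suc d₁ * suc d₂
   P₁ : ℕ → ℕ → ℕ
   P₁ k k' = 𝟙 (δ₁ ∣? u k k')
   P₂ : ℕ → ℕ
   P₂ s = 𝟙 (δ₂ ∣? w s)
   P₃ : ℕ → ℕ → ℕ
   P₃ s σ = 𝟙 (δ ∣? E s σ)
   R : ℕ → ℕ
   R s = P₂ s * ∑ (2 * J) (P₃ s)
   cop₁ : Coprime δ₁ H
   cop₁ = coprime-∣ˡ (m∣m*n δ₂) cop-δ
   cop₂ : Coprime δ₂ H
   cop₂ = coprime-∣ˡ (n∣m*n δ₁) cop-δ
   pull : ∀ k k' → k < J → k' < J → (∑[ σ < 2 * J ] cond d₁ d₂ k k' σ) ≡ ∑[ s < 2 * J ] R s * (𝟙 (k + k' ≟ s) * P₁ k k')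
   pull k k' k<J k'<J = begin-equality
    ∑[ σ < 2 * J ] cond d₁ d₂ k k' σ
     ≡⟨ trans (∑-*ˡ (2 * J) (P₁ k k') _) (cong (P₁ k k' *_) (∑-*ˡ (2 * J) (P₂ (k + k')) _)) ⟩
    P₁ k k' * R (k + k')
     ≡⟨ sym (∑-𝟙* (2 * J) (k + k') _ (<-≤-trans (+-mono-< k<J k'<J) (≤-reflexive (cong (_+_ J) (sym (+-identityʳ J)))))) ⟩
    ∑[ s < 2 * J ] 𝟙 (k + k' ≟ s) * (P₁ k k' * R (k + k'))
     ≡⟨ ∑-cong (2 * J) (λ s _ → at s) ⟩
    ∑[ s < 2 * J ] R s * (𝟙 (k + k' ≟ s) * P₁ k k') ∎
    where
    at : ∀ s → 𝟙 (k + k' ≟ s) * (P₁ k k' * R (k + k')) ≡ R s * (𝟙 (k + k' ≟ s) * P₁ k k')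
    at s with k + k' ≟ s
    ... | yes refl = ring5 (P₁ k k') (R (k + k'))
    ... | no _ = sym (*-zeroʳ (R s))
   ∣-diff : ∀ {d p q m n} → Coprime d q → d ∣ p + q * m → d ∣ p + q * n → m < n → d ∣ n ∸ m
   ∣-diff {d} {p} {q} {m} {n} cop' x y m<n = coprime-divisor cop' (∣m+n∣m⇒∣n (subst (d ∣_) split y) x)
    where
    split : p + q * n ≡ p + q * m + q * (n ∸ m)
    split = trans (cong (λ v → p + q * v) (sym (m+[n∸m]≡n (<⇒≤ m<n)))) (ring6 p q m (n ∸ m))
   s-count : ∑ (2 * J) P₂ ≤ c d₂ + 1
   s-count = count≤ (2 * J) δ₂ _ (∑-progression (2 * J) P₂ δ₂ (λ s _ → 𝟙≤1 (δ₂ ∣? w s))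
    (λ s₁ s₂ s₁<s₂ _ h₁ h₂ → ∣-diff cop₂ (𝟙-pos (δ₂ ∣? w s₁) h₁) (𝟙-pos (δ₂ ∣? w s₂) h₂) s₁<s₂))
   σ-count : ∀ s → ∑ (2 * J) (P₃ s) ≤ c₂ d₁ d₂ + 1
   σ-count s = count≤ (2 * J) δ _ (∑-progression (2 * J) (P₃ s) δ (λ σ _ → 𝟙≤1 (δ ∣? E s σ))
    (λ σ₁ σ₂ σ₁<σ₂ _ h₁ h₂ → ∣-diff {q = M} (coprime-*ʳ (coprime-∣ʳ 2∣H cop-δ) cop-δ) (form-of (𝟙-pos (δ ∣? E s σ₁) h₁)) (form-of (𝟙-pos (δ ∣? E s σ₂) h₂)) σ₁<σ₂))
    where
    form-of : ∀ {σ} → δ ∣ E s σ → δ ∣ (2 * (y₀ + H * (2 * J)) + (z₀ + H * s)) + M * σ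
    form-of {σ} = subst (δ ∣_) (ring17 y₀ H J σ z₀ s)
   k-count : ∀ s → (∑[ k < J ] ∑[ k' < J ] 𝟙 (k + k' ≟ s) * P₁ k k') ≤ c d₁ + 1
   k-count s = ≤-trans (count≤ J δ₁ _ (∑-progression J row' δ₁ (λ k _ → row≤1 k) steps))
          (+-monoˡ-≤ 1 (/-monoˡ-≤ δ₁ (m≤m+n J (J + 0))))
    where
    row' : ℕ → ℕ
    row' k = ∑[ k' < J ] 𝟙 (k + k' ≟ s) * P₁ k k'
    row≤1 : ∀ k → row' k ≤ 1
    row≤1 k = ∑-unique J _ (λ k' _ → *-mono-≤ (𝟙≤1 (k + k' ≟ s)) (𝟙≤1 (δ₁ ∣? u k k')))
     (λ k₁ k₂ _ _ h₁ h₂ → +-cancelˡ-≡ k k₁ k₂ (trans (𝟙-pos (k + k₁ ≟ s) (proj₁ (*-pos (𝟙 (k + k₁ ≟ s)) _ h₁))) (sym (𝟙-pos (k + k₂ ≟ s) (proj₁ (*-pos (𝟙 (k + k₂ ≟ s)) _ h₂))))))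
    wit : ∀ k → 0 < row' k → + δ₁ ∣z + s -z + 2 *z + k
    wit k h with ∑-pos J _ h
    ... | k' , _ , h₁ with *-pos (𝟙 (k + k' ≟ s)) _ h₁
    ... | p , q = subst (+ δ₁ ∣z_) (trans (ringz4 (+ k) (+ k')) (cong (λ v → + v -z + 2 *z + k) (𝟙-pos (k + k' ≟ s) p)))
            (ℤ∣.∣ᵤ⇒∣ {+ δ₁} {+ k' -z + k} (𝟙-pos (δ₁ ∣? u k k') q))
    steps : ∀ k₁ k₂ → k₁ < k₂ → k₂ < J → 0 < row' k₁ → 0 < row' k₂ → δ₁ ∣ k₂ ∸ k₁
    steps k₁ k₂ k₁<k₂ _ h₁ h₂ = coprime-divisor (coprime-∣ʳ 2∣H cop₁) (subst (δ₁ ∣_)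
     (trans (abs-pos-* 2 (+ k₂ -z + k₁)) (cong (λ v → 2 * abs v) (-z-≥ (<⇒≤ k₁<k₂))))
     (ℤ∣.∣⇒∣ᵤ (subst (+ δ₁ ∣z_) (ringz5 (+ s) (+ k₁) (+ k₂)) (ℤ∣.∣m∣n⇒∣m-n (wit k₁ h₁) (wit k₂ h₂)))))

  total-excess : ℕ
  total-excess = ∑[ k < J ] ∑[ k' < J ] ∑[ σ < 2 * J ] excess J>0 k k' σ

  total-excess-bound : Q * (A * b₀ * total-excess) ≤
   2 * G * (32 * (J * J * J)) + Q * (2 * G * (32 * (Nm * Nm * (h₁ * h₁))) + A * b₀ * (16 * (Nm * Nm * Nm * (h₁ * h₁))))
  total-excess-bound = ≤-trans (*-monoʳ-≤ Q (begin
   A * b₀ * total-excess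
    ≡⟨ distribute (A * b₀) (excess J>0) ⟩
   ∑[ k < J ] ∑[ k' < J ] ∑[ σ < 2 * J ] A * b₀ * excess J>0 k k' σ
    ≤⟨ ∑-mono J (λ k k<J → ∑-mono J (λ k' k'<J → ∑-mono (2 * J) (λ σ σ<2J → excess-bound k<J k'<J σ<2J))) ⟩
   ∑[ k < J ] ∑[ k' < J ] ∑[ σ < 2 * J ] ∑[ d₁ < Nm ] ∑[ d₂ < Nm ] f d₁ d₂ k k' σ
    ≡⟨ ∑-cong J (λ k _ → trans (∑-cong J (λ k' _ → ∑-swap₂ (2 * J) Nm Nm _)) (∑-swap₂ J Nm Nm _)) ⟩
   ∑[ k < J ] ∑[ d₁ < Nm ] ∑[ d₂ < Nm ] ∑[ k' < J ] ∑[ σ < 2 * J ] f d₁ d₂ k k' σ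
    ≡⟨ ∑-swap₂ J Nm Nm _ ⟩
   ∑[ d₁ < Nm ] ∑[ d₂ < Nm ] ∑[ k < J ] ∑[ k' < J ] ∑[ σ < 2 * J ] f d₁ d₂ k k' σ
    ≡⟨ ∑-cong Nm (λ d₁ _ → ∑-cong Nm (λ d₂ _ → sym (trans (cong (W d₁ d₂ *_) (distribute (q d₁ d₂) (cond d₁ d₂))) (distribute (W d₁ d₂) (λ k k' σ → q d₁ d₂ * cond d₁ d₂ k k' σ))))) ⟩
   ∑[ d₁ < Nm ] ∑[ d₂ < Nm ] W d₁ d₂ * (q d₁ d₂ * T d₁ d₂)
    ≤⟨ ∑-mono Nm (λ d₁ _ → ∑-mono Nm (λ d₂ _ → *-monoʳ-≤ (W d₁ d₂) (≤-trans (*-monoʳ-≤ (q d₁ d₂) (T-bound d₁ d₂)) (≤-reflexive (ring48 (q d₁ d₂) (𝟙 (suc d₁ * suc d₂ ≤? Nm)) (V d₁ d₂)))))) ⟩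
   ∑[ d₁ < Nm ] ∑[ d₂ < Nm ] W d₁ d₂ * (𝟙 (suc d₁ * suc d₂ ≤? Nm) * (q d₁ d₂ * V d₁ d₂)) ∎)) (divisor-sum (2 * G) (A * b₀))
   where
   open ≤-Reasoning
   q : ℕ → ℕ → ℕ
   q d₁ d₂ = 2 * G + A * b₀ * (suc d₁ * suc d₂)
   f : ℕ → ℕ → ℕ → ℕ → ℕ → ℕ
   f d₁ d₂ k k' σ = W d₁ d₂ * (q d₁ d₂ * cond d₁ d₂ k k' σ)
   distribute : ∀ r (f : ℕ → ℕ → ℕ → ℕ) → r * (∑[ k < J ] ∑[ k' < J ] ∑[ σ < 2 * J ] f k k' σ) ≡ ∑[ k < J ] ∑[ k' < J ] ∑[ σ < 2 * J ] r * f k k' σ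
   distribute r f = trans (sym (∑-*ˡ J r _)) (∑-cong J (λ k _ → trans (sym (∑-*ˡ J r _)) (∑-cong J (λ k' _ → sym (∑-*ˡ (2 * J) r _)))))

  module Moment (J₁ : ℕ) (J≡ : J ≡ J₁ + J₁) where

   S : ℕ
   S = ∑[ k < J ] ∑[ k' < J ] pairs k k'

   -- J is even so that for each j exactly half of the j' give σ the right parity.
   even-fibres : ∀ k k' → ∑[ σ < 2 * J ] even J>0 k k' σ * fibre J>0 σ ≡ J * J₁
   even-fibres k k' = begin
    ∑[ σ < 2 * J ] e σ * (∑[ j < J ] ∑[ j' < J ] 𝟙 (j + j' ≟ σ))
     ≡⟨ ∑-cong (2 * J) (λ σ _ → trans (sym (∑-*ˡ J (e σ) _)) (∑-cong J (λ j _ → sym (∑-*ˡ J (e σ) _)))) ⟩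
    ∑[ σ < 2 * J ] ∑[ j < J ] ∑[ j' < J ] e σ * 𝟙 (j + j' ≟ σ)
     ≡⟨ ∑-swap₂ (2 * J) J J _ ⟩
    ∑[ j < J ] ∑[ j' < J ] ∑[ σ < 2 * J ] e σ * 𝟙 (j + j' ≟ σ)
     ≡⟨ ∑-cong J (λ j j<J → ∑-cong J (λ j' j'<J → point j j' j<J j'<J)) ⟩
    ∑[ j < J ] ∑[ j' < J ] e (j + j')
     ≡⟨ ∑-cong J (λ j _ → trans (∑-cong J (λ j' _ → cong (λ v → 𝟙 (2 ∣? v)) (ring18 j j' ((k + k') * y₀)))) (subst (λ n → (∑[ j' < n ] 𝟙 (2 ∣? j' + (j + (k + k') * y₀))) ≡ J₁) (sym J≡) (even-count J₁ (j + (k + k') * y₀)))) ⟩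
    ∑[ j < J ] J₁
     ≡⟨ ∑-const J J₁ ⟩
    J * J₁ ∎
    where
    open ≡-Reasoning
    e : ℕ → ℕ
    e = even J>0 k k'
    point : ∀ j j' → j < J → j' < J → (∑[ σ < 2 * J ] e σ * 𝟙 (j + j' ≟ σ)) ≡ e (j + j')
    point j j' j<J j'<J = trans (∑-cong (2 * J) (λ σ _ → at σ)) (∑-𝟙* (2 * J) (j + j') (e (j + j')) (<-≤-trans (+-mono-< j<J j'<J) (≤-reflexive (cong (_+_ J) (sym (+-identityʳ J))))))
     where
     at : ∀ σ → e σ * 𝟙 (j + j' ≟ σ) ≡ 𝟙 (j + j' ≟ σ) * e (j + j')
     at σ with j + j' ≟ σ
     ... | yes refl = *-comm (e (j + j')) 1
     ... | no _ = *-zeroʳ (e σ)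

   -- The leading term is κ I J⁴: there are J² pairs (k, k'), and for each of them 2 · fibre, summed
   -- over the σ of the right parity, is J².
   S-bound : ∀ κ ι → κ * I ≤ X → I ≡ ι * (2 * M * J) →
    κ * A * b₀ * S ≤ κ * (I + Nm) * (J * J * (J * J)) + J * J * J * (suc ι * (G + κ * A * b₀)) + suc ι * κ * (A * b₀ * total-excess)
   S-bound κ ι κI≤X I≡ = begin
    Ab₀ * S
     ≡⟨ cong (Ab₀ *_) (∑-cong J (λ k _ → ∑-cong J (λ k' _ → pairs≡ k k'))) ⟩
    Ab₀ * (∑[ k < J ] ∑[ k' < J ] ∑[ σ < 2 * J ] row J>0 k k' σ)
     ≡⟨ trans (sym (∑-*ˡ J Ab₀ _)) (∑-cong J (λ k _ → trans (sym (∑-*ˡ J Ab₀ _)) (∑-cong J (λ k' _ → sym (∑-*ˡ (2 * J) Ab₀ _))))) ⟩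
    ∑[ k < J ] ∑[ k' < J ] ∑[ σ < 2 * J ] Ab₀ * row J>0 k k' σ
     ≤⟨ ∑-mono J (λ k k<J → ∑-mono J (λ k' k'<J → ∑-mono (2 * J) (λ σ σ< → row-total J>0 κ ι κI≤X I≡ k<J k'<J σ<))) ⟩
    ∑[ k < J ] ∑[ k' < J ] ∑[ σ < 2 * J ] (even J>0 k k' σ * (p * fibre J>0 σ + q) + r * excess J>0 k k' σ)
     ≡⟨ ∑-cong J (λ k _ → ∑-cong J (λ k' _ → inner k k')) ⟩
    ∑[ k < J ] ∑[ k' < J ] (p * (J * J₁) + q * J + r * (∑[ σ < 2 * J ] excess J>0 k k' σ))
     ≡⟨ ∑-cong J (λ k _ → trans (∑-+ J _ _) (cong₂ _+_ (∑-const J _) (∑-*ˡ J r _))) ⟩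
    ∑[ k < J ] (J * (p * (J * J₁) + q * J) + r * (∑[ k' < J ] ∑[ σ < 2 * J ] excess J>0 k k' σ))
     ≡⟨ trans (∑-+ J _ _) (cong₂ _+_ (∑-const J _) (∑-*ˡ J r _)) ⟩
    J * (J * (p * (J * J₁) + q * J)) + r * total-excess
     ≡⟨ lem' κ (I + Nm) J J₁ J≡ (suc ι) (G + κ * A * b₀) A b₀ total-excess ⟩
    κ * (I + Nm) * (J * J * (J * J)) + J * J * J * (suc ι * (G + κ * A * b₀)) + suc ι * κ * (A * b₀ * total-excess) ∎
    where
    open ≤-Reasoning
    Ab₀ = κ * A * b₀
    p = 2 * κ * (I + Nm)
    q = suc ι * (G + κ * A * b₀)
    r = suc ι * (κ * A * b₀)
    lem' : ∀ κ n J j → J ≡ j + j → ∀ ι g A b t → J * (J * (2 * κ * n * (J * j) + ι * g * J)) + ι * (κ * A * b) * t ≡ κ * n * (J * J * (J * J)) + J * J * J * (ι * g) + ι * κ * (A * b * t)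
    lem' κ n _ j refl = ring19 κ n j
    inner : ∀ k k' → (∑[ σ < 2 * J ] (even J>0 k k' σ * (p * fibre J>0 σ + q) + r * excess J>0 k k' σ)) ≡ p * (J * J₁) + q * J + r * (∑[ σ < 2 * J ] excess J>0 k k' σ)
    inner k k' = begin-equality
     ∑[ σ < 2 * J ] (e σ * (p * fibre J>0 σ + q) + r * excess J>0 k k' σ)
      ≡⟨ trans (∑-+ (2 * J) _ _) (cong₂ _+_ (∑-cong (2 * J) (λ σ _ → ring7 (e σ) p (fibre J>0 σ) q)) (∑-*ˡ (2 * J) r _)) ⟩
     (∑[ σ < 2 * J ] (p * (e σ * fibre J>0 σ) + q * e σ)) + r * (∑[ σ < 2 * J ] excess J>0 k k' σ)
      ≡⟨ cong (_+ r * (∑[ σ < 2 * J ] excess J>0 k k' σ)) (trans (∑-+ (2 * J) _ _) (cong₂ _+_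
         (trans (∑-*ˡ (2 * J) p _) (cong (p *_) (even-fibres k k')))
         (trans (∑-*ˡ (2 * J) q _) (cong (q *_) (trans (cong (λ n → ∑ n e) (cong (_+_ J) (+-identityʳ J))) (even-count J _)))))) ⟩
     p * (J * J₁) + q * J + r * (∑[ σ < 2 * J ] excess J>0 k k' σ) ∎
     where
     e : ℕ → ℕ
     e = even J>0 k k'

   ρ : ℕ → ℕ
   ρ m = ∑[ k < J ] ∑[ i < I ] ∑[ j < J ] 𝟙 (Φ i j k ≟ m)

   ρ-pos : ∀ m → 0 < ρ m → Σ ℕ λ i → Σ ℕ λ j → Σ ℕ λ k → i < I × j < J × k < J × Φ i j k ≡ m
   ρ-pos m h with ∑-pos J _ h
   ... | k , k<J , h₁ with ∑-pos I _ h₁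
   ... | i , i<I , h₂ with ∑-pos J _ h₂
   ... | j , j<J , h₃ = i , j , k , i<I , j<J , k<J , 𝟙-pos (Φ i j k ≟ m) h₃

   module _ (B : ℕ) (Φ<B : ∀ i j k → i < I → j < J → k < J → Φ i j k < B) where

    ∑ρ : ∑ B ρ ≡ J * (I * J)
    ∑ρ = begin
     ∑ B ρ ≡⟨ ∑-swap B J _ ⟩
     ∑[ k < J ] ∑[ m < B ] ∑[ i < I ] ∑[ j < J ] 𝟙 (Φ i j k ≟ m) ≡⟨ ∑-cong J (λ k k< → inner k k<) ⟩
     ∑[ k < J ] I * J ≡⟨ ∑-const J (I * J) ⟩
     J * (I * J) ∎
     where
     open ≡-Reasoning
     inner : ∀ k → k < J → (∑[ m < B ] ∑[ i < I ] ∑[ j < J ] 𝟙 (Φ i j k ≟ m)) ≡ I * J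
     inner k k< = begin
      ∑[ m < B ] ∑[ i < I ] ∑[ j < J ] 𝟙 (Φ i j k ≟ m) ≡⟨ ∑-swap₂ B I J _ ⟩
      ∑[ i < I ] ∑[ j < J ] ∑[ m < B ] 𝟙 (Φ i j k ≟ m) ≡⟨ ∑-cong I (λ i i< → ∑-cong J (λ j j< → ∑-𝟙-hit B (Φ i j k) (Φ<B i j k i< j< k<))) ⟩
      ∑[ i < I ] ∑[ j < J ] 1 ≡⟨ ∑-cong I (λ i _ → trans (∑-const J 1) (*-identityʳ J)) ⟩
      ∑[ i < I ] J ≡⟨ ∑-const I J ⟩
      I * J ∎

    ∑ρ² : ∑[ m < B ] ρ m * ρ m ≡ S
    ∑ρ² = begin
     ∑[ m < B ] ρ m * ρ m
      ≡⟨ ∑-cong B (λ m _ → square m) ⟩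
     ∑[ m < B ] ∑[ k < J ] ∑[ k' < J ] ∑[ i < I ] ∑[ i' < I ] ∑[ j < J ] ∑[ j' < J ] f m k k' i i' j j'
      ≡⟨ ∑-swap₂ B J J _ ⟩
     ∑[ k < J ] ∑[ k' < J ] ∑[ m < B ] ∑[ i < I ] ∑[ i' < I ] ∑[ j < J ] ∑[ j' < J ] f m k k' i i' j j'
      ≡⟨ ∑-cong J (λ k k< → ∑-cong J (λ k' k'< → trans (∑-swap₂ B I I _) (∑-cong I (λ i i< → ∑-cong I (λ i' i'< →
         trans (∑-swap₂ B J J _) (∑-cong J (λ j j< → ∑-cong J (λ j' j'< → point k k' i i' j j' (Φ<B i j k i< j< k<))))))))) ⟩
     S ∎
     where
     open ≡-Reasoning
     f : ℕ → ℕ → ℕ → ℕ → ℕ → ℕ → ℕ → ℕ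
     f m k k' i i' j j' = 𝟙 (Φ i j k ≟ m) * 𝟙 (Φ i' j' k' ≟ m)
     square : ∀ m → ρ m * ρ m ≡ ∑[ k < J ] ∑[ k' < J ] ∑[ i < I ] ∑[ i' < I ] ∑[ j < J ] ∑[ j' < J ] f m k k' i i' j j'
     square m = trans (∑-prod J J _ _) (∑-cong J (λ k _ → ∑-cong J (λ k' _ → trans (∑-prod I I _ _) (∑-cong I (λ i _ → ∑-cong I (λ i' _ → ∑-prod J J _ _))))))
     point : ∀ k k' i i' j j' → Φ i j k < B → (∑[ m < B ] f m k k' i i' j j') ≡ 𝟙 (Φ i j k ≟ Φ i' j' k')
     point k k' i i' j j' Φ< = trans (∑-cong B (λ m _ → at m)) (∑-𝟙* B (Φ i j k) _ Φ<)
      where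
      at : ∀ m → f m k k' i i' j j' ≡ 𝟙 (Φ i j k ≟ m) * 𝟙 (Φ i j k ≟ Φ i' j' k')
      at m with Φ i j k ≟ m
      ... | no _ = refl
      ... | yes refl with Φ i' j' k' ≟ Φ i j k | Φ i j k ≟ Φ i' j' k'
      ... | yes _ | yes _ = refl
      ... | no _ | no _ = refl
      ... | yes p | no q = contradiction (sym p) q
      ... | no p | yes q = contradiction (sym q) p

    represented : ℕ
    represented = ∑[ m < B ] sg (ρ m)

    -- By Chebyshev's inequality with the expected multiplicity J² / (A b₀).
    many-represented : ∀ ν → ν * (A * b₀ * S) ≤ suc ν * (J * J * (J * J) * I) →
     ν * (A * b₀ * I) ≤ ν * represented + A * b₀ * I
    many-represented ν S≤ = *-cancelˡ-≤ J⁴ {{m*n≢0 (J * J) (J * J) {{m*n≢0 J J {{nz}} {{nz}}}} {{m*n≢0 J J {{nz}} {{nz}}}}}}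
     (+-cancelʳ-≤ (J⁴ * (ν * (q * I))) _ _ (begin
      J⁴ * (ν * (q * I)) + J⁴ * (ν * (q * I)) ≡⟨ ring8 J ν q I ⟩
      ν * (2 * (J * J * q * (J * (I * J)))) ≡⟨ cong (λ v → ν * (2 * (J * J * q * v))) (sym ∑ρ) ⟩
      ν * (2 * (J * J * q * ∑ B ρ)) ≤⟨ *-monoʳ-≤ ν (chebyshev B ρ (J * J) q) ⟩
      ν * (J * J * (J * J) * represented + q * q * (∑[ m < B ] ρ m * ρ m)) ≡⟨ cong (λ v → ν * (J⁴ * represented + q * q * v)) ∑ρ² ⟩
      ν * (J⁴ * represented + q * q * S) ≡⟨ ring9 ν J⁴ represented q S ⟩
      ν * J⁴ * represented + q * (ν * (q * S)) ≤⟨ +-monoʳ-≤ _ (*-monoʳ-≤ q S≤) ⟩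
      ν * J⁴ * represented + q * (suc ν * (J⁴ * I)) ≡⟨ ring10 ν J⁴ represented q I ⟩
      J⁴ * (ν * represented + q * I) + J⁴ * (ν * (q * I)) ∎))
     where
     open ≤-Reasoning
     J⁴ = J * J * (J * J)
     q = A * b₀
     nz : NonZero J
     nz = >-nonZero J>0

-- Sampling representations

-- a exceeds b by at most the fraction 1 / ν of a.
Near : ℕ → ℕ → ℕ → Set
Near ν a b = ν * a ≤ ν * b + a

Near-trans : ∀ ν {a b c} → Near (2 * ν) a b → Near (2 * ν) b c → Near ν a c
Near-trans zero p q = z≤n
Near-trans ν@(suc ν') {a} {b} {c} p q = *-cancelˡ-≤ 2 (≤-trans (≤-reflexive (sym (*-assoc 2 ν a))) (≤-trans core (≤-reflexive (ring137 ν c a))))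
 where
 open ≤-Reasoning
 core : 2 * ν * a ≤ 2 * ν * c + 2 * a
 core with ≤-total b a
 ... | inj₁ b≤a = begin
  2 * ν * a ≤⟨ p ⟩
  2 * ν * b + a ≤⟨ +-monoˡ-≤ a q ⟩
  2 * ν * c + b + a ≤⟨ +-monoˡ-≤ a (+-monoʳ-≤ (2 * ν * c) b≤a) ⟩
  2 * ν * c + a + a ≡⟨ ring102 (2 * ν * c) a ⟩
  2 * ν * c + 2 * a ∎
 ... | inj₂ a≤b = ≤-trans (+-cancelʳ-≤ b _ _ (begin
  2 * suc ν' * a + b ≡⟨ cong (λ v → 2 * suc ν' * a + v) (sym (m+[n∸m]≡n a≤b)) ⟩
  2 * suc ν' * a + (a + (b ∸ a)) ≤⟨ +-monoʳ-≤ (2 * suc ν' * a) (+-monoʳ-≤ a (m≤n*m (b ∸ a) (2 * suc ν'))) ⟩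
  2 * suc ν' * a + (a + 2 * suc ν' * (b ∸ a)) ≡⟨ ring103 (2 * suc ν') a (b ∸ a) ⟩
  2 * suc ν' * (a + (b ∸ a)) + a ≡⟨ cong (λ v → 2 * suc ν' * v + a) (m+[n∸m]≡n a≤b) ⟩
  2 * suc ν' * b + a ≤⟨ +-monoˡ-≤ a q ⟩
  2 * suc ν' * c + b + a ≡⟨ ring104 (2 * suc ν' * c) b a ⟩
  2 * suc ν' * c + a + b ∎)) (+-monoʳ-≤ (2 * suc ν' * c) (m≤m+n a (a + 0)))

Near-* : ∀ ν c {a b} → Near ν a b → Near ν (c * a) (c * b)
Near-* ν c {a} {b} p = begin
 ν * (c * a) ≡⟨ ring48 ν c a ⟩
 c * (ν * a) ≤⟨ *-monoʳ-≤ c p ⟩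
 c * (ν * b + a) ≡⟨ ring138 ν c a b ⟩
 ν * (c * b) + c * a ∎
 where
 open ≤-Reasoning

Near-mono : ∀ ν {a b c} → Near ν a b → b ≤ c → Near ν a c
Near-mono ν {a} p b≤c = ≤-trans p (+-monoˡ-≤ a (*-monoʳ-≤ ν b≤c))

square-bracket : ∀ c → 0 < c → ∀ N → ∃ λ r → c * (r * r) ≤ N × N < c * (suc r * suc r)
square-bracket c c>0 zero = 0 , ≤-reflexive (*-zeroʳ c) , ≤-trans c>0 (≤-reflexive (sym (*-identityʳ c)))
square-bracket c c>0 (suc N) with square-bracket c c>0 N
... | r , lo , hi with suc N <? c * (suc r * suc r)
... | yes p = r , m≤n⇒m≤1+n lo , p
... | no ¬p = suc r , ≮⇒≥ ¬p , ≤-<-trans hi (*-monoʳ-< c {{>-nonZero c>0}} (*-mono-< (≤-refl {suc (suc r)}) (≤-refl {suc (suc r)})))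

log-bracket : ∀ J → 0 < J → ∃ λ e → 2 ^ e ≤ J × J < 2 ^ suc e
log-bracket (suc zero) _ = 0 , ≤-refl , ≤-refl
log-bracket (suc (suc n)) _ with log-bracket (suc n) z<s
... | e , lo , hi with suc (suc n) <? 2 ^ suc e
... | yes p = e , m≤n⇒m≤1+n lo , p
... | no ¬p = suc e , ≮⇒≥ ¬p , ≤-<-trans hi (<-≤-trans (m<m+n (2 ^ suc e) (m^n>0 2 (suc e))) (≤-reflexive (cong (_+_ (2 ^ suc e)) (sym (+-identityʳ _)))))

cube≤2^ : ∀ n → n * n * n ≤ 2 ^ (n + 3)
cube≤2^ 0 = z≤n
cube≤2^ 1 = s≤s z≤n
cube≤2^ 2 = ≤ᵇ⇒≤ 8 32 _
cube≤2^ 3 = ≤ᵇ⇒≤ 27 64 _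
cube≤2^ 4 = ≤ᵇ⇒≤ 64 128 _
cube≤2^ (suc n@(suc (suc (suc (suc m))))) = begin
 suc n * suc n * suc n ≤⟨ m≤m+n _ (2 + 21 * m + 9 * (m * m) + m * m * m + 1) ⟩
 suc n * suc n * suc n + (2 + 21 * m + 9 * (m * m) + m * m * m + 1) ≡⟨ ring139 m ⟩
 2 * (n * n * n) ≤⟨ *-monoʳ-≤ 2 (cube≤2^ n) ⟩
 2 * 2 ^ (n + 3) ∎
 where
 open ≤-Reasoning

2^-reflects-< : ∀ {m n} → 2 ^ m < 2 ^ n → m < n
2^-reflects-< {m} {n} h = ≰⇒> (λ n≤m → <⇒≱ h (^-monoʳ-≤ 2 n≤m))

n≤2^n : ∀ n → n ≤ 2 ^ n
n≤2^n zero = z≤n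
n≤2^n (suc n) = begin
 1 + n ≤⟨ +-mono-≤ (m^n>0 2 n) (n≤2^n n) ⟩
 2 ^ n + 2 ^ n ≡⟨ cong (_+_ (2 ^ n)) (sym (+-identityʳ (2 ^ n))) ⟩
 2 ^ suc n ∎
 where open ≤-Reasoning

log²-growth : ∀ c d → ∃ λ J₀ → ∀ J → J₀ ≤ J → ∃ λ h → d * J ≤ 2 ^ h × c * (suc h * suc h) ≤ J
log²-growth c d = 2 ^ e₀ , λ J J₀≤J → bound J J₀≤J (log-bracket J (≤-trans (m^n>0 2 e₀) J₀≤J))
 where
 open ≤-Reasoning
 -- With n = d + e + 2 this turns n³ ≤ 2^(n+3) into n³ ≤ p · 2^e ≤ p · J, and `e₀` = c p makes c p ≤
 -- n, so that p can be cancelled from p c n² ≤ n³.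
 p = 2 ^ (d + 5)
 e₀ = c * p
 bound : ∀ J → 2 ^ e₀ ≤ J → (∃ λ e → 2 ^ e ≤ J × J < 2 ^ suc e) → ∃ λ h → d * J ≤ 2 ^ h × c * (suc h * suc h) ≤ J
 bound J J₀≤J (e , lo , hi) = d + suc e ,
  (begin
   d * J ≤⟨ *-mono-≤ (n≤2^n d) (<⇒≤ hi) ⟩
   2 ^ d * 2 ^ suc e ≡⟨ sym (^-distribˡ-+-* 2 d (suc e)) ⟩
   2 ^ (d + suc e) ∎) ,
  ≤-trans (*-cancelˡ-≤ p {{m^n≢0 2 (d + 5)}} (begin
   p * (c * (n * n)) ≡⟨ ring105 p c n ⟩
   c * p * (n * n) ≤⟨ *-monoˡ-≤ (n * n) e₀≤n ⟩
   n * (n * n) ≡⟨ sym (*-assoc n n n) ⟩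
   n * n * n ≤⟨ cube≤2^ n ⟩
   2 ^ (n + 3) ≡⟨ cong (2 ^_) (ring106 d e) ⟩
   2 ^ (d + 5 + e) ≡⟨ ^-distribˡ-+-* 2 (d + 5) e ⟩
   p * 2 ^ e ∎)) lo
  where
  n = suc (d + suc e)
  e₀≤n : e₀ ≤ n
  e₀≤n = ≤-trans (s≤s⁻¹ (2^-reflects-< (≤-<-trans J₀≤J hi))) (≤-trans (m≤n+m e (suc d + 1)) (≤-reflexive (ring54 d e)))

-- The five error terms of the second moment, each at most a fifth of U.
moment-arithmetic : ∀ ν κ ι Q A g M J X C t S Y → 0 < κ → 0 < Q → 1 ≤ ι → 20 * ν ≤ ι → 5 * ν * g ≤ κ → 320 * ν * g ≤ Q →
 X ≤ C * J → 10 * ν * A * C ≤ J → 5 * ν * (4096 * g * (M * M * M) + 16384 * A * C * (M * M * M * M)) * t ≤ M * J →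
 let I = ι * (2 * M * J) ; N = 8 * (M * J) ; G = g * (M * J * J) ; b = 2 * M * X in
 κ * A * b * S ≤ κ * (I + N) * (J * J * (J * J)) + J * J * J * (suc ι * (G + κ * A * b)) + suc ι * κ * (A * b * Y) →
 Q * (A * b * Y) ≤ 2 * G * (32 * (J * J * J)) + Q * (2 * G * (32 * (N * N * t)) + A * b * (16 * (N * N * N * t))) →
 ν * (A * b * S) ≤ suc ν * (J * J * (J * J) * I)
moment-arithmetic ν κ ι Q A g M J X C t S Y κ>0 Q>0 1≤ι hι hκ hQ hX hJ ht hS hY =
 *-cancelˡ-≤ (κ * Q) {{m*n≢0 κ Q {{>-nonZero κ>0}} {{>-nonZero Q>0}}}} (begin
  κ * Q * (ν * (A * b * S))
   ≡⟨ ring140 κ Q ν A b S ⟩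
  ν * Q * (κ * A * b * S)
   ≤⟨ *-monoʳ-≤ (ν * Q) hS ⟩
  ν * Q * (κ * (I + N) * J⁴ + J * J * J * (suc ι * (G + κ * A * b)) + suc ι * κ * (A * b * Y))
   ≡⟨ ring141 ν Q κ I N J (suc ι) G (A * b) Y A b ⟩
  ν * U + (ν * Q * (κ * N * J⁴) + ν * Q * (J * J * J * (suc ι * G)) + ν * Q * (J * J * J * (suc ι * (κ * A * b))) + ν * suc ι * κ * (Q * (A * b * Y)))
   ≤⟨ +-monoʳ-≤ (ν * U) (+-monoʳ-≤ (ν * Q * (κ * N * J⁴) + ν * Q * (J * J * J * (suc ι * G)) + ν * Q * (J * J * J * (suc ι * (κ * A * b)))) (*-monoʳ-≤ (ν * suc ι * κ) hY)) ⟩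
  ν * U + (e₁ + e₂ + e₃ + ν * suc ι * κ * (2 * G * (32 * (J * J * J)) + Q * Z))
   ≡⟨ cong (_+_ (ν * U)) (ring6 (e₁ + e₂ + e₃) (ν * suc ι * κ) (2 * G * (32 * (J * J * J))) (Q * Z)) ⟩
  ν * U + (e₁ + e₂ + e₃ + e₄ + e₅)
   ≤⟨ +-monoʳ-≤ (ν * U) small ⟩
  ν * U + U
   ≡⟨ ring142 ν κ Q J I ⟩
  κ * Q * (suc ν * (J⁴ * I)) ∎)
 where
 open ≤-Reasoning
 I = ι * (2 * M * J)
 N = 8 * (M * J)
 G = g * (M * J * J)
 b = 2 * M * X
 J⁴ = J * J * (J * J)
 U = κ * Q * (J⁴ * I)
 Z = 2 * G * (32 * (N * N * t)) + A * b * (16 * (N * N * N * t))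
 -- The sources of the errors: I + E in place of I, the variation of `b` over the window, the
 -- rounding of the number of α, the divisors above Q, and the lower order terms of the divisor sum.
 -- They are made small by ι, κ, J, Q and the growth of J beyond its squared logarithm,
 -- respectively.
 e₁ = ν * Q * (κ * N * J⁴)
 e₂ = ν * Q * (J * J * J * (suc ι * G))
 e₃ = ν * Q * (J * J * J * (suc ι * (κ * A * b)))
 e₄ = ν * suc ι * κ * (2 * G * (32 * (J * J * J)))
 e₅ = ν * suc ι * κ * (Q * Z)
 ι+1≤2ι : suc ι ≤ 2 * ι
 ι+1≤2ι = ≤-trans (+-monoˡ-≤ ι 1≤ι) (≤-reflexive (cong (_+_ ι) (sym (+-identityʳ ι))))
 b₁ : 5 * e₁ ≤ U
 b₁ = begin
  5 * e₁ ≡⟨ ring107 ν Q κ M J ⟩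
  κ * Q * J⁴ * (2 * (M * J)) * (20 * ν) ≤⟨ *-monoʳ-≤ (κ * Q * J⁴ * (2 * (M * J))) hι ⟩
  κ * Q * J⁴ * (2 * (M * J)) * ι ≡⟨ ring108 κ Q J M ι ⟩
  U ∎
 b₂ : 5 * e₂ ≤ U
 b₂ = begin
  5 * e₂ ≡⟨ ring109 ν Q J (suc ι) g M ⟩
  Q * (J * J * J) * (M * J * J) * (5 * ν * g * suc ι) ≤⟨ *-monoʳ-≤ (Q * (J * J * J) * (M * J * J)) (*-mono-≤ hκ ι+1≤2ι) ⟩
  Q * (J * J * J) * (M * J * J) * (κ * (2 * ι)) ≡⟨ ring110 κ Q J M ι ⟩
  U ∎
 b₃ : 5 * e₃ ≤ U
 b₃ = begin
  5 * e₃ ≡⟨ ring111 ν Q J (suc ι) κ A M X ⟩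
  κ * Q * (J * J * J) * (10 * ν * A * M) * (suc ι * X) ≤⟨ *-monoʳ-≤ (κ * Q * (J * J * J) * (10 * ν * A * M)) (*-mono-≤ ι+1≤2ι hX) ⟩
  κ * Q * (J * J * J) * (10 * ν * A * M) * (2 * ι * (C * J)) ≡⟨ ring112 κ Q J ν A M ι C ⟩
  κ * Q * (J * J * J * J) * (2 * M * ι) * (10 * ν * A * C) ≤⟨ *-monoʳ-≤ (κ * Q * (J * J * J * J) * (2 * M * ι)) hJ ⟩
  κ * Q * (J * J * J * J) * (2 * M * ι) * J ≡⟨ ring113 κ Q J M ι ⟩
  U ∎
 b₄ : 5 * e₄ ≤ U
 b₄ = begin
  5 * e₄ ≡⟨ ring114 ν (suc ι) κ g M J ⟩
  κ * (J * J * J) * (M * J * J) * (320 * ν * g * suc ι) ≤⟨ *-monoʳ-≤ (κ * (J * J * J) * (M * J * J)) (*-mono-≤ hQ ι+1≤2ι) ⟩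
  κ * (J * J * J) * (M * J * J) * (Q * (2 * ι)) ≡⟨ ring115 κ Q J M ι ⟩
  U ∎
 Z≤ : Z ≤ J⁴ * ((4096 * g * (M * M * M) + 16384 * A * C * (M * M * M * M)) * t)
 Z≤ = begin
  2 * G * (32 * (N * N * t)) + A * b * (16 * (N * N * N * t)) ≤⟨ +-monoʳ-≤ (2 * G * (32 * (N * N * t))) (*-monoˡ-≤ (16 * (N * N * N * t)) (*-monoʳ-≤ A (*-monoʳ-≤ (2 * M) hX))) ⟩
  2 * G * (32 * (N * N * t)) + A * (2 * M * (C * J)) * (16 * (N * N * N * t)) ≡⟨ ring116 g M J t A C ⟩
  J⁴ * ((4096 * g * (M * M * M) + 16384 * A * C * (M * M * M * M)) * t) ∎
 b₅ : 5 * e₅ ≤ U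
 b₅ = begin
  5 * e₅ ≡⟨ ring117 ν (suc ι) κ Q Z ⟩
  κ * Q * (5 * ν) * (suc ι * Z) ≤⟨ *-monoʳ-≤ (κ * Q * (5 * ν)) (*-mono-≤ ι+1≤2ι Z≤) ⟩
  κ * Q * (5 * ν) * (2 * ι * (J⁴ * (γ * t))) ≡⟨ ring118 κ Q ν ι J⁴ γ t ⟩
  κ * Q * (2 * ι * J⁴) * (5 * ν * γ * t) ≤⟨ *-monoʳ-≤ (κ * Q * (2 * ι * J⁴)) ht ⟩
  κ * Q * (2 * ι * J⁴) * (M * J) ≡⟨ ring119 κ Q J⁴ M ι J ⟩
  U ∎
  where
  γ = 4096 * g * (M * M * M) + 16384 * A * C * (M * M * M * M)
 small : e₁ + e₂ + e₃ + e₄ + e₅ ≤ U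
 small = *-cancelˡ-≤ 5 (begin
  5 * (e₁ + e₂ + e₃ + e₄ + e₅) ≡⟨ ring120 e₁ e₂ e₃ e₄ e₅ ⟩
  5 * e₁ + 5 * e₂ + 5 * e₃ + 5 * e₄ + 5 * e₅ ≤⟨ +-mono-≤ (+-mono-≤ (+-mono-≤ (+-mono-≤ b₁ b₂) b₃) b₄) b₅ ⟩
  U + U + U + U + U ≡⟨ ring121 U ⟩
  5 * U ∎)

moment-bound : ∀ ν κ ι Q A g M J X C t S Y I → 0 < κ → 0 < Q → 1 ≤ ι → 20 * ν ≤ ι → 5 * ν * g ≤ κ → 320 * ν * g ≤ Q →
 X ≤ C * J → 10 * ν * A * C ≤ J → 5 * ν * (4096 * g * (M * M * M) + 16384 * A * C * (M * M * M * M)) * t ≤ M * J → I ≡ ι * (2 * M * J) →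
 let N = 8 * (M * J) ; G = g * (M * J * J) ; b = 2 * M * X in
 κ * A * b * S ≤ κ * (I + N) * (J * J * (J * J)) + J * J * J * (suc ι * (G + κ * A * b)) + suc ι * κ * (A * b * Y) →
 Q * (A * b * Y) ≤ 2 * G * (32 * (J * J * J)) + Q * (2 * G * (32 * (N * N * t)) + A * b * (16 * (N * N * N * t))) →
 ν * (A * b * S) ≤ suc ν * (J * J * (J * J) * I)
moment-bound ν κ ι Q A g M J X C t S Y I p₁ p₂ p₃ p₄ p₅ p₆ p₇ p₈ p₉ refl = moment-arithmetic ν κ ι Q A g M J X C t S Y p₁ p₂ p₃ p₄ p₅ p₆ p₇ p₈ p₉

sg-zero : ∀ n → ¬ 0 < n → sg n ≡ 0
sg-zero zero _ = refl
sg-zero (suc n) h = contradiction z<s h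

sg≤ : ∀ n {c} → (0 < n → 1 ≤ c) → sg n ≤ c
sg≤ zero _ = z≤n
sg≤ (suc n) h = h z<s

-- The range of x is cut into windows starting at t W for κ ≤ t < T. The values from window t lie
-- between `lo t` and `lo (suc t)`, so different windows give different integers and the counts add
-- up. W exceeds the length I of a window by J: this gap absorbs the contribution of y and z to the
-- value. The restriction t ≥ κ makes x large compared with I.
module Scale (A K L H Q ν κ ι n T C J₁ I W h x₀ y₀ z₀ : ℕ) (adm : Admissible A K L H Q x₀ y₀ z₀)
      (ν>0 : 0 < ν) (κ>0 : 0 < κ) (Q>0 : 0 < Q)
      (hι : 20 * ν ≤ ι) (ι≥ : 6 + K ≤ ι) (hκ : 5 * ν * (11 + 4 * K) ≤ κ) (hQ : 320 * ν * (11 + 4 * K) ≤ Q)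
      (I≡ : I ≡ ι * (2 * (2 * H) * (J₁ + J₁))) (W≡ : W ≡ I + (J₁ + J₁)) (T≡ : T ≡ κ + n) (n≡ : n ≡ 2 * ν * (κ * κ))
      (TW≤ : T * W ≤ C * (J₁ + J₁)) (J₁≥3ν : 3 * ν ≤ J₁) (J₁≥ : 10 * ν * A * C ≤ J₁)
      (Nm≤ : 8 * (2 * H * (J₁ + J₁)) ≤ 2 ^ h)
      (log-small : 5 * ν * (4096 * (11 + 4 * K) * (2 * H * (2 * H) * (2 * H)) + 16384 * A * C * (2 * H * (2 * H) * (2 * H) * (2 * H))) * (suc h * suc h) ≤ J₁ + J₁)
      (γ : ℕ → ℕ) where

 private
  J M : ℕ
  J = J₁ + J₁
  M = 2 * H

  A>0 : 0 < A
  A>0 = Admissible.A>0 adm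
  H>0 : 0 < H
  H>0 = Admissible.H>0 adm
  M>0 : 0 < M
  M>0 = pos-* {2} z<s H>0

  J>0 : 0 < J
  J>0 = ≤-trans (pos-* {3} z<s ν>0) (≤-trans J₁≥3ν (m≤m+n J₁ J₁))

 lo : ℕ → ℕ
 lo t = A * (M * (t * W) * (M * (t * W)))

 lo-mono : ∀ {s t} → s ≤ t → lo s ≤ lo t
 lo-mono s≤t = *-monoʳ-≤ A (*-mono-≤ le le)
  where
  le = *-monoʳ-≤ M (*-monoˡ-≤ W s≤t)

 module Window (t : ℕ) (κ≤t : κ ≤ t) (t≤T : t ≤ T) where
  2J≤Nm : 2 * J ≤ 8 * (2 * H * J)
  2J≤Nm = *-mono-≤ {2} {8} (s≤s (s≤s z≤n)) (≤-trans (≤-reflexive (sym (*-identityˡ J))) (*-monoˡ-≤ J (≤-trans H>0 (m≤n*m H 2))))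
  Φ = SecondMoment.Φ A K L H Q x₀ y₀ z₀ J (t * W) I adm
  b₀ = SecondMoment.b₀ A K L H Q x₀ y₀ z₀ J (t * W) I adm
  total-excess = SecondMoment.Excess.total-excess A K L H Q x₀ y₀ z₀ J (t * W) I adm h J>0 2J≤Nm Nm≤
  total-excess-bound = SecondMoment.Excess.total-excess-bound A K L H Q x₀ y₀ z₀ J (t * W) I adm h J>0 2J≤Nm Nm≤
  S = SecondMoment.Excess.Moment.S A K L H Q x₀ y₀ z₀ J (t * W) I adm h J>0 2J≤Nm Nm≤ J₁ refl
  S-bound = SecondMoment.Excess.Moment.S-bound A K L H Q x₀ y₀ z₀ J (t * W) I adm h J>0 2J≤Nm Nm≤ J₁ refl
  ρ = SecondMoment.Excess.Moment.ρ A K L H Q x₀ y₀ z₀ J (t * W) I adm h J>0 2J≤Nm Nm≤ J₁ refl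
  ρ-pos = SecondMoment.Excess.Moment.ρ-pos A K L H Q x₀ y₀ z₀ J (t * W) I adm h J>0 2J≤Nm Nm≤ J₁ refl
  represented = SecondMoment.Excess.Moment.represented A K L H Q x₀ y₀ z₀ J (t * W) I adm h J>0 2J≤Nm Nm≤ J₁ refl
  many-represented = SecondMoment.Excess.Moment.many-represented A K L H Q x₀ y₀ z₀ J (t * W) I adm h J>0 2J≤Nm Nm≤ J₁ refl
  open Admissible adm using (x₀≤; y₀≤; z₀≤)

  κI≤X : κ * I ≤ t * W
  κI≤X = *-mono-≤ κ≤t (≤-trans (m≤m+n I J) (≤-reflexive (sym W≡)))

  S≤ : ν * (A * b₀ * S) ≤ suc ν * (J * J * (J * J) * I)
  S≤ = moment-bound ν κ ι Q A (11 + 4 * K) M J (t * W) C (suc h * suc h) S total-excess I κ>0 Q>0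
   (≤-trans (s≤s z≤n) ι≥) hι hκ hQ
   (≤-trans (*-monoˡ-≤ W t≤T) TW≤)
   (≤-trans J₁≥ (m≤m+n J₁ J₁)) (≤-trans log-small (m≤n*m J M {{>-nonZero M>0}})) I≡
   (S-bound κ ι κI≤X I≡) total-excess-bound

  Φ<hi : ∀ i j k → i < I → j < J → k < J → Φ i j k < lo (suc t)
  Φ<hi i j k i<I j<J k<J = begin-strict
   A * (x * x) + y * y + y * z + K * (z * z)
    ≤⟨ +-mono-≤ (+-mono-≤ (+-mono-≤ (*-monoʳ-≤ A (*-mono-≤ x≤ x≤)) (*-mono-≤ y≤ y≤)) (*-mono-≤ y≤ z≤)) (*-monoʳ-≤ K (*-mono-≤ z≤ z≤)) ⟩
   A * (M * (t * W + I) * (M * (t * W + I))) + M * (J + J) * (M * (J + J)) + M * (J + J) * (M * J) + K * (M * J * (M * J))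
    ≡⟨ ring55 A M (t * W + I) J K ⟩
   A * (M * (t * W + I) * (M * (t * W + I))) + M * M * (J * ((6 + K) * J))
    <⟨ +-monoʳ-< (A * (M * (t * W + I) * (M * (t * W + I)))) small ⟩
   A * (M * (t * W + I) * (M * (t * W + I))) + A * (M * M * (J * (2 * (t * W + I) + J)))
    ≡⟨ ring56 A M (t * W + I) J ⟩
   A * (M * (t * W + I + J) * (M * (t * W + I + J)))
    ≡⟨ cong (λ v → A * (M * v * (M * v))) (trans (+-assoc (t * W) I J) (trans (+-comm (t * W) (I + J)) (cong (_+ t * W) (sym W≡)))) ⟩
   lo (suc t) ∎
   where
   open ≤-Reasoning
   x = x₀ + M * (t * W + i)
   y = y₀ + M * (J + j)
   z = z₀ + M * k
   bound : ∀ c u v → c ≤ 2 * H → u < v → ∀ r → c + M * (r + u) ≤ M * (r + v)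
   bound c u v c≤ u<v r = ≤-trans (+-monoˡ-≤ (M * (r + u)) c≤) (≤-trans (≤-reflexive (sym (*-suc M (r + u)))) (*-monoʳ-≤ M (≤-trans (≤-reflexive (sym (+-suc r u))) (+-monoʳ-≤ r u<v))))
   x≤ : x ≤ M * (t * W + I)
   x≤ = bound x₀ i I x₀≤ i<I (t * W)
   y≤ : y ≤ M * (J + J)
   y≤ = bound y₀ j J y₀≤ j<J J
   z≤ : z ≤ M * J
   z≤ = bound z₀ k J z₀≤ k<J 0
   I≥ : (6 + K) * J ≤ I
   I≥ = ≤-trans (*-mono-≤ ι≥ (≤-trans (≤-reflexive (sym (*-identityˡ J))) (*-monoˡ-≤ J (≤-trans M>0 (m≤n*m M 2))))) (≤-reflexive (sym I≡))
   small : M * M * (J * ((6 + K) * J)) < A * (M * M * (J * (2 * (t * W + I) + J)))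
   small = begin-strict
    M * M * (J * ((6 + K) * J)) ≤⟨ *-monoʳ-≤ (M * M) (*-monoʳ-≤ J (≤-trans I≥ (≤-trans (m≤n+m I (t * W)) (m≤m+n _ (t * W + I + 0))))) ⟩
    M * M * (J * (2 * (t * W + I))) <⟨ *-monoʳ-< (M * M) {{m*n≢0 M M {{>-nonZero M>0}} {{>-nonZero M>0}}}} (*-monoʳ-< J {{>-nonZero J>0}} (m<m+n _ J>0)) ⟩
    M * M * (J * (2 * (t * W + I) + J)) ≤⟨ m≤n*m _ A {{>-nonZero A>0}} ⟩
    A * (M * M * (J * (2 * (t * W + I) + J))) ∎

  lo≤Φ : ∀ i j k → lo t ≤ Φ i j k
  lo≤Φ i j k = ≤-trans (*-monoʳ-≤ A (*-mono-≤ le le)) (≤-trans (m≤m+n _ _) (≤-trans (m≤m+n _ _) (m≤m+n _ _)))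
   where
   le : M * (t * W) ≤ x₀ + M * (t * W + i)
   le = ≤-trans (*-monoʳ-≤ M (m≤m+n (t * W) i)) (m≤n+m _ x₀)

  R : ℕ
  R = represented (lo (suc t)) Φ<hi

  R-near : Near ν (A * (2 * M * (t * W)) * I) R
  R-near = many-represented (lo (suc t)) Φ<hi ν S≤

  step : (∀ i j k → Φ i j k < lo (suc t) → 1 ≤ γ (Φ i j k)) → ∑ (lo t) γ + R ≤ ∑ (lo (suc t)) γ
  step hyp = begin
   ∑ (lo t) γ + R
    ≡⟨ cong (_+_ (∑ (lo t) γ)) (trans (cong (λ v → ∑ v (λ m → sg (ρ m))) (sym B≡)) (∑-split (lo t) d (λ m → sg (ρ m)))) ⟩
   ∑ (lo t) γ + ((∑[ m < lo t ] sg (ρ m)) + (∑[ i < d ] sg (ρ (lo t + i))))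
    ≡⟨ cong (λ v → ∑ (lo t) γ + (v + (∑[ i < d ] sg (ρ (lo t + i))))) (∑-zero (lo t) below) ⟩
   ∑ (lo t) γ + (∑[ i < d ] sg (ρ (lo t + i)))
    ≤⟨ +-monoʳ-≤ (∑ (lo t) γ) (∑-mono d (λ i i<d → at (lo t + i) (<-≤-trans (+-monoʳ-< (lo t) i<d) (≤-reflexive B≡)))) ⟩
   ∑ (lo t) γ + (∑[ i < d ] γ (lo t + i))
    ≡⟨ trans (sym (∑-split (lo t) d γ)) (cong (λ v → ∑ v γ) B≡) ⟩
   ∑ (lo (suc t)) γ ∎
   where
   open ≤-Reasoning
   d = lo (suc t) ∸ lo t
   B≡ : lo t + d ≡ lo (suc t)
   B≡ = m+[n∸m]≡n (lo-mono (n≤1+n t))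
   below : ∀ m → m < lo t → sg (ρ m) ≡ 0
   below m m<lo = sg-zero (ρ m) (λ h → none (ρ-pos m h))
    where
    none : (Σ ℕ λ i → Σ ℕ λ j → Σ ℕ λ k → i < I × j < J × k < J × Φ i j k ≡ m) → ⊥
    none (i , j , k , _ , _ , _ , eq) = <⇒≱ m<lo (≤-trans (lo≤Φ i j k) (≤-reflexive eq))
   at : ∀ m → m < lo (suc t) → sg (ρ m) ≤ γ m
   at m m<hi = sg≤ (ρ m) (λ h → some (ρ-pos m h))
    where
    some : (Σ ℕ λ i → Σ ℕ λ j → Σ ℕ λ k → i < I × j < J × k < J × Φ i j k ≡ m) → 1 ≤ γ m
    some (i , j , k , _ , _ , _ , eq) = subst (λ v → 1 ≤ γ v) eq (hyp i j k (≤-<-trans (≤-reflexive eq) m<hi))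

 module _ (N : ℕ) (lo≤N : lo T ≤ N)
      (hyp : ∀ i j k → form A K (x₀ + M * i) (y₀ + M * j) (z₀ + M * k) < N →
         1 ≤ γ (form A K (x₀ + M * i) (y₀ + M * j) (z₀ + M * k))) where

  private
   κ+r≤T : ∀ {r} → r < n → κ + r ≤ T
   κ+r≤T r<n = ≤-trans (+-monoʳ-≤ κ (<⇒≤ r<n)) (≤-reflexive (sym T≡))

   Y : ℕ → ℕ
   Y r = A * (2 * M * ((κ + r) * W)) * I

  accumulate : ∀ r → r ≤ n → ∃ λ G → Near ν (∑ r Y) G × G ≤ ∑ (lo (κ + r)) γ
  accumulate zero _ = 0 , ≤-trans (≤-reflexive (*-zeroʳ ν)) z≤n , z≤n
  accumulate (suc r) r<n with accumulate r (<⇒≤ r<n)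
  ... | G , near , G≤ = G + R , near' , ≤-trans (+-monoˡ-≤ R G≤) (≤-trans (step hyp') (≤-reflexive (cong (λ v → ∑ (lo v) γ) (sym (+-suc κ r)))))
   where
   R = Window.R (κ + r) (m≤m+n κ r) (κ+r≤T r<n)
   R-near = Window.R-near (κ + r) (m≤m+n κ r) (κ+r≤T r<n)
   step = Window.step (κ + r) (m≤m+n κ r) (κ+r≤T r<n)
   near' : Near ν (∑ r Y + Y r) (G + R)
   near' = ≤-trans (≤-reflexive (*-distribˡ-+ ν (∑ r Y) (Y r))) (≤-trans (+-mono-≤ near R-near) (≤-reflexive (ring20 ν G R (∑ r Y) (Y r))))
   hi≤N : lo (suc (κ + r)) ≤ N
   hi≤N = ≤-trans (lo-mono (≤-trans (≤-reflexive (sym (+-suc κ r))) (≤-trans (+-monoʳ-≤ κ r<n) (≤-reflexive (sym T≡))))) lo≤N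
   hyp' : ∀ i j k → _ → _
   hyp' i j k lt = hyp ((κ + r) * W + i) (J + j) k (<-≤-trans lt hi≤N)

  ∑Y : ∑ n Y ≡ A * M * W * I * (n * (2 * κ + n ∸ n) + n * (n ∸ 1))
  ∑Y = trans (∑-cong n (λ r _ → ring57 A M κ r W I)) (trans (∑-*ˡ n (A * M * W * I) _) (cong (A * M * W * I *_) (trans (gauss n) (cong (λ v → n * v + n * (n ∸ 1)) (sym (m+n∸n≡m (2 * κ) n))))))
   where
   gauss : ∀ n → ∑[ r < n ] 2 * (κ + r) ≡ n * (2 * κ) + n * (n ∸ 1)
   gauss zero = refl
   gauss (suc zero) = ring21 κ
   gauss (suc m@(suc m')) = trans (cong (_+ 2 * (κ + m)) (gauss m)) (ring22 κ m')

  -- Four losses of the fraction 1 / (4μ) each: from N down to `lo T`; from T² to `Θ`, which omits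
  -- the windows below κ and replaces (t+1)² - t² by 2t; from W to I, the gaps between windows; and
  -- the loss of the second moment inside each window.
  conclusion : ∀ μ c → ν ≡ 2 * (2 * μ) → lo T ≡ c * (J₁ * J₁) → N < c * (suc J₁ * suc J₁) → Near μ N (M * ∑ N γ)
  conclusion μ c ν≡ lo≡ N< = Near-trans μ
    (Near-trans (2 * μ) (subst (λ v → Near v N (lo T)) ν≡ near₁) (subst (λ v → Near v (lo T) (A * M * W * M * (W * Θ))) ν≡ near₂))
    (Near-trans (2 * μ) (subst (λ v → Near v (A * M * W * M * (W * Θ)) (A * M * W * M * (I * Θ))) ν≡ near₃)
              (subst (λ v → Near v (A * M * W * M * (I * Θ)) (M * ∑ N γ)) ν≡ near₄))
   where
   open ≤-Reasoning
   Θ = n * (2 * κ + n ∸ n) + n * (n ∸ 1)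
   n>0 : 0 < n
   n>0 = ≤-trans (pos-* (pos-* {2} z<s ν>0) (pos-* κ>0 κ>0)) (≤-reflexive (sym n≡))
   near₁ : Near ν N (lo T)
   near₁ = begin
    ν * N ≡⟨ cong (ν *_) (sym (m+[n∸m]≡n lo≤N)) ⟩
    ν * (lo T + (N ∸ lo T)) ≡⟨ *-distribˡ-+ ν (lo T) (N ∸ lo T) ⟩
    ν * lo T + ν * (N ∸ lo T) ≤⟨ +-monoʳ-≤ (ν * lo T) gap ⟩
    ν * lo T + N ∎
    where
    J₁>0 : 0 < J₁
    J₁>0 = ≤-trans (pos-* {3} z<s ν>0) J₁≥3ν
    gap : ν * (N ∸ lo T) ≤ N
    gap = begin
     ν * (N ∸ lo T) ≤⟨ *-monoʳ-≤ ν (m≤n+o⇒m∸n≤o N (lo T) (≤-trans (<⇒≤ N<) (≤-reflexive (trans (ring12 c J₁) (cong (_+ c * (2 * J₁ + 1)) (sym lo≡)))))) ⟩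
     ν * (c * (2 * J₁ + 1)) ≤⟨ *-monoʳ-≤ ν (*-monoʳ-≤ c (+-monoʳ-≤ (2 * J₁) J₁>0)) ⟩
     ν * (c * (2 * J₁ + J₁)) ≡⟨ ring11 ν c J₁ ⟩
     c * (J₁ * (3 * ν)) ≤⟨ *-monoʳ-≤ c (*-monoʳ-≤ J₁ J₁≥3ν) ⟩
     c * (J₁ * J₁) ≡⟨ sym lo≡ ⟩
     lo T ≤⟨ lo≤N ⟩
     N ∎
   near₂ : Near ν (lo T) (A * M * W * M * (W * Θ))
   near₂ = subst₂ (Near ν) (ring23 A M W T) (ring24 A M W Θ) (Near-* ν (A * (M * M) * (W * W)) {T * T} {Θ} core)
    where
    T²≡ : T * T ≡ Θ + (κ * κ + n)
    T²≡ = trans (cong₂ _*_ T≡ T≡) (trans (sq-lem κ n n>0) (cong (λ v → n * v + n * (n ∸ 1) + (κ * κ + n)) (sym (m+n∸n≡m (2 * κ) n))))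
     where
     sq-lem : ∀ κ n → 0 < n → (κ + n) * (κ + n) ≡ n * (2 * κ) + n * (n ∸ 1) + (κ * κ + n)
     sq-lem κ (suc m) _ = ring3 κ m
    core : Near ν (T * T) Θ
    core = begin
     ν * (T * T) ≡⟨ cong (ν *_) T²≡ ⟩
     ν * (Θ + (κ * κ + n)) ≡⟨ *-distribˡ-+ ν Θ _ ⟩
     ν * Θ + ν * (κ * κ + n) ≤⟨ +-monoʳ-≤ (ν * Θ) tail-small ⟩
     ν * Θ + T * T ∎
     where
     n≤T : n ≤ T
     n≤T = ≤-trans (m≤n+m n κ) (≤-reflexive (sym T≡))
     2ν≤n : 2 * ν ≤ n
     2ν≤n = ≤-trans (≤-reflexive (sym (*-identityʳ (2 * ν)))) (≤-trans (*-monoʳ-≤ (2 * ν) (pos-* κ>0 κ>0)) (≤-reflexive (sym n≡)))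
     tail-small : ν * (κ * κ + n) ≤ T * T
     tail-small = *-cancelˡ-≤ 2 (begin
      2 * (ν * (κ * κ + n)) ≡⟨ ring4 ν (κ * κ) n ⟩
      2 * ν * (κ * κ) + 2 * ν * n ≤⟨ +-mono-≤ (≤-trans (≤-reflexive (sym n≡)) (m≤n*m n n {{>-nonZero n>0}})) (*-monoˡ-≤ n 2ν≤n) ⟩
      n * n + n * n ≡⟨ cong (_+_ (n * n)) (sym (+-identityʳ (n * n))) ⟩
      2 * (n * n) ≤⟨ *-monoʳ-≤ 2 (*-mono-≤ n≤T n≤T) ⟩
      2 * (T * T) ∎)
   near₃ : Near ν (A * M * W * M * (W * Θ)) (A * M * W * M * (I * Θ))
   near₃ = Near-* ν (A * M * W * M) (subst₂ (Near ν) (*-comm Θ W) (*-comm Θ I) (Near-* ν Θ {W} {I} core))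
    where
    core : Near ν W I
    core = ≤-trans (≤-reflexive (trans (cong (ν *_) W≡) (*-distribˡ-+ ν I J))) (+-monoʳ-≤ (ν * I) (≤-trans (*-mono-≤ ν≤ι J≤) (≤-trans (≤-reflexive (sym I≡)) (≤-trans (m≤m+n I J) (≤-reflexive (sym W≡))))))
     where
     ν≤ι : ν ≤ ι
     ν≤ι = ≤-trans (m≤n*m ν 20) hι
     J≤ : J ≤ 2 * M * J
     J≤ = m≤n*m J (2 * M) {{m*n≢0 2 M {{_}} {{>-nonZero M>0}}}}
   near₄ : Near ν (A * M * W * M * (I * Θ)) (M * ∑ N γ)
   near₄ with accumulate n ≤-refl
   ... | G , near , G≤ = subst (λ v → Near ν v (M * ∑ N γ)) (trans (cong (M *_) ∑Y) (ring25 A M W I Θ))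
       (Near-* ν M (Near-mono ν near (≤-trans G≤ (∑-mono-range γ (≤-trans (≤-reflexive (cong lo (sym T≡))) lo≤N)))))

Represents : ℕ → ℕ → ℕ → ℕ → ℕ → ℕ → ℕ → (ℕ → ℕ) → Set
Represents A K H x₀ y₀ z₀ N γ = ∀ i j k → form A K (x₀ + 2 * H * i) (y₀ + 2 * H * j) (z₀ + 2 * H * k) < N →
 1 ≤ γ (form A K (x₀ + 2 * H * i) (y₀ + 2 * H * j) (z₀ + 2 * H * k))

private
 -- The constant c is such that the windows end at c J₁², and J₁ is the integral part of √(N / c).
 -- Thus the boxes grow with N while the number of windows and the proportions κ, ι stay fixed.
 sampling-at : ∀ A K L H Q μ ν κ ι n T ω C c → 0 < ν → 0 < κ → 0 < Q → 0 < c → ν ≡ 2 * (2 * μ) →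
  20 * ν ≤ ι → 6 + K ≤ ι → 5 * ν * (11 + 4 * K) ≤ κ → 320 * ν * (11 + 4 * K) ≤ Q →
  T ≡ κ + n → n ≡ 2 * ν * (κ * κ) → ω ≡ ι * (2 * (2 * H)) + 1 → C ≡ T * ω →
  c ≡ A * (2 * H * (T * (ω * 2)) * (2 * H * (T * (ω * 2)))) →
  ∃ λ N₀ → ∀ N → N₀ ≤ N → ∀ {x₀ y₀ z₀} → Admissible A K L H Q x₀ y₀ z₀ → (γ : ℕ → ℕ) →
   Represents A K H x₀ y₀ z₀ N γ → Near μ N (2 * H * ∑ N γ)
 sampling-at A K L H Q μ ν κ ι n T ω C c ν>0 κ>0 Q>0 c>0 ν≡ hι ι≥ hκ hQ T≡ n≡ ω≡ C≡ c≡ =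
  c * (Jm * Jm) , λ N N₀≤N adm γ hyp → go N N₀≤N adm γ hyp (square-bracket c c>0 N)
  where
  growth : ∃ λ J₀ → ∀ J → J₀ ≤ J → ∃ λ h → 8 * (2 * H) * J ≤ 2 ^ h ×
   5 * ν * (4096 * (11 + 4 * K) * (2 * H * (2 * H) * (2 * H)) + 16384 * A * C * (2 * H * (2 * H) * (2 * H) * (2 * H))) * (suc h * suc h) ≤ J
  growth = log²-growth (5 * ν * (4096 * (11 + 4 * K) * (2 * H * (2 * H) * (2 * H)) + 16384 * A * C * (2 * H * (2 * H) * (2 * H) * (2 * H)))) (8 * (2 * H))
  J₀ = proj₁ growth
  Jm = J₀ + 3 * ν + 10 * ν * A * C
  go : ∀ N → c * (Jm * Jm) ≤ N → ∀ {x₀ y₀ z₀} → Admissible A K L H Q x₀ y₀ z₀ → (γ : ℕ → ℕ) → Represents A K H x₀ y₀ z₀ N γ →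
   (∃ λ r → c * (r * r) ≤ N × N < c * (suc r * suc r)) → Near μ N (2 * H * ∑ N γ)
  go N N₀≤N {x₀} {y₀} {z₀} adm γ hyp (J₁ , lower , upper) = finish (proj₂ growth (J₁ + J₁) (≤-trans J₀≤ (m≤m+n J₁ J₁)))
   where
   Jm≤J₁ : Jm ≤ J₁
   Jm≤J₁ = s≤s⁻¹ (≰⇒> (λ le → <⇒≱ (≤-<-trans N₀≤N upper) (*-monoʳ-≤ c (*-mono-≤ le le))))
   J₀≤ : J₀ ≤ J₁
   J₀≤ = ≤-trans (≤-trans (m≤m+n J₀ (3 * ν)) (m≤m+n _ (10 * ν * A * C))) Jm≤J₁
   W = ι * (2 * (2 * H) * (J₁ + J₁)) + (J₁ + J₁)
   W≡ : W ≡ ω * (J₁ + J₁)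
   W≡ = trans (ring26 ι H (J₁ + J₁)) (cong (_* (J₁ + J₁)) (sym ω≡))
   lo≡ : A * (2 * H * (T * W) * (2 * H * (T * W))) ≡ c * (J₁ * J₁)
   lo≡ = trans (cong (λ v → A * (2 * H * (T * v) * (2 * H * (T * v)))) W≡) (trans (ring27 A (2 * H) T ω J₁) (cong (_* (J₁ * J₁)) (sym c≡)))
   finish : (∃ λ h → 8 * (2 * H) * (J₁ + J₁) ≤ 2 ^ h × _) → Near μ N (2 * H * ∑ N γ)
   finish (h , h₁ , h₂) = Scale.conclusion A K L H Q ν κ ι n T C J₁ (ι * (2 * (2 * H) * (J₁ + J₁))) W h x₀ y₀ z₀ adm
    ν>0 κ>0 Q>0 hι ι≥ hκ hQ refl refl T≡ n≡
    (≤-reflexive (trans (cong (T *_) W≡) (trans (sym (*-assoc T ω (J₁ + J₁))) (cong (_* (J₁ + J₁)) (sym C≡)))))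
    (≤-trans (≤-trans (m≤n+m (3 * ν) J₀) (m≤m+n _ (10 * ν * A * C))) Jm≤J₁) (≤-trans (m≤n+m (10 * ν * A * C) _) Jm≤J₁)
    (≤-trans (≤-reflexive (sym (*-assoc 8 (2 * H) (J₁ + J₁)))) h₁) h₂ γ N
    (≤-trans (≤-reflexive lo≡) lower) hyp μ c ν≡ lo≡ upper

-- The threshold N₀ precedes the residue class and γ: the bound is used for all classes modulo 2H
-- simultaneously, with a γ that depends on the class and on an arbitrary exceptional set.
sampling : ∀ A K L H Q μ → 0 < A → 0 < H → 0 < μ → 320 * (2 * (2 * μ)) * (11 + 4 * K) ≤ Q →
 ∃ λ N₀ → ∀ N → N₀ ≤ N → ∀ {x₀ y₀ z₀} → Admissible A K L H Q x₀ y₀ z₀ → (γ : ℕ → ℕ) →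
  Represents A K H x₀ y₀ z₀ N γ → Near μ N (2 * H * ∑ N γ)
sampling A K L H Q μ A>0 H>0 μ>0 hQ =
 sampling-at A K L H Q μ ν κ ι n (κ + n) ω ((κ + n) * ω) (A * (2 * H * ((κ + n) * (ω * 2)) * (2 * H * ((κ + n) * (ω * 2)))))
  ν>0 κ>0 (≤-trans (pos-* (pos-* {320} z<s ν>0) z<s) hQ) (pos-* A>0 (pos-* r>0 r>0)) refl
  (≤-trans (m≤m+n (20 * ν) (6 + K)) (≤-reflexive (sym (+-assoc (20 * ν) 6 K))))
  (≤-trans (m≤n+m (6 + K) (20 * ν)) (≤-reflexive (sym (+-assoc (20 * ν) 6 K)))) ≤-refl hQ refl refl refl refl refl
 where
 ν = 2 * (2 * μ)
 κ = 5 * ν * (11 + 4 * K)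
 ι = 20 * ν + 6 + K
 n = 2 * ν * (κ * κ)
 ω = ι * (2 * (2 * H)) + 1
 ν>0 : 0 < ν
 ν>0 = pos-* {2} z<s (pos-* {2} z<s μ>0)
 κ>0 : 0 < κ
 κ>0 = pos-* (pos-* {5} z<s ν>0) z<s
 r>0 : 0 < 2 * H * ((κ + n) * (ω * 2))
 r>0 = pos-* (pos-* {2} z<s H>0) (pos-* (≤-trans κ>0 (m≤m+n κ n)) (pos-* {ω} (m≤n+m 1 (ι * (2 * (2 * H)))) z<s))

-- Congruences and local solutions

∣z-resp : ∀ {n a b} → a ≡ b → n ∣z a → n ∣z b
∣z-resp refl h = h

∣z-0 : ∀ {n} → n ∣z 0ℤ
∣z-0 = dividesz 0ℤ refl

∣z-*ˡ : ∀ {n} a {b} → n ∣z b → n ∣z a *z b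
∣z-*ˡ a = ℤ∣.∣n⇒∣m*n a

∣z-*ʳ : ∀ {n a} b → n ∣z a → n ∣z a *z b
∣z-*ʳ b = ℤ∣.∣m⇒∣m*n b

∣z-+ : ∀ {n a b} → n ∣z a → n ∣z b → n ∣z a +z b
∣z-+ = ℤ∣.∣m∣n⇒∣m+n

∣z-- : ∀ {n a b} → n ∣z a → n ∣z b → n ∣z a -z b
∣z-- = ℤ∣.∣m∣n⇒∣m-n

∣z-trans : ∀ {a b c} → a ∣z b → b ∣z c → a ∣z c
∣z-trans = ℤ∣.∣-trans

∣⇒∣z : ∀ {m n} → m ∣ n → + m ∣z + n
∣⇒∣z = ℤ∣.∣ᵤ⇒∣

∣z⇒∣ : ∀ {m n} → + m ∣z + n → m ∣ n
∣z⇒∣ = ℤ∣.∣⇒∣ᵤ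

euclid : ∀ {p} → Prime p → ∀ a b → + p ∣z a *z b → + p ∣z a ⊎ + p ∣z b
euclid {p} pp a b h with euclidsLemma (abs a) (abs b) pp (subst (p ∣_) (ℤₚ.abs-* a b) (ℤ∣.∣⇒∣ᵤ h))
... | inj₁ q = inj₁ (ℤ∣.∣ᵤ⇒∣ q)
... | inj₂ q = inj₂ (ℤ∣.∣ᵤ⇒∣ q)

∤-* : ∀ {p} → Prime p → ∀ a b → ¬ + p ∣z a → ¬ + p ∣z b → ¬ + p ∣z a *z b
∤-* pp a b na nb h with euclid pp a b h
... | inj₁ q = na q
... | inj₂ q = nb q

coprime-divisorz : ∀ {n} a b → Coprime n (abs a) → + n ∣z a *z b → + n ∣z b
coprime-divisorz {n} a b c h = ℤ∣.∣ᵤ⇒∣ (coprime-divisor c (subst (n ∣_) (ℤₚ.abs-* a b) (ℤ∣.∣⇒∣ᵤ h)))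

prime-coprime : ∀ {p n} → Prime p → ¬ p ∣ n → Coprime p n
prime-coprime pp p∤n {d} (d∣p , d∣n) with prime⇒irreducible pp d∣p
... | inj₁ d≡1 = d≡1
... | inj₂ refl = contradiction d∣n p∤n

prime>1 : ∀ {p} → Prime p → 1 < p
prime>1 {p} pp = nonTrivial⇒n>1 p {{prime⇒nonTrivial pp}}

small-∤ : ∀ {p d} → 0 < d → d < p → ¬ p ∣ d
small-∤ {p} {d} d>0 d<p h = <⇒≱ d<p (∣⇒≤ {{>-nonZero d>0}} h)

inverse : ∀ n a → Coprime (abs a) n → ∃ λ b → + n ∣z a *z b -z + 1
inverse n a c = fix (invℕ (abs a) (Coprimality.coprime-Bézout c)) (sign-abs a)
 where
 invℕ : ∀ m → Bézout.Identity 1 m n → ∃ λ b → + n ∣z + m *z b -z + 1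
 invℕ m (Bézout.+- x y eq) = + x , dividesz (+ y) (begin
  + m *z + x -z + 1 ≡⟨ cong (_-z + 1) (trans (ℤₚ.*-comm (+ m) (+ x)) (sym (cast-* x m))) ⟩
  + (x * m) -z + 1 ≡⟨ cong (λ v → + v -z + 1) (sym eq) ⟩
  + (1 + y * n) -z + 1 ≡⟨ cong (λ v → + 1 +z v -z + 1) (cast-* y n) ⟩
  + 1 +z + y *z + n -z + 1 ≡⟨ ringz45 (+ y *z + n) ⟩
  + y *z + n ∎)
  where
  open ≡-Reasoning
 invℕ m (Bézout.-+ x y eq) = -z + x , dividesz (-z + y) (begin
  + m *z (-z + x) -z + 1 ≡⟨ ringz46 (+ m) (+ x) ⟩
  -z (+ 1 +z + x *z + m) ≡⟨ cong (λ v → -z (+ 1 +z v)) (sym (cast-* x m)) ⟩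
  -z (+ (1 + x * m)) ≡⟨ cong (λ v → -z (+ v)) eq ⟩
  -z (+ (y * n)) ≡⟨ cong -z_ (cast-* y n) ⟩
  -z (+ y *z + n) ≡⟨ ℤₚ.neg-distribˡ-* (+ y) (+ n) ⟩
  -z + y *z + n ∎)
  where
  open ≡-Reasoning
 sign-abs : ∀ a → + abs a ≡ a ⊎ + abs a ≡ -z a
 sign-abs (+ n) = inj₁ refl
 sign-abs ℤ.-[1+ n ] = inj₂ refl
 fix : (∃ λ b → + n ∣z + abs a *z b -z + 1) → + abs a ≡ a ⊎ + abs a ≡ -z a → ∃ λ b → + n ∣z a *z b -z + 1
 fix (b , h) (inj₁ e) = b , subst (λ v → + n ∣z v *z b -z + 1) e h
 fix (b , h) (inj₂ e) = -z b , ∣z-resp (trans (cong (λ v → v *z b -z + 1) e) (ringz47 a b)) h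

inverse-mod-prime : ∀ {p} → Prime p → ∀ a → ¬ + p ∣z a → ∃ λ b → + p ∣z a *z b -z + 1
inverse-mod-prime {p} pp a h = inverse p a (Coprimality.sym (prime-coprime pp (λ d → h (ℤ∣.∣ᵤ⇒∣ d))))

crt : ∀ m n → Coprime m n → ∀ a b → ∃ λ x → + m ∣z x -z a × + n ∣z x -z b
crt m n c a b with inverse n (+ m) c
... | m' , dividesz q eq = a +z + m *z (m' *z (b -z a)) ,
  dividesz (m' *z (b -z a)) (ringz99 a (+ m) (m' *z (b -z a))) ,
  dividesz (q *z (b -z a)) (trans (ringz100 a b (+ m) m') (trans (cong (_*z (b -z a)) eq) (ringz101 q (+ n) (b -z a))))

residue : ∀ n .{{_ : NonZero n}} a → ∃ λ r → r < n × + n ∣z a -z + r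
residue n a = a ℤ/.%ℕ n , ℤ/.n%ℕd<d a n , dividesz (a ℤ/./ℕ n) (begin
 a -z + (a ℤ/.%ℕ n) ≡⟨ cong (_-z + (a ℤ/.%ℕ n)) (ℤ/.a≡a%ℕn+[a/ℕn]*n a n) ⟩
 + (a ℤ/.%ℕ n) +z (a ℤ/./ℕ n) *z + n -z + (a ℤ/.%ℕ n) ≡⟨ ringz102 (+ (a ℤ/.%ℕ n)) ((a ℤ/./ℕ n) *z + n) ⟩
 (a ℤ/./ℕ n) *z + n ∎)
 where
 open ≡-Reasoning

pigeonhole-mod : ∀ n k → n < k → 0 < n → (f : ℕ → ℤ) → Σ ℕ λ i → Σ ℕ λ j → i < j × j < k × + n ∣z f i -z f j
pigeonhole-mod n k n<k n>0 f with Finₚ.pigeonhole n<k (λ i → fromℕ< (proj₁ (proj₂ (residue n {{>-nonZero n>0}} (f (toℕ i))))))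
... | i , j , i<j , eq = toℕ i , toℕ j , i<j , Finₚ.toℕ<n j ,
  ∣z-resp (ringz103 (f (toℕ i)) (f (toℕ j)) (+ r i)) (∣z-- (div i) (subst (λ v → + n ∣z f (toℕ j) -z + v) (sym r≡) (div j)))
 where
 instance
  n≢0 : NonZero n
  n≢0 = >-nonZero n>0
 r : Fin k → ℕ
 r i = proj₁ (residue n (f (toℕ i)))
 div : ∀ i → + n ∣z f (toℕ i) -z + r i
 div i = proj₂ (proj₂ (residue n (f (toℕ i))))
 r≡ : r i ≡ r j
 r≡ = trans (sym (Finₚ.toℕ-fromℕ< _)) (trans (cong toℕ eq) (Finₚ.toℕ-fromℕ< _))

-- Two of the h + 1 values α x² and the h + 1 values c − β y² agree modulo p = 2h + 1.
conic : ∀ {p} h → Prime p → p ≡ 1 + 2 * h → ∀ α β c → ¬ + p ∣z α → ¬ + p ∣z β →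
 Σ ℤ λ x → Σ ℤ λ y → + p ∣z α *z (x *z x) +z β *z (y *z y) -z c
conic {p} h pp p≡ α β c nα nβ = found (pigeonhole-mod p (suc p) ≤-refl (<⇒≤ (prime>1 pp)) f)
 where
 A B : ℕ → ℤ
 A i = α *z (+ i *z + i)
 B i = c -z β *z (+ i *z + i)
 f : ℕ → ℤ
 f i with i ≤? h
 ... | yes _ = A i
 ... | no _ = B (i ∸ suc h)
 distinct : ∀ γ → ¬ + p ∣z γ → ∀ {i j} → i < j → j ≤ h → ¬ + p ∣z γ *z (+ i *z + i) -z γ *z (+ j *z + j)
 distinct γ nγ {i} {j} i<j j≤h d = ∤-* pp γ ((+ j -z + i) *z (+ i +z + j)) nγ (∤-* pp (+ j -z + i) (+ i +z + j)
   (λ e → small-∤ {p} (m<n⇒0<n∸m i<j) (≤-<-trans (m∸n≤m j i) (≤-<-trans j≤h h<p)) (∣z⇒∣ (∣z-resp (-z-≥ (<⇒≤ i<j)) e)))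
   (λ e → small-∤ {p} (≤-trans (≤-trans (s≤s z≤n) i<j) (m≤n+m j i)) (≤-<-trans (+-mono-≤ (≤-trans (<⇒≤ i<j) j≤h) j≤h) h+h<p) (∣z⇒∣ e)))
   (∣z-resp (ringz48 γ (+ i) (+ j)) (∣z-- ∣z-0 d))
  where
  h+h<p : h + h < p
  h+h<p = ≤-reflexive (sym (trans p≡ (cong (λ v → suc (h + v)) (+-identityʳ h))))
  h<p : h < p
  h<p = ≤-<-trans (m≤m+n h h) h+h<p
 second : ∀ {j} → j < suc p → ¬ j ≤ h → j ∸ suc h ≤ h
 second {j} j<p j≰h = m≤n+o⇒m∸n≤o j (suc h) (≤-trans (s≤s⁻¹ j<p) (≤-reflexive (trans p≡ (cong (λ v → suc (h + v)) (+-identityʳ h)))))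
 found : (Σ ℕ λ i → Σ ℕ λ j → i < j × j < suc p × + p ∣z f i -z f j) → Σ ℤ λ x → Σ ℤ λ y → + p ∣z α *z (x *z x) +z β *z (y *z y) -z c
 found (i , j , i<j , j<p , d) with i ≤? h | j ≤? h
 ... | yes _ | yes j≤h = contradiction d (distinct α nα i<j j≤h)
 ... | yes _ | no _ = + i , + (j ∸ suc h) , ∣z-resp (ringz49 (A i) (β *z (+ (j ∸ suc h) *z + (j ∸ suc h))) c) d
 ... | no i≰h | yes j≤h = contradiction (≤-trans (<⇒≤ i<j) j≤h) i≰h
 ... | no i≰h | no j≰h = contradiction (∣z-resp (ringz50 c (β *z (+ (i ∸ suc h) *z + (i ∸ suc h))) (β *z (+ (j ∸ suc h) *z + (j ∸ suc h)))) (∣z-- ∣z-0 d))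
               (distinct β nβ (∸-monoˡ-< i<j (≰⇒> i≰h)) (second j<p j≰h))

odd-prime : ∀ {p} → Prime p → 2 < p → ∃ λ h → p ≡ 1 + 2 * h
odd-prime {p} pp 2<p = odd p (λ 2∣p → not2 (prime⇒irreducible pp 2∣p))
 where
 not2 : 2 ≡ 1 ⊎ 2 ≡ p → ⊥
 not2 (inj₂ refl) = <-irrefl refl 2<p
 odd : ∀ n → ¬ 2 ∣ n → ∃ λ m → n ≡ 1 + 2 * m
 odd zero ¬p = ⊥-elim (¬p (divides 0 refl))
 odd (suc zero) ¬p = 0 , refl
 odd (suc (suc n)) ¬p with odd n (λ d → ¬p (∣m∣n⇒∣m+n ∣-refl d))
 ... | m , eq = suc m , trans (cong (λ v → suc (suc v)) eq) (ring42 m)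

∤-literal : ∀ {p} n → 0 < n → n < p → ¬ + p ∣z + n
∤-literal n n>0 n<p h = small-∤ n>0 n<p (∣z⇒∣ h)

private

 -- The values of α + β t² at t = 1 and t = 2 differ by 3β, so a prime p > 4 cannot divide both.
 slope : ∀ {p} → Prime p → 4 < p → ∀ α β → ¬ + p ∣z β → ∃ λ t → ¬ + p ∣z t × ¬ + p ∣z α +z β *z (t *z t)
 slope {p} pp 4<p α β nβ = choose (+ p ℤ∣.∣? (α +z β *z (+ 1 *z + 1))) (+ p ℤ∣.∣? (α +z β *z (+ 2 *z + 2)))
  where
  choose : Dec (+ p ∣z α +z β *z (+ 1 *z + 1)) → Dec (+ p ∣z α +z β *z (+ 2 *z + 2)) → ∃ λ t → ¬ + p ∣z t × ¬ + p ∣z α +z β *z (t *z t)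
  choose (no n₁) _ = + 1 , ∤-literal 1 z<s (prime>1 pp) , n₁
  choose (yes _) (no n₂) = + 2 , ∤-literal 2 z<s (<-trans (n<1+n 2) (<-trans (n<1+n 3) 4<p)) , n₂
  choose (yes d₁) (yes d₂) = contradiction (∣z-resp (ringz51 α β) (∣z-- d₂ d₁)) (∤-* pp (+ 3) β (∤-literal 3 z<s (<-trans (n<1+n 3) 4<p)) nβ)

 second-point : ∀ {p} → Prime p → 4 < p → ∀ α β c y t v → ¬ + p ∣z β → ¬ + p ∣z c → ¬ + p ∣z t →
  + p ∣z β *z (y *z y) -z c → + p ∣z (α +z β *z (t *z t)) *z v -z + 1 →
  Σ ℤ λ x → Σ ℤ λ y → ¬ + p ∣z x × + p ∣z α *z (x *z x) +z β *z (y *z y) -z c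
 second-point {p} pp 4<p α β c y t v nβ nc nt by² inv =
  -z (+ 2 *z β *z t *z v *z y) , y -z + 2 *z β *z (t *z t) *z v *z y , nx ,
  ∣z-resp (ringz104 α β c t v y) (∣z-+ (∣z-*ˡ (+ 4 *z (β *z β) *z (t *z t) *z v *z (y *z y)) inv) by²)
  where
  ny : ¬ + p ∣z y
  ny p∣y = nc (∣z-resp (ringz28 β c y) (∣z-- (∣z-*ˡ β (∣z-*ˡ y p∣y)) by²))
  nv : ¬ + p ∣z v
  nv p∣v = ∤-literal 1 z<s (prime>1 pp) (∣z-resp (ringz29 ((α +z β *z (t *z t)) *z v)) (∣z-- (∣z-*ˡ (α +z β *z (t *z t)) p∣v) inv))
  n₂ : ¬ + p ∣z + 2
  n₂ = ∤-literal 2 z<s (<-trans (n<1+n 2) (<-trans (n<1+n 3) 4<p))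
  nprod : ¬ + p ∣z + 2 *z β *z t *z v *z y
  nprod = ∤-* pp (+ 2 *z β *z t *z v) y (∤-* pp (+ 2 *z β *z t) v (∤-* pp (+ 2 *z β) t (∤-* pp (+ 2) β n₂ nβ) nt) nv) ny
  nx : ¬ + p ∣z -z (+ 2 *z β *z t *z v *z y)
  nx d = nprod (∣z-resp (ringz30 (+ 2 *z β *z t *z v *z y)) (∣z-- ∣z-0 d))

-- If the point found has x ≡ 0, take the second intersection of the conic with the line of direction (1, t) through it.
conic-x≢0 : ∀ {p} → Prime p → 4 < p → ∀ α β c → ¬ + p ∣z α → ¬ + p ∣z β → ¬ + p ∣z c →
 Σ ℤ λ x → Σ ℤ λ y → ¬ + p ∣z x × + p ∣z α *z (x *z x) +z β *z (y *z y) -z c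
conic-x≢0 {p} pp 4<p α β c nα nβ nc = start (odd-prime pp (<-trans (n<1+n 2) (<-trans (n<1+n 3) 4<p)))
 where
 Point : Set
 Point = Σ ℤ λ x → Σ ℤ λ y → ¬ + p ∣z x × + p ∣z α *z (x *z x) +z β *z (y *z y) -z c
 move : ∀ y → + p ∣z β *z (y *z y) -z c → (∃ λ t → ¬ + p ∣z t × ¬ + p ∣z α +z β *z (t *z t)) → Point
 move y by² (t , nt , nn) = let v , inv = inverse-mod-prime pp (α +z β *z (t *z t)) nn in second-point pp 4<p α β c y t v nβ nc nt by² inv
 check : ∀ x y → + p ∣z α *z (x *z x) +z β *z (y *z y) -z c → Dec (+ p ∣z x) → Point
 check x y on (no nx) = x , y , nx , on
 check x y on (yes p∣x) = move y (∣z-resp (ringz105 α β c x y) (∣z-- on (∣z-*ˡ α (∣z-*ˡ x p∣x)))) (slope pp 4<p α β nβ)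
 start : (∃ λ h → p ≡ 1 + 2 * h) → Point
 start (h , p≡) = let x , y , on = conic h pp p≡ α β c nα nβ in check x y on (+ p ℤ∣.∣? x)

square-diff : ∀ {n} a b → n ∣z a -z b → n ∣z a *z a -z b *z b
square-diff a b h = ∣z-resp (ringz106 a b) (∣z-*ˡ (a +z b) h)

small-root : ∀ {p} h → p ≡ 1 + 2 * h → ∀ r → ∃ λ ρ → ρ ≤ h × + p ∣z + ρ *z + ρ -z r *z r
small-root {p} h p≡ r = go (residue p {{nz}} r)
 where
 nz : NonZero p
 nz = >-nonZero (≤-trans z<s (≤-reflexive (sym p≡)))
 go : (∃ λ a → a < p × + p ∣z r -z + a) → ∃ λ ρ → ρ ≤ h × + p ∣z + ρ *z + ρ -z r *z r
 go (a , a<p , d) with a ≤? h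
 ... | yes a≤h = a , a≤h , ∣z-resp (ringz11 (r *z r) (+ a *z + a)) (∣z-- ∣z-0 (square-diff r (+ a) d))
 ... | no a≰h = p ∸ a , p∸a≤h , subst (λ v → + p ∣z v *z v -z r *z r) (-z-≥ (<⇒≤ a<p))
    (∣z-resp (sym (ringz107 (+ p) (+ a) r)) (∣z-- (∣z-*ˡ (+ p -z + 2 *z + a) (dividesz (+ 1) (sym (ℤₚ.*-identityˡ (+ p))))) (square-diff r (+ a) d)))
  where
  p∸a≤h : p ∸ a ≤ h
  p∸a≤h = m≤n+o⇒m∸n≤o p a (≤-trans (≤-reflexive (trans p≡ (cong (λ v → suc (h + v)) (+-identityʳ h)))) (+-monoˡ-≤ h (≰⇒> a≰h)))

-- Up to sign every square root has a representative at most h, where p = 2h + 1; so p residues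
-- would share h + 1 < p roots.
not-all-squares : ∀ {p} → Prime p → 2 < p → ¬ (∀ n → ∃ λ r → + p ∣z r *z r -z + n)
not-all-squares {p} pp 2<p sq = start (odd-prime pp 2<p)
 where
 start : (∃ λ h → p ≡ 1 + 2 * h) → ⊥
 start (h , p≡) = collide (Finₚ.pigeonhole h+1<p (λ n → fromℕ< (s≤s (proj₁ (proj₂ (ρ (toℕ n)))))))
  where
  ρ : ∀ n → ∃ λ ρ → ρ ≤ h × + p ∣z + ρ *z + ρ -z proj₁ (sq n) *z proj₁ (sq n)
  ρ n = small-root h p≡ (proj₁ (sq n))
  1≤h : 1 ≤ h
  1≤h = *-cancelˡ-< 2 0 h (s≤s⁻¹ (≤-trans (≤-trans (n≤1+n 2) 2<p) (≤-reflexive p≡)))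
  h+1<p : suc h < p
  h+1<p = ≤-trans (s≤s (≤-trans (≤-reflexive (+-comm 1 h)) (+-monoʳ-≤ h (≤-trans 1≤h (m≤m+n h 0))))) (≤-reflexive (sym p≡))
  collide : (Σ (Fin p) λ i → Σ (Fin p) λ j → toℕ i < toℕ j × fromℕ< (s≤s (proj₁ (proj₂ (ρ (toℕ i))))) ≡ fromℕ< (s≤s (proj₁ (proj₂ (ρ (toℕ j)))))) → ⊥
  collide (i , j , i<j , eq) = small-∤ (m<n⇒0<n∸m i<j) (≤-<-trans (m∸n≤m (toℕ j) (toℕ i)) (Finₚ.toℕ<n j))
   (∣z⇒∣ (∣z-resp (trans (ringz108 (+ ri *z + ri) (proj₁ (sq (toℕ i)) *z proj₁ (sq (toℕ i))) (proj₁ (sq (toℕ j)) *z proj₁ (sq (toℕ j))) (+ toℕ i) (+ toℕ j)) (-z-≥ (<⇒≤ i<j)))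
    (∣z-- (∣z-+ (proj₂ (sq (toℕ i))) (proj₂ (proj₂ (ρ (toℕ i)))))
       (∣z-+ (proj₂ (sq (toℕ j))) (subst (λ v → + p ∣z + v *z + v -z proj₁ (sq (toℕ j)) *z proj₁ (sq (toℕ j))) (sym ri≡) (proj₂ (proj₂ (ρ (toℕ j)))))))))
   where
   ri = proj₁ (ρ (toℕ i))
   ri≡ : ri ≡ proj₁ (ρ (toℕ j))
   ri≡ = trans (sym (Finₚ.toℕ-fromℕ< _)) (trans (cong toℕ eq) (Finₚ.toℕ-fromℕ< _))

-- −ℓ(4s² + 1), up to sign: the discriminant of the binary form (4s² + 1) u² + ℓ z².
disc : ℤ → ℤ → ℤ → ℤ
disc ℓ s t = t *z t +z ℓ *z (+ 4 *z (s *z s) +z + 1)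

disc-cong : ∀ {n} ℓ s s' t t' → n ∣z s -z s' → n ∣z t -z t' → n ∣z disc ℓ s t → n ∣z disc ℓ s' t'
disc-cong ℓ s s' t t' ds dt h = ∣z-resp (ringz109 ℓ s s' t t') (∣z-- h (∣z-+ (square-diff t t' dt) (∣z-*ˡ (ℓ *z + 4) (square-diff s s' ds))))

Nonsplit : ℤ → ℕ → ℤ → Set
Nonsplit ℓ p s = ∀ t → ¬ + p ∣z disc ℓ s t

-- Otherwise −ℓ would be a square t₀², and then r² + 1 a square for every r, so everything would be a square.
nonsplit : ∀ {p} → Prime p → 2 < p → ∀ ℓ → ¬ + p ∣z ℓ → ∃ (Nonsplit ℓ p)
nonsplit {p} pp 2<p ℓ nℓ = decide (Finₚ.any? (λ s → Finₚ.all? (λ t → ¬? (+ p ℤ∣.∣? disc ℓ (+ toℕ {p} s) (+ toℕ {p} t)))))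
 where
 instance
  p≢0 : NonZero p
  p≢0 = prime⇒nonZero pp
 same : ∀ {n} x → n ∣z x -z x
 same x = ∣z-resp (sym (ℤₚ.+-inverseʳ x)) ∣z-0
 decide : Dec (Σ (Fin p) λ s → ∀ t → ¬ + p ∣z disc ℓ (+ toℕ s) (+ toℕ {p} t)) → ∃ (Nonsplit ℓ p)
 decide (yes (s , h)) = + toℕ s , λ t d → let r , r<p , dr = residue p t in
  h (fromℕ< r<p) (subst (λ v → + p ∣z disc ℓ (+ toℕ s) (+ v)) (sym (Finₚ.toℕ-fromℕ< r<p)) (disc-cong ℓ (+ toℕ s) (+ toℕ s) t (+ r) (same (+ toℕ s)) dr d))
 decide (no ¬h) = ⊥-elim (not-all-squares pp 2<p squares)
  where
  root-fin : ∀ (s : Fin p) → ∃ λ t → + p ∣z disc ℓ (+ toℕ s) t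
  root-fin s = let t , nn = Finₚ.¬∀⟶∃¬ p _ (λ t → ¬? (+ p ℤ∣.∣? disc ℓ (+ toℕ s) (+ toℕ {p} t))) (λ h → ¬h (s , h)) in
   + toℕ t , decidable-stable (+ p ℤ∣.∣? disc ℓ (+ toℕ s) (+ toℕ {p} t)) nn
  root : ∀ s → ∃ λ t → + p ∣z disc ℓ s t
  root s = let r , r<p , dr = residue p s ; t , d = root-fin (fromℕ< r<p) in
   t , disc-cong ℓ (+ r) s t t (∣z-resp (ringz11 s (+ r)) (∣z-- ∣z-0 dr)) (same t) (subst (λ v → + p ∣z disc ℓ (+ v) t) (Finₚ.toℕ-fromℕ< r<p) d)
  t₀ : ℤ
  t₀ = proj₁ (root 0ℤ)
  d₀ : + p ∣z t₀ *z t₀ +z ℓ *z (+ 4 *z (0ℤ *z 0ℤ) +z + 1)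
  d₀ = proj₂ (root 0ℤ)
  nt₀ : ¬ + p ∣z t₀
  nt₀ d = nℓ (∣z-resp (ringz31 ℓ t₀) (∣z-- d₀ (∣z-*ˡ t₀ d)))
  squares : ∀ n → ∃ λ r → + p ∣z r *z r -z + n
  squares zero = 0ℤ , ∣z-0
  -- If n ≡ r², apply `root` to r / 2: then t² ≡ -ℓ (r² + 1), while t₀² ≡ -ℓ, so n + 1 ≡ r² + 1 ≡ (t
  -- / t₀)². Here c is the inverse of 2 and v that of t₀.
  squares (suc n) = step (squares n) (inverse-mod-prime pp (+ 2) (∤-literal 2 z<s 2<p)) (inverse-mod-prime pp t₀ nt₀)
   where
   step : (∃ λ r → + p ∣z r *z r -z + n) → (∃ λ c → + p ∣z + 2 *z c -z + 1) → (∃ λ v → + p ∣z t₀ *z v -z + 1) → ∃ λ r → + p ∣z r *z r -z + suc n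
   step (r , dr) (c , dc) (v , dv) = t *z v ,
     ∣z-resp (ringz32 ℓ r (+ n) c v t₀ t) (∣z-+ (∣z-+ (∣z-+
      (∣z-*ˡ (v *z v) (∣z-- dt (∣z-*ʳ (+ 4 *z ((r *z c) *z (r *z c)) +z + 1) d₀)))
      (∣z-*ˡ ((t₀ *z v) *z (t₀ *z v)) (∣z-*ˡ (r *z r) (square-diff (+ 2 *z c) (+ 1) dc))))
      (∣z-*ˡ (r *z r +z + 1) (square-diff (t₀ *z v) (+ 1) dv))) dr)
    where
    t : ℤ
    t = proj₁ (root (r *z c))
    dt : + p ∣z t *z t +z ℓ *z (+ 4 *z ((r *z c) *z (r *z c)) +z + 1)
    dt = proj₂ (root (r *z c))

-- Descent: with 0 ≤ a < n even, the cofactor of n in a² + 1 is again ≡ 3 (mod 4), and smaller.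
-1-nonsquare : ∀ n → n % 4 ≡ 3 → ∀ a → ¬ n ∣ a * a + 1
-1-nonsquare = <-rec (λ n → n % 4 ≡ 3 → ∀ a → ¬ n ∣ a * a + 1) step
 where
 mod4 : ∀ n → n % 4 ≡ 3 → n ≡ 3 + n / 4 * 4
 mod4 n eq = trans (m≡m%n+[m/n]*n n 4) (cong (_+ n / 4 * 4) eq)
 cofactor : ∀ n q b → n % 4 ≡ 3 → q * n ≡ 1 + b * 4 → q % 4 ≡ 3
 cofactor n q b n≡ eq = three (q % 4) (m%n<n q 4) (begin
  (q % 4 * 3) % 4 ≡⟨ cong (λ v → (q % 4 * v) % 4) (sym n≡) ⟩
  (q % 4 * (n % 4)) % 4 ≡⟨ sym (%-distribˡ-* q n 4) ⟩
  (q * n) % 4 ≡⟨ cong (_% 4) eq ⟩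
  (1 + b * 4) % 4 ≡⟨ [m+kn]%n≡m%n 1 b 4 ⟩
  1 ∎)
  where
  open ≡-Reasoning
  three : ∀ r → r < 4 → (r * 3) % 4 ≡ 1 → r ≡ 3
  three 0 _ ()
  three 1 _ ()
  three 2 _ ()
  three 3 _ _ = refl
  three (suc (suc (suc (suc r)))) (s≤s (s≤s (s≤s (s≤s ())))) _
 step : ∀ n → (∀ {m} → m < n → m % 4 ≡ 3 → ∀ a → ¬ m ∣ a * a + 1) → n % 4 ≡ 3 → ∀ a → ¬ n ∣ a * a + 1
 step n rec n≡ a h = parity-case (a % n) (m%n<n a n) reduce
  where
  n≡₄ = mod4 n n≡
  instance
   n≢0 : NonZero n
   n≢0 = >-nonZero (≤-trans z<s (≤-reflexive (sym n≡₄)))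
  1<n : 1 < n
  1<n = ≤-trans (s≤s z<s) (≤-reflexive (sym n≡₄))
  reduce : n ∣ (a % n) * (a % n) + 1
  reduce = ∣z⇒∣ (∣z-resp eq (∣z-- (∣⇒∣z h) (square-diff (+ a) (+ (a % n)) (dividesz (+ (a / n)) quot))))
   where
   open ≡-Reasoning
   eq : + (a * a + 1) -z (+ a *z + a -z + (a % n) *z + (a % n)) ≡ + ((a % n) * (a % n) + 1)
   eq = trans (cong (λ v → (v +z + 1) -z (+ a *z + a -z + (a % n) *z + (a % n))) (cast-* a a))
       (trans (ringz33 (+ a *z + a) (+ (a % n) *z + (a % n))) (cong (_+z + 1) (sym (cast-* (a % n) (a % n)))))
   quot : + a -z + (a % n) ≡ + (a / n) *z + n
   quot = trans (cong (λ v → + v -z + (a % n)) (m≡m%n+[m/n]*n a n)) (trans (ringz12 (+ (a % n)) (+ (a / n * n))) (cast-* (a / n) n))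
  even-case : ∀ b → 2 * b < n → ¬ n ∣ 2 * b * (2 * b) + 1
  even-case b 2b<n (divides q eq) = rec q<n (cofactor n q (b * b) n≡ (trans (sym eq) (ring58 b))) (2 * b) (divides n (trans eq (*-comm q n)))
   where
   q<n : q < n
   q<n = *-cancelʳ-< n q n (≤-<-trans (≤-reflexive (sym eq)) square<)
    where
    open ≤-Reasoning
    square< : 2 * b * (2 * b) + 1 < n * n
    square< = begin-strict
     2 * b * (2 * b) + 1 ≤⟨ +-monoˡ-≤ 1 (*-monoʳ-≤ (2 * b) (<⇒≤ 2b<n)) ⟩
     2 * b * n + 1 <⟨ +-monoʳ-< (2 * b * n) 1<n ⟩
     2 * b * n + n ≡⟨ +-comm (2 * b * n) n ⟩
     suc (2 * b) * n ≤⟨ *-monoˡ-≤ n 2b<n ⟩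
     n * n ∎
  halves : ∀ r → (∃ λ b → r ≡ 2 * b) ⊎ (∃ λ b → r ≡ 1 + 2 * b)
  halves zero = inj₁ (0 , refl)
  halves (suc r) with halves r
  ... | inj₁ (b , e) = inj₂ (b , cong suc e)
  ... | inj₂ (b , e) = inj₁ (suc b , trans (cong suc e) (ring59 b))
  parity-case : ∀ r → r < n → ¬ n ∣ r * r + 1
  parity-case r r<n d with halves r
  ... | inj₁ (b , refl) = even-case b r<n d
  -- As n is odd, an odd residue r is replaced by the even number n - r, whose square is the same
  -- modulo n.
  ... | inj₂ (b , refl) = even-case c (≤-<-trans (≤-reflexive 2c≡) (∸-monoʳ-< z<s (<⇒≤ r<n))) (subst (λ v → n ∣ v * v + 1) (sym 2c≡) flipped)
   where
   c = 1 + n / 4 * 2 ∸ b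
   b≤ : b ≤ 1 + n / 4 * 2
   b≤ = *-cancelˡ-≤ 2 (s≤s⁻¹ (≤-trans (<⇒≤ r<n) (≤-reflexive (trans n≡₄ (ring28 (n / 4))))))
   2c≡ : 2 * c ≡ n ∸ (1 + 2 * b)
   2c≡ = begin
    2 * (1 + n / 4 * 2 ∸ b) ≡⟨ *-distribˡ-∸ 2 (1 + n / 4 * 2) b ⟩
    2 * (1 + n / 4 * 2) ∸ 2 * b ≡⟨⟩
    suc (2 * (1 + n / 4 * 2)) ∸ suc (2 * b) ≡⟨ cong (_∸ suc (2 * b)) (sym (trans n≡₄ (ring28 (n / 4)))) ⟩
    n ∸ (1 + 2 * b) ∎
    where
    open ≡-Reasoning
   flipped : n ∣ (n ∸ (1 + 2 * b)) * (n ∸ (1 + 2 * b)) + 1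
   flipped = ∣z⇒∣ (∣z-resp eq (∣z-+ (∣⇒∣z d) (∣z-*ʳ (+ n -z + 2 *z + r) (dividesz (+ 1) (sym (ℤₚ.*-identityˡ (+ n)))))))
    where
    eq : + (r * r + 1) +z + n *z (+ n -z + 2 *z + r) ≡ + ((n ∸ r) * (n ∸ r) + 1)
    eq = trans (cong (λ v → (v +z + 1) +z + n *z (+ n -z + 2 *z + r)) (cast-* r r))
        (trans (ringz9 (+ n) (+ r)) (cong (_+z + 1) (trans (cong₂ _*z_ (-z-≥ (<⇒≤ r<n)) (-z-≥ (<⇒≤ r<n))) (sym (cast-* (n ∸ r) (n ∸ r))))))

sum-of-squares : ∀ {p} → Prime p → p % 4 ≡ 3 → ∀ x y → + p ∣z x *z x +z y *z y → + p ∣z x × + p ∣z y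
sum-of-squares {p} pp p≡ x y h = p∣ x y h , p∣ y x (∣z-resp (ℤₚ.+-comm (x *z x) (y *z y)) h)
 where
 abs² : ∀ a → + (abs a * abs a) ≡ a *z a
 abs² (+ n) = cast-* n n
 abs² ℤ.-[1+ n ] = refl
 p∣ : ∀ x y → + p ∣z x *z x +z y *z y → + p ∣z x
 p∣ x y h = decidable-stable (+ p ℤ∣.∣? x) (λ nx → let v , dv = inverse-mod-prime pp x nx in
  -1-nonsquare p p≡ (abs (y *z v)) (∣z⇒∣ (∣z-resp (trans (ringz110 x y v) (cong (_+z + 1) (sym (abs² (y *z v)))))
   (∣z-- (∣z-*ʳ (v *z v) h) (square-diff (x *z v) (+ 1) dv)))))

-- Primes congruent to 3 modulo 4

prime-divisor : ∀ n → 1 < n → ∃ λ p → Prime p × p ∣ n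
prime-divisor = <-rec (λ n → 1 < n → ∃ λ p → Prime p × p ∣ n) step
 where
 step : ∀ n → (∀ {m} → m < n → 1 < m → ∃ λ p → Prime p × p ∣ m) → 1 < n → ∃ λ p → Prime p × p ∣ n
 step n rec 1<n with prime? n
 ... | yes pn = n , pn , ∣-refl
 ... | no ¬pn with ¬prime⇒composite {{n>1⇒nonTrivial 1<n}} ¬pn
 ... | composite {d} d<n d∣n with rec d<n (nonTrivial⇒n>1 d)
 ... | p , pp , p∣d = p , pp , ∣-trans p∣d d∣n

prime-3mod4-divisor : ∀ n → n % 4 ≡ 3 → ∃ λ p → Prime p × p % 4 ≡ 3 × p ∣ n
prime-3mod4-divisor = <-rec (λ n → n % 4 ≡ 3 → ∃ λ p → Prime p × p % 4 ≡ 3 × p ∣ n) step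
 where
 factor : ∀ a b → a < 4 → b < 4 → (a * b) % 4 ≡ 3 → a ≡ 3 ⊎ b ≡ 3
 factor 3 _ _ _ _ = inj₁ refl
 factor 0 _ _ _ ()
 factor 1 3 _ _ _ = inj₂ refl
 factor 2 3 _ _ ()
 factor 1 0 _ _ ()
 factor 1 1 _ _ ()
 factor 1 2 _ _ ()
 factor 2 0 _ _ ()
 factor 2 1 _ _ ()
 factor 2 2 _ _ ()
 factor _ (suc (suc (suc (suc b)))) _ (s≤s (s≤s (s≤s (s≤s ())))) _
 factor (suc (suc (suc (suc a)))) _ (s≤s (s≤s (s≤s (s≤s ())))) _ _
 step : ∀ n → (∀ {m} → m < n → m % 4 ≡ 3 → ∃ λ p → Prime p × p % 4 ≡ 3 × p ∣ m) → n % 4 ≡ 3 → ∃ λ p → Prime p × p % 4 ≡ 3 × p ∣ n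
 step n rec n≡ with prime? n
 ... | yes pn = n , pn , n≡ , ∣-refl
 ... | no ¬pn with ¬prime⇒composite {{n>1⇒nonTrivial 1<n}} ¬pn
  where
  1<n : 1 < n
  1<n = ≤-trans (s≤s z<s) (≤-trans (≤-reflexive (sym n≡)) (m%n≤m n 4))
 ... | composite {d} d<n (divides q eq) with factor (q % 4) (d % 4) (m%n<n q 4) (m%n<n d 4)
                        (trans (sym (%-distribˡ-* q d 4)) (trans (cong (_% 4) (sym eq)) n≡))
 ... | inj₂ d≡ = let p , pp , p≡ , p∣d = rec d<n d≡ in p , pp , p≡ , ∣-trans p∣d (divides q eq)
 ... | inj₁ q≡ = let p , pp , p≡ , p∣q = rec q<n q≡ in p , pp , p≡ , ∣-trans p∣q (divides d (trans eq (*-comm q d)))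
  where
  q>0 : 0 < q
  q>0 = ≤-trans z<s (≤-trans (≤-reflexive (sym q≡)) (m%n≤m q 4))
  q<n : q < n
  q<n = subst (q <_) (sym eq) (m<m*n q d {{>-nonZero q>0}} (nonTrivial⇒n>1 d))

primes-3mod4 : ∀ B → ∃ λ p → Prime p × p % 4 ≡ 3 × B < p
primes-3mod4 B = found (prime-3mod4-divisor (3 + (B ! ∸ 1) * 4) ([m+kn]%n≡m%n 3 (B ! ∸ 1) 4))
 where
 -- This is 4 · B! - 1, written so that its residue modulo 4 is visible; a prime up to B dividing it
 -- would divide 1.
 N = 3 + (B ! ∸ 1) * 4
 B!>0 : 0 < B !
 B!>0 = n≢0⇒n>0 (≢-nonZero⁻¹ (B !) {{B !≢0}})
 N+1≡ : N + 1 ≡ 4 * B !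
 N+1≡ = trans (ring122 (B ! ∸ 1)) (cong (4 *_) (m+[n∸m]≡n B!>0))
 found : (∃ λ p → Prime p × p % 4 ≡ 3 × p ∣ N) → ∃ λ p → Prime p × p % 4 ≡ 3 × B < p
 found (p , pp , p≡ , p∣N) = p , pp , p≡ , ≰⇒> (λ p≤B → <⇒≢ (prime>1 pp) (sym (∣1⇒≡1 (∣m+n∣m⇒∣n (subst (p ∣_) (sym N+1≡) (∣n⇒∣m*n 4 (∣-trans (p∣p! (prime>1 pp)) (m≤n⇒m!∣n! p≤B)))) p∣N))))
  where
  p∣p! : ∀ {n} → 1 < n → n ∣ n !
  p∣p! {suc n} _ = m∣m*n (n !)

coprime-product-∣ : ∀ {m n k} → Coprime m n → m ∣ k → n ∣ k → m * n ∣ k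
coprime-product-∣ {m} {n} {k} c (divides q eq) n∣k with coprime-divisor {n} {m} {q} (Coprimality.sym c) (subst (n ∣_) (trans eq (*-comm q m)) n∣k)
... | divides r eq' = divides r (trans eq (trans (cong (_* m) eq') (trans (*-assoc r n m) (cong (r *_) (*-comm n m)))))

coprime-product-∣z : ∀ {m n a} → Coprime m n → + m ∣z a → + n ∣z a → + (m * n) ∣z a
coprime-product-∣z c p q = ℤ∣.∣ᵤ⇒∣ (coprime-product-∣ c (ℤ∣.∣⇒∣ᵤ p) (ℤ∣.∣⇒∣ᵤ q))

-- Squarefree moduli

Squarefree : ℕ → Set
Squarefree P = ∀ p → Prime p → ¬ p * p ∣ P

-- The common frame of all passages from primes to P by the Chinese remainder theorem: a prime
-- factor p is split off from e, and squarefreeness makes it coprime to the cofactor.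
squarefree-induction : ∀ {P} → 0 < P → Squarefree P → (X : ℕ → Set) → X 1 →
 (∀ p e → Prime p → p * e ∣ P → Coprime p e → X e → X (p * e)) → ∀ e → e ∣ P → X e
squarefree-induction {P} P>0 sqf X X1 Xp = <-rec (λ e → e ∣ P → X e) step
 where
 step : ∀ e → (∀ {d} → d < e → d ∣ P → X d) → e ∣ P → X e
 step zero rec 0∣P = contradiction (0∣⇒≡0 0∣P) (>⇒≢ P>0)
 step (suc zero) rec _ = X1
 step e@(suc (suc _)) rec e∣P with prime-divisor e (s≤s z<s)
 ... | p , pp , divides q eq = subst X (sym e≡) (Xp p q pp (subst (_∣ P) e≡ e∣P) cop (rec q<e (∣-trans (divides p e≡) e∣P)))
  where
  e≡ : e ≡ p * q
  e≡ = trans eq (*-comm q p)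
  q>0 : 0 < q
  q>0 = n≢0⇒n>0 (λ { refl → 1+n≢0 eq })
  q<e : q < e
  q<e = subst (q <_) (sym eq) (m<m*n q p {{>-nonZero q>0}} (prime>1 pp))
  cop : Coprime p q
  cop = prime-coprime pp (λ p∣q → sqf p pp (∣-trans (*-monoʳ-∣ p p∣q) (subst (_∣ P) e≡ e∣P)))

nonsplit-all : ∀ {P} → 0 < P → Squarefree P → ∀ ℓ → (∀ p → Prime p → p ∣ P → 2 < p × ¬ + p ∣z ℓ) →
 ∃ λ s → ∀ p → Prime p → p ∣ P → Nonsplit ℓ p s
nonsplit-all {P} P>0 sqf ℓ hyp = squarefree-induction P>0 sqf (λ e → ∃ λ s → ∀ p → Prime p → p ∣ e → Nonsplit ℓ p s)
 (0ℤ , λ p pp p∣1 → contradiction (∣1⇒≡1 p∣1) (>⇒≢ (prime>1 pp))) step P ∣-refl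
 where
 same : ∀ {n} x → n ∣z x -z x
 same x = ∣z-resp (sym (ℤₚ.+-inverseʳ x)) ∣z-0
 step : ∀ p e → Prime p → p * e ∣ P → Coprime p e → (∃ λ s → ∀ p → Prime p → p ∣ e → Nonsplit ℓ p s) → ∃ λ s → ∀ q → Prime q → q ∣ p * e → Nonsplit ℓ q s
 step p e pp pe∣P cop (sₑ , hₑ) = combine (nonsplit pp (proj₁ (hyp p pp p∣P)) ℓ (proj₂ (hyp p pp p∣P)))
  where
  p∣P : p ∣ P
  p∣P = ∣-trans (m∣m*n e) pe∣P
  combine : ∃ (Nonsplit ℓ p) → ∃ λ s → ∀ q → Prime q → q ∣ p * e → Nonsplit ℓ q s
  combine (sₚ , hₚ) = glue (crt p e cop sₚ sₑ)
   where
   glue : (∃ λ s → + p ∣z s -z sₚ × + e ∣z s -z sₑ) → ∃ λ s → ∀ q → Prime q → q ∣ p * e → Nonsplit ℓ q s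
   glue (s , dp , de) = s , λ q qq q∣ t d → here q qq t d (euclidsLemma p e qq q∣)
    where
    here : ∀ q → Prime q → ∀ t → + q ∣z disc ℓ s t → q ∣ p ⊎ q ∣ e → ⊥
    here q qq t d (inj₁ q∣p) with prime⇒irreducible pp q∣p
    ... | inj₁ q≡1 = >⇒≢ (prime>1 qq) q≡1
    ... | inj₂ refl = hₚ t (disc-cong ℓ s sₚ t t dp (same t) d)
    here q qq t d (inj₂ q∣e) = hₑ q qq q∣e t (disc-cong ℓ s sₑ t t (∣z-trans (∣⇒∣z q∣e) de) (same t) d)

Nonsplit⇒∤ℓ : ∀ {p} ℓ s → Nonsplit ℓ p s → ¬ + p ∣z ℓ
Nonsplit⇒∤ℓ ℓ s h d = h 0ℤ (∣z-resp (ringz111 ℓ s) (∣z-*ʳ (+ 4 *z (s *z s) +z + 1) d))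

Nonsplit⇒∤α : ∀ {p} ℓ s → Nonsplit ℓ p s → ¬ + p ∣z + 4 *z (s *z s) +z + 1
Nonsplit⇒∤α ℓ s h d = h 0ℤ (∣z-resp (ringz111 ℓ s) (∣z-*ˡ ℓ d))

Anisotropic : ℤ → ℤ → ℕ → Set
Anisotropic α β n = ∀ u z → + n ∣z α *z (u *z u) +z β *z (z *z z) → + n ∣z u × + n ∣z z

-- If p did not divide u, then β z / u would be a square root of -α β modulo p, against the
-- hypothesis on t; once p divides u, it divides β z².
anisotropic-prime : ∀ {p} → Prime p → ∀ α β → ¬ + p ∣z β → (∀ t → ¬ + p ∣z t *z t +z β *z α) → Anisotropic α β p
anisotropic-prime {p} pp α β nβ h u z d = p∣u , p∣z
 where
 p∣u : + p ∣z u
 p∣u = decidable-stable (+ p ℤ∣.∣? u) (λ nu → let v , dv = inverse-mod-prime pp u nu in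
  h (β *z z *z v) (∣z-resp (ringz112 α β u z v) (∣z-- (∣z-*ˡ (β *z (v *z v)) d) (∣z-*ˡ (β *z α) (square-diff (u *z v) (+ 1) dv)))))
 p∣z : + p ∣z z
 p∣z = decidable-stable (+ p ℤ∣.∣? z) (λ nz → ∤-* pp β (z *z z) nβ (∤-* pp z z nz nz) (∣z-resp (ringz113 α β u z) (∣z-- d (∣z-*ˡ α (∣z-*ˡ u p∣u)))))

anisotropic-all : ∀ {P} → 0 < P → Squarefree P → ∀ α β → (∀ p → Prime p → p ∣ P → Anisotropic α β p) → ∀ e → e ∣ P → Anisotropic α β e
anisotropic-all {P} P>0 sqf α β hyp = squarefree-induction P>0 sqf (Anisotropic α β)
 (λ u z _ → dividesz u (sym (ℤₚ.*-identityʳ u)) , dividesz z (sym (ℤₚ.*-identityʳ z)))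
 (λ p e pp pe∣P cop ani u z d →
  let a , b = hyp p pp (∣-trans (m∣m*n e) pe∣P) u z (∣z-trans (∣⇒∣z (m∣m*n e)) d) ; a' , b' = ani u z (∣z-trans (∣⇒∣z (n∣m*n p)) d) in coprime-product-∣z cop a a' , coprime-product-∣z cop b b')

Fz : ℤ → ℤ → ℤ → ℤ → ℤ → ℤ
Fz A K x y z = A *z (x *z x) +z y *z y +z y *z z +z K *z (z *z z)

-- Completing the square in y: the binary form y² + y z + K z² has discriminant 1 - 4K = -ℓ, so with
-- u = 2y + z it is (u² + ℓ z²) / 4.
four-F : ∀ A K ℓ → + 4 *z K ≡ + 1 +z ℓ → ∀ x y z →
 + 4 *z Fz A K x y z ≡ + 4 *z (A *z (x *z x)) +z (+ 2 *z y +z z) *z (+ 2 *z y +z z) +z ℓ *z (z *z z)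
four-F A K ℓ eq x y z = trans (ringz114 A K x y z) (trans (cong (λ k → + 4 *z (A *z (x *z x)) +z (+ 4 *z (y *z y) +z + 4 *z (y *z z)) +z k *z (z *z z)) eq) (ringz115 A ℓ x y z))

F-cong : ∀ {n} A K x x' y y' z z' → n ∣z x -z x' → n ∣z y -z y' → n ∣z z -z z' → n ∣z Fz A K x y z -z Fz A K x' y' z'
F-cong A K x x' y y' z z' dx dy dz = ∣z-resp (ringz116 A K x x' y y' z z')
 (∣z-+ (∣z-+ (∣z-*ˡ (A *z (x +z x')) dx) (∣z-*ˡ (y +z y' +z z) dy)) (∣z-*ˡ (y' +z K *z (z +z z')) dz))

-- Solutions modulo N of F = m whose partial derivative 2y + z is a unit, with x ≡ s (e y + z) modulo D.
record Local (A K s e m : ℤ) (N D : ℕ) : Set where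
 constructor local
 field
  x y z : ℤ
  value : + N ∣z Fz A K x y z -z m
  unit : Coprime N (abs (+ 2 *z y +z z))
  plane : + D ∣z x -z s *z (e *z y +z z)

coprime-congz : ∀ {n} a b → + n ∣z a -z b → Coprime n (abs b) → Coprime n (abs a)
coprime-congz {n} a b d c {k} (k∣n , k∣a) = c (k∣n , ℤ∣.∣⇒∣ᵤ (∣z-resp (ringz117 a b) (∣z-- (ℤ∣.∣ᵤ⇒∣ {+ k} {a} k∣a) (∣z-trans (∣⇒∣z k∣n) d))))

local-transport : ∀ {A K s e m N D} → D ∣ N → (S : Local A K s e m N D) → ∀ x y z →
 + N ∣z x -z Local.x S → + N ∣z y -z Local.y S → + N ∣z z -z Local.z S →
 + N ∣z Fz A K x y z -z m × Coprime N (abs (+ 2 *z y +z z)) × + D ∣z x -z s *z (e *z y +z z)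
local-transport {A} {K} {s} {e} {m} {N} {D} D∣N (local x₀ y₀ z₀ value unit plane) x y z dx dy dz =
 (∣z-resp (ringz13 (Fz A K x y z) (Fz A K x₀ y₀ z₀) m) (∣z-+ (F-cong A K x x₀ y y₀ z z₀ dx dy dz) value)) ,
 (coprime-congz (+ 2 *z y +z z) (+ 2 *z y₀ +z z₀) (∣z-resp (ringz118 y y₀ z z₀) (∣z-+ (∣z-*ˡ (+ 2) dy) dz)) unit) ,
 (∣z-resp (ringz14 s e x x₀ y y₀ z z₀) (∣z-+ (∣z-- (∣z-trans D∣zN dx) (∣z-*ˡ s (∣z-+ (∣z-*ˡ e (∣z-trans D∣zN dy)) (∣z-trans D∣zN dz)))) plane))
 where
 D∣zN = ∣⇒∣z D∣N

coprime-*ˡ : ∀ {m n k} → Coprime m k → Coprime n k → Coprime (m * n) k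
coprime-*ˡ a b = Coprimality.sym (coprime-*ʳ (Coprimality.sym a) (Coprimality.sym b))

local-* : ∀ {A K s e m N₁ N₂ D₁ D₂} → Coprime N₁ N₂ → D₁ ∣ N₁ → D₂ ∣ N₂ →
 Local A K s e m N₁ D₁ → Local A K s e m N₂ D₂ → Local A K s e m (N₁ * N₂) (D₁ * D₂)
local-* {A} {K} {s} {e} {m} {N₁} {N₂} {D₁} {D₂} cop d₁ d₂ S₁ S₂ =
 glue (crt N₁ N₂ cop (Local.x S₁) (Local.x S₂)) (crt N₁ N₂ cop (Local.y S₁) (Local.y S₂)) (crt N₁ N₂ cop (Local.z S₁) (Local.z S₂))
 where
 glue : (∃ λ x → + N₁ ∣z x -z Local.x S₁ × + N₂ ∣z x -z Local.x S₂) → (∃ λ y → + N₁ ∣z y -z Local.y S₁ × + N₂ ∣z y -z Local.y S₂) →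
  (∃ λ z → + N₁ ∣z z -z Local.z S₁ × + N₂ ∣z z -z Local.z S₂) → Local A K s e m (N₁ * N₂) (D₁ * D₂)
 glue (x , x₁ , x₂) (y , y₁ , y₂) (z , z₁ , z₂) =
  join (local-transport d₁ S₁ x y z x₁ y₁ z₁) (local-transport d₂ S₂ x y z x₂ y₂ z₂)
  where
  V U : ℤ
  V = Fz A K x y z -z m
  U = x -z s *z (e *z y +z z)
  join : + N₁ ∣z V × Coprime N₁ (abs (+ 2 *z y +z z)) × + D₁ ∣z U →
      + N₂ ∣z V × Coprime N₂ (abs (+ 2 *z y +z z)) × + D₂ ∣z U → Local A K s e m (N₁ * N₂) (D₁ * D₂)
  join (v₁ , u₁ , p₁) (v₂ , u₂ , p₂) = local x y z (coprime-product-∣z {N₁} {N₂} {V} cop v₁ v₂)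
   (coprime-*ˡ {N₁} {N₂} {abs (+ 2 *z y +z z)} u₁ u₂)
   (coprime-product-∣z {D₁} {D₂} {U} (coprime-∣ˡ {D₁} {N₁} {D₂} d₁ (coprime-∣ʳ {D₂} {N₁} {N₂} d₂ cop)) p₁ p₂)

private
 local-odd-value : ∀ {q} → Prime q → 2 < q → ∀ A K ℓ → + 4 *z K ≡ + 1 +z ℓ → ∀ m x u y z → + q ∣z (+ 2 *z y +z z) -z u →
  + q ∣z + 4 *z (A *z (x *z x)) +z u *z u +z ℓ *z (z *z z) -z + 4 *z m → + q ∣z Fz A K x y z -z m
 local-odd-value {q} qq 2<q A K ℓ 4K m x u y z du h = cancel4 (euclid qq (+ 4) (Fz A K x y z -z m) four)
  where
  n₂ : ¬ + q ∣z + 2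
  n₂ = ∤-literal 2 z<s 2<q
  four : + q ∣z + 4 *z (Fz A K x y z -z m)
  four = ∣z-resp (trans (ringz52 (+ 4 *z (A *z (x *z x))) (u *z u) (ℓ *z (z *z z)) m ((+ 2 *z y +z z) *z (+ 2 *z y +z z)))
    (trans (cong (_-z + 4 *z m) (sym (four-F A K ℓ 4K x y z))) (ringz53 (Fz A K x y z) m)))
   (∣z-+ h (square-diff (+ 2 *z y +z z) u du))
  cancel4 : + q ∣z + 4 ⊎ + q ∣z Fz A K x y z -z m → + q ∣z Fz A K x y z -z m
  cancel4 (inj₂ d) = d
  cancel4 (inj₁ d) = contradiction d (∤-* qq (+ 2) (+ 2) n₂ n₂)

-- Modulo an odd prime the variables (x, u, z) with u = 2y + z can be used.
local-odd : ∀ {q} → Prime q → 2 < q → ∀ A K ℓ → + 4 *z K ≡ + 1 +z ℓ → ∀ m x u z → ¬ + q ∣z u →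
 + q ∣z + 4 *z (A *z (x *z x)) +z u *z u +z ℓ *z (z *z z) -z + 4 *z m →
 ∃ λ y → + q ∣z Fz A K x y z -z m × Coprime q (abs (+ 2 *z y +z z)) × + q ∣z (+ 2 *z y +z z) -z u
local-odd {q} qq 2<q A K ℓ 4K m x u z nu h = build (inverse-mod-prime qq (+ 2) (∤-literal 2 z<s 2<q))
 where
 q⊥u : Coprime q (abs u)
 q⊥u = prime-coprime {q} {abs u} qq (λ d → nu (ℤ∣.∣ᵤ⇒∣ {+ q} {u} d))
 finish : ∀ y → + q ∣z (+ 2 *z y +z z) -z u → ∃ λ y → + q ∣z Fz A K x y z -z m × Coprime q (abs (+ 2 *z y +z z)) × + q ∣z (+ 2 *z y +z z) -z u
 finish y du = y , local-odd-value qq 2<q A K ℓ 4K m x u y z du h , coprime-congz {q} (+ 2 *z y +z z) u du q⊥u , du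
 build : (∃ λ c → + q ∣z + 2 *z c -z + 1) → ∃ λ y → + q ∣z Fz A K x y z -z m × Coprime q (abs (+ 2 *z y +z z)) × + q ∣z (+ 2 *z y +z z) -z u
 build (c , dc) = finish (c *z (u -z z)) (∣z-resp (ringz119 c u z) (∣z-*ʳ (u -z z) dc))

-- Density of the integers represented by F

∣z-1 : ∀ a → + 1 ∣z a
∣z-1 a = dividesz a (sym (ℤₚ.*-identityʳ a))

-- All but o(N) of the m < N in C lie in R: a set e disjoint from R inside C is sparse.
AlmostAll : (ℕ → Set) → (ℕ → Set) → Set
AlmostAll C R = ∀ ν → ∃ λ N₀ → ∀ N → N₀ ≤ N → ∀ e → (∀ m → e m ≤ 1) → (∀ m → m < N → 0 < e m → C m × ¬ R m) → ν * ∑ N e ≤ N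

%≡⇒∣z : ∀ n .{{_ : NonZero n}} a → + n ∣z + a -z + (a % n)
%≡⇒∣z n a = dividesz (+ (a / n)) (trans (cong (λ v → + v -z + (a % n)) (m≡m%n+[m/n]*n a n)) (trans (ringz12 (+ (a % n)) (+ (a / n * n))) (cast-* (a / n) n)))

small-multiple : ∀ n d → n ∣ d → d < n → d ≡ 0
small-multiple n zero _ _ = refl
small-multiple n (suc d) h d<n = contradiction (∣⇒≤ h) (<⇒≱ d<n)

abs-< : ∀ {n x y} → x < n → y < n → abs (+ x -z + y) < n
abs-< {suc n} x<n y<n = s≤s (abs-between {0} z≤n (s≤s⁻¹ x<n) z≤n (s≤s⁻¹ y<n))

∣z⇒%≡ : ∀ n .{{_ : NonZero n}} a b → + n ∣z + a -z + b → a % n ≡ b % n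
∣z⇒%≡ n a b h = ℤₚ.+-injective (ℤₚ.i-j≡0⇒i≡j (+ (a % n)) (+ (b % n)) (ℤₚ.∣i∣≡0⇒i≡0 (small-multiple n _ (ℤ∣.∣⇒∣ᵤ diff) (abs-< (m%n<n a n) (m%n<n b n)))))
 where
 diff : + n ∣z + (a % n) -z + (b % n)
 diff = ∣z-resp (ringz120 (+ a) (+ b) (+ (a % n)) (+ (b % n))) (∣z-+ (∣z-- h (%≡⇒∣z n a)) (%≡⇒∣z n b))

class-count : ∀ M .{{_ : NonZero M}} c N → M * (∑[ m < N ] 𝟙 (m % M ≟ c)) ≤ N + M
class-count M c N = ∑-progression N (λ m → 𝟙 (m % M ≟ c)) M (λ m _ → 𝟙≤1 (m % M ≟ c)) (λ i j i<j _ h₁ h₂ →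
 ∣z⇒∣ (∣z-resp (trans (ringz121 (+ i) (+ j) (+ c)) (-z-≥ (<⇒≤ i<j)))
  (∣z-- (subst (λ v → + M ∣z + j -z + v) (𝟙-pos (j % M ≟ c) h₂) (%≡⇒∣z M j)) (subst (λ v → + M ∣z + i -z + v) (𝟙-pos (i % M ≟ c) h₁) (%≡⇒∣z M i)))))

∑-classes : ∀ M .{{_ : NonZero M}} N f → ∑ N f ≡ ∑[ c < M ] ∑[ m < N ] 𝟙 (m % M ≟ c) * f m
∑-classes M N f = trans (∑-cong N (λ m _ → sym (∑-𝟙* M (m % M) (f m) (m%n<n m M)))) (∑-swap N M _)

AlmostAll-⊆ : ∀ {C C' R R' : ℕ → Set} → (∀ m → C m → C' m) → (∀ m → R' m → R m) → AlmostAll C' R' → AlmostAll C R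
AlmostAll-⊆ f g h ν = let N₀ , b = h ν in N₀ , λ N N₀≤N e e≤1 supp → b N N₀≤N e e≤1 (λ m m<N p → let c , nr = supp m m<N p in f m c , λ r → nr (g m r))

AlmostAll-∅ : ∀ {C R : ℕ → Set} → (∀ m → ¬ C m) → AlmostAll C R
AlmostAll-∅ none ν = 0 , λ N _ e _ supp → ≤-trans (≤-reflexive (trans (cong (ν *_) (∑-zero N (λ m m<N → n≤0⇒n≡0 (≮⇒≥ (λ p → none m (proj₁ (supp m m<N p))))))) (*-zeroʳ ν))) z≤n

AlmostAll-bounded : ∀ {C R : ℕ → Set} B → (∀ m → C m → m < B) → AlmostAll C R
AlmostAll-bounded {C} B bd ν = B + ν * B , λ N N₀≤N e e≤1 supp → ≤-trans (*-monoʳ-≤ ν (small N e e≤1 supp (≤-trans (m≤m+n B _) N₀≤N))) (≤-trans (m≤n+m (ν * B) B) N₀≤N)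
 where
 open ≤-Reasoning
 small : ∀ N e → (∀ m → e m ≤ 1) → (∀ m → m < N → 0 < e m → C m × _) → B ≤ N → ∑ N e ≤ B
 small N e e≤1 supp B≤N = begin
  ∑ N e ≡⟨ cong (λ v → ∑ v e) (sym (m+[n∸m]≡n B≤N)) ⟩
  ∑ (B + (N ∸ B)) e ≡⟨ ∑-split B (N ∸ B) e ⟩
  ∑ B e + (∑[ i < N ∸ B ] e (B + i)) ≡⟨ cong (_+_ (∑ B e)) (∑-zero (N ∸ B) (λ i i< → n≤0⇒n≡0 (≮⇒≥ (λ p → <⇒≱ (bd (B + i) (proj₁ (supp (B + i) (<-≤-trans (+-monoʳ-< B i<) (≤-reflexive (m+[n∸m]≡n B≤N))) p))) (m≤m+n B i))))) ⟩
  ∑ B e + 0 ≡⟨ +-identityʳ (∑ B e) ⟩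
  ∑ B e ≤⟨ ∑≤n B (λ m _ → e≤1 m) ⟩
  B ∎

-- The decision procedure for D is what allows an arbitrary exceptional set to be cut in two; each
-- half is granted the accuracy 2ν.
AlmostAll-split : ∀ {C D R : ℕ → Set} → (∀ m → Dec (D m)) → AlmostAll (λ m → D m × C m) R → AlmostAll (λ m → ¬ D m × C m) R → AlmostAll C R
AlmostAll-split {C} {D} {R} dec h₁ h₂ ν = let N₁ , b₁ = h₁ (2 * ν) ; N₂ , b₂ = h₂ (2 * ν) in N₁ + N₂ , λ N N₀≤N e e≤1 supp →
 let e₁ m = 𝟙 (dec m) * e m ; e₂ m = (1 ∸ 𝟙 (dec m)) * e m in *-cancelˡ-≤ 2 (begin
  2 * (ν * ∑ N e) ≡⟨ sym (*-assoc 2 ν (∑ N e)) ⟩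
  2 * ν * ∑ N e ≡⟨ cong (2 * ν *_) (trans (∑-cong N (λ m _ → split (dec m) (e m))) (∑-+ N e₁ e₂)) ⟩
  2 * ν * (∑ N e₁ + ∑ N e₂) ≡⟨ *-distribˡ-+ (2 * ν) (∑ N e₁) (∑ N e₂) ⟩
  2 * ν * ∑ N e₁ + 2 * ν * ∑ N e₂ ≤⟨ +-mono-≤ (b₁ N (≤-trans (m≤m+n N₁ N₂) N₀≤N) e₁ (λ m → *-mono-≤ (𝟙≤1 (dec m)) (e≤1 m)) (λ m m<N p → inside m (*-pos (𝟙 (dec m)) (e m) p) (supp m m<N)))
                        (b₂ N (≤-trans (m≤n+m N₂ N₁) N₀≤N) e₂ (λ m → *-mono-≤ (m∸n≤m 1 (𝟙 (dec m))) (e≤1 m)) (λ m m<N p → outside (dec m) (*-pos (1 ∸ 𝟙 (dec m)) (e m) p) (supp m m<N))) ⟩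
  N + N ≡⟨ cong (_+_ N) (sym (+-identityʳ N)) ⟩
  2 * N ∎)
 where
 open ≤-Reasoning
 split : ∀ {p} {Q : Set p} (d : Dec Q) x → x ≡ 𝟙 d * x + (1 ∸ 𝟙 d) * x
 split (yes _) x = sym (trans (+-identityʳ (1 * x)) (*-identityˡ x))
 split (no _) x = sym (*-identityˡ x)
 inside : ∀ m {x} → 0 < 𝟙 (dec m) × 0 < x → (0 < x → C m × ¬ R m) → (D m × C m) × ¬ R m
 inside m (p , q) f = let c , nr = f q in (𝟙-pos (dec m) p , c) , nr
 outside : ∀ {m x} (d : Dec (D m)) → 0 < 1 ∸ 𝟙 d × 0 < x → (0 < x → C m × ¬ R m) → (¬ D m × C m) × ¬ R m
 outside (no ¬d) (p , q) f = let c , nr = f q in (¬d , c) , nr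

AlmostAll-partition : ∀ {C R : ℕ → Set} (φ : ℕ → ℕ) n → (∀ i → i < n → AlmostAll (λ m → φ m ≡ i × C m) R) → AlmostAll (λ m → φ m < n × C m) R
AlmostAll-partition φ zero h = AlmostAll-∅ (λ m → λ { (() , _) })
AlmostAll-partition {C} {R} φ (suc n) h = AlmostAll-split (λ m → φ m <? n)
 (AlmostAll-⊆ (λ m → λ { (p , _ , c) → p , c }) (λ m r → r) (AlmostAll-partition φ n (λ i i<n → h i (m<n⇒m<1+n i<n))))
 (AlmostAll-⊆ (λ m → λ { (¬p , q , c) → ≤-antisym (s≤s⁻¹ q) (≮⇒≥ ¬p) , c }) (λ m r → r) (h n ≤-refl))

AlmostAll-⊎ : ∀ {C₁ C₂ R : ℕ → Set} → (∀ m → Dec (C₁ m)) → AlmostAll C₁ R → AlmostAll C₂ R → AlmostAll (λ m → C₁ m ⊎ C₂ m) R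
AlmostAll-⊎ dec h₁ h₂ = AlmostAll-split dec (AlmostAll-⊆ (λ m → proj₁) (λ m r → r) h₁)
 (AlmostAll-⊆ (λ m → λ { (¬c , inj₁ c) → contradiction c ¬c ; (_ , inj₂ c) → c }) (λ m r → r) h₂)

-- An exceptional set is pulled back along the injective map m₁ ↦ t m₁ + a. Since m₁ ≤ m < N the
-- pullback lies below the same N, and the possible gain of a factor t is given away.
AlmostAll-affine : ∀ {C C₁ R R₁ : ℕ → Set} t a → 0 < t → (∀ m → C m → ∃ λ m₁ → m ≡ t * m₁ + a × C₁ m₁) → (∀ m₁ → R₁ m₁ → R (t * m₁ + a)) →
 AlmostAll C₁ R₁ → AlmostAll C R
AlmostAll-affine {C} {C₁} {R} {R₁} t a t>0 f g h ν = let N₀ , b = h ν in N₀ , λ N N₀≤N e e≤1 supp →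
 let e' m₁ = 𝟙 (t * m₁ + a <? N) * e (t * m₁ + a) in
 ≤-trans (*-monoʳ-≤ ν (transfer N e supp)) (b N N₀≤N e' (λ m₁ → *-mono-≤ (𝟙≤1 (t * m₁ + a <? N)) (e≤1 (t * m₁ + a)))
  (λ m₁ _ p → let p₁ , p₂ = *-pos (𝟙 (t * m₁ + a <? N)) _ p in pull m₁ (supp (t * m₁ + a) (𝟙-pos (t * m₁ + a <? N) p₁) p₂)))
 where
 open ≤-Reasoning
 t-inj : ∀ {m n} → t * m + a ≡ t * n + a → m ≡ n
 t-inj {m} {n} eq = *-cancelˡ-≡ m n t {{>-nonZero t>0}} (+-cancelʳ-≡ a (t * m) (t * n) eq)
 pull : ∀ m₁ → C (t * m₁ + a) × ¬ R (t * m₁ + a) → C₁ m₁ × ¬ R₁ m₁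
 pull m₁ (c , nr) = let m' , eq , c₁ = f (t * m₁ + a) c in subst C₁ (sym (t-inj eq)) c₁ , λ r → nr (g m₁ r)
 transfer : ∀ N e → (∀ m → m < N → 0 < e m → C m × ¬ R m) → ∑ N e ≤ ∑[ m₁ < N ] 𝟙 (t * m₁ + a <? N) * e (t * m₁ + a)
 transfer N e supp = begin
  ∑ N e ≤⟨ ∑-mono N point ⟩
  ∑[ m < N ] ∑[ m₁ < N ] 𝟙 (t * m₁ + a ≟ m) * e m ≡⟨ ∑-swap N N _ ⟩
  ∑[ m₁ < N ] ∑[ m < N ] 𝟙 (t * m₁ + a ≟ m) * e m ≤⟨ ∑-mono N (λ m₁ _ → fibre m₁) ⟩
  ∑[ m₁ < N ] 𝟙 (t * m₁ + a <? N) * e (t * m₁ + a) ∎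
  where
  point : ∀ m → m < N → e m ≤ ∑[ m₁ < N ] 𝟙 (t * m₁ + a ≟ m) * e m
  point m m<N with e m ≟ 0
  ... | yes z = ≤-trans (≤-reflexive z) z≤n
  ... | no nz with f m (proj₁ (supp m m<N (n≢0⇒n>0 nz)))
  ... | m₁ , eq , _ = ≤-trans (≤-reflexive (sym (trans (cong (_* e m) (𝟙-yes (t * m₁ + a ≟ m) (sym eq))) (*-identityˡ (e m)))))
       (∑-term N (λ m₁ → 𝟙 (t * m₁ + a ≟ m) * e m) (≤-<-trans (≤-trans (m≤n*m m₁ t {{>-nonZero t>0}}) (≤-trans (m≤m+n (t * m₁) a) (≤-reflexive (sym eq)))) m<N))
  fibre : ∀ m₁ → (∑[ m < N ] 𝟙 (t * m₁ + a ≟ m) * e m) ≤ 𝟙 (t * m₁ + a <? N) * e (t * m₁ + a)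
  fibre m₁ with t * m₁ + a <? N
  ... | yes lt = ≤-reflexive (trans (∑-cong N (λ m _ → at m)) (trans (∑-𝟙* N (t * m₁ + a) (e (t * m₁ + a)) lt) (sym (*-identityˡ _))))
   where
   at : ∀ m → 𝟙 (t * m₁ + a ≟ m) * e m ≡ 𝟙 (t * m₁ + a ≟ m) * e (t * m₁ + a)
   at m with t * m₁ + a ≟ m
   ... | yes refl = refl
   ... | no _ = refl
  ... | no ¬lt = ≤-reflexive (∑-zero N (λ m m<N → cong (_* e m) (𝟙-no (t * m₁ + a ≟ m) (λ eq → ¬lt (≤-<-trans (≤-reflexive eq) m<N)))))

-- For squarefree P the gcd is the product of the primes p ∣ P that divide m, and its square divides
-- m exactly if each of them divides m at least twice.
Lset : ℕ → ℕ → Set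
Lset P m = gcd m P * gcd m P ∣ m

Lset? : ∀ P m → Dec (Lset P m)
Lset? P m = gcd m P * gcd m P ∣? m

gcd-coprime-* : ∀ c m P → Coprime c P → gcd (c * m) P ≡ gcd m P
gcd-coprime-* c m P c⊥P = ∣-antisym
 (gcd-greatest (coprime-divisor (coprime-∣ˡ (gcd[m,n]∣n (c * m) P) (Coprimality.sym c⊥P)) (gcd[m,n]∣m (c * m) P)) (gcd[m,n]∣n (c * m) P))
 (gcd-greatest (∣n⇒∣m*n c (gcd[m,n]∣m m P)) (gcd[m,n]∣n m P))

Lset-coprime-* : ∀ c m P → Coprime c P → Lset P (c * m) → Lset P m
Lset-coprime-* c m P c⊥P h = coprime-divisor (coprime-*ˡ g⊥c g⊥c) (subst (λ g → g * g ∣ c * m) (gcd-coprime-* c m P c⊥P) h)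
 where
 g⊥c : Coprime (gcd m P) c
 g⊥c = coprime-∣ˡ (gcd[m,n]∣n m P) (Coprimality.sym c⊥P)

-- Division by g² leads back to numbers prime to the modulus: the primes of g drop out of it, and a
-- prime dividing both n and P' would divide g too, so that its square would divide P = g P'.
Lset-split : ∀ {P} → 0 < P → Squarefree P → ∀ m → Lset P m → Σ ℕ λ P' → Σ ℕ λ n → P ≡ gcd m P * P' × m ≡ gcd m P * gcd m P * n × Coprime n P'
Lset-split {P} P>0 sqf m h@(divides n m≡) with gcd[m,n]∣n m P
... | divides P' P≡ = P' , n , trans P≡ (*-comm P' g) , trans m≡ (*-comm n (g * g)) , cop
 where
 g = gcd m P
 P'>0 : 0 < P'
 P'>0 = n≢0⇒n>0 (λ { refl → >⇒≢ P>0 P≡ })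
 bad : ∀ p → Prime p → p ∣ n → p ∣ P' → ⊥
 bad p pp p∣n p∣P' = sqf p pp (subst (p * p ∣_) (sym P≡) (*-pres-∣ p∣P' (gcd-greatest (∣-trans p∣n (divides (g * g) (trans m≡ (*-comm n (g * g))))) (∣-trans p∣P' (divides g (trans P≡ (*-comm P' g)))))))
 cop : Coprime n P'
 cop {zero} (_ , q) = contradiction (0∣⇒≡0 q) (>⇒≢ P'>0)
 cop {suc zero} _ = refl
 cop {d@(suc (suc _))} (p , q) = let r , rr , r∣d = prime-divisor d (s≤s z<s) in ⊥-elim (bad r rr (∣-trans r∣d p) (∣-trans r∣d q))

squarefree-∣ : ∀ {P P'} → P' ∣ P → Squarefree P → Squarefree P'
squarefree-∣ h sqf p pp d = sqf p pp (∣-trans d h)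

-- Periodic sets and certificates

Periodic : ℕ → (ℕ → Set) → Set
Periodic q C = ∀ m → (C m → C (m + q)) × (C (m + q) → C m)

Periodic-* : ∀ n {q C} → Periodic q C → Periodic (n * q) C
Periodic-* zero {q} {C} h m = subst C (sym (+-identityʳ m)) , subst C (+-identityʳ m)
Periodic-* (suc n) {q} {C} h m = (λ c → subst C (+-assoc m q (n * q)) (proj₁ (Periodic-* n h (m + q)) (proj₁ (h m) c))) ,
                 (λ c → proj₂ (h m) (proj₂ (Periodic-* n h (m + q)) (subst C (sym (+-assoc m q (n * q))) c)))

Periodic-∣ : ∀ {q r C} → q ∣ r → Periodic q C → Periodic r C
Periodic-∣ {q} {r} {C} (divides n eq) h = subst (λ v → Periodic v C) (sym eq) (Periodic-* n h)

Periodic-× : ∀ {q C D} → Periodic q C → Periodic q D → Periodic q (λ m → C m × D m)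
Periodic-× h k m = (λ { (c , d) → proj₁ (h m) c , proj₁ (k m) d }) , (λ { (c , d) → proj₂ (h m) c , proj₂ (k m) d })

Periodic-⊎ : ∀ {q C D} → Periodic q C → Periodic q D → Periodic q (λ m → C m ⊎ D m)
Periodic-⊎ {C = C} {D} h k m = to , from
 where
 to : C m ⊎ D m → _
 to (inj₁ c) = inj₁ (proj₁ (h m) c)
 to (inj₂ d) = inj₂ (proj₁ (k m) d)
 from : C (m + _) ⊎ D (m + _) → C m ⊎ D m
 from (inj₁ c) = inj₁ (proj₂ (h m) c)
 from (inj₂ d) = inj₂ (proj₂ (k m) d)

Periodic-scale : ∀ {q C} b → 0 < b → Periodic q C → Periodic (b * q) (λ m → ∃ λ m₁ → m ≡ b * m₁ × C m₁)
Periodic-scale {q} {C} b b>0 h m = (λ { (m₁ , eq , c) → m₁ + q , trans (cong (_+ b * q) eq) (sym (*-distribˡ-+ b m₁ q)) , proj₁ (h m₁) c }) , back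
 where
 back : (∃ λ m₁ → m + b * q ≡ b * m₁ × C m₁) → ∃ λ m₁ → m ≡ b * m₁ × C m₁
 back (m₁ , eq , c) = m₁ ∸ q , +-cancelʳ-≡ (b * q) m (b * (m₁ ∸ q)) (trans eq (trans (cong (b *_) (sym (m∸n+n≡m q≤m₁))) (*-distribˡ-+ b (m₁ ∸ q) q))) ,
   proj₂ (h (m₁ ∸ q)) (subst C (sym (m∸n+n≡m q≤m₁)) c)
  where
  q≤m₁ : q ≤ m₁
  q≤m₁ = *-cancelˡ-≤ b {{>-nonZero b>0}} (≤-trans (m≤n+m (b * q) m) (≤-reflexive eq))

gcd-+ : ∀ m P n → gcd (m + n * P) P ≡ gcd m P
gcd-+ m P n = ∣-antisym
 (gcd-greatest (∣m+n∣m⇒∣n (subst (gcd (m + n * P) P ∣_) (+-comm m (n * P)) (gcd[m,n]∣m (m + n * P) P)) (∣n⇒∣m*n n (gcd[m,n]∣n (m + n * P) P))) (gcd[m,n]∣n (m + n * P) P))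
 (gcd-greatest (∣m∣n⇒∣m+n (gcd[m,n]∣m m P) (∣n⇒∣m*n n (gcd[m,n]∣n m P))) (gcd[m,n]∣n m P))

Lset-periodic : ∀ P → Periodic (P * P) (Lset P)
Lset-periodic P m = (λ h → subst (λ g → g * g ∣ m + P * P) (sym (gcd-+ m P P)) (∣m∣n⇒∣m+n h g²∣P²)) ,
  (λ h → ∣m+n∣m⇒∣n (subst (gcd m P * gcd m P ∣_) (+-comm m (P * P)) (subst (λ g → g * g ∣ m + P * P) (gcd-+ m P P) h)) g²∣P²)
 where
 g²∣P² : gcd m P * gcd m P ∣ P * P
 g²∣P² = *-pres-∣ (gcd[m,n]∣n m P) (gcd[m,n]∣n m P)

-- The data from which a density near that of L is extracted. `necessary` and `generic` determine R
-- up to the multiples of ℓ, which locates any limit up to 1/ℓ. `exhausted` makes the limit exist: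
-- up to density 0, R contains a periodic set C and exceeds it at most by multiples of some d ≥ k.
-- The value of the limit is never computed.
record Certificate (ℓ P : ℕ) (R : ℕ → Set) : Set₁ where
 field
  necessary : ∀ m → R m → Lset P m
  generic : AlmostAll (λ m → ¬ ℓ ∣ m × Lset P m) R
  exhausted : ∀ k → Σ (ℕ → Set) λ C → (∀ m → Dec (C m)) × (Σ ℕ λ q → 0 < q × Periodic q C) × AlmostAll C R ×
         (Σ ℕ λ d → k ≤ d × (∀ m → R m → C m ⊎ d ∣ m))

-- The indefinite ternary form

module Indefinite (w : ℤ) where

 -- A solution of w y² + z² ≡ m modulo e in which y has the shape a² - m b². For an integer y of
 -- this shape with b prime to y, m ≡ (a / b)² modulo y; so z can be chosen with m - z² = y τ, and
 -- the congruence modulo P then gives τ ≡ w y, that is τ = P k + w y.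
 record LocalPoint (m : ℤ) (e : ℕ) : Set where
  constructor point
  field
   a b z : ℤ
   on : + e ∣z w *z ((a *z a -z m *z (b *z b)) *z (a *z a -z m *z (b *z b))) +z z *z z -z m
   b⊥e : Coprime e (abs b)
   y⊥e : Coprime e (abs (a *z a -z m *z (b *z b)))

 prime-unit : ∀ {p} → Prime p → ∀ a → ¬ + p ∣z a → Coprime p (abs a)
 prime-unit {p} pp a n = prime-coprime {p} {abs a} pp (λ d → n (ℤ∣.∣ᵤ⇒∣ {+ p} {a} d))

 y-cong : ∀ {n} m a a' b b' → n ∣z a -z a' → n ∣z b -z b' → n ∣z (a *z a -z m *z (b *z b)) -z (a' *z a' -z m *z (b' *z b'))
 y-cong m a a' b b' da db = ∣z-resp (ringz54 m (a *z a) (a' *z a') (b *z b) (b' *z b')) (∣z-- (square-diff a a' da) (∣z-*ˡ m (square-diff b b' db)))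

 on-cong : ∀ {n} m y y' z z' → n ∣z y -z y' → n ∣z z -z z' → n ∣z w *z (y' *z y') +z z' *z z' -z m → n ∣z w *z (y *z y) +z z *z z -z m
 on-cong m y y' z z' dy dz h = ∣z-resp (ringz55 w m (y *z y) (y' *z y') (z *z z) (z' *z z')) (∣z-+ (∣z-+ (∣z-*ˡ w (square-diff y y' dy)) (square-diff z z' dz)) h)

 -- Two conics in succession: w y² + z² = m supplies a unit y, and a² - m b² = y then supplies a
 -- unit b.
 local-prime : ∀ {p} → Prime p → 4 < p → ¬ + p ∣z w → ∀ m → ¬ + p ∣z m → LocalPoint m p
 local-prime {p} pp 4<p nw m nm = first (conic-x≢0 pp 4<p w (+ 1) m nw n₁ nm)
  where
  n₁ : ¬ + p ∣z + 1
  n₁ = ∤-literal 1 z<s (prime>1 pp)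
  same : ∀ {n} x → n ∣z x -z x
  same x = ∣z-resp (sym (ℤₚ.+-inverseʳ x)) ∣z-0
  first : (Σ ℤ λ y → Σ ℤ λ z → ¬ + p ∣z y × + p ∣z w *z (y *z y) +z + 1 *z (z *z z) -z m) → LocalPoint m p
  first (y , z , ny , h) = second (conic-x≢0 pp 4<p (-z m) (+ 1) y (λ d → nm (∣z-resp (ringz30 m) (∣z-- ∣z-0 d))) n₁ ny)
   where
   second : (Σ ℤ λ b → Σ ℤ λ a → ¬ + p ∣z b × + p ∣z (-z m) *z (b *z b) +z + 1 *z (a *z a) -z y) → LocalPoint m p
   second (b , a , nb , h₂) = finish (∣z-resp (ringz56 m a b y) h₂)
    where
    finish : + p ∣z (a *z a -z m *z (b *z b)) -z y → LocalPoint m p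
    finish dy = point a b z (on-cong m (a *z a -z m *z (b *z b)) y z z dy (same z) (∣z-resp (ringz57 w y z m) h)) (prime-unit pp b nb)
     (coprime-congz {p} (a *z a -z m *z (b *z b)) y dy (prime-unit pp y ny))

 local-point-cong : ∀ {m e} (S : LocalPoint m e) a b z → + e ∣z a -z LocalPoint.a S → + e ∣z b -z LocalPoint.b S → + e ∣z z -z LocalPoint.z S →
  + e ∣z w *z ((a *z a -z m *z (b *z b)) *z (a *z a -z m *z (b *z b))) +z z *z z -z m × Coprime e (abs b) × Coprime e (abs (a *z a -z m *z (b *z b)))
 local-point-cong {m} {e} (point a₀ b₀ z₀ on b⊥ y⊥) a b z da db dz =
  on-cong m (a *z a -z m *z (b *z b)) (a₀ *z a₀ -z m *z (b₀ *z b₀)) z z₀ (y-cong m a a₀ b b₀ da db) dz on ,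
  coprime-congz {e} b b₀ db b⊥ ,
  coprime-congz {e} (a *z a -z m *z (b *z b)) (a₀ *z a₀ -z m *z (b₀ *z b₀)) (y-cong m a a₀ b b₀ da db) y⊥

 local-point-* : ∀ {m e₁ e₂} → Coprime e₁ e₂ → LocalPoint m e₁ → LocalPoint m e₂ → LocalPoint m (e₁ * e₂)
 local-point-* {m} {e₁} {e₂} cop S₁ S₂ = glue (crt e₁ e₂ cop (LocalPoint.a S₁) (LocalPoint.a S₂)) (crt e₁ e₂ cop (LocalPoint.b S₁) (LocalPoint.b S₂)) (crt e₁ e₂ cop (LocalPoint.z S₁) (LocalPoint.z S₂))
  where
  glue : (∃ λ a → + e₁ ∣z a -z LocalPoint.a S₁ × + e₂ ∣z a -z LocalPoint.a S₂) → (∃ λ b → + e₁ ∣z b -z LocalPoint.b S₁ × + e₂ ∣z b -z LocalPoint.b S₂) →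
   (∃ λ z → + e₁ ∣z z -z LocalPoint.z S₁ × + e₂ ∣z z -z LocalPoint.z S₂) → LocalPoint m (e₁ * e₂)
  glue (a , a₁ , a₂) (b , b₁ , b₂) (z , z₁ , z₂) = join (local-point-cong S₁ a b z a₁ b₁ z₁) (local-point-cong S₂ a b z a₂ b₂ z₂)
   where
   V : ℤ
   V = w *z ((a *z a -z m *z (b *z b)) *z (a *z a -z m *z (b *z b))) +z z *z z -z m
   Y : ℕ
   Y = abs (a *z a -z m *z (b *z b))
   join : + e₁ ∣z V × Coprime e₁ (abs b) × Coprime e₁ Y → + e₂ ∣z V × Coprime e₂ (abs b) × Coprime e₂ Y → LocalPoint m (e₁ * e₂)
   join (o₁ , p₁ , q₁) (o₂ , p₂ , q₂) = point a b z (coprime-product-∣z {e₁} {e₂} {V} cop o₁ o₂) (coprime-*ˡ {e₁} {e₂} {abs b} p₁ p₂) (coprime-*ˡ {e₁} {e₂} {Y} q₁ q₂)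

 local-all : ∀ {P} → 0 < P → Squarefree P → (∀ p → Prime p → p ∣ P → 4 < p × ¬ + p ∣z w) → ∀ m → Coprime (abs m) P → LocalPoint m P
 local-all {P} P>0 sqf hyp m m⊥P = squarefree-induction P>0 sqf (LocalPoint m)
  (point 0ℤ 0ℤ 0ℤ (∣z-1 (w *z ((0ℤ *z 0ℤ -z m *z (0ℤ *z 0ℤ)) *z (0ℤ *z 0ℤ -z m *z (0ℤ *z 0ℤ))) +z 0ℤ *z 0ℤ -z m)) (λ { (d∣1 , _) → ∣1⇒≡1 d∣1 }) (λ { (d∣1 , _) → ∣1⇒≡1 d∣1 }))
  (λ p e pp pe∣P cop S → let p∣P = ∣-trans (m∣m*n e) pe∣P ; 4<p , nw = hyp p pp p∣P in
   local-point-* cop (local-prime pp 4<p nw m (λ d → >⇒≢ (prime>1 pp) (m⊥P (ℤ∣.∣⇒∣ᵤ {+ p} {m} d , p∣P)))) S) P ∣-refl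

 Solution : ℕ → ℤ → Set
 Solution P m = Σ ℤ λ k → Σ ℤ λ y → Σ ℤ λ z → y *z (+ P *z k +z w *z y) +z z *z z ≡ m

 -- y = a² − m b² divides m − z² as soon as b z ≡ a modulo y.
 solve-with : ∀ P m a b z y → y ≡ a *z a -z m *z (b *z b) → + P ∣z w *z (y *z y) +z z *z z -z m → Coprime P (abs y) → Coprime (abs y) (abs b) → + abs y ∣z b *z z -z a → Solution P m
 solve-with P m a b z y y≡ on P⊥y y⊥b bz = go (∣z-trans (ℤ∣.m∣∣m∣ {y}) y∣)
  where
  self : + abs y ∣z y
  self = ℤ∣.∣m∣∣m {y}
  y∣ : + abs y ∣z m -z z *z z
  y∣ = coprime-divisorz b (m -z z *z z) y⊥b (coprime-divisorz b (b *z (m -z z *z z)) y⊥b (∣z-resp (trans (ringz58 m a b z) (ℤₚ.*-assoc b b (m -z z *z z)))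
   (∣z-- (∣z-resp (cong (_*z -z (+ 1)) y≡) (∣z-*ʳ (-z (+ 1)) self)) (square-diff (b *z z) a bz))))
  go : y ∣z m -z z *z z → Solution P m
  go (dividesz τ eq) = finish (coprime-divisorz y (τ -z w *z y) P⊥y (∣z-resp (trans (cong (λ v → 0ℤ -z (w *z (y *z y) -z v)) (sym rearr)) (ringz35 w y τ)) (∣z-- ∣z-0 (∣z-resp (ringz34 w y z m) on))))
   where
   rearr : τ *z y ≡ m -z z *z z
   rearr = sym eq
   finish : + P ∣z τ -z w *z y → Solution P m
   finish (dividesz k eq') = k , y , z , (begin
    y *z (+ P *z k +z w *z y) +z z *z z ≡⟨ cong (λ v → y *z (v +z w *z y) +z z *z z) (trans (ℤₚ.*-comm (+ P) k) (sym eq')) ⟩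
    y *z ((τ -z w *z y) +z w *z y) +z z *z z ≡⟨ cong (λ v → y *z v +z z *z z) (ringz24 τ (w *z y)) ⟩
    y *z τ +z z *z z ≡⟨ cong (_+z z *z z) (trans (ℤₚ.*-comm y τ) rearr) ⟩
    (m -z z *z z) +z z *z z ≡⟨ ringz24 m (z *z z) ⟩
    m ∎)
    where open ≡-Reasoning

 -- From the local point to integers: a is made ≡ 1 modulo b, which renders b prime to a and
 -- therefore to y = a² - m b². Then z is prescribed as a / b modulo y and as the local value modulo
 -- P; these moduli are coprime because y is a unit modulo P.
 solve : ∀ {P} → 0 < P → Squarefree P → (∀ p → Prime p → p ∣ P → 4 < p × ¬ + p ∣z w) → ∀ m → Coprime (abs m) P → Solution P m
 solve {P} P>0 sqf hyp m m⊥P = lift (local-all P>0 sqf hyp m m⊥P)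
  where
  lift : LocalPoint m P → Solution P m
  lift (point a₀ b z₀ on b⊥ y⊥) = choose-a (crt P (abs b) b⊥ a₀ (+ 1))
   where
   choose-a : (∃ λ a → + P ∣z a -z a₀ × + abs b ∣z a -z + 1) → Solution P m
   choose-a (a , da , da') = with-y (a *z a -z m *z (b *z b)) refl
    where
    same : ∀ {n} x → n ∣z x -z x
    same x = ∣z-resp (sym (ℤₚ.+-inverseʳ x)) ∣z-0
    b⊥a : Coprime (abs b) (abs a)
    b⊥a = coprime-congz {abs b} a (+ 1) da' (λ { (_ , d∣1) → ∣1⇒≡1 d∣1 })
    with-y : ∀ y → y ≡ a *z a -z m *z (b *z b) → Solution P m
    with-y y y≡ = choose-z (inverse (abs y) b b⊥y)
     where
     b⊥y : Coprime (abs b) (abs y)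
     b⊥y = coprime-congz {abs b} y (a *z a) (∣z-resp (trans (sym (ringz10 a m b)) (cong (_-z a *z a) (sym y≡))) (∣z-*ˡ (-z m *z b) (ℤ∣.∣m∣∣m {b})))
      (subst (Coprime (abs b)) (sym (ℤₚ.abs-* a a)) (coprime-*ʳ {abs b} {abs a} {abs a} b⊥a b⊥a))
     dy : + P ∣z y -z (a₀ *z a₀ -z m *z (b *z b))
     dy = subst (λ v → + P ∣z v -z (a₀ *z a₀ -z m *z (b *z b))) (sym y≡) (y-cong m a a₀ b b da (same b))
     P⊥y : Coprime P (abs y)
     P⊥y = coprime-congz {P} y (a₀ *z a₀ -z m *z (b *z b)) dy y⊥
     choose-z : (∃ λ b' → + abs y ∣z b *z b' -z + 1) → Solution P m
     choose-z (b' , db') = conclude (crt P (abs y) P⊥y z₀ (a *z b'))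
      where
      conclude : (∃ λ z → + P ∣z z -z z₀ × + abs y ∣z z -z a *z b') → Solution P m
      conclude (z , dz , dz') = solve-with P m a b z y y≡ (on-cong m y (a₀ *z a₀ -z m *z (b *z b)) z z₀ dy dz on) P⊥y (Coprimality.sym b⊥y)
       (∣z-resp (ringz1 a b b' z) (∣z-+ (∣z-*ˡ b dz') (∣z-*ˡ a db')))

 Lset⇒Solution : ∀ {P} → 0 < P → Squarefree P → (∀ p → Prime p → p ∣ P → 4 < p × ¬ + p ∣z w) → ∀ m → Lset P (abs m) → Solution P m
 Lset⇒Solution {P} P>0 sqf hyp m l = go (Lset-split P>0 sqf (abs m) l)
  where
  g = gcd (abs m) P
  signed : ∀ m g n → abs m ≡ g * g * n → ∃ λ m₁ → m ≡ + g *z + g *z m₁ × abs m₁ ≡ n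
  signed (+ a) g n eq = + n , trans (cong +_ eq) (trans (cast-* (g * g) n) (cong (_*z + n) (cast-* g g))) , refl
  signed ℤ.-[1+ a ] g n eq = -z + n , trans (cong (λ v → -z (+ v)) eq) (trans (cong -z_ (trans (cast-* (g * g) n) (cong (_*z + n) (cast-* g g)))) (ℤₚ.neg-distribʳ-* (+ g *z + g) (+ n))) , ℤₚ.∣-i∣≡∣i∣ (+ n)
  go : (Σ ℕ λ P' → Σ ℕ λ n → P ≡ g * P' × abs m ≡ g * g * n × Coprime n P') → Solution P m
  go (P' , n , P≡ , m≡ , cop) = scale (signed m g n m≡)
   where
   P'∣P : P' ∣ P
   P'∣P = divides g P≡
   P'>0 : 0 < P'
   P'>0 = n≢0⇒n>0 (λ { refl → >⇒≢ P>0 (trans P≡ (*-zeroʳ g)) })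
   scale : (∃ λ m₁ → m ≡ + g *z + g *z m₁ × abs m₁ ≡ n) → Solution P m
   scale (m₁ , eq , abs≡) = up (solve P'>0 (squarefree-∣ P'∣P sqf) (λ p pp p∣ → hyp p pp (∣-trans p∣ P'∣P)) m₁ (subst (λ v → Coprime v P') (sym abs≡) cop))
    where
    up : Solution P' m₁ → Solution P m
    -- Only y and z are scaled by g: in the term y · P k the second factor g comes from P = g P'.
    up (k , y , z , val) = k , + g *z y , + g *z z ,
     trans (cong (λ v → (+ g *z y) *z (v *z k +z w *z (+ g *z y)) +z (+ g *z z) *z (+ g *z z)) (trans (cong +_ P≡) (cast-* g P')))
      (trans (ringz59 (+ g) (+ P') k w y z) (trans (cong (+ g *z + g *z_) val) (sym eq)))

 -- Modulo a divisor e of P the value is w y² + z². If e also divides the value, anisotropy gives e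
 -- ∣ y and e ∣ z, and then e² divides every term. The term P² r accounts for the additional
 -- variables of the longer forms.
 Solution⇒Lset : ∀ {P} → (∀ e → e ∣ P → Anisotropic w (+ 1) e) → ∀ m k y z r → y *z (+ P *z k +z w *z y) +z z *z z +z + P *z + P *z r ≡ m → Lset P (abs m)
 Solution⇒Lset {P} ani m k y z r val = go (ani e e∣P y z e∣)
  where
  e = gcd (abs m) P
  e∣P : e ∣ P
  e∣P = gcd[m,n]∣n (abs m) P
  e∣zP : + e ∣z + P
  e∣zP = ∣⇒∣z e∣P
  e∣m : + e ∣z m
  e∣m = ℤ∣.∣ᵤ⇒∣ {+ e} {m} (gcd[m,n]∣m (abs m) P)
  e∣ : + e ∣z w *z (y *z y) +z + 1 *z (z *z z)
  e∣ = ∣z-resp (ringz60 (+ P) k w y z r) (∣z-- (∣z-resp (sym val) e∣m) (∣z-*ʳ (k *z y +z + P *z r) e∣zP))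
  both : ∀ a b → + e ∣z a → + e ∣z b → + (e * e) ∣z a *z b
  both a b (dividesz q eq) (dividesz q' eq') = dividesz (q *z q') (trans (cong₂ _*z_ eq eq') (trans (ringz62 q q' (+ e)) (cong (q *z q' *z_) (sym (cast-* e e)))))
  go : + e ∣z y × + e ∣z z → Lset P (abs m)
  go (ey , ez) = ℤ∣.∣⇒∣ᵤ {+ (e * e)} {m} (∣z-resp (trans (ringz61 (+ P) k w y z r) val)
   (∣z-+ (∣z-+ (∣z-+ (∣z-*ʳ k (both (+ P) y e∣zP ey)) (∣z-*ˡ w (both y y ey ey))) (both z z ez ez)) (∣z-*ʳ r (both (+ P) (+ P) e∣zP e∣zP))))

-- The density of Lset

∑-image : ∀ N N₁ (f e : ℕ → ℕ) → (∀ m → m < N → 0 < e m → ∃ λ m₁ → m₁ < N₁ × f m₁ ≡ m) → ∑ N e ≤ ∑[ m₁ < N₁ ] e (f m₁)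
∑-image N N₁ f e h = begin
 ∑ N e ≤⟨ ∑-mono N point ⟩
 ∑[ m < N ] ∑[ m₁ < N₁ ] 𝟙 (f m₁ ≟ m) * e m ≡⟨ ∑-swap N N₁ _ ⟩
 ∑[ m₁ < N₁ ] ∑[ m < N ] 𝟙 (f m₁ ≟ m) * e m ≤⟨ ∑-mono N₁ (λ m₁ _ → inner m₁) ⟩
 ∑[ m₁ < N₁ ] e (f m₁) ∎
 where
 open ≤-Reasoning
 point : ∀ m → m < N → e m ≤ ∑[ m₁ < N₁ ] 𝟙 (f m₁ ≟ m) * e m
 point m m<N with e m ≟ 0
 ... | yes z = ≤-trans (≤-reflexive z) z≤n
 ... | no nz with h m m<N (n≢0⇒n>0 nz)
 ... | m₁ , m₁< , eq = ≤-trans (≤-reflexive (sym (trans (cong (_* e m) (𝟙-yes (f m₁ ≟ m) eq)) (*-identityˡ (e m))))) (∑-term N₁ (λ m₁ → 𝟙 (f m₁ ≟ m) * e m) m₁<)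
 inner : ∀ m₁ → (∑[ m < N ] 𝟙 (f m₁ ≟ m) * e m) ≤ e (f m₁)
 inner m₁ = begin
  ∑[ m < N ] 𝟙 (f m₁ ≟ m) * e m ≡⟨ ∑-cong N (λ m _ → at m) ⟩
  ∑[ m < N ] e (f m₁) * 𝟙 (f m₁ ≟ m) ≡⟨ ∑-*ˡ N (e (f m₁)) _ ⟩
  e (f m₁) * (∑[ m < N ] 𝟙 (f m₁ ≟ m)) ≤⟨ *-monoʳ-≤ (e (f m₁)) (∑-unique N _ (λ m _ → 𝟙≤1 (f m₁ ≟ m)) (λ i j _ _ p q → trans (sym (𝟙-pos (f m₁ ≟ i) p)) (𝟙-pos (f m₁ ≟ j) q))) ⟩
  e (f m₁) * 1 ≡⟨ *-identityʳ (e (f m₁)) ⟩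
  e (f m₁) ∎
  where
  at : ∀ m → 𝟙 (f m₁ ≟ m) * e m ≡ e (f m₁) * 𝟙 (f m₁ ≟ m)
  at m with f m₁ ≟ m
  ... | yes refl = *-comm 1 (e (f m₁))
  ... | no _ = sym (*-zeroʳ (e (f m₁)))

-- By injectivity every fibre of φ has at most one element, and the b fibres have b elements
-- together; so each has exactly one.
∑-permute : ∀ b (φ g : ℕ → ℕ) → (∀ i → i < b → φ i < b) → (∀ i j → i < b → j < b → φ i ≡ φ j → i ≡ j) → ∑[ i < b ] g (φ i) ≡ ∑ b g
∑-permute b φ g φ< inj = begin
 ∑[ i < b ] g (φ i) ≡⟨ ∑-cong b (λ i i<b → trans (sym (∑-𝟙* b (φ i) (g (φ i)) (φ< i i<b))) (∑-cong b (λ c _ → at (φ i) c))) ⟩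
 ∑[ i < b ] ∑[ c < b ] g c * 𝟙 (φ i ≟ c) ≡⟨ ∑-swap b b _ ⟩
 ∑[ c < b ] ∑[ i < b ] g c * 𝟙 (φ i ≟ c) ≡⟨ ∑-cong b (λ c c<b → trans (∑-*ˡ b (g c) _) (trans (cong (g c *_) (hit c c<b)) (*-identityʳ (g c)))) ⟩
 ∑ b g ∎
 where
 open ≡-Reasoning
 n : ℕ → ℕ
 n c = ∑[ i < b ] 𝟙 (φ i ≟ c)
 at : ∀ x c → 𝟙 (x ≟ c) * g x ≡ g c * 𝟙 (x ≟ c)
 at x c with x ≟ c
 ... | yes refl = *-comm 1 (g x)
 ... | no _ = sym (*-zeroʳ (g c))
 n≤1 : ∀ c → n c ≤ 1
 n≤1 c = ∑-unique b _ (λ i _ → 𝟙≤1 (φ i ≟ c)) (λ i j i<b j<b p q → inj i j i<b j<b (trans (𝟙-pos (φ i ≟ c) p) (sym (𝟙-pos (φ j ≟ c) q))))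
 ∑n : ∑ b n ≡ b
 ∑n = trans (∑-swap b b _) (trans (∑-cong b (λ i i<b → ∑-𝟙-hit b (φ i) (φ< i i<b))) (trans (∑-const b 1) (*-identityʳ b)))
 deficit : ∑[ c < b ] (1 ∸ n c) ≡ 0
 deficit = +-cancelˡ-≡ b _ 0 (trans (cong (_+ (∑[ c < b ] (1 ∸ n c))) (sym ∑n)) (trans (sym (∑-+ b n (λ c → 1 ∸ n c)))
  (trans (∑-cong b (λ c _ → m+[n∸m]≡n (n≤1 c))) (trans (∑-const b 1) (trans (*-identityʳ b) (sym (+-identityʳ b)))))))
 hit : ∀ c → c < b → n c ≡ 1
 hit c c<b = ≤-antisym (n≤1 c) (m∸n≡0⇒m≤n (n≤0⇒n≡0 (≤-trans (∑-term b (λ c → 1 ∸ n c) c<b) (≤-reflexive deficit))))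

-- In blocks of length a: for fixed j the numbers i a + j run through all residues modulo b, since a
-- is invertible there.
∑-crt : ∀ a b .{{_ : NonZero a}} .{{_ : NonZero b}} → Coprime a b → ∀ f g → ∑[ c < b * a ] f (c % a) * g (c % b) ≡ ∑ a f * ∑ b g
∑-crt a b a⊥b f g = begin
 ∑[ c < b * a ] f (c % a) * g (c % b) ≡⟨ ∑-blocks b a _ ⟩
 ∑[ i < b ] ∑[ j < a ] f ((i * a + j) % a) * g ((i * a + j) % b) ≡⟨ ∑-cong b (λ i _ → ∑-cong a (λ j j<a → cong (λ v → f v * g ((i * a + j) % b)) (trans (cong (_% a) (+-comm (i * a) j)) (trans ([m+kn]%n≡m%n j i a) (m<n⇒m%n≡m j<a))))) ⟩
 ∑[ i < b ] ∑[ j < a ] f j * g ((i * a + j) % b) ≡⟨ ∑-swap b a _ ⟩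
 ∑[ j < a ] ∑[ i < b ] f j * g ((i * a + j) % b) ≡⟨ ∑-cong a (λ j _ → trans (∑-*ˡ b (f j) _) (cong (f j *_) (∑-permute b (λ i → (i * a + j) % b) g (λ i _ → m%n<n (i * a + j) b) (inj j)))) ⟩
 ∑[ j < a ] f j * ∑ b g ≡⟨ trans (∑-cong a (λ j _ → *-comm (f j) (∑ b g))) (trans (∑-*ˡ a (∑ b g) f) (*-comm (∑ b g) (∑ a f))) ⟩
 ∑ a f * ∑ b g ∎
 where
 open ≡-Reasoning
 cast : ∀ i j → + (i * a + j) ≡ + i *z + a +z + j
 cast i j = cong (_+z + j) (cast-* i a)
 inj : ∀ j i i' → i < b → i' < b → (i * a + j) % b ≡ (i' * a + j) % b → i ≡ i'
 inj j i i' i<b i'<b eq = ℤₚ.+-injective (ℤₚ.i-j≡0⇒i≡j (+ i) (+ i') (ℤₚ.∣i∣≡0⇒i≡0 (small-multiple b _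
  (ℤ∣.∣⇒∣ᵤ {+ b} {+ i -z + i'} (coprime-divisorz (+ a) (+ i -z + i') (Coprimality.sym a⊥b)
   (∣z-resp (trans (cong₂ (λ u v → (u -z + ((i * a + j) % b)) -z (v -z + ((i * a + j) % b))) (cast i j) (cast i' j)) (ringz122 (+ i) (+ i') (+ a) (+ j) (+ ((i * a + j) % b))))
    (∣z-- (%≡⇒∣z b (i * a + j)) (subst (λ v → + b ∣z + (i' * a + j) -z + v) (sym eq) (%≡⇒∣z b (i' * a + j))))))) (abs-< i<b i'<b))))

𝟙-cong : ∀ {p q} {A : Set p} {B : Set q} (d : Dec A) (d' : Dec B) → (A → B) → (B → A) → 𝟙 d ≡ 𝟙 d'
𝟙-cong (yes a) d' f g = sym (𝟙-yes d' (f a))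
𝟙-cong (no ¬a) d' f g = sym (𝟙-no d' (λ b → ¬a (g b)))

Periodic-% : ∀ {q C} .{{_ : NonZero q}} → Periodic q C → ∀ m → (C m → C (m % q)) × (C (m % q) → C m)
Periodic-% {q} {C} h m = (λ c → proj₂ (Periodic-* (m / q) h (m % q)) (subst C (m≡m%n+[m/n]*n m q) c)) ,
             (λ c → subst C (sym (m≡m%n+[m/n]*n m q)) (proj₁ (Periodic-* (m / q) h (m % q)) c))

L-count : ℕ → ℕ
L-count P = ∑[ m < P * P ] 𝟙 (Lset? P m)

Lset-*⇔ : ∀ p P → 0 < p → 0 < P → Coprime p P → ∀ m → (Lset (p * P) m → Lset P m × Lset p m) × (Lset P m × Lset p m → Lset (p * P) m)
Lset-*⇔ p P p>0 P>0 p⊥P m = to , from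
 where
 g∣ : ∀ {d e} → d ∣ e → gcd m d ∣ gcd m e
 g∣ {d} h = gcd-greatest (gcd[m,n]∣m m d) (∣-trans (gcd[m,n]∣n m d) h)
 to : Lset (p * P) m → Lset P m × Lset p m
 to h = ∣-trans (*-pres-∣ (g∣ (n∣m*n p)) (g∣ (n∣m*n p))) h , ∣-trans (*-pres-∣ (g∣ (m∣m*n P)) (g∣ (m∣m*n P))) h
 G = gcd m (p * P)
 G>0 : 0 < G
 G>0 = n≢0⇒n>0 (gcd[m,n]≢0 m (p * P) (inj₂ (>⇒≢ (pos-* p>0 P>0))))
 g⊥g : Coprime (gcd m p) (gcd m P)
 g⊥g = coprime-∣ˡ (gcd[m,n]∣n m p) (coprime-∣ʳ (gcd[m,n]∣n m P) p⊥P)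
 G∣ : G ∣ gcd m p * gcd m P
 G∣ = from (split-divisor G p P G>0 (gcd[m,n]∣n m (p * P)))
  where
  from : (Σ ℕ λ δ₁ → Σ ℕ λ δ₂ → G ≡ δ₁ * δ₂ × δ₁ ∣ p × δ₂ ∣ P) → G ∣ gcd m p * gcd m P
  from (δ₁ , δ₂ , eq , d₁ , d₂) = subst (_∣ gcd m p * gcd m P) (sym eq) (*-pres-∣
   (gcd-greatest (∣-trans (divides δ₂ (trans eq (*-comm δ₁ δ₂))) (gcd[m,n]∣m m (p * P))) d₁)
   (gcd-greatest (∣-trans (divides δ₁ eq) (gcd[m,n]∣m m (p * P))) d₂))
 from : Lset P m × Lset p m → Lset (p * P) m
 from (h₁ , h₂) = ∣-trans (*-pres-∣ G∣ G∣) (subst (_∣ m) (sym (ring74 (gcd m p) (gcd m P)))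
  (coprime-product-∣ (coprime-*ʳ (coprime-*ˡ g⊥g g⊥g) (coprime-*ˡ g⊥g g⊥g)) h₂ h₁))

-- Each of the p blocks of length p contains p - 1 numbers prime to p, and the multiples of p
-- contribute only 0. The density is 1 - 1/p + 1/p²; the term p is moved to the left to avoid
-- subtraction.
L-count-prime : ∀ {p} → Prime p → L-count p + p ≡ p * p + 1
L-count-prime {p@(suc r)} pp = begin
 L-count p + p ≡⟨ cong (_+ p) (∑-blocks p p _) ⟩
 (∑[ i < p ] ∑[ j < p ] 𝟙 (Lset? p (i * p + j))) + p ≡⟨ cong (_+ p) (trans (∑-cong p (λ i i<p → block i i<p)) (∑-split 1 r _)) ⟩
 (0 + (r + 𝟙 (0 ≟ 0))) + (∑[ i < r ] (r + 𝟙 (suc i ≟ 0))) + p ≡⟨ cong (λ v → (r + 1) + v + p) (trans (∑-cong r (λ i _ → +-identityʳ r)) (∑-const r r)) ⟩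
 (r + 1) + r * r + p ≡⟨ ring143 r ⟩
 p * p + 1 ∎
 where
 open ≡-Reasoning
 p∤j : ∀ i j → suc j < p → ¬ p ∣ i * p + suc j
 p∤j i j j<p d = small-∤ z<s j<p (∣m+n∣m⇒∣n d (n∣m*n i))
 unit : ∀ m → ¬ p ∣ m → Lset p m
 unit m p∤m = subst (λ g → g * g ∣ m) (sym (Coprimality.coprime⇒gcd≡1 (Coprimality.sym (prime-coprime pp p∤m)))) (1∣ m)
 multiple : ∀ i → i < p → (Lset p (i * p + 0) → i ≡ 0) × (i ≡ 0 → Lset p (i * p + 0))
 multiple i i<p = (λ h → small-multiple p i (*-cancelʳ-∣ p (subst (p * p ∣_) (+-identityʳ (i * p)) (subst (λ g → g * g ∣ i * p + 0) g≡p h))) i<p) ,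
          (λ { refl → _ ∣0 })
  where
  g≡p : gcd (i * p + 0) p ≡ p
  g≡p = ∣-antisym (gcd[m,n]∣n (i * p + 0) p) (gcd-greatest (∣m∣n⇒∣m+n (n∣m*n i) (p ∣0)) ∣-refl)
 block : ∀ i → i < p → (∑[ j < p ] 𝟙 (Lset? p (i * p + j))) ≡ r + 𝟙 (i ≟ 0)
 block i i<p = begin
  ∑[ j < suc r ] 𝟙 (Lset? p (i * p + j)) ≡⟨ ∑-split 1 r (λ j → 𝟙 (Lset? p (i * p + j))) ⟩
  𝟙 (Lset? p (i * p + 0)) + (∑[ j < r ] 𝟙 (Lset? p (i * p + suc j))) ≡⟨ cong₂ _+_ (𝟙-cong (Lset? p (i * p + 0)) (i ≟ 0) (proj₁ (multiple i i<p)) (proj₂ (multiple i i<p)))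
                                    (trans (∑-cong r (λ j j<r → 𝟙-yes (Lset? p (i * p + suc j)) (unit _ (p∤j i j (s≤s j<r))))) (trans (∑-const r 1) (*-identityʳ r))) ⟩
  𝟙 (i ≟ 0) + r ≡⟨ +-comm (𝟙 (i ≟ 0)) r ⟩
  r + 𝟙 (i ≟ 0) ∎

L-count-* : ∀ {p} P → Prime p → 0 < P → Coprime p P → L-count (p * P) ≡ L-count P * L-count p
L-count-* {p} P pp P>0 p⊥P = begin
 ∑[ m < p * P * (p * P) ] 𝟙 (Lset? (p * P) m) ≡⟨ cong (λ n → ∑ n (λ m → 𝟙 (Lset? (p * P) m))) (ring74 p P) ⟩
 ∑[ m < p * p * (P * P) ] 𝟙 (Lset? (p * P) m) ≡⟨ ∑-cong (p * p * (P * P)) (λ m _ → point m) ⟩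
 ∑[ m < p * p * (P * P) ] 𝟙 (Lset? P (m % (P * P))) * 𝟙 (Lset? p (m % (p * p))) ≡⟨ ∑-crt (P * P) (p * p) (coprime-*ʳ P²⊥p P²⊥p) _ _ ⟩
 L-count P * L-count p ∎
 where
 open ≡-Reasoning
 p>0 : 0 < p
 p>0 = <⇒≤ (prime>1 pp)
 instance
  P²≢0 : NonZero (P * P)
  P²≢0 = >-nonZero (pos-* P>0 P>0)
  p²≢0 : NonZero (p * p)
  p²≢0 = >-nonZero (pos-* p>0 p>0)
 P²⊥p : Coprime (P * P) p
 P²⊥p = coprime-*ˡ {P} {P} {p} (Coprimality.sym p⊥P) (Coprimality.sym p⊥P)
 point : ∀ m → 𝟙 (Lset? (p * P) m) ≡ 𝟙 (Lset? P (m % (P * P))) * 𝟙 (Lset? p (m % (p * p)))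
 point m with Lset? P (m % (P * P)) | Lset? p (m % (p * p))
 ... | yes a | yes b = 𝟙-yes (Lset? (p * P) m) (proj₂ (Lset-*⇔ p P p>0 P>0 p⊥P m) (proj₂ (Periodic-% (Lset-periodic P) m) a , proj₂ (Periodic-% (Lset-periodic p) m) b))
 ... | no ¬a | _ = 𝟙-no (Lset? (p * P) m) (λ h → ¬a (proj₁ (Periodic-% (Lset-periodic P) m) (proj₁ (proj₁ (Lset-*⇔ p P p>0 P>0 p⊥P m) h))))
 ... | yes _ | no ¬b = 𝟙-no (Lset? (p * P) m) (λ h → ¬b (proj₁ (Periodic-% (Lset-periodic p) m) (proj₂ (proj₁ (Lset-*⇔ p P p>0 P>0 p⊥P m) h))))

L-count≤ : ∀ P → L-count P ≤ P * P
L-count≤ P = ∑≤n (P * P) (λ m _ → 𝟙≤1 (Lset? P m))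

-- Induction on B with p = B + 1 prime: the smooth numbers divisible by p are p times smooth numbers
-- up to 2^(t-1), because p ≥ 2, so each power of p costs one dyadic step. In effect each exponent
-- takes at most t + 1 values.
smooth-count : ∀ B t v → (∀ m → v m ≤ 1) → (∀ m → 0 < v m → 0 < m × (∀ p → Prime p → p ∣ m → p ≤ B)) →
        ∑ (suc (2 ^ t)) v ≤ suc t ^ B
smooth-count zero t v v≤1 smooth = ∑-unique (suc (2 ^ t)) v (λ m _ → v≤1 m)
 (λ i j _ _ p q → trans (one i p) (sym (one j q)))
 where
 one : ∀ m → 0 < v m → m ≡ 1
 one m p with smooth m p
 ... | m>0 , h with m ≤? 1
 ... | yes m≤1 = ≤-antisym m≤1 m>0
 ... | no m≰1 with prime-divisor m (≰⇒> m≰1)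
 ... | q , qp , q∣m = contradiction (h q qp q∣m) (<⇒≱ (<⇒≤ (prime>1 qp)))
smooth-count (suc B) t v v≤1 smooth with prime? (suc B)
... | no ¬prime = ≤-trans (smooth-count B t v v≤1 smooth') (m≤n*m (suc t ^ B) (suc t))
 where
 smooth' : ∀ m → 0 < v m → 0 < m × (∀ p → Prime p → p ∣ m → p ≤ B)
 smooth' m v>0 = proj₁ (smooth m v>0) , λ p pp p∣m → s≤s⁻¹ (≤∧≢⇒< (proj₂ (smooth m v>0) p pp p∣m) (λ { refl → ¬prime pp }))
... | yes pp = begin
 ∑ (suc (2 ^ t)) v ≡⟨ ∑-cong (suc (2 ^ t)) (λ m _ → cases m) ⟩
 ∑[ m < suc (2 ^ t) ] (v₀ m + v₁ m) ≡⟨ ∑-+ (suc (2 ^ t)) v₀ v₁ ⟩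
 ∑ (suc (2 ^ t)) v₀ + ∑ (suc (2 ^ t)) v₁ ≤⟨ +-mono-≤ (smooth-count B t v₀ v₀≤1 smooth₀) (multiples t) ⟩
 suc t ^ B + t * suc t ^ B ∎
 where
 open ≤-Reasoning
 p = suc B
 v₀ v₁ : ℕ → ℕ
 v₀ m = (1 ∸ 𝟙 (p ∣? m)) * v m
 v₁ m = 𝟙 (p ∣? m) * v m
 cases : ∀ m → v m ≡ v₀ m + v₁ m
 cases m with p ∣? m
 ... | yes _ = sym (+-identityʳ (v m))
 ... | no _ = sym (trans (+-identityʳ _) (+-identityʳ (v m)))
 v₀≤1 : ∀ m → v₀ m ≤ 1
 v₀≤1 m = ≤-trans (≤-trans (m≤m+n (v₀ m) (v₁ m)) (≤-reflexive (sym (cases m)))) (v≤1 m)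
 smooth₀ : ∀ m → 0 < v₀ m → 0 < m × (∀ q → Prime q → q ∣ m → q ≤ B)
 smooth₀ m pos with p ∣? m
 ... | no p∤m = proj₁ hm , λ q qp q∣m → s≤s⁻¹ (≤∧≢⇒< (proj₂ hm q qp q∣m) (λ { refl → p∤m q∣m }))
  where hm = smooth m (subst (0 <_) (+-identityʳ (v m)) pos)
 multiples : ∀ t → ∑ (suc (2 ^ t)) v₁ ≤ t * suc t ^ B
 multiples zero = ≤-reflexive (∑-zero 2 (λ m m<2 → none m m<2 (v₁ m ≟ 0)))
  where
  none : ∀ m → m < 2 → Dec (v₁ m ≡ 0) → v₁ m ≡ 0
  none m m<2 (yes z) = z
  none m m<2 (no nz) = contradiction (small-∤ (proj₁ (smooth m (proj₂ pq))) (≤-<-trans (s≤s⁻¹ m<2) (prime>1 pp))) (λ f → f (𝟙-pos (p ∣? m) (proj₁ pq)))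
   where pq = *-pos (𝟙 (p ∣? m)) (v m) (n≢0⇒n>0 nz)
 multiples (suc t) = begin
  ∑ (suc (2 ^ suc t)) v₁ ≤⟨ ∑-image (suc (2 ^ suc t)) (suc (2 ^ t)) (_* p) v₁ hit ⟩
  ∑[ m < suc (2 ^ t) ] v₁ (m * p) ≤⟨ smooth-count (suc B) t (λ m → v₁ (m * p)) (λ m → v₁≤1 (m * p)) smooth₁ ⟩
  suc t * suc t ^ B ≤⟨ *-monoʳ-≤ (suc t) (^-monoˡ-≤ B (n≤1+n (suc t))) ⟩
  suc t * suc (suc t) ^ B ∎
  where
  v₁≤1 : ∀ m → v₁ m ≤ 1
  v₁≤1 m = ≤-trans (≤-trans (m≤n+m (v₁ m) (v₀ m)) (≤-reflexive (sym (cases m)))) (v≤1 m)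
  bound : ∀ m₁ → m₁ * p ≤ 2 ^ suc t → m₁ ≤ 2 ^ t
  bound m₁ h = *-cancelˡ-≤ 2 (≤-trans (≤-reflexive (*-comm 2 m₁)) (≤-trans (*-monoʳ-≤ m₁ (prime>1 pp)) h))
  hit : ∀ m → m < suc (2 ^ suc t) → 0 < v₁ m → ∃ λ m₁ → m₁ < suc (2 ^ t) × m₁ * p ≡ m
  hit m m< pos with 𝟙-pos (p ∣? m) (proj₁ (*-pos (𝟙 (p ∣? m)) (v m) pos))
  ... | divides m₁ eq = m₁ , s≤s (bound m₁ (≤-trans (≤-reflexive (sym eq)) (s≤s⁻¹ m<))) , sym eq
  smooth₁ : ∀ m → 0 < v₁ (m * p) → 0 < m × (∀ q → Prime q → q ∣ m → q ≤ p)
  smooth₁ m pos = proj₁ (*-pos m p (proj₁ hm)) , λ q qp q∣m → proj₂ hm q qp (∣m⇒∣m*n p q∣m)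
   where hm = smooth (m * p) (proj₂ (*-pos (𝟙 (p ∣? m * p)) (v (m * p)) pos))

multiples-count : ∀ p N .{{_ : NonZero p}} → ∑[ m < suc N ] 𝟙 (0 <? m) * 𝟙 (p ∣? m) ≤ N / p
multiples-count p N = begin
 ∑ (suc N) e ≤⟨ ∑-image (suc N) (suc (N / p)) (_* p) e hit ⟩
 ∑[ m₁ < suc (N / p) ] e (m₁ * p) ≡⟨ ∑-split 1 (N / p) _ ⟩
 (∑[ i < N / p ] e (suc i * p)) ≤⟨ ∑≤n (N / p) (λ i _ → *-mono-≤ (𝟙≤1 (0 <? suc i * p)) (𝟙≤1 (p ∣? suc i * p))) ⟩
 N / p ∎
 where
 open ≤-Reasoning
 e : ℕ → ℕ
 e m = 𝟙 (0 <? m) * 𝟙 (p ∣? m)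
 hit : ∀ m → m < suc N → 0 < e m → ∃ λ m₁ → m₁ < suc (N / p) × m₁ * p ≡ m
 hit m m< pos with 𝟙-pos (p ∣? m) (proj₂ (*-pos (𝟙 (0 <? m)) (𝟙 (p ∣? m)) pos))
 ... | divides m₁ eq = m₁ , s≤s (/-bound p (≤-trans (≤-reflexive (trans (*-comm p m₁) (sym eq))) (s≤s⁻¹ m<))) , sym eq

large-prime : ℕ → ℕ → ℕ
large-prime B p = 𝟙 (prime? p ×-dec (B <? p))

-- Erdős: few integers up to 2^t are B-smooth, so the multiples of the larger primes cover at least half of them.
∑-large-primes : ∀ B t → 2 * suc t ^ B ≤ 2 ^ t → 2 ^ t ≤ 2 * (∑[ j < 2 ^ t ] large-prime B (suc j) * (2 ^ t / suc j))
∑-large-primes B t bound = +-cancelˡ-≤ N N _ (begin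
 N + N ≡⟨ ring144 N ⟩
 2 * N ≤⟨ *-monoʳ-≤ 2 total ⟩
 2 * (∑ (suc N) v + (∑[ j < N ] χ j * (N / suc j))) ≤⟨ ≤-trans (≤-reflexive (*-distribˡ-+ 2 (∑ (suc N) v) _)) (+-monoˡ-≤ _ (≤-trans (*-monoʳ-≤ 2 (smooth-count B t v v≤1 smooth)) bound)) ⟩
 N + 2 * (∑[ j < N ] χ j * (N / suc j)) ∎)
 where
 open ≤-Reasoning
 N = 2 ^ t
 χ : ℕ → ℕ
 χ j = large-prime B (suc j)
 w v : ℕ → ℕ
 w m = ∑[ j < N ] χ j * 𝟙 (suc j ∣? m)
 v m = 𝟙 (w m ≟ 0) * (𝟙 (0 <? m) * 𝟙 (m ≤? N))
 v≤1 : ∀ m → v m ≤ 1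
 v≤1 m = *-mono-≤ (𝟙≤1 (w m ≟ 0)) (*-mono-≤ (𝟙≤1 (0 <? m)) (𝟙≤1 (m ≤? N)))
 smooth : ∀ m → 0 < v m → 0 < m × (∀ p → Prime p → p ∣ m → p ≤ B)
 smooth m pos = m>0 , small
  where
  p₁ = *-pos (𝟙 (w m ≟ 0)) _ pos
  p₂ = *-pos (𝟙 (0 <? m)) _ (proj₂ p₁)
  m>0 : 0 < m
  m>0 = 𝟙-pos (0 <? m) (proj₁ p₂)
  small : ∀ p → Prime p → p ∣ m → p ≤ B
  small zero pp _ = z≤n
  small p@(suc j) pp p∣m = ≮⇒≥ (λ B<p → >⇒≢ (≤-trans (pos-* (≤-reflexive (sym (𝟙-yes (prime? p ×-dec (B <? p)) (pp , B<p)))) (≤-reflexive (sym (𝟙-yes (p ∣? m) p∣m))))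
   (∑-term N (λ j → χ j * 𝟙 (suc j ∣? m)) (≤-trans (∣⇒≤ {{>-nonZero m>0}} p∣m) (𝟙-pos (m ≤? N) (proj₂ p₂))))) (𝟙-pos (w m ≟ 0) (proj₁ p₁)))
 point : ∀ m → m < suc N → 𝟙 (0 <? m) ≤ v m + 𝟙 (0 <? m) * w m
 point m m< with 0 <? m
 ... | no _ = z≤n
 ... | yes m>0 with w m ≟ 0
 ... | yes _ = ≤-trans (≤-reflexive (sym (cong (λ v → v + 0 + 0) (𝟙-yes (m ≤? N) (s≤s⁻¹ m<))))) (m≤m+n _ _)
 ... | no nz = ≤-trans (n≢0⇒n>0 nz) (≤-reflexive (sym (+-identityʳ (w m))))
 w-sum : ∑[ m < suc N ] 𝟙 (0 <? m) * w m ≤ ∑[ j < N ] χ j * (N / suc j)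
 w-sum = begin
  ∑[ m < suc N ] 𝟙 (0 <? m) * w m ≡⟨ ∑-cong (suc N) (λ m _ → trans (sym (∑-*ˡ N (𝟙 (0 <? m)) _)) (∑-cong N (λ j _ → ring48 (𝟙 (0 <? m)) (χ j) (𝟙 (suc j ∣? m))))) ⟩
  ∑[ m < suc N ] ∑[ j < N ] χ j * (𝟙 (0 <? m) * 𝟙 (suc j ∣? m)) ≡⟨ ∑-swap (suc N) N _ ⟩
  ∑[ j < N ] ∑[ m < suc N ] χ j * (𝟙 (0 <? m) * 𝟙 (suc j ∣? m)) ≤⟨ ∑-mono N (λ j _ → ≤-trans (≤-reflexive (∑-*ˡ (suc N) (χ j) _)) (*-monoʳ-≤ (χ j) (multiples-count (suc j) N))) ⟩
  ∑[ j < N ] χ j * (N / suc j) ∎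
 total : N ≤ ∑ (suc N) v + (∑[ j < N ] χ j * (N / suc j))
 total = begin
  N ≡⟨ sym (trans (∑-const N 1) (*-identityʳ N)) ⟩
  ∑[ i < N ] 𝟙 (0 <? suc i) ≡⟨ sym (∑-split 1 N (λ m → 𝟙 (0 <? m))) ⟩
  ∑[ m < suc N ] 𝟙 (0 <? m) ≤⟨ ∑-mono (suc N) point ⟩
  ∑[ m < suc N ] (v m + 𝟙 (0 <? m) * w m) ≡⟨ ∑-+ (suc N) v _ ⟩
  ∑ (suc N) v + (∑[ m < suc N ] 𝟙 (0 <? m) * w m) ≤⟨ +-monoʳ-≤ (∑ (suc N) v) w-sum ⟩
  ∑ (suc N) v + (∑[ j < N ] χ j * (N / suc j)) ∎

power-beats-polynomial : ∀ B → ∃ λ t → 2 * suc t ^ B ≤ 2 ^ t × B ≤ 2 ^ t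
power-beats-polynomial B = t , key , ≤-trans (≤-trans (n≤2^n B) (^-monoˡ-≤ B (≤-trans (^-monoʳ-≤ 2 {1} {r} (≤-trans (s≤s z≤n) (m≤n+m 16 (8 * B)))) (≤-reflexive (sym st))))) (≤-trans (m≤n*m _ 2) key)
 where
 open ≤-Reasoning
 r = 8 * B + 16
 -- As t + 1 is a power of 2, the claim is a comparison of exponents, r B + 1 ≤ t, and follows from
 -- r B + 2 ≤ 2^r; the choice r = 8B + 16 makes the cubic bound `cube≤2^` sufficient for this.
 t = pred (2 ^ r)
 st : suc t ≡ 2 ^ r
 st = suc-pred (2 ^ r) {{m^n≢0 2 r}}
 small : r * B + 2 ≤ 2 ^ r
 small = *-cancelˡ-≤ 8 (begin
  8 * (r * B + 2) ≤⟨ ≤-trans (m≤m+n _ 240) (m≤m+n _ (128 * B)) ⟩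
  8 * (r * B + 2) + 240 + 128 * B ≡⟨ ring145 B ⟩
  r * r ≤⟨ m≤m*n (r * r) r {{>-nonZero (≤-trans z<s (m≤n+m 16 (8 * B)))}} ⟩
  r * r * r ≤⟨ cube≤2^ r ⟩
  2 ^ (r + 3) ≡⟨ trans (^-distribˡ-+-* 2 r 3) (*-comm (2 ^ r) 8) ⟩
  8 * 2 ^ r ∎)
 key : 2 * suc t ^ B ≤ 2 ^ t
 key = begin
  2 * suc t ^ B ≡⟨ cong (λ x → 2 * x ^ B) st ⟩
  2 * (2 ^ r) ^ B ≡⟨ cong (2 *_) (^-*-assoc 2 r B) ⟩
  2 ^ suc (r * B) ≤⟨ ^-monoʳ-≤ 2 (s≤s⁻¹ (≤-trans (≤-reflexive (+-comm 2 (r * B))) (≤-trans small (≤-reflexive (sym st))))) ⟩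
  2 ^ t ∎

-- Partial products over primes

factor : ∀ {p} {A : Set p} → Dec A → ℕ → ℕ
factor (yes _) p = p
factor (no _) _ = 1

prime-product : ℕ → ℕ → ℕ
prime-product ℓ zero = 1
prime-product ℓ (suc n) = factor (prime? (suc n) ×-dec (ℓ <? suc n)) (suc n) * prime-product ℓ n

-- This is (1 + x/T) (1 - 1/p + 1/p²) ≤ 1 for x/T ≤ 1/(2p), with p = n + 2: the gain x/T uses up at
-- most half of the loss 1/p, and the other half covers the terms of higher order.
prime-gain-suc : ∀ T x n → 2 * (suc (suc n) * x) ≤ T → (T + x) * (suc (suc n) * suc (suc n) + 1) ≤ T * (suc (suc n) * suc (suc n)) + (T + x) * suc (suc n)
prime-gain-suc T x n h = begin
 (T + x) * (p * p + 1) ≤⟨ m≤m+n _ (x * (n * n + n + n + n + 1)) ⟩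
 (T + x) * (p * p + 1) + x * (n * n + n + n + n + 1) ≡⟨ ring146 T x n ⟩
 T * (p * p) + (T + x * p) + suc n * (2 * (p * x)) ≤⟨ +-monoʳ-≤ (T * (p * p) + (T + x * p)) (*-monoʳ-≤ (suc n) h) ⟩
 T * (p * p) + (T + x * p) + suc n * T ≡⟨ ring147 T x n ⟩
 T * (p * p) + (T + x) * p ∎
 where
 open ≤-Reasoning
 p = suc (suc n)
prime-gain : ∀ p → 1 < p → ∀ T x → 2 * (p * x) ≤ T → (T + x) * (p * p + 1) ≤ T * (p * p) + (T + x) * p
prime-gain (suc zero) (s≤s ())
prime-gain (suc (suc n)) _ T x h = prime-gain-suc T x n h

shrink-arithmetic : ∀ N s c q c' q' → 0 < N → N ≤ 2 * s → (2 * N + s) * c * q' ≤ 2 * N * q * c' → 5 * (c * q') ≤ 4 * (q * c')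
shrink-arithmetic N s c q c' q' N>0 half h = *-cancelˡ-≤ N {{>-nonZero N>0}} (begin
 N * (5 * (c * q')) ≡⟨ ring148 N c q' ⟩
 (4 * N + N) * c * q' ≤⟨ *-monoˡ-≤ q' (*-monoˡ-≤ c (+-monoʳ-≤ (4 * N) half)) ⟩
 (4 * N + 2 * s) * c * q' ≡⟨ ring149 N s c q' ⟩
 2 * ((2 * N + s) * c * q') ≤⟨ *-monoʳ-≤ 2 h ⟩
 2 * (2 * N * q * c') ≡⟨ ring150 N q c' ⟩
 N * (4 * (q * c')) ∎)
 where
 open ≤-Reasoning

shrink-compose : ∀ a b c q c' q' → 0 < q' → 5 * (c * q') ≤ 4 * (q * c') → a * c' ≤ b * q' → 5 * a * c ≤ 4 * b * q
shrink-compose a b c q c' q' q'>0 h ih = *-cancelʳ-≤ _ _ q' {{>-nonZero q'>0}} (begin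
 5 * a * c * q' ≡⟨ ring151 a c q' ⟩
 a * (5 * (c * q')) ≤⟨ *-monoʳ-≤ a h ⟩
 a * (4 * (q * c')) ≡⟨ ring152 a q c' ⟩
 4 * (a * c') * q ≤⟨ *-monoˡ-≤ q (*-monoʳ-≤ 4 ih) ⟩
 4 * (b * q') * q ≡⟨ ring153 b q' q ⟩
 4 * b * q * q' ∎)
 where
 open ≤-Reasoning

bernoulli : ∀ r → (4 + r) * 4 ^ r ≤ 4 * 5 ^ r
bernoulli zero = ≤-refl
bernoulli (suc r) = begin
 (4 + suc r) * (4 * 4 ^ r) ≤⟨ m≤m+n _ (r * 4 ^ r) ⟩
 (4 + suc r) * (4 * 4 ^ r) + r * 4 ^ r ≡⟨ ring154 r (4 ^ r) ⟩
 5 * ((4 + r) * 4 ^ r) ≤⟨ *-monoʳ-≤ 5 (bernoulli r) ⟩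
 5 * (4 * 5 ^ r) ≡⟨ ring155 (5 ^ r) ⟩
 4 * (5 * 5 ^ r) ∎
 where
 open ≤-Reasoning

module PrimeProduct (ℓ : ℕ) where

 P c q : ℕ → ℕ
 P n = prime-product ℓ n
 c n = L-count (P n)
 q n = P n * P n

 P>0 : ∀ n → 0 < P n
 P>0 zero = z<s
 P>0 (suc n) with prime? (suc n) ×-dec (ℓ <? suc n)
 ... | yes _ = pos-* {suc n} {P n} z<s (P>0 n)
 ... | no _ = pos-* {1} {P n} z<s (P>0 n)

 q>0 : ∀ n → 0 < q n
 q>0 n = pos-* (P>0 n) (P>0 n)

 divisors : ∀ n p → Prime p → p ∣ P n → ℓ < p × p ≤ n
 divisors zero p pp p∣1 = contradiction (∣⇒≤ p∣1) (<⇒≱ (prime>1 pp))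
 divisors (suc n) p pp p∣ with prime? (suc n) ×-dec (ℓ <? suc n)
 ... | no _ = proj₁ ih , m≤n⇒m≤1+n (proj₂ ih)
  where ih = divisors n p pp (subst (p ∣_) (+-identityʳ (P n)) p∣)
 ... | yes (qp , ℓ<q) with euclidsLemma (suc n) (P n) pp p∣
 ... | inj₂ p∣P = proj₁ (divisors n p pp p∣P) , m≤n⇒m≤1+n (proj₂ (divisors n p pp p∣P))
 ... | inj₁ p∣q with prime⇒irreducible qp p∣q
 ... | inj₁ refl = contradiction (prime>1 pp) (<-irrefl refl)
 ... | inj₂ refl = ℓ<q , ≤-refl

 fresh : ∀ n → Prime (suc n) → Coprime (suc n) (P n)
 fresh n pp = prime-coprime pp (λ d → <⇒≱ (n<1+n n) (proj₂ (divisors n (suc n) pp d)))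

 squarefree : ∀ n → Squarefree (P n)
 squarefree zero p pp d = contradiction (∣⇒≤ (∣-trans (m∣m*n p) d)) (<⇒≱ (prime>1 pp))
 squarefree (suc n) p pp d with prime? (suc n) ×-dec (ℓ <? suc n)
 ... | no _ = squarefree n p pp (subst (p * p ∣_) (+-identityʳ (P n)) d)
 ... | yes (qp , _) with p ≟ suc n
 ... | yes refl = <⇒≱ (n<1+n n) (proj₂ (divisors n (suc n) pp (*-cancelˡ-∣ (suc n) d)))
 ... | no p≢q = squarefree n p pp (coprime-divisor (coprime-*ˡ p⊥q p⊥q) d)
  where
  p⊥q : Coprime p (suc n)
  p⊥q = prime-coprime pp (λ p∣q → p≢q (prime-irr p∣q))
   where
   prime-irr : p ∣ suc n → p ≡ suc n
   prime-irr p∣q with prime⇒irreducible qp p∣q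
   ... | inj₁ refl = contradiction (prime>1 pp) (<-irrefl refl)
   ... | inj₂ eq = eq

 data Step (n : ℕ) : Set where
  skip : ¬ (Prime (suc n) × ℓ < suc n) → c (suc n) ≡ c n → q (suc n) ≡ q n → Step n
  take : Prime (suc n) → ℓ < suc n → c (suc n) + c n * suc n ≡ c n * (suc n * suc n + 1) → q (suc n) ≡ q n * (suc n * suc n) → Step n

 step : ∀ n → Step n
 step n = go (prime? (suc n) ×-dec (ℓ <? suc n)) refl
  where
  go : (d : Dec (Prime (suc n) × ℓ < suc n)) → P (suc n) ≡ factor d (suc n) * P n → Step n
  go (no ¬h) eq = skip ¬h (cong L-count eq') (cong₂ _*_ eq' eq')
   where
   eq' : P (suc n) ≡ P n
   eq' = trans eq (+-identityʳ (P n))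
  go (yes (pp , ℓ<p)) eq = take pp ℓ<p
   (trans (cong (_+ c n * suc n) (trans (cong L-count eq) (L-count-* (P n) pp (P>0 n) (fresh n pp))))
    (trans (sym (*-distribˡ-+ (c n) (L-count (suc n)) (suc n))) (cong (c n *_) (L-count-prime pp))))
   (trans (cong₂ _*_ eq eq) (ring123 (suc n) (P n)))

 module Block (B N : ℕ) (ℓ≤B : ℓ ≤ B) (N>0 : 0 < N) where

  S : ℕ → ℕ
  S n = ∑[ j < n ] large-prime B (suc j) * (N / suc j)

  S-small : S B ≡ 0
  S-small = ∑-zero B (λ j j<B → cong (_* (N / suc j)) (𝟙-no (prime? (suc j) ×-dec (B <? suc j)) (λ h → <⇒≱ (proj₂ h) j<B)))

  -- In terms of the density d = c / q of L: the product of 1 + S/(2N) and d(n) never exceeds d(B).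
  -- Each prime p beyond B multiplies d by 1 - 1/p + 1/p² and adds about N / p to S, and
  -- `prime-gain` compares the two effects.
  invariant : ∀ k → (2 * N + S (k + B)) * c (k + B) * q B ≤ 2 * N * q (k + B) * c B
  invariant zero = ≤-reflexive (trans (cong (λ v → (2 * N + v) * c B * q B) S-small) (ring60 N (c B) (q B)))
  invariant (suc k) = go (step n)
   where
   n = k + B
   p = suc n
   x = N / p
   T = 2 * N + S n
   px≤ : p * x ≤ N
   px≤ = d*[n/d]≤n N p
   go : Step n → (2 * N + S p) * c p * q B ≤ 2 * N * q p * c B
   go (skip ¬h c≡ q≡) = subst₂ (λ c' q' → (2 * N + S p) * c' * q B ≤ 2 * N * q' * c B) (sym c≡) (sym q≡)
    (subst (λ v → (2 * N + v) * c n * q B ≤ 2 * N * q n * c B) (sym S≡) (invariant k))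
    where
    S≡ : S p ≡ S n
    S≡ = trans (cong (λ v → S n + v * x) (𝟙-no (prime? p ×-dec (B <? p)) (λ h → ¬h (proj₁ h , ≤-<-trans ℓ≤B (proj₂ h))))) (+-identityʳ (S n))
   go (take pp _ c≡ q≡) = subst (λ v → (2 * N + v) * c p * q B ≤ 2 * N * q p * c B) (sym S≡) (+-cancelʳ-≤ ((2 * N + (S n + x)) * (c n * p) * q B) _ _ (begin
    (2 * N + (S n + x)) * c p * q B + (2 * N + (S n + x)) * (c n * p) * q B ≡⟨ ring29 (2 * N) (S n) x (c p) (c n * p) (q B) ⟩
    (T + x) * (c p + c n * p) * q B ≡⟨ cong (λ v → (T + x) * v * q B) c≡ ⟩
    (T + x) * (c n * (p * p + 1)) * q B ≡⟨ ring30 (T + x) (c n) (p * p + 1) (q B) ⟩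
    (T + x) * (p * p + 1) * (c n * q B) ≤⟨ *-monoˡ-≤ (c n * q B) (prime-gain p (prime>1 pp) T x (≤-trans (*-monoʳ-≤ 2 px≤) (m≤m+n (2 * N) (S n)))) ⟩
    (T * (p * p) + (T + x) * p) * (c n * q B) ≡⟨ ring31 T (p * p) (T + x) p (c n) (q B) ⟩
    T * c n * q B * (p * p) + (T + x) * (c n * p) * q B ≤⟨ +-monoˡ-≤ ((T + x) * (c n * p) * q B) (*-monoˡ-≤ (p * p) (invariant k)) ⟩
    2 * N * q n * c B * (p * p) + (T + x) * (c n * p) * q B ≡⟨ cong₂ _+_ (trans (ring32 (2 * N) (q n) (c B) (p * p)) (cong (λ v → 2 * N * v * c B) (sym q≡))) (cong (λ v → v * (c n * p) * q B) (+-assoc (2 * N) (S n) x)) ⟩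
    2 * N * q p * c B + (2 * N + (S n + x)) * (c n * p) * q B ∎))
    where
    open ≤-Reasoning
    S≡ : S p ≡ S n + x
    S≡ = trans (cong (λ v → S n + v * x) (𝟙-yes (prime? p ×-dec (B <? p)) (pp , s≤s (m≤n+m B k)))) (cong (_+_ (S n)) (+-identityʳ x))

 -- By Erdős' bound S ≥ N/2, hence 1 + S/(2N) ≥ 5/4: a finite range of primes beyond B multiplies
 -- the density by at most 4/5, and this can be repeated.
 shrink : ∀ B → ℓ ≤ B → ∃ λ N → B ≤ N × 5 * (c N * q B) ≤ 4 * (q N * c B)
 shrink B ℓ≤B = from (power-beats-polynomial B)
  where
  from : (∃ λ t → 2 * suc t ^ B ≤ 2 ^ t × B ≤ 2 ^ t) → ∃ λ N → B ≤ N × 5 * (c N * q B) ≤ 4 * (q N * c B)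
  from (t , bound , B≤N) = go (2 ^ t) B≤N (m^n>0 2 t) (∑-large-primes B t bound)
   where
   go : ∀ N → B ≤ N → 0 < N → N ≤ 2 * (∑[ j < N ] large-prime B (suc j) * (N / suc j)) → ∃ λ N → B ≤ N × 5 * (c N * q B) ≤ 4 * (q N * c B)
   go N B≤N N>0 half = N , B≤N , shrink-arithmetic N (S N) (c N) (q N) (c B) (q B) N>0 half
     (subst (λ n → (2 * N + S n) * c n * q B ≤ 2 * N * q n * c B) (m∸n+n≡m B≤N) (invariant (N ∸ B)))
    where open Block B N ℓ≤B N>0

 shrink^ : ∀ r → ∃ λ n → ℓ ≤ n × 5 ^ r * c n ≤ 4 ^ r * q n
 shrink^ zero = ℓ , ≤-refl , *-monoʳ-≤ 1 (L-count≤ (P ℓ))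
 shrink^ (suc r) = from (shrink^ r)
  where
  from : (∃ λ n → ℓ ≤ n × 5 ^ r * c n ≤ 4 ^ r * q n) → ∃ λ n → ℓ ≤ n × 5 * 5 ^ r * c n ≤ 4 * 4 ^ r * q n
  from (B , ℓ≤B , ih) = go (shrink B ℓ≤B)
   where
   go : (∃ λ N → B ≤ N × 5 * (c N * q B) ≤ 4 * (q N * c B)) → ∃ λ n → ℓ ≤ n × 5 * 5 ^ r * c n ≤ 4 * 4 ^ r * q n
   go (N , B≤N , h) = N , ≤-trans ℓ≤B B≤N , shrink-compose (5 ^ r) (4 ^ r) (c N) (q N) (c B) (q B) (q>0 B) h ih

 product-tends-to-0 : ∀ D → ∃ λ n → D * c n < q n
 product-tends-to-0 D with shrink^ (4 * D)
 ... | n , _ , h = n , strict (c n) bound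
  where
  growth : suc D * 4 ^ (4 * D) ≤ 5 ^ (4 * D)
  growth = *-cancelˡ-≤ 4 (≤-trans (≤-reflexive (ring61 D (4 ^ (4 * D)))) (bernoulli (4 * D)))
  bound : suc D * c n ≤ q n
  bound = *-cancelˡ-≤ (4 ^ (4 * D)) {{m^n≢0 4 (4 * D)}} (≤-trans (≤-reflexive (ring13 (4 ^ (4 * D)) (suc D) (c n))) (≤-trans (*-monoˡ-≤ (c n) growth) h))
  strict : ∀ c → suc D * c ≤ q n → D * c < q n
  strict zero _ = subst (_< q n) (sym (*-zeroʳ D)) (q>0 n)
  strict (suc c) h = ≤-trans (s≤s (m≤n+m (D * suc c) c)) h

 -- At the step where c / q falls below B'/D the previous ratio was still at least B'/D, and as B'/D
 -- ≤ 1 the factor 1 - 1/p + 1/p² lowers this bound by at most 1/p < 1/ℓ. Thus B'/D is undershot by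
 -- at most 1/ℓ. The search runs downwards from an n with ratio below B'/D and must stop before n =
 -- 0, where the ratio is 1.
 first : ∀ D B' → B' ≤ D → ∀ n → D * c n < B' * q n → ∃ λ m → D * c m < B' * q m × B' * q m * ℓ ≤ D * c m * ℓ + D * q m
 first D B' B'≤D zero h = contradiction B'≤D (<⇒≱ (subst₂ _<_ (*-identityʳ D) (*-identityʳ B') h))
 first D B' B'≤D (suc n) h with D * c n <? B' * q n
 ... | yes h' = first D B' B'≤D n h'
 ... | no ≮ = go (step n)
  where
  open ≤-Reasoning
  p = suc n
  go : Step n → ∃ λ m → D * c m < B' * q m × B' * q m * ℓ ≤ D * c m * ℓ + D * q m
  go (skip _ c≡ q≡) = contradiction (subst₂ (λ c q → D * c < B' * q) c≡ q≡ h) ≮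
  go (take pp ℓ<p c≡ q≡) = suc n , h , +-cancelʳ-≤ (D * (c n * p) * ℓ) _ _ (begin
   B' * q p * ℓ + D * (c n * p) * ℓ ≡⟨ cong (λ v → B' * v * ℓ + D * (c n * p) * ℓ) q≡ ⟩
   B' * (q n * (p * p)) * ℓ + D * (c n * p) * ℓ ≡⟨ ring62 B' (q n) n ℓ D (c n) ⟩
   B' * q n * (n * p * ℓ) + (D * c n * (p * ℓ) + B' * (q n * p) * ℓ) ≤⟨ +-mono-≤ (*-monoˡ-≤ (n * p * ℓ) (≮⇒≥ ≮)) (+-monoʳ-≤ (D * c n * (p * ℓ)) (*-mono-≤ (*-monoˡ-≤ (q n * p) B'≤D) (<⇒≤ ℓ<p))) ⟩
   D * c n * (n * p * ℓ) + (D * c n * (p * ℓ) + D * (q n * p) * p) ≤⟨ m≤m+n _ (D * c n * ℓ) ⟩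
   D * c n * (n * p * ℓ) + (D * c n * (p * ℓ) + D * (q n * p) * p) + D * c n * ℓ ≡⟨ ring63 D (c n) n ℓ (q n) ⟩
   D * (c n * (p * p + 1)) * ℓ + D * (q n * (p * p)) ≡⟨ cong₂ (λ u v → D * u * ℓ + D * v) (sym c≡) (sym q≡) ⟩
   D * (c p + c n * p) * ℓ + D * q p ≡⟨ ring64 D (c p) (c n * p) ℓ (D * q p) ⟩
   D * c p * ℓ + D * q p + D * (c n * p) * ℓ ∎)

 -- The interval from A'/D to B'/D is longer than 2/ℓ. One 1/ℓ pays for the undershoot in `first`;
 -- the other stays in reserve above A'/D for the multiples of ℓ, about which `generic` says
 -- nothing.
 choose : ∀ D A' B' → 2 * D < ℓ → A' < B' → B' ≤ D → ∃ λ n → D * c n < B' * q n × A' * q n * ℓ + D * q n < D * c n * ℓ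
 choose D A' B' 2D<ℓ A'<B' B'≤D = from (product-tends-to-0 D)
  where
  margin : ∀ c q → 0 < q → B' * q * ℓ ≤ D * c * ℓ + D * q → A' * q * ℓ + D * q < D * c * ℓ
  margin c q q>0 close = +-cancelʳ-< (D * q) _ _ (begin-strict
   A' * q * ℓ + D * q + D * q ≡⟨ ring124 (A' * q * ℓ) D q ⟩
   A' * q * ℓ + 2 * D * q <⟨ +-monoʳ-< (A' * q * ℓ) (*-monoˡ-< q {{>-nonZero q>0}} 2D<ℓ) ⟩
   A' * q * ℓ + ℓ * q ≡⟨ ring125 A' q ℓ ⟩
   suc A' * q * ℓ ≤⟨ *-monoˡ-≤ ℓ (*-monoˡ-≤ q A'<B') ⟩
   B' * q * ℓ ≤⟨ close ⟩
   D * c * ℓ + D * q ∎)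
   where open ≤-Reasoning
  from : (∃ λ n → D * c n < q n) → ∃ λ n → D * c n < B' * q n × A' * q n * ℓ + D * q n < D * c n * ℓ
  from (n₀ , small) = go (first D B' B'≤D n₀ (≤-trans small (m≤n*m (q n₀) B' {{>-nonZero (≤-trans z<s A'<B')}})))
   where
   go : (∃ λ m → D * c m < B' * q m × B' * q m * ℓ ≤ D * c m * ℓ + D * q m) → ∃ λ n → D * c n < B' * q n × A' * q n * ℓ + D * q n < D * c n * ℓ
   go (n , below , close) = n , below , margin (c n) (q n) (q>0 n) close

-- Limits of counting ratios

periodic-density : ∀ {q C} → 0 < q → Periodic q C → (C? : ∀ m → Dec (C m)) → ∀ n →
 q * (∑[ m < n ] 𝟙 (C? m)) ≤ (∑[ m < q ] 𝟙 (C? m)) * n + q * q × (∑[ m < q ] 𝟙 (C? m)) * n ≤ q * (∑[ m < n ] 𝟙 (C? m)) + q * q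
periodic-density {q} {C} q>0 per C? n = upper , lower
 where
 open ≤-Reasoning
 instance
  q≢0 : NonZero q
  q≢0 = >-nonZero q>0
 g : ℕ → ℕ
 g m = 𝟙 (C? m)
 c t : ℕ
 c = ∑ q g
 t = n / q
 c≤q : c ≤ q
 c≤q = ∑≤n q (λ m _ → 𝟙≤1 (C? m))
 whole : ∀ t → ∑ (t * q) g ≡ t * c
 whole t = trans (∑-blocks t q g) (trans (∑-cong t (λ i _ → ∑-cong q (λ j _ → shift i j))) (∑-const t c))
  where
  shift : ∀ i j → g (i * q + j) ≡ g j
  shift i j = trans (cong g (+-comm (i * q) j)) (𝟙-cong (C? (j + i * q)) (C? j) (proj₂ (Periodic-* i per j)) (proj₁ (Periodic-* i per j)))
 tq≤n : t * q ≤ n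
 tq≤n = ≤-trans (≤-reflexive (*-comm t q)) (d*[n/d]≤n n q)
 n≤ : n ≤ suc t * q
 n≤ = ≤-trans (≤-reflexive (m≡m%n+[m/n]*n n q)) (+-monoˡ-≤ (t * q) (<⇒≤ (m%n<n n q)))
 upper : q * ∑ n g ≤ c * n + q * q
 upper = begin
  q * ∑ n g ≤⟨ *-monoʳ-≤ q (≤-trans (∑-mono-range g n≤) (≤-reflexive (whole (suc t)))) ⟩
  q * (suc t * c) ≡⟨ ring156 q t c ⟩
  c * (t * q) + q * c ≤⟨ +-mono-≤ (*-monoʳ-≤ c tq≤n) (*-monoʳ-≤ q c≤q) ⟩
  c * n + q * q ∎
 lower : c * n ≤ q * ∑ n g + q * q
 lower = begin
  c * n ≤⟨ *-monoʳ-≤ c n≤ ⟩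
  c * (suc t * q) ≡⟨ ring157 q t c ⟩
  q * (t * c) + c * q ≤⟨ +-mono-≤ (*-monoʳ-≤ q (≤-trans (≤-reflexive (sym (whole t))) (∑-mono-range g tq≤n))) (*-monoˡ-≤ q c≤q) ⟩
  q * ∑ n g + q * q ∎

-- R speaks of the existence of representations and carries no decision procedure in general, so it
-- is counted through any 0-1 function that agrees with it on [1, N]. The value 0 at 0 lets the sums
-- start at 0.
record Indicates (R : ℕ → Set) (N : ℕ) (ρ : ℕ → ℕ) : Set where
 field
  ρ≤1 : ∀ m → ρ m ≤ 1
  ρ-0 : ρ 0 ≡ 0
  sound : ∀ m → 0 < m → m ≤ N → 0 < ρ m → R m
  full : ∀ m → 0 < m → m ≤ N → ρ m ≡ 0 → ¬ R m

Ratio : (ℕ → Set) → ℕ → ℚ → Set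
Ratio R M q = Σ (ℕ → ℕ) λ ρ → Indicates R (suc M) ρ × q ≡ (+ ∑ (suc (suc M)) ρ) ℚ./ suc M

almost-all-count : ∀ {C R : ℕ → Set} → (C? : ∀ m → Dec (C m)) → AlmostAll C R → ∀ ν → ∃ λ N₀ → ∀ N → N₀ ≤ N → ∀ ρ → Indicates R N ρ →
 ν * (∑[ m < suc N ] 𝟙 (C? m)) ≤ ν * ∑ (suc N) ρ + 2 * N
almost-all-count {C} {R} C? aa ν = proj₁ (aa ν) + suc ν , bound
 where
 open ≤-Reasoning
 bound : ∀ N → proj₁ (aa ν) + suc ν ≤ N → ∀ ρ → Indicates R N ρ → ν * (∑[ m < suc N ] 𝟙 (C? m)) ≤ ν * ∑ (suc N) ρ + 2 * N
 bound N N≥ ρ ind = begin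
  ν * (∑[ m < suc N ] 𝟙 (C? m)) ≤⟨ *-monoʳ-≤ ν (∑-mono (suc N) point) ⟩
  ν * (∑[ m < suc N ] (e m + (ρ m + 𝟙 (0 ≟ m)))) ≡⟨ cong (ν *_) (trans (∑-+ (suc N) e _) (cong (_+_ (∑ (suc N) e)) (trans (∑-+ (suc N) ρ _) (cong (_+_ (∑ (suc N) ρ)) (∑-𝟙-hit (suc N) 0 z<s))))) ⟩
  ν * (∑ (suc N) e + (∑ (suc N) ρ + 1)) ≡⟨ ring126 ν (∑ (suc N) e) (∑ (suc N) ρ) ⟩
  ν * ∑ (suc N) ρ + (ν * ∑ (suc N) e + ν) ≤⟨ +-monoʳ-≤ (ν * ∑ (suc N) ρ) (+-monoˡ-≤ ν (proj₂ (aa ν) (suc N) (≤-trans (m≤m+n _ (suc ν)) (m≤n⇒m≤1+n N≥)) e e≤1 supp)) ⟩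
  ν * ∑ (suc N) ρ + (suc N + ν) ≡⟨ cong (_+_ (ν * ∑ (suc N) ρ)) (sym (+-suc N ν)) ⟩
  ν * ∑ (suc N) ρ + (N + suc ν) ≤⟨ +-monoʳ-≤ (ν * ∑ (suc N) ρ) (+-monoʳ-≤ N (≤-trans (≤-trans (m≤n+m (suc ν) _) N≥) (≤-reflexive (sym (+-identityʳ N))))) ⟩
  ν * ∑ (suc N) ρ + 2 * N ∎
  where
  open Indicates ind
  -- The exceptional set: members of C rejected by ρ. The number 0 is excluded because ρ is not
  -- compared with R there; this costs the summand `𝟙 (0 ≟ m)`.
  e : ℕ → ℕ
  e m = 𝟙 (C? m) * ((1 ∸ ρ m) * 𝟙 (0 <? m))
  e≤1 : ∀ m → e m ≤ 1
  e≤1 m = *-mono-≤ (𝟙≤1 (C? m)) (*-mono-≤ (m∸n≤m 1 (ρ m)) (𝟙≤1 (0 <? m)))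
  supp : ∀ m → m < suc N → 0 < e m → C m × ¬ R m
  supp m m< pos = 𝟙-pos (C? m) (proj₁ p₁) , full m (𝟙-pos (0 <? m) (proj₂ p₂)) (s≤s⁻¹ m<) (zero-ρ (ρ m) (proj₁ p₂))
   where
   p₁ = *-pos (𝟙 (C? m)) _ pos
   p₂ = *-pos (1 ∸ ρ m) _ (proj₂ p₁)
   zero-ρ : ∀ x → 0 < 1 ∸ x → x ≡ 0
   zero-ρ zero _ = refl
   zero-ρ (suc x) h = contradiction (subst (0 <_) (0∸n≡0 x) h) (λ ())
  point : ∀ m → m < suc N → 𝟙 (C? m) ≤ e m + (ρ m + 𝟙 (0 ≟ m))
  point zero _ = ≤-trans (𝟙≤1 (C? 0)) (≤-trans (m≤n+m 1 (ρ 0)) (m≤n+m (ρ 0 + 1) (e 0)))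
  point (suc i) _ = split (𝟙 (C? (suc i))) (ρ (suc i)) (𝟙≤1 (C? (suc i)))
   where
   split : ∀ a x → a ≤ 1 → a ≤ a * ((1 ∸ x) * 1) + (x + 0)
   split a zero _ = ≤-trans (≤-reflexive (sym (*-identityʳ a))) (m≤m+n (a * 1) 0)
   split a (suc x) a≤ = ≤-trans a≤ (≤-trans (s≤s z≤n) (m≤n+m (suc x + 0) _))

covered-count : ∀ {C R : ℕ → Set} {d} → 0 < d → (C? : ∀ m → Dec (C m)) → (∀ m → R m → C m ⊎ d ∣ m) → ∀ N ρ → Indicates R N ρ →
 ∃ λ x → d * x ≤ N × ∑ (suc N) ρ ≤ (∑[ m < suc N ] 𝟙 (C? m)) + x
covered-count {C} {R} {d} d>0 C? cover N ρ ind = N / d , d*[n/d]≤n N d , (begin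
 ∑ (suc N) ρ ≤⟨ ∑-mono (suc N) point ⟩
 ∑[ m < suc N ] (𝟙 (C? m) + 𝟙 (0 <? m) * 𝟙 (d ∣? m)) ≡⟨ ∑-+ (suc N) _ _ ⟩
 (∑[ m < suc N ] 𝟙 (C? m)) + (∑[ m < suc N ] 𝟙 (0 <? m) * 𝟙 (d ∣? m)) ≤⟨ +-monoʳ-≤ _ (multiples-count d N) ⟩
 (∑[ m < suc N ] 𝟙 (C? m)) + N / d ∎)
 where
 open ≤-Reasoning
 open Indicates ind
 instance
  d≢0 : NonZero d
  d≢0 = >-nonZero d>0
 point : ∀ m → m < suc N → ρ m ≤ 𝟙 (C? m) + 𝟙 (0 <? m) * 𝟙 (d ∣? m)
 point zero _ = ≤-trans (≤-reflexive ρ-0) z≤n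
 point (suc i) m< with ρ (suc i) ≟ 0
 ... | yes z = ≤-trans (≤-reflexive z) z≤n
 ... | no nz with cover (suc i) (sound (suc i) z<s (s≤s⁻¹ m<) (n≢0⇒n>0 nz))
 ... | inj₁ c = ≤-trans (ρ≤1 (suc i)) (≤-trans (≤-reflexive (sym (𝟙-yes (C? (suc i)) c))) (m≤m+n _ _))
 ... | inj₂ d∣ = ≤-trans (ρ≤1 (suc i)) (≤-trans (≤-reflexive (sym (cong (_+ 0) (𝟙-yes (d ∣? suc i) d∣)))) (m≤n+m _ (𝟙 (C? (suc i)))))

Approximates : (ℕ → Set) → ℕ → ℕ → ℕ → Set
Approximates R ν q c = ∃ λ N₀ → ∀ N → N₀ ≤ N → ∀ ρ → Indicates R N ρ →
 ν * q * ∑ (suc N) ρ ≤ ν * c * N + q * N × ν * c * N ≤ ν * q * ∑ (suc N) ρ + q * N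

upper-arithmetic : ∀ ν q c N k C x d → 4 * ν ≤ d → c ≤ q → 4 * ν * suc q ≤ N → d * x ≤ N → k ≤ C + x → q * C ≤ c * suc N + q * q → ν * q * k ≤ ν * c * N + q * N
upper-arithmetic ν q c N k C x d ν≤d c≤q N≥ dx≤ k≤ C≤ = *-cancelˡ-≤ 4 (begin
 4 * (ν * q * k) ≤⟨ *-monoʳ-≤ 4 (*-monoʳ-≤ (ν * q) k≤) ⟩
 4 * (ν * q * (C + x)) ≡⟨ ring158 ν q C x ⟩
 4 * ν * (q * C) + q * (4 * ν * x) ≤⟨ +-mono-≤ (*-monoʳ-≤ (4 * ν) C≤) (*-monoʳ-≤ q (≤-trans (*-monoˡ-≤ x ν≤d) dx≤)) ⟩
 4 * ν * (c * suc N + q * q) + q * N ≡⟨ ring159 ν c N q ⟩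
 4 * ν * c * N + (4 * ν * (c + q * q) + q * N) ≤⟨ +-monoʳ-≤ (4 * ν * c * N) (+-monoˡ-≤ (q * N) (*-monoʳ-≤ (4 * ν) (+-monoˡ-≤ (q * q) c≤q))) ⟩
 4 * ν * c * N + (4 * ν * (q + q * q) + q * N) ≡⟨ ring160 ν c N q ⟩
 4 * ν * c * N + (q * (4 * ν * suc q) + q * N) ≤⟨ +-monoʳ-≤ (4 * ν * c * N) (+-monoˡ-≤ (q * N) (*-monoʳ-≤ q N≥)) ⟩
 4 * ν * c * N + (q * N + q * N) ≤⟨ m≤m+n _ (2 * (q * N)) ⟩
 4 * ν * c * N + (q * N + q * N) + 2 * (q * N) ≡⟨ ring161 ν c N q ⟩
 4 * (ν * c * N + q * N) ∎)
 where
 open ≤-Reasoning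

lower-arithmetic : ∀ ν q c N k C → 4 * ν * suc q ≤ N → 4 * ν * C ≤ 4 * ν * k + 2 * N → c * suc N ≤ q * C + q * q → ν * c * N ≤ ν * q * k + q * N
lower-arithmetic ν q c N k C N≥ C≤ h = *-cancelˡ-≤ 4 (begin
 4 * (ν * c * N) ≤⟨ *-monoʳ-≤ 4 (*-monoʳ-≤ (ν * c) (n≤1+n N)) ⟩
 4 * (ν * c * suc N) ≡⟨ ring162 ν c (suc N) ⟩
 4 * ν * (c * suc N) ≤⟨ *-monoʳ-≤ (4 * ν) h ⟩
 4 * ν * (q * C + q * q) ≡⟨ ring163 ν q C ⟩
 q * (4 * ν * C) + q * (4 * ν * q) ≤⟨ +-mono-≤ (*-monoʳ-≤ q C≤) (*-monoʳ-≤ q (≤-trans (*-monoʳ-≤ (4 * ν) (n≤1+n q)) N≥)) ⟩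
 q * (4 * ν * k + 2 * N) + q * N ≤⟨ m≤m+n _ (q * N) ⟩
 q * (4 * ν * k + 2 * N) + q * N + q * N ≡⟨ ring164 ν q k N ⟩
 4 * (ν * q * k + q * N) ∎)
 where
 open ≤-Reasoning

module Limit {ℓ P : ℕ} {R : ℕ → Set} (cert : Certificate ℓ P R) (ℓ>0 : 0 < ℓ) (P>0 : 0 < P) where
 open Certificate cert

 -- The periodic set for k = 4ν has a rational density c / q. The exceptions of `AlmostAll`, the
 -- multiples of d ≥ 4ν and the incomplete period each move the ratio by a fraction of 1/ν, with
 -- total at most 1/ν.
 approximation : ∀ ν → 0 < ν → Σ ℕ λ q → Σ ℕ λ c → 0 < q × Approximates R ν q c
 approximation ν ν>0 = from (exhausted (4 * ν))
  where
  from : (Σ (ℕ → Set) λ C → (∀ m → Dec (C m)) × (Σ ℕ λ q → 0 < q × Periodic q C) × AlmostAll C R × (Σ ℕ λ d → 4 * ν ≤ d × (∀ m → R m → C m ⊎ d ∣ m))) →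
   Σ ℕ λ q → Σ ℕ λ c → 0 < q × Approximates R ν q c
  from (C , C? , (q , q>0 , per) , aa , d , d≥ , cover) = q , c , q>0 , N₀ + 4 * ν * suc q , λ N N≥ ρ ind → up N (≤-trans (m≤n+m _ N₀) N≥) ρ ind , down N N≥ ρ ind
   where
   c N₀ : ℕ
   c = ∑[ m < q ] 𝟙 (C? m)
   N₀ = proj₁ (almost-all-count C? aa (4 * ν))
   up : ∀ N → 4 * ν * suc q ≤ N → ∀ ρ → Indicates R N ρ → ν * q * ∑ (suc N) ρ ≤ ν * c * N + q * N
   up N N≥ ρ ind = let (x , dx≤ , k≤) = covered-count (≤-trans (pos-* {4} z<s ν>0) d≥) C? cover N ρ ind in
    upper-arithmetic ν q c N (∑ (suc N) ρ) (∑[ m < suc N ] 𝟙 (C? m)) x d d≥ (∑≤n q (λ m _ → 𝟙≤1 (C? m))) N≥ dx≤ k≤ (proj₁ (periodic-density q>0 per C? (suc N)))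
   down : ∀ N → N₀ + 4 * ν * suc q ≤ N → ∀ ρ → Indicates R N ρ → ν * c * N ≤ ν * q * ∑ (suc N) ρ + q * N
   down N N≥ ρ ind = lower-arithmetic ν q c N (∑ (suc N) ρ) (∑[ m < suc N ] 𝟙 (C? m)) (≤-trans (m≤n+m _ N₀) N≥)
    (proj₂ (almost-all-count C? aa (4 * ν)) N (≤-trans (m≤m+n N₀ _) N≥) ρ ind) (proj₂ (periodic-density q>0 per C? (suc N)))

 private
  q c : ℕ
  q = P * P
  c = L-count P
  q>0 : 0 < q
  q>0 = pos-* P>0 P>0

 -- Since R lies in L, its ratio is eventually below c/q + 1/(2Dq), which is u / v. This is still
 -- below B'/D, because two different fractions with denominators q and D are at least 1/(Dq) apart.
 upper-bound : ∀ D B' → 0 < D → D * c < B' * q → Σ ℕ λ u → Σ ℕ λ v → 0 < v × u * D < B' * v ×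
  ∃ λ N₀ → ∀ N → N₀ ≤ N → ∀ ρ → Indicates R N ρ → v * ∑ (suc N) ρ ≤ u * N
 upper-bound D B' D>0 below = 2 * (D * c) + 1 , 2 * D * q , pos-* (pos-* {2} z<s D>0) q>0 , margin D c q B' D>0 below , 2 * D * (c + q * q) , λ N N≥ ρ ind →
   arith D c q N (∑ (suc N) ρ) N≥ (≤-trans (*-monoʳ-≤ q (∑-mono (suc N) (point N ρ ind))) (proj₁ (periodic-density q>0 (Lset-periodic P) (Lset? P) (suc N))))
  where
  open ≤-Reasoning
  margin : ∀ D c q B' → 0 < D → D * c < B' * q → (2 * (D * c) + 1) * D < B' * (2 * D * q)
  margin D c q B' D>0 h = begin-strict
   (2 * (D * c) + 1) * D <⟨ m<m+n _ D>0 ⟩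
   (2 * (D * c) + 1) * D + D ≡⟨ ring65 D c ⟩
   2 * D * suc (D * c) ≤⟨ *-monoʳ-≤ (2 * D) h ⟩
   2 * D * (B' * q) ≡⟨ ring66 D B' q ⟩
   B' * (2 * D * q) ∎
  arith : ∀ D c q N k → 2 * D * (c + q * q) ≤ N → q * k ≤ c * suc N + q * q → 2 * D * q * k ≤ (2 * (D * c) + 1) * N
  arith D c q N k N≥ h = begin
   2 * D * q * k ≡⟨ *-assoc (2 * D) q k ⟩
   2 * D * (q * k) ≤⟨ *-monoʳ-≤ (2 * D) h ⟩
   2 * D * (c * suc N + q * q) ≡⟨ ring67 D c N (q * q) ⟩
   2 * (D * c) * N + 2 * D * (c + q * q) ≤⟨ +-monoʳ-≤ (2 * (D * c) * N) N≥ ⟩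
   2 * (D * c) * N + N ≡⟨ ring68 (2 * (D * c)) N ⟩
   (2 * (D * c) + 1) * N ∎
  point : ∀ N ρ → Indicates R N ρ → ∀ m → m < suc N → ρ m ≤ 𝟙 (Lset? P m)
  point N ρ ind zero _ = ≤-trans (≤-reflexive (Indicates.ρ-0 ind)) z≤n
  point N ρ ind (suc i) m< with ρ (suc i) ≟ 0
  ... | yes z = ≤-trans (≤-reflexive z) z≤n
  ... | no nz = ≤-trans (Indicates.ρ≤1 ind (suc i)) (≤-reflexive (sym (𝟙-yes (Lset? P (suc i)) (necessary (suc i) (Indicates.sound ind (suc i) z<s (s≤s⁻¹ m<) (n≢0⇒n>0 nz))))))

 -- Without the multiples of ℓ, L keeps at least c/q - 1/ℓ, and by integrality this exceeds A'/D by
 -- at least 1/(D q ℓ). One quarter of that margin separates u / v from A'/D; the other three absorb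
 -- the exceptional set and the incomplete period.
 lower-bound : ∀ D A' → 0 < D → A' * q * ℓ + D * q < D * c * ℓ → Σ ℕ λ u → Σ ℕ λ v → 0 < v × A' * v < u * D ×
  ∃ λ N₀ → ∀ N → N₀ ≤ N → ∀ ρ → Indicates R N ρ → u * N ≤ v * ∑ (suc N) ρ
 lower-bound D A' D>0 above = 4 * (A' * q * ℓ) + 1 , 4 * (D * q * ℓ) , pos-* {4} z<s (pos-* (pos-* D>0 q>0) ℓ>0) , margin A' D q ℓ D>0 , N₀ + 4 * (D * ℓ * (q + q * q)) , λ N N≥ ρ ind →
   arith D c q ℓ A' N (∑ (suc N) ρ) (L N) (G N) (N / ℓ) (≤-trans (m≤n+m _ N₀) N≥) (d*[n/d]≤n N ℓ) above (proj₂ low N (≤-trans (m≤m+n N₀ _) N≥) ρ ind) (L≤G N)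
    (proj₂ (periodic-density q>0 (Lset-periodic P) (Lset? P) (suc N)))
  where
  open ≤-Reasoning
  instance
   ℓ≢0 : NonZero ℓ
   ℓ≢0 = >-nonZero ℓ>0
  low : ∃ λ N₀ → ∀ N → N₀ ≤ N → ∀ ρ → Indicates R N ρ → 4 * (D * q * ℓ) * (∑[ m < suc N ] 𝟙 (¬? (ℓ ∣? m) ×-dec Lset? P m)) ≤ 4 * (D * q * ℓ) * ∑ (suc N) ρ + 2 * N
  low = almost-all-count (λ m → ¬? (ℓ ∣? m) ×-dec Lset? P m) generic (4 * (D * q * ℓ))
  N₀ : ℕ
  N₀ = proj₁ low
  G L : ℕ → ℕ
  G N = ∑[ m < suc N ] 𝟙 (¬? (ℓ ∣? m) ×-dec Lset? P m)
  L N = ∑[ m < suc N ] 𝟙 (Lset? P m)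
  L≤G : ∀ N → L N ≤ G N + N / ℓ + 1
  L≤G N = begin
   L N ≤⟨ ∑-mono (suc N) (λ m _ → point m) ⟩
   ∑[ m < suc N ] (g m + 𝟙 (0 <? m) * 𝟙 (ℓ ∣? m) + 𝟙 (0 ≟ m)) ≡⟨ trans (∑-+ (suc N) _ (λ m → 𝟙 (0 ≟ m))) (cong₂ _+_ (∑-+ (suc N) g _) (∑-𝟙-hit (suc N) 0 z<s)) ⟩
   G N + (∑[ m < suc N ] 𝟙 (0 <? m) * 𝟙 (ℓ ∣? m)) + 1 ≤⟨ +-monoˡ-≤ 1 (+-monoʳ-≤ (G N) (multiples-count ℓ N)) ⟩
   G N + N / ℓ + 1 ∎
   where
   g : ℕ → ℕ
   g m = 𝟙 (¬? (ℓ ∣? m) ×-dec Lset? P m)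
   point : ∀ m → 𝟙 (Lset? P m) ≤ g m + 𝟙 (0 <? m) * 𝟙 (ℓ ∣? m) + 𝟙 (0 ≟ m)
   point zero = ≤-trans (𝟙≤1 (Lset? P 0)) (m≤n+m 1 _)
   point (suc i) with Lset? P (suc i) | ℓ ∣? suc i
   ... | no _ | _ = z≤n
   ... | yes _ | yes _ = s≤s z≤n
   ... | yes _ | no _ = s≤s z≤n
  margin : ∀ A D q ℓ → 0 < D → A * (4 * (D * q * ℓ)) < (4 * (A * q * ℓ) + 1) * D
  margin A D q ℓ D>0 = <-≤-trans (m<m+n _ D>0) (≤-reflexive (ring69 A D q ℓ))
  arith : ∀ D c q ℓ A N k L G x → 4 * (D * ℓ * (q + q * q)) ≤ N → ℓ * x ≤ N → A * q * ℓ + D * q < D * c * ℓ → 4 * (D * q * ℓ) * G ≤ 4 * (D * q * ℓ) * k + 2 * N →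
   L ≤ G + x + 1 → c * suc N ≤ q * L + q * q → (4 * (A * q * ℓ) + 1) * N ≤ 4 * (D * q * ℓ) * k
  arith D c q ℓ A N k L G x N≥ ℓx≤ above low L≤ h = +-cancelʳ-≤ (3 * N + 4 * (D * q) * N) _ _ (begin
   (4 * (A * q * ℓ) + 1) * N + (3 * N + 4 * (D * q) * N) ≡⟨ ring70 (A * q * ℓ) (D * q) N ⟩
   4 * (suc (A * q * ℓ + D * q) * N) ≤⟨ *-monoʳ-≤ 4 (*-mono-≤ above (n≤1+n N)) ⟩
   4 * (D * c * ℓ * suc N) ≡⟨ ring71 D c ℓ (suc N) ⟩
   4 * (D * ℓ) * (c * suc N) ≤⟨ *-monoʳ-≤ (4 * (D * ℓ)) (≤-trans h (+-monoˡ-≤ (q * q) (*-monoʳ-≤ q L≤))) ⟩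
   4 * (D * ℓ) * (q * (G + x + 1) + q * q) ≡⟨ ring72 D ℓ q G x ⟩
   4 * (D * q * ℓ) * G + 4 * (D * q) * (ℓ * x) + 4 * (D * ℓ * (q + q * q)) ≤⟨ +-mono-≤ (+-mono-≤ low (*-monoʳ-≤ (4 * (D * q)) ℓx≤)) N≥ ⟩
   4 * (D * q * ℓ) * k + 2 * N + 4 * (D * q) * N + N ≡⟨ ring73 (4 * (D * q * ℓ) * k) N (4 * (D * q) * N) ⟩
   4 * (D * q * ℓ) * k + (3 * N + 4 * (D * q) * N) ∎)

-- Rational inequalities as inequalities of natural numbers

numerator : ∀ a → 0ℚ ℚ.≤ a → ∃ λ n → ℚ.↥ a ≡ + n
numerator (ℚ.mkℚ (+ n) _ _) _ = n , refl
numerator (ℚ.mkℚ ℤ.-[1+ n ] d _) (ℚ.*≤* ())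

cast-<* : ∀ {a b c d} → a * b < c * d → + a *z + b ℤ.< + c *z + d
cast-<* {a} {b} {c} {d} h = subst₂ ℤ._<_ (ℤₚ.pos-* a b) (ℤₚ.pos-* c d) (ℤ.+<+ h)

cast-≤* : ∀ {a b c d} → a * b ≤ c * d → + a *z + b ℤ.≤ + c *z + d
cast-≤* {a} {b} {c} {d} h = subst₂ ℤ._≤_ (ℤₚ.pos-* a b) (ℤₚ.pos-* c d) (ℤ.+≤+ h)

fraction-≤ : ∀ {k n k' n'} → k * suc n' ≤ k' * suc n → (+ k) ℚ./ suc n ℚ.≤ (+ k') ℚ./ suc n'
fraction-≤ {k} {n} {k'} {n'} h = ℚₚ.toℚᵘ-cancel-≤ (ℚᵘₚ.≤-respˡ-≃ (ℚᵘₚ.≃-sym (ℚₚ.toℚᵘ-fromℚᵘ (mkℚᵘ (+ k) n))) (ℚᵘₚ.≤-respʳ-≃ (ℚᵘₚ.≃-sym (ℚₚ.toℚᵘ-fromℚᵘ (mkℚᵘ (+ k') n')))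
 (*≤* (cast-≤* {k} {suc n'} {k'} {suc n} h))))

fraction-> : ∀ {k n} a m → ℚ.↥ a ≡ + m → m * suc n < k * ℚ.↧ₙ a → a ℚ.< (+ k) ℚ./ suc n
fraction-> {k} {n} a@(ℚ.mkℚ _ d _) m refl h = ℚₚ.toℚᵘ-cancel-< (ℚᵘₚ.<-respʳ-≃ (ℚᵘₚ.≃-sym (ℚₚ.toℚᵘ-fromℚᵘ (mkℚᵘ (+ k) n))) (*<* (cast-<* {m} {suc n} {k} {suc d} h)))

fraction-< : ∀ {k n} b m → ℚ.↥ b ≡ + m → k * ℚ.↧ₙ b < m * suc n → (+ k) ℚ./ suc n ℚ.< b
fraction-< {k} {n} b@(ℚ.mkℚ _ d _) m refl h = ℚₚ.toℚᵘ-cancel-< (ℚᵘₚ.<-respˡ-≃ (ℚᵘₚ.≃-sym (ℚₚ.toℚᵘ-fromℚᵘ (mkℚᵘ (+ k) n))) (*<* (cast-<* {k} {suc d} {m} {suc n} h)))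

fraction-<-+ : ∀ {k n k' n'} ε e → ℚ.↥ ε ≡ + e → k * (suc n' * ℚ.↧ₙ ε) < (k' * ℚ.↧ₙ ε + e * suc n') * suc n → (+ k) ℚ./ suc n ℚ.< (+ k') ℚ./ suc n' ℚ.+ ε
fraction-<-+ {k} {n} {k'} {n'} ε@(ℚ.mkℚ _ d _) e refl h = ℚₚ.toℚᵘ-cancel-< (ℚᵘₚ.<-respˡ-≃ (ℚᵘₚ.≃-sym (ℚₚ.toℚᵘ-fromℚᵘ (mkℚᵘ (+ k) n)))
 (ℚᵘₚ.<-respʳ-≃ (ℚᵘₚ.≃-sym (ℚᵘₚ.≃-trans (ℚₚ.toℚᵘ-homo-+ ((+ k') ℚ./ suc n') ε) (ℚᵘₚ.+-congˡ (ℚ.toℚᵘ ε) (ℚₚ.toℚᵘ-fromℚᵘ (mkℚᵘ (+ k') n')))))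
  (*<* (subst (λ v → + k *z + (suc n' * suc d) ℤ.< v *z + suc n) (cong₂ _+z_ (ℤₚ.pos-* k' (suc d)) (ℤₚ.pos-* e (suc n'))) (cast-<* {k} {suc n' * suc d} {k' * suc d + e * suc n'} {suc n} h)))))

∣-∣< : ∀ {x y ε} → x ℚ.< y ℚ.+ ε → y ℚ.< x ℚ.+ ε → ℚ.∣ x ℚ.- y ∣ ℚ.< ε
∣-∣< {x} {y} {ε} h h' = case (ℚₚ.∣p∣≡p∨∣p∣≡-p (x ℚ.- y))
 where
 diff : ∀ {x y} → x ℚ.< y ℚ.+ ε → x ℚ.- y ℚ.< ε
 diff {x} {y} h = subst (x ℚ.- y ℚ.<_) (xyx⁻¹≈y y ε) (ℚₚ.+-monoˡ-< (ℚ.- y) h)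
 case : ℚ.∣ x ℚ.- y ∣ ≡ x ℚ.- y ⊎ ℚ.∣ x ℚ.- y ∣ ≡ ℚ.- (x ℚ.- y) → ℚ.∣ x ℚ.- y ∣ ℚ.< ε
 case (inj₁ eq) = subst (ℚ._< ε) (sym eq) (diff h)
 case (inj₂ eq) = subst (ℚ._< ε) (sym (trans eq (⁻¹-anti-homo‿- x y))) (diff h')

-- Both ratios lie within 1/ν of c / q, so they differ by at most 2/ν < 1/E ≤ e/E, where e/E is the
-- given accuracy.
close-arithmetic : ∀ ν q c k n k' n' e E → 0 < q → 0 < e → 2 * E < ν → ν * q * k ≤ ν * c * suc n + q * suc n → ν * c * suc n' ≤ ν * q * k' + q * suc n' →
 k * (suc n' * E) < (k' * E + e * suc n') * suc n
close-arithmetic ν q c k n k' n' e E q>0 e>0 2E<ν h h' = *-cancelˡ-< ν _ _ (begin-strict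
 ν * (k * (N' * E)) ≡⟨ ring165 ν k N' E ⟩
 ν * k * N' * E ≤⟨ *-monoˡ-≤ E key ⟩
 (ν * k' * N + 2 * (N * N')) * E ≡⟨ ring166 ν k' N N' E ⟩
 ν * k' * N * E + 2 * E * (N * N') <⟨ +-monoʳ-< (ν * k' * N * E) (*-monoˡ-< (N * N') 2E<ν) ⟩
 ν * k' * N * E + ν * (N * N') ≤⟨ +-monoʳ-≤ (ν * k' * N * E) (*-monoʳ-≤ ν (m≤n*m (N * N') e {{>-nonZero e>0}})) ⟩
 ν * k' * N * E + ν * (e * (N * N')) ≡⟨ ring167 ν k' N E e N' ⟩
 ν * ((k' * E + e * N') * N) ∎)
 where
 open ≤-Reasoning
 N N' : ℕ
 N = suc n
 N' = suc n'
 key : ν * k * N' ≤ ν * k' * N + 2 * (N * N')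
 key = *-cancelˡ-≤ q {{>-nonZero q>0}} (begin
  q * (ν * k * N') ≡⟨ ring127 q ν k N' ⟩
  ν * q * k * N' ≤⟨ *-monoˡ-≤ N' h ⟩
  (ν * c * N + q * N) * N' ≡⟨ ring128 (ν * c) q N N' ⟩
  ν * c * N' * N + q * (N * N') ≤⟨ +-monoˡ-≤ (q * (N * N')) (*-monoˡ-≤ N h') ⟩
  (ν * q * k' + q * N') * N + q * (N * N') ≡⟨ ring129 ν q k' N N' ⟩
  q * (ν * k' * N + 2 * (N * N')) ∎)

Dense-data : ℚ → ℚ → ℕ → ℕ → ℕ → Set
Dense-data a b D A' B' = Σ ℕ λ α → Σ ℕ λ β → ℚ.↥ a ≡ + α × ℚ.↥ b ≡ + β × D ≡ ℚ.↧ₙ a * ℚ.↧ₙ b × A' ≡ α * ℚ.↧ₙ b × B' ≡ β * ℚ.↧ₙ a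

Approximable : (ℕ → Set) → Set
Approximable R = ∀ ν → 0 < ν → Σ ℕ λ q → Σ ℕ λ c → 0 < q × Approximates R ν q c

BoundedBelow BoundedAbove : (ℕ → Set) → ℕ → ℕ → Set
BoundedBelow R D A' = Σ ℕ λ u → Σ ℕ λ v → 0 < v × A' * v < u * D × ∃ λ N₀ → ∀ N → N₀ ≤ N → ∀ ρ → Indicates R N ρ → u * N ≤ v * ∑ (suc N) ρ
BoundedAbove R D B' = Σ ℕ λ u → Σ ℕ λ v → 0 < v × u * D < B' * v × ∃ λ N₀ → ∀ N → N₀ ≤ N → ∀ ρ → Indicates R N ρ → v * ∑ (suc N) ρ ≤ u * N

positive-numerator : ∀ ε → 0ℚ ℚ.< ε → ∃ λ e → ℚ.↥ ε ≡ + e × 0 < e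
positive-numerator (ℚ.mkℚ (+ suc e) _ _) _ = suc e , refl , z<s
positive-numerator (ℚ.mkℚ (+ zero) _ _) (ℚ.*<* (ℤ.+<+ ()))
positive-numerator (ℚ.mkℚ ℤ.-[1+ _ ] _ _) (ℚ.*<* ())

approximable⇒close : ∀ {R} ε e E → ℚ.↥ ε ≡ + e → ℚ.↧ₙ ε ≡ E → 0 < e → ∀ ν → 2 * E < ν → ∀ q c → 0 < q → ∀ N₀ →
 (∀ N → N₀ ≤ N → ∀ ρ → Indicates R N ρ → ν * q * ∑ (suc N) ρ ≤ ν * c * N + q * N × ν * c * N ≤ ν * q * ∑ (suc N) ρ + q * N) →
 ∀ M M' x x' → N₀ ≤ M → N₀ ≤ M' → Ratio R M x → Ratio R M' x' → ℚ.∣ x ℚ.- x' ∣ ℚ.< ε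
approximable⇒close {R} ε e E ↥ε ↧ε e>0 ν 2E<ν q c q>0 N₀ approx M M' _ _ M≥ M'≥ (ρ , ind , refl) (ρ' , ind' , refl) =
  ∣-∣< {(+ ∑ (suc (suc M)) ρ) ℚ./ suc M} {(+ ∑ (suc (suc M')) ρ') ℚ./ suc M'} {ε} (near M M' M≥ M'≥ ρ ρ' ind ind') (near M' M M'≥ M≥ ρ' ρ ind' ind)
 where
 near : ∀ M M' → N₀ ≤ M → N₀ ≤ M' → ∀ ρ ρ' → Indicates R (suc M) ρ → Indicates R (suc M') ρ' →
  (+ ∑ (suc (suc M)) ρ) ℚ./ suc M ℚ.< (+ ∑ (suc (suc M')) ρ') ℚ./ suc M' ℚ.+ ε
 near M M' M≥ M'≥ ρ ρ' ind ind' = fraction-<-+ {k} {M} {k'} {M'} ε e ↥ε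
  (subst (λ E → k * (suc M' * E) < (k' * E + e * suc M') * suc M) (sym ↧ε) (close-arithmetic ν q c k M k' M' e E q>0 e>0 2E<ν
   (proj₁ (approx (suc M) (m≤n⇒m≤1+n M≥) ρ ind)) (proj₂ (approx (suc M') (m≤n⇒m≤1+n M'≥) ρ' ind'))))
  where
  k k' : ℕ
  k = ∑ (suc (suc M)) ρ
  k' = ∑ (suc (suc M')) ρ'

limit-in : ∀ {R a b D A' B'} → Dense-data a b D A' B' → Approximable R → BoundedBelow R D A' → BoundedAbove R D B' → LimitIn (Ratio R) a b
limit-in {R} {a} {b} {D} {A'} {B'} (α , β , ↥a , ↥b , D≡ , A≡ , B≡) approximable below above = cauchy , bounds below above
 where
 cauchy : ∀ ε → 0ℚ ℚ.< ε → ∃ λ M₀ → ∀ M M' x x' → M₀ ≤ M → M₀ ≤ M' → Ratio R M x → Ratio R M' x' → ℚ.∣ x ℚ.- x' ∣ ℚ.< ε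
 cauchy ε ε>0 = from (positive-numerator ε ε>0)
  where
  from : (∃ λ e → ℚ.↥ ε ≡ + e × 0 < e) → ∃ λ M₀ → ∀ M M' x x' → M₀ ≤ M → M₀ ≤ M' → Ratio R M x → Ratio R M' x' → ℚ.∣ x ℚ.- x' ∣ ℚ.< ε
  from (e , ↥ε , e>0) = go (suc (2 * ℚ.↧ₙ ε)) ≤-refl
   where
   go : ∀ ν → 2 * ℚ.↧ₙ ε < ν → ∃ λ M₀ → ∀ M M' x x' → M₀ ≤ M → M₀ ≤ M' → Ratio R M x → Ratio R M' x' → ℚ.∣ x ℚ.- x' ∣ ℚ.< ε
   go ν lt = let (q , c , q>0 , N₀ , approx) = approximable ν (≤-<-trans z≤n lt) in N₀ , approximable⇒close {R} ε e (ℚ.↧ₙ ε) ↥ε refl e>0 ν lt q c q>0 N₀ approx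
 bounds : BoundedBelow R D A' → BoundedAbove R D B' →
  Σ ℚ λ x → Σ ℚ λ y → (a ℚ.< x) × (y ℚ.< b) × ∃ λ M₀ → ∀ M r → M₀ ≤ M → Ratio R M r → (x ℚ.≤ r) × (r ℚ.≤ y)
 bounds (u , suc v , _ , a<x , N₁ , low) (u' , suc v' , _ , y<b , N₂ , up) = (+ u) ℚ./ suc v , (+ u') ℚ./ suc v' ,
  fraction-> {u} {v} a α ↥a (cross₁ α (ℚ.↧ₙ a) (ℚ.↧ₙ b) u (suc v) (subst₂ (λ A D → A * suc v < u * D) A≡ D≡ a<x)) ,
  fraction-< {u'} {v'} b β ↥b (cross₂ β (ℚ.↧ₙ a) (ℚ.↧ₙ b) u' (suc v') (subst₂ (λ B D → u' * D < B * suc v') B≡ D≡ y<b)) ,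
  N₁ + N₂ , located
  where
  cross₁ : ∀ α a b u v → α * b * v < u * (a * b) → α * v < u * a
  cross₁ α a b u v h = *-cancelʳ-< b (α * v) (u * a) (subst₂ _<_ (ring130 α b v) (sym (*-assoc u a b)) h)
  cross₂ : ∀ β a b u v → u * (a * b) < β * a * v → u * b < β * v
  cross₂ β a b u v h = *-cancelʳ-< a (u * b) (β * v) (subst₂ _<_ (ring82 u a b) (ring130 β a v) h)
  located : ∀ M r → N₁ + N₂ ≤ M → Ratio R M r → ((+ u) ℚ./ suc v ℚ.≤ r) × (r ℚ.≤ (+ u') ℚ./ suc v')
  located M _ M≥ (ρ , ind , refl) =
   fraction-≤ {u} {v} {k} {M} (subst (u * suc M ≤_) (*-comm (suc v) k) (low (suc M) (m≤n⇒m≤1+n (≤-trans (m≤m+n N₁ N₂) M≥)) ρ ind)) ,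
   fraction-≤ {k} {M} {u'} {v'} (subst (_≤ u' * suc M) (*-comm (suc v') k) (up (suc M) (m≤n⇒m≤1+n (≤-trans (m≤n+m N₂ N₁) M≥)) ρ ind))
   where
   k : ℕ
   k = ∑ (suc (suc M)) ρ

certificate⇒limit : ∀ {ℓ P R a b D A' B'} → Certificate ℓ P R → 0 < ℓ → 0 < P → 0 < D → Dense-data a b D A' B' →
 A' * (P * P) * ℓ + D * (P * P) < D * L-count P * ℓ → D * L-count P < B' * (P * P) → LimitIn (Ratio R) a b
certificate⇒limit {ℓ} {P} {R} {a} {b} {D} {A'} {B'} cert ℓ>0 P>0 D>0 dd above below =
 limit-in {R} {a} {b} {D} {A'} {B'} dd (Limit.approximation cert ℓ>0 P>0) (Limit.lower-bound cert ℓ>0 P>0 D A' D>0 above) (Limit.upper-bound cert ℓ>0 P>0 D B' D>0 below)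

LimitIn-⊆ : ∀ {R R' a b} → (∀ M q → R' M q → R M q) → LimitIn R a b → LimitIn R' a b
LimitIn-⊆ sub (cauchy , c , d , a<c , d<b , M₀ , bounds) =
 (λ ε ε>0 → proj₁ (cauchy ε ε>0) , λ M M' q q' M≥ M'≥ r r' → proj₂ (cauchy ε ε>0) M M' q q' M≥ M'≥ (sub M q r) (sub M' q' r')) ,
 c , d , a<c , d<b , M₀ , λ M q M≥ r → bounds M q M≥ (sub M q r)

-- Derivations of `Count` as indicator functions

record Counted (g : ℕ → Set) (N k : ℕ) : Set where
 field
  e : ℕ → ℕ
  e≤1 : ∀ i → e i ≤ 1
  sound : ∀ i → i < N → 0 < e i → g i
  full : ∀ i → i < N → e i ≡ 0 → ¬ g i
  total : ∑ N e ≡ k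

count-indicator : ∀ {g N k} → Count g N k → Counted g N k
count-indicator c0 = record { e = λ _ → 0 ; e≤1 = λ _ → z≤n ; sound = λ _ () ; full = λ _ () ; total = refl }
count-indicator {g} (cyes {L} gL c) = extend (count-indicator c)
 where
 extend : ∀ {k} → Counted g L k → Counted g (suc L) (suc k)
 extend C = record { e = λ i → at i (i ≟ L) ; e≤1 = λ i → at≤1 i (i ≟ L) ; sound = λ i → snd i (i ≟ L) ; full = λ i → fll i (i ≟ L) ;
   total = trans (cong₂ _+_ (trans (∑-cong L (λ i i<L → off i i<L (i ≟ L))) total) (on (L ≟ L))) (+-comm _ 1) }
  where
  open Counted C
  at : ∀ i → Dec (i ≡ L) → ℕ
  at i (yes _) = 1
  at i (no _) = e i
  at≤1 : ∀ i d → at i d ≤ 1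
  at≤1 i (yes _) = ≤-refl
  at≤1 i (no _) = e≤1 i
  snd : ∀ i d → i < suc L → 0 < at i d → g i
  snd i (yes refl) _ _ = gL
  snd i (no i≢L) i< p = sound i (≤∧≢⇒< (s≤s⁻¹ i<) i≢L) p
  fll : ∀ i d → i < suc L → at i d ≡ 0 → ¬ g i
  fll i (no i≢L) i< p = full i (≤∧≢⇒< (s≤s⁻¹ i<) i≢L) p
  off : ∀ i → i < L → ∀ d → at i d ≡ e i
  off i i<L (yes refl) = contradiction i<L (<-irrefl refl)
  off i i<L (no _) = refl
  on : ∀ d → at L d ≡ 1
  on (yes _) = refl
  on (no L≢L) = contradiction refl L≢L
count-indicator {g} (cno {L} ¬gL c) = extend (count-indicator c)
 where
 extend : ∀ {k} → Counted g L k → Counted g (suc L) k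
 extend C = record { e = λ i → 𝟙 (i <? L) * e i ; e≤1 = λ i → *-mono-≤ (𝟙≤1 (i <? L)) (e≤1 i)
  ; sound = λ i _ p → let pq = *-pos (𝟙 (i <? L)) (e i) p in sound i (𝟙-pos (i <? L) (proj₁ pq)) (proj₂ pq)
  ; full = λ i i< → fll i i< (i <? L)
  ; total = trans (cong₂ _+_ (trans (∑-cong L (λ i i<L → trans (cong (_* e i) (𝟙-yes (i <? L) i<L)) (+-identityʳ (e i)))) total) (cong (_* e L) (𝟙-no (L <? L) (<-irrefl refl)))) (+-identityʳ _) }
  where
  open Counted C
  fll : ∀ i → i < suc L → (d : Dec (i < L)) → 𝟙 d * e i ≡ 0 → ¬ g i
  fll i _ (yes i<L) p = full i i<L (trans (sym (+-identityʳ (e i))) p)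
  fll i i< (no i≮L) _ gi = ¬gL (subst g (≤-antisym (s≤s⁻¹ i<) (≮⇒≥ i≮L)) gi)

count-ratio : ∀ {R : ℕ → Set} {g : ℕ → Set} {M k} → (∀ i → g i → R (suc i)) → (∀ i → R (suc i) → g i) → Count g (suc M) k → Ratio R M ((+ k) ℚ./ suc M)
count-ratio {R} {g} {M} {k} to from cnt = ρ , record
  { ρ≤1 = λ { zero → z≤n ; (suc i) → e≤1 i } ; ρ-0 = refl
  ; sound = λ { (suc i) _ i≤ p → to i (sound i i≤ p) } ; full = λ { (suc i) _ i≤ p r → full i i≤ p (from i r) } } ,
  cong (λ v → (+ v) ℚ./ suc M) (sym (trans (∑-split 1 (suc M) ρ) total))
 where
 open Counted (count-indicator cnt)
 ρ : ℕ → ℕ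
 ρ zero = 0
 ρ (suc i) = e i

PosRatio⇒Ratio : ∀ {S R} → (∀ i → S (+ suc i) → R (suc i)) → (∀ i → R (suc i) → S (+ suc i)) → ∀ M q → PosRatio S M q → Ratio R M q
PosRatio⇒Ratio {S} {R} to from M _ (k , cnt , refl) = count-ratio {R} to from cnt

NegRatio⇒Ratio : ∀ {S R} → (∀ i → S (-z (+ suc i)) → R (suc i)) → (∀ i → R (suc i) → S (-z (+ suc i))) → ∀ M q → NegRatio S M q → Ratio R M q
NegRatio⇒Ratio {S} {R} to from M _ (k , cnt , refl) = count-ratio {R} to from cnt

-- S is symmetric, so the 2N + 1 integers from -N to N can be replaced by their absolute values: N,
-- ..., 1 and then 0, ..., N. As 0 is not counted, the total is twice the one-sided count, and the 2
-- cancels against the denominator 2N.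
IndRatio⇒Ratio : ∀ {S : ℤ → Set} {R : ℕ → Set} → (∀ m → Dec (R m)) → (∀ m → S m → 0 < abs m × R (abs m)) → (∀ m → 0 < abs m → R (abs m) → S m) → ∀ M q → IndRatio S M q → Ratio R M q
IndRatio⇒Ratio {S} {R} R? to from M _ (k , cnt , refl) = ρ , record
  { ρ≤1 = λ m → *-mono-≤ (𝟙≤1 (0 <? m)) (𝟙≤1 (R? m)) ; ρ-0 = refl
  ; sound = λ m _ _ p → 𝟙-pos (R? m) (proj₂ (*-pos (𝟙 (0 <? m)) (𝟙 (R? m)) p))
  ; full = λ { (suc m) _ _ p r → 1+n≢0 (trans (sym (cong (_+ 0) (𝟙-yes (R? (suc m)) r))) p) } } ,
  ℚₚ.fromℚᵘ-cong {mkℚᵘ (+ k) _} {mkℚᵘ (+ ∑ (suc N) ρ) M} (*≡* (trans (sym (ℤₚ.pos-* k N)) (trans (cong +_ double) (ℤₚ.pos-* (∑ (suc N) ρ) (2 * N)))))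
 where
 open ≡-Reasoning
 N : ℕ
 N = suc M
 ρ : ℕ → ℕ
 ρ m = 𝟙 (0 <? m) * 𝟙 (R? m)
 open Counted (count-indicator cnt)
 distance : ℕ → ℕ
 distance i = abs (+ i -z + N)
 agree : ∀ i → i < suc (2 * N) → e i ≡ ρ (distance i)
 agree i i< = decide (e i ≟ 0)
  where
  decide : Dec (e i ≡ 0) → e i ≡ ρ (distance i)
  decide (no nz) = trans (≤-antisym (e≤1 i) (n≢0⇒n>0 nz)) (sym (cong₂ _*_ (𝟙-yes (0 <? distance i) (proj₁ h)) (𝟙-yes (R? (distance i)) (proj₂ h))))
   where h = to _ (sound i i< (n≢0⇒n>0 nz))
  decide (yes z) = trans z (sym (n≤0⇒n≡0 (≮⇒≥ (λ p → let pq = *-pos (𝟙 (0 <? distance i)) (𝟙 (R? (distance i))) p in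
   full i i< z (from _ (𝟙-pos (0 <? distance i) (proj₁ pq)) (𝟙-pos (R? (distance i)) (proj₂ pq)))))))
 below : ∀ i → i < N → distance i ≡ suc (M ∸ i)
 below i i<N = trans (cong abs (ℤₚ.m-n≡m⊖n i N)) (trans (ℤₚ.∣⊖∣-≤ (<⇒≤ i<N)) (+-∸-assoc 1 (s≤s⁻¹ i<N)))
 above : ∀ j → distance (N + j) ≡ j
 above j = trans (cong abs (ℤₚ.m-n≡m⊖n (N + j) N)) (trans (cong abs (ℤₚ.⊖-≥ (m≤m+n N j))) (m+n∸m≡n N j))
 half : ∑[ i < N ] ρ (suc i) ≡ ∑ (suc N) ρ
 half = sym (∑-split 1 N ρ)
 double : k * N ≡ ∑ (suc N) ρ * (2 * N)
 double = begin
  k * N ≡⟨ cong (_* N) (trans (sym total) (∑-cong (suc (2 * N)) agree)) ⟩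
  (∑[ i < suc (2 * N) ] ρ (distance i)) * N ≡⟨ cong (λ n → ∑ n (λ i → ρ (distance i)) * N) (ring131 N) ⟩
  (∑[ i < N + suc N ] ρ (distance i)) * N ≡⟨ cong (_* N) (∑-split N (suc N) _) ⟩
  ((∑[ i < N ] ρ (distance i)) + (∑[ j < suc N ] ρ (distance (N + j)))) * N ≡⟨ cong (_* N) (cong₂ _+_ (trans (∑-cong N (λ i i<N → cong ρ (below i i<N)))
    (trans (∑-permute N (M ∸_) (λ i → ρ (suc i)) (λ i _ → s≤s (m∸n≤m M i)) (λ i j i<N j<N → ∸-cancelˡ-≡ (s≤s⁻¹ i<N) (s≤s⁻¹ j<N))) half)) (∑-cong (suc N) (λ j _ → cong ρ (above j)))) ⟩
  (∑ (suc N) ρ + ∑ (suc N) ρ) * N ≡⟨ ring132 (∑ (suc N) ρ) N ⟩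
  ∑ (suc N) ρ * (2 * N) ∎

-- Signatures of quadratic forms

ℚ-ring : AlmostCommutativeRing _ _
ℚ-ring = fromCommutativeRing ℚₚ.+-*-commutativeRing (λ x → dec⇒maybe (0ℚ ℚₚ.≟ x))

sumℤ-cong : ∀ {n} {f g : Fin n → ℤ} → (∀ i → f i ≡ g i) → sumℤ f ≡ sumℤ g
sumℤ-cong {zero} h = refl
sumℤ-cong {suc n} h = cong₂ _+z_ (h Fin.zero) (sumℤ-cong (λ i → h (Fin.suc i)))

sumℤ-zero : ∀ {n} {f : Fin n → ℤ} → (∀ i → f i ≡ + 0) → sumℤ f ≡ + 0
sumℤ-zero {zero} h = refl
sumℤ-zero {suc n} h = cong₂ _+z_ (h Fin.zero) (sumℤ-zero (λ i → h (Fin.suc i)))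

sumℤ-neg : ∀ {n} (f : Fin n → ℤ) → sumℤ (λ i → -z f i) ≡ -z sumℤ f
sumℤ-neg {zero} f = refl
sumℤ-neg {suc n} f = trans (cong (-z f Fin.zero +z_) (sumℤ-neg (λ i → f (Fin.suc i)))) (sym (ℤₚ.neg-distrib-+ (f Fin.zero) _))

sumℚ-cong : ∀ {n} {f g : Fin n → ℚ} → (∀ i → f i ≡ g i) → sumℚ f ≡ sumℚ g
sumℚ-cong {zero} h = refl
sumℚ-cong {suc n} h = cong₂ ℚ._+_ (h Fin.zero) (sumℚ-cong (λ i → h (Fin.suc i)))

sumℚ-zero : ∀ {n} {f : Fin n → ℚ} → (∀ i → f i ≡ 0ℚ) → sumℚ f ≡ 0ℚ
sumℚ-zero {zero} h = refl
sumℚ-zero {suc n} h = trans (cong₂ ℚ._+_ (h Fin.zero) (sumℚ-zero (λ i → h (Fin.suc i)))) (ℚₚ.+-identityˡ 0ℚ)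

sumℚ-neg : ∀ {n} (f : Fin n → ℚ) → sumℚ (λ i → ℚ.- f i) ≡ ℚ.- sumℚ f
sumℚ-neg {zero} f = refl
sumℚ-neg {suc n} f = trans (cong (ℚ._+_ (ℚ.- f Fin.zero)) (sumℚ-neg (λ i → f (Fin.suc i)))) (sym (ℚₚ.neg-distrib-+ (f Fin.zero) _))

sumℚ-last : ∀ {n} (f : Fin (suc n) → ℚ) → sumℚ f ≡ f (Fin.fromℕ n) ℚ.+ sumℚ (λ i → f (Fin.inject₁ i))
sumℚ-last {zero} f = refl
sumℚ-last {suc n} f = trans (cong (ℚ._+_ (f Fin.zero)) (sumℚ-last (λ i → f (Fin.suc i)))) (lem (f Fin.zero) (f (Fin.suc (Fin.fromℕ n))) _)
 where
 lem : ∀ a b c → a ℚ.+ (b ℚ.+ c) ≡ b ℚ.+ (a ℚ.+ c)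
 lem = RingSolver.solve-∀ ℚ-ring

sumℚ-opposite : ∀ {n} (f : Fin n → ℚ) → sumℚ (λ i → f (Fin.opposite i)) ≡ sumℚ f
sumℚ-opposite {zero} f = refl
sumℚ-opposite {suc n} f = trans (cong (ℚ._+_ (f (Fin.fromℕ n))) (sumℚ-opposite (λ i → f (Fin.inject₁ i)))) (sym (sumℚ-last f))

evalℚ-cong : ∀ {n} (a : QForm n) {x y : Fin n → ℚ} → (∀ i → x i ≡ y i) → evalℚ a x ≡ evalℚ a y
evalℚ-cong a h = sumℚ-cong (λ i → sumℚ-cong (λ j → cong ((a i j ℚ./ 1) ℚ.*_) (cong₂ ℚ._*_ (h i) (h j))))

δ : ∀ {n} → Fin n → Fin n → ℚ
δ Fin.zero Fin.zero = 1ℚ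
δ Fin.zero (Fin.suc j) = 0ℚ
δ (Fin.suc i) Fin.zero = 0ℚ
δ (Fin.suc i) (Fin.suc j) = δ i j

δ-refl : ∀ {n} (i : Fin n) → δ i i ≡ 1ℚ
δ-refl Fin.zero = refl
δ-refl (Fin.suc i) = δ-refl i

δ-≢ : ∀ {n} {i j : Fin n} → i ≢ j → δ i j ≡ 0ℚ
δ-≢ {i = Fin.zero} {Fin.zero} h = contradiction refl h
δ-≢ {i = Fin.zero} {Fin.suc j} h = refl
δ-≢ {i = Fin.suc i} {Fin.zero} h = refl
δ-≢ {i = Fin.suc i} {Fin.suc j} h = δ-≢ (λ eq → h (cong Fin.suc eq))

RightInverse : ∀ {n} → (Fin n → Fin n → ℚ) → (Fin n → Fin n → ℚ) → Set
RightInverse P Q = ∀ i j → sumℚ (λ k → P i k ℚ.* Q k j) ≡ δ i j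

invertible : ∀ {n} (P Q : Fin n → Fin n → ℚ) → RightInverse P Q → Invertible P
proj₁ (invertible P Q h) = Q
proj₂ (invertible P Q h) i j with i Fin.≟ j
... | yes refl = trans (h i i) (δ-refl i)
... | no i≢j = trans (h i j) (δ-≢ i≢j)

right-inverse : ∀ {n} (P : Fin n → Fin n → ℚ) → Invertible P → Σ (Fin n → Fin n → ℚ) (RightInverse P)
right-inverse P (Q , h) = Q , at
 where
 at : ∀ i j → sumℚ (λ k → P i k ℚ.* Q k j) ≡ δ i j
 at i j with i Fin.≟ j | h i j
 ... | yes refl | eq = trans eq (sym (δ-refl i))
 ... | no i≢j | eq = trans eq (sym (δ-≢ i≢j))

border : ∀ {n} → ℚ → (Fin n → Fin n → ℚ) → Fin (suc n) → Fin (suc n) → ℚ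
border c P Fin.zero Fin.zero = c
border c P Fin.zero (Fin.suc j) = 0ℚ
border c P (Fin.suc i) Fin.zero = 0ℚ
border c P (Fin.suc i) (Fin.suc j) = P i j

prepend : ∀ {n} → ℤ → QForm n → QForm (suc n)
prepend c f Fin.zero Fin.zero = c
prepend c f Fin.zero (Fin.suc j) = + 0
prepend c f (Fin.suc i) Fin.zero = + 0
prepend c f (Fin.suc i) (Fin.suc j) = f i j

eval-prepend : ∀ {n} c (f : QForm n) x → eval (prepend c f) x ≡ c *z (x Fin.zero *z x Fin.zero) +z eval f (λ i → x (Fin.suc i))
eval-prepend c f x = cong₂ _+z_
 (trans (cong (t₀ +z_) (sumℤ-zero {f = λ j → + 0 *z (x Fin.zero *z x (Fin.suc j))} (λ j → refl))) (ℤₚ.+-identityʳ t₀))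
 (sumℤ-cong {f = λ i → + 0 +z row i} {row} (λ i → ℤₚ.+-identityˡ (row i)))
 where
 t₀ = c *z (x Fin.zero *z x Fin.zero)
 row : Fin _ → ℤ
 row i = sumℤ (λ j → f i j *z (x (Fin.suc i) *z x (Fin.suc j)))

evalℚ-prepend : ∀ {n} c (f : QForm n) x → evalℚ (prepend c f) x ≡ (c ℚ./ 1) ℚ.* (x Fin.zero ℚ.* x Fin.zero) ℚ.+ evalℚ f (λ i → x (Fin.suc i))
evalℚ-prepend c f x = cong₂ ℚ._+_
 (trans (cong (ℚ._+_ t₀) (sumℚ-zero {f = λ j → 0ℚ ℚ.* (x Fin.zero ℚ.* x (Fin.suc j))} (λ j → ℚₚ.*-zeroˡ (x Fin.zero ℚ.* x (Fin.suc j))))) (ℚₚ.+-identityʳ t₀))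
 (sumℚ-cong {f = λ i → 0ℚ ℚ.* (x (Fin.suc i) ℚ.* x Fin.zero) ℚ.+ row i} {row} (λ i → trans (cong (ℚ._+ row i) (ℚₚ.*-zeroˡ (x (Fin.suc i) ℚ.* x Fin.zero))) (ℚₚ.+-identityˡ (row i))))
 where
 t₀ = (c ℚ./ 1) ℚ.* (x Fin.zero ℚ.* x Fin.zero)
 row : Fin _ → ℚ
 row i = sumℚ (λ j → (f i j ℚ./ 1) ℚ.* (x (Fin.suc i) ℚ.* x (Fin.suc j)))

positive-/1 : ∀ n → 0 < n → 0ℚ ℚ.< (+ n) ℚ./ 1
positive-/1 (suc n) _ = ℚₚ.toℚᵘ-cancel-< (ℚᵘₚ.<-respʳ-≃ (ℚᵘₚ.≃-sym (ℚₚ.toℚᵘ-fromℚᵘ (mkℚᵘ (+ suc n) 0))) (*<* (ℤ.+<+ z<s)))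

ℤ-cancel : ∀ n x → 0 < n → + n *z x ≡ + 0 → x ≡ + 0
ℤ-cancel (suc n) x _ h = ℤₚ.*-cancelˡ-≡ (+ suc n) x (+ 0) (trans h (sym (ℤₚ.*-zeroʳ (+ suc n))))

InS-prepend : ∀ {n r s} c (f : QForm n) → 0 < c → InS r s f → InS (suc r) s (prepend (+ c) f)
InS-prepend {n} {r} {s} c f c>0 (nondeg , r+s≡n , P , inv , d , d+ , d- , diag) = nondeg' , cong suc r+s≡n , border 1ℚ P , inv' (right-inverse P inv) , d' , d+' , d-' , diag'
 where
 nondeg' : Nondegenerate (prepend (+ c) f)
 nondeg' x h = λ { Fin.zero → ℤ-cancel (c + c) (x Fin.zero) (≤-trans c>0 (m≤m+n c c)) (trans (sym row₀) (h Fin.zero)) ; (Fin.suc i) → rest i }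
  where
  row₀ : sumℤ (λ j → (prepend (+ c) f Fin.zero j +z prepend (+ c) f j Fin.zero) *z x j) ≡ + (c + c) *z x Fin.zero
  row₀ = trans (cong (+ (c + c) *z x Fin.zero +z_) (sumℤ-zero {f = λ j → + 0 *z x (Fin.suc j)} (λ j → refl))) (ℤₚ.+-identityʳ _)
  rest : ∀ i → x (Fin.suc i) ≡ + 0
  rest = nondeg (λ i → x (Fin.suc i)) (λ i → trans (sym (ℤₚ.+-identityˡ _)) (h (Fin.suc i)))
 inv' : Σ (Fin n → Fin n → ℚ) (RightInverse P) → Invertible (border 1ℚ P)
 inv' (Q , h) = invertible (border 1ℚ P) (border 1ℚ Q) at
  where
  at : RightInverse (border 1ℚ P) (border 1ℚ Q)
  at Fin.zero Fin.zero = trans (cong (ℚ._+_ 1ℚ) (sumℚ-zero {n} (λ k → ℚₚ.*-zeroˡ 0ℚ))) (ℚₚ.+-identityʳ 1ℚ)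
  at Fin.zero (Fin.suc j) = trans (cong (ℚ._+_ 0ℚ) (sumℚ-zero (λ k → ℚₚ.*-zeroˡ (Q k j)))) (ℚₚ.+-identityʳ 0ℚ)
  at (Fin.suc i) Fin.zero = trans (cong (ℚ._+_ 0ℚ) (sumℚ-zero (λ k → ℚₚ.*-zeroʳ (P i k)))) (ℚₚ.+-identityʳ 0ℚ)
  at (Fin.suc i) (Fin.suc j) = trans (ℚₚ.+-identityˡ _) (h i j)
 d' : Fin (suc n) → ℚ
 d' Fin.zero = (+ c) ℚ./ 1
 d' (Fin.suc i) = d i
 d+' : ∀ i → toℕ i < suc r → 0ℚ ℚ.< d' i
 d+' Fin.zero _ = positive-/1 c c>0
 d+' (Fin.suc i) h = d+ i (s≤s⁻¹ h)
 d-' : ∀ i → suc r ≤ toℕ i → d' i ℚ.< 0ℚ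
 d-' (Fin.suc i) h = d- i (s≤s⁻¹ h)
 diag' : ∀ y → evalℚ (prepend (+ c) f) (λ i → sumℚ (λ k → border 1ℚ P i k ℚ.* y k)) ≡ sumℚ (λ i → d' i ℚ.* (y i ℚ.* y i))
 diag' y = trans (evalℚ-prepend (+ c) f x) (cong₂ ℚ._+_ (cong (λ v → ((+ c) ℚ./ 1) ℚ.* (v ℚ.* v)) first)
   (trans (evalℚ-cong f {λ i → x (Fin.suc i)} {x'} (λ i → trans (cong (ℚ._+ x' i) (ℚₚ.*-zeroˡ (y Fin.zero))) (ℚₚ.+-identityˡ (x' i)))) (diag (λ i → y (Fin.suc i)))))
  where
  x : Fin (suc n) → ℚ
  x i = sumℚ (λ k → border 1ℚ P i k ℚ.* y k)
  x' : Fin n → ℚ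
  x' i = sumℚ (λ k → P i k ℚ.* y (Fin.suc k))
  first : sumℚ (λ k → border 1ℚ P Fin.zero k ℚ.* y k) ≡ y Fin.zero
  first = trans (cong₂ ℚ._+_ (ℚₚ.*-identityˡ (y Fin.zero)) (sumℚ-zero (λ k → ℚₚ.*-zeroˡ (y (Fin.suc k))))) (ℚₚ.+-identityʳ (y Fin.zero))

negate : ∀ {n} → QForm n → QForm n
negate f i j = -z f i j

eval-negate : ∀ {n} (f : QForm n) x → eval (negate f) x ≡ -z eval f x
eval-negate f x = trans (sumℤ-cong (λ i → trans (sumℤ-cong (λ j → sym (ℤₚ.neg-distribˡ-* (f i j) (x i *z x j)))) (sumℤ-neg (λ j → f i j *z (x i *z x j))))) (sumℤ-neg (λ i → sumℤ (λ j → f i j *z (x i *z x j))))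

neg-/1 : ∀ a → (-z a) ℚ./ 1 ≡ ℚ.- (a ℚ./ 1)
neg-/1 (+ zero) = refl
neg-/1 (+ suc n) = refl
neg-/1 ℤ.-[1+ n ] = sym (⁻¹-involutive ((+ suc n) ℚ./ 1))

evalℚ-negate : ∀ {n} (f : QForm n) x → evalℚ (negate f) x ≡ ℚ.- evalℚ f x
evalℚ-negate f x = trans (sumℚ-cong (λ i → trans (sumℚ-cong (λ j → trans (cong (ℚ._* (x i ℚ.* x j)) (neg-/1 (f i j))) (sym (ℚₚ.neg-distribˡ-* (f i j ℚ./ 1) (x i ℚ.* x j)))))
 (sumℚ-neg (λ j → (f i j ℚ./ 1) ℚ.* (x i ℚ.* x j))))) (sumℚ-neg (λ i → sumℚ (λ j → (f i j ℚ./ 1) ℚ.* (x i ℚ.* x j))))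

-- `HasSignature` lists the positive coefficients before the negative ones, so the diagonal
-- coordinates must be reversed along with the signs; `opposite` does this.
InS-negate : ∀ {n r s} (f : QForm n) → InS r s f → InS s r (negate f)
InS-negate {n} {r} {s} f (nondeg , r+s≡n , P , inv , d , d+ , d- , diag) = nondeg' , s+r≡n , P' , inv' (right-inverse P inv) , d' , d+' , d-' , diag'
 where
 s+r≡n : s + r ≡ n
 s+r≡n = trans (+-comm s r) r+s≡n
 nondeg' : Nondegenerate (negate f)
 nondeg' x h = nondeg x (λ i → ℤₚ.neg-injective (trans (sym (trans (sumℤ-cong (λ j → ringz63 (f i j) (f j i) (x j))) (sumℤ-neg (λ j → (f i j +z f j i) *z x j)))) (h i)))
 P' : Fin n → Fin n → ℚ
 P' i k = P i (Fin.opposite k)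
 d' : Fin n → ℚ
 d' i = ℚ.- d (Fin.opposite i)
 inv' : Σ (Fin n → Fin n → ℚ) (RightInverse P) → Invertible P'
 inv' (Q , h) = invertible P' (λ k j → Q (Fin.opposite k) j) (λ i j → trans (sumℚ-opposite (λ k → P i k ℚ.* Q k j)) (h i j))
 d+' : ∀ i → toℕ i < s → 0ℚ ℚ.< d' i
 d+' i h = ℚₚ.neg-antimono-< (d- (Fin.opposite i) (≤-trans (m+n≤o⇒m≤o∸n r (≤-trans (+-monoʳ-≤ r h) (≤-reflexive r+s≡n))) (≤-reflexive (sym (Finₚ.opposite-prop i)))))
 d-' : ∀ i → s ≤ toℕ i → d' i ℚ.< 0ℚ
 d-' i h = ℚₚ.neg-antimono-< (d+ (Fin.opposite i) (≤-trans (s≤s (≤-reflexive (Finₚ.opposite-prop i)))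
  (+-cancelˡ-≤ s _ _ (≤-trans (≤-trans (≤-reflexive (+-suc s _)) (≤-trans (+-monoˡ-≤ (n ∸ suc (toℕ i)) (s≤s h)) (≤-reflexive (m+[n∸m]≡n (Finₚ.toℕ<n i))))) (≤-reflexive (sym s+r≡n))))))
 diag' : ∀ y → evalℚ (negate f) (λ i → sumℚ (λ k → P' i k ℚ.* y k)) ≡ sumℚ (λ i → d' i ℚ.* (y i ℚ.* y i))
 diag' y = begin
  evalℚ (negate f) (λ i → sumℚ (λ k → P' i k ℚ.* y k)) ≡⟨ evalℚ-negate f (λ i → sumℚ (λ k → P' i k ℚ.* y k)) ⟩
  ℚ.- evalℚ f (λ i → sumℚ (λ k → P' i k ℚ.* y k)) ≡⟨ cong ℚ.-_ (evalℚ-cong f {λ i → sumℚ (λ k → P' i k ℚ.* y k)} {λ i → sumℚ (λ k → P i k ℚ.* y' k)} (λ i → trans (sumℚ-cong (λ k → cong (λ v → P i (Fin.opposite k) ℚ.* y v) (sym (Finₚ.opposite-involutive k)))) (sumℚ-opposite (λ k → P i k ℚ.* y' k)))) ⟩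
  ℚ.- evalℚ f (λ i → sumℚ (λ k → P i k ℚ.* y' k)) ≡⟨ cong ℚ.-_ (diag y') ⟩
  ℚ.- sumℚ (λ i → d i ℚ.* (y' i ℚ.* y' i)) ≡⟨ cong ℚ.-_ (sym (sumℚ-opposite (λ i → d i ℚ.* (y' i ℚ.* y' i)))) ⟩
  ℚ.- sumℚ (λ i → d (Fin.opposite i) ℚ.* (y' (Fin.opposite i) ℚ.* y' (Fin.opposite i))) ≡⟨ sym (sumℚ-neg (λ i → d (Fin.opposite i) ℚ.* (y' (Fin.opposite i) ℚ.* y' (Fin.opposite i)))) ⟩
  sumℚ (λ i → ℚ.- (d (Fin.opposite i) ℚ.* (y' (Fin.opposite i) ℚ.* y' (Fin.opposite i)))) ≡⟨ sumℚ-cong (λ i → trans (ℚₚ.neg-distribˡ-* (d (Fin.opposite i)) (y' (Fin.opposite i) ℚ.* y' (Fin.opposite i))) (cong (λ v → d' i ℚ.* (y v ℚ.* y v)) (Finₚ.opposite-involutive i))) ⟩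
  sumℚ (λ i → d' i ℚ.* (y i ℚ.* y i)) ∎
  where
  open ≡-Reasoning
  y' : Fin n → ℚ
  y' k = y (Fin.opposite k)

ι : ℤ → ℚ
ι a = a ℚ./ 1

ι-+ : ∀ a b → ι (a +z b) ≡ ι a ℚ.+ ι b
ι-+ a b = ℚₚ.toℚᵘ-injective (ℚᵘₚ.≃-trans (ℚₚ.toℚᵘ-fromℚᵘ (mkℚᵘ (a +z b) 0)) (ℚᵘₚ.≃-sym (ℚᵘₚ.≃-trans (ℚₚ.toℚᵘ-homo-+ (ι a) (ι b))
 (ℚᵘₚ.≃-trans (ℚᵘₚ.+-cong (ℚₚ.toℚᵘ-fromℚᵘ (mkℚᵘ a 0)) (ℚₚ.toℚᵘ-fromℚᵘ (mkℚᵘ b 0))) (*≡* (ringz123 a b))))))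

ι-* : ∀ a b → ι (a *z b) ≡ ι a ℚ.* ι b
ι-* a b = ℚₚ.toℚᵘ-injective (ℚᵘₚ.≃-trans (ℚₚ.toℚᵘ-fromℚᵘ (mkℚᵘ (a *z b) 0)) (ℚᵘₚ.≃-sym (ℚᵘₚ.≃-trans (ℚₚ.toℚᵘ-homo-* (ι a) (ι b))
 (ℚᵘₚ.≃-trans (ℚᵘₚ.*-cong (ℚₚ.toℚᵘ-fromℚᵘ (mkℚᵘ a 0)) (ℚₚ.toℚᵘ-fromℚᵘ (mkℚᵘ b 0))) (*≡* refl)))))

ι-inverse : ∀ n → 0 < n → ∃ λ v → ι (+ n) ℚ.* v ≡ 1ℚ
ι-inverse n n>0 = (ℚ.1/ ι (+ n)) {{nz}} , ℚₚ.*-inverseʳ (ι (+ n)) {{nz}}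
 where
 nz : ℚ.NonZero (ι (+ n))
 nz = ℚ.>-nonZero (positive-/1 n n>0)

-- Ternary forms with upper triangular coefficients

triangle : {A : Set} → A → (a b c d e f : A) → Fin 3 → Fin 3 → A
triangle o a b c d e f 0F 0F = a
triangle o a b c d e f 0F 1F = b
triangle o a b c d e f 0F 2F = c
triangle o a b c d e f 1F 0F = o
triangle o a b c d e f 1F 1F = d
triangle o a b c d e f 1F 2F = e
triangle o a b c d e f 2F 0F = o
triangle o a b c d e f 2F 1F = o
triangle o a b c d e f 2F 2F = f

triple : {A : Set} → A → A → A → Fin 3 → A
triple a b c 0F = a
triple a b c 1F = b
triple a b c 2F = c

triangle-invertible : ∀ a b c d e f v → a ℚ.* d ℚ.* f ℚ.* v ≡ 1ℚ → Invertible (triangle 0ℚ a b c d e f)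
triangle-invertible a b c d e f v h = invertible (triangle 0ℚ a b c d e f) Q at
 where
 Q : Fin 3 → Fin 3 → ℚ
 -- The adjugate matrix times `v`, the inverse of the determinant a d f.
 Q = triangle 0ℚ (d ℚ.* f ℚ.* v) (ℚ.- (b ℚ.* f ℚ.* v)) ((b ℚ.* e ℚ.- c ℚ.* d) ℚ.* v) (a ℚ.* f ℚ.* v) (ℚ.- (a ℚ.* e ℚ.* v)) (a ℚ.* d ℚ.* v)
 l₀₀ : ∀ a b c d f v → a ℚ.* (d ℚ.* f ℚ.* v) ℚ.+ (b ℚ.* 0ℚ ℚ.+ (c ℚ.* 0ℚ ℚ.+ 0ℚ)) ≡ a ℚ.* d ℚ.* f ℚ.* v
 l₀₀ = RingSolver.solve-∀ ℚ-ring
 l₀₁ : ∀ a b c f v → a ℚ.* (ℚ.- (b ℚ.* f ℚ.* v)) ℚ.+ (b ℚ.* (a ℚ.* f ℚ.* v) ℚ.+ (c ℚ.* 0ℚ ℚ.+ 0ℚ)) ≡ 0ℚ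
 l₀₁ = RingSolver.solve-∀ ℚ-ring
 l₀₂ : ∀ a b c d e v → a ℚ.* ((b ℚ.* e ℚ.- c ℚ.* d) ℚ.* v) ℚ.+ (b ℚ.* (ℚ.- (a ℚ.* e ℚ.* v)) ℚ.+ (c ℚ.* (a ℚ.* d ℚ.* v) ℚ.+ 0ℚ)) ≡ 0ℚ
 l₀₂ = RingSolver.solve-∀ ℚ-ring
 l₁₀ : ∀ x d e → 0ℚ ℚ.* x ℚ.+ (d ℚ.* 0ℚ ℚ.+ (e ℚ.* 0ℚ ℚ.+ 0ℚ)) ≡ 0ℚ
 l₁₀ = RingSolver.solve-∀ ℚ-ring
 l₁₁ : ∀ x a d e f v → 0ℚ ℚ.* x ℚ.+ (d ℚ.* (a ℚ.* f ℚ.* v) ℚ.+ (e ℚ.* 0ℚ ℚ.+ 0ℚ)) ≡ a ℚ.* d ℚ.* f ℚ.* v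
 l₁₁ = RingSolver.solve-∀ ℚ-ring
 l₁₂ : ∀ x a d e v → 0ℚ ℚ.* x ℚ.+ (d ℚ.* (ℚ.- (a ℚ.* e ℚ.* v)) ℚ.+ (e ℚ.* (a ℚ.* d ℚ.* v) ℚ.+ 0ℚ)) ≡ 0ℚ
 l₁₂ = RingSolver.solve-∀ ℚ-ring
 l₂₀ : ∀ x y f → 0ℚ ℚ.* x ℚ.+ (0ℚ ℚ.* y ℚ.+ (f ℚ.* 0ℚ ℚ.+ 0ℚ)) ≡ 0ℚ
 l₂₀ = RingSolver.solve-∀ ℚ-ring
 l₂₂ : ∀ x y a d f v → 0ℚ ℚ.* x ℚ.+ (0ℚ ℚ.* y ℚ.+ (f ℚ.* (a ℚ.* d ℚ.* v) ℚ.+ 0ℚ)) ≡ a ℚ.* d ℚ.* f ℚ.* v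
 l₂₂ = RingSolver.solve-∀ ℚ-ring
 at : RightInverse (triangle 0ℚ a b c d e f) Q
 at 0F 0F = trans (l₀₀ a b c d f v) h
 at 0F 1F = l₀₁ a b c f v
 at 0F 2F = l₀₂ a b c d e v
 at 1F 0F = l₁₀ (Q 0F 0F) d e
 at 1F 1F = trans (l₁₁ (Q 0F 1F) a d e f v) h
 at 1F 2F = l₁₂ (Q 0F 2F) a d e v
 at 2F 0F = l₂₀ (Q 0F 0F) (Q 1F 0F) f
 at 2F 1F = l₂₀ (Q 0F 1F) (Q 1F 1F) f
 at 2F 2F = trans (l₂₂ (Q 0F 2F) (Q 1F 2F) a d f v) h

ternary : (a b c d e f x y z : ℚ) → ℚ
ternary a b c d e f x y z = a ℚ.* (x ℚ.* x) ℚ.+ b ℚ.* (x ℚ.* y) ℚ.+ c ℚ.* (x ℚ.* z) ℚ.+ d ℚ.* (y ℚ.* y) ℚ.+ e ℚ.* (y ℚ.* z) ℚ.+ f ℚ.* (z ℚ.* z)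

ternary-cong : ∀ {a b c d e f a' b' c' d' e' f'} x y z → a ≡ a' → b ≡ b' → c ≡ c' → d ≡ d' → e ≡ e' → f ≡ f' → ternary a b c d e f x y z ≡ ternary a' b' c' d' e' f' x y z
ternary-cong x y z refl refl refl refl refl refl = refl

evalℚ-triangle : ∀ a b c d e f x → evalℚ (triangle (+ 0) a b c d e f) x ≡
 ternary (ι a) (ι b) (ι c) (ι d) (ι e) (ι f) (x 0F) (x 1F) (x 2F)
evalℚ-triangle a b c d e f x = lem (ι a) (ι b) (ι c) (ι d) (ι e) (ι f) (x 0F) (x 1F) (x 2F)
 where
 lem : ∀ a b c d e f x y z →
  (a ℚ.* (x ℚ.* x) ℚ.+ (b ℚ.* (x ℚ.* y) ℚ.+ (c ℚ.* (x ℚ.* z) ℚ.+ 0ℚ))) ℚ.+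
  ((0ℚ ℚ.* (y ℚ.* x) ℚ.+ (d ℚ.* (y ℚ.* y) ℚ.+ (e ℚ.* (y ℚ.* z) ℚ.+ 0ℚ))) ℚ.+
  ((0ℚ ℚ.* (z ℚ.* x) ℚ.+ (0ℚ ℚ.* (z ℚ.* y) ℚ.+ (f ℚ.* (z ℚ.* z) ℚ.+ 0ℚ))) ℚ.+ 0ℚ))
  ≡ a ℚ.* (x ℚ.* x) ℚ.+ b ℚ.* (x ℚ.* y) ℚ.+ c ℚ.* (x ℚ.* z) ℚ.+ d ℚ.* (y ℚ.* y) ℚ.+ e ℚ.* (y ℚ.* z) ℚ.+ f ℚ.* (z ℚ.* z)
 lem = RingSolver.solve-∀ ℚ-ring

eval-triangle : ∀ a b c d e f x → eval (triangle (+ 0) a b c d e f) x ≡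
 a *z (x 0F *z x 0F) +z b *z (x 0F *z x 1F) +z c *z (x 0F *z x 2F) +z
 d *z (x 1F *z x 1F) +z e *z (x 1F *z x 2F) +z f *z (x 2F *z x 2F)
eval-triangle a b c d e f x = ringz124 a b c d e f (x 0F) (x 1F) (x 2F)

signature-3 : ∀ {A B C D E F a b c d e f} v d₀ d₁ d₂ {r s} → r + s ≡ 3 → a ℚ.* d ℚ.* f ℚ.* v ≡ 1ℚ →
 (∀ i → toℕ i < r → 0ℚ ℚ.< triple d₀ d₁ d₂ i) → (∀ i → r ≤ toℕ i → triple d₀ d₁ d₂ i ℚ.< 0ℚ) →
 (∀ x y z → ternary (ι A) (ι B) (ι C) (ι D) (ι E) (ι F) (a ℚ.* x ℚ.+ b ℚ.* y ℚ.+ c ℚ.* z) (d ℚ.* y ℚ.+ e ℚ.* z) (f ℚ.* z) ≡ d₀ ℚ.* (x ℚ.* x) ℚ.+ d₁ ℚ.* (y ℚ.* y) ℚ.+ d₂ ℚ.* (z ℚ.* z)) →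
 HasSignature (triangle (+ 0) A B C D E F) r s
signature-3 {A} {B} {C} {D} {E} {F} {a} {b} {c} {d} {e} {f} v d₀ d₁ d₂ r+s h d+ d- diag =
  r+s , M , triangle-invertible a b c d e f v h , triple d₀ d₁ d₂ , d+ , d- , λ y →
   trans (evalℚ-cong (triangle (+ 0) A B C D E F) {λ i → sumℚ (λ k → M i k ℚ.* y k)} {linear (y 0F) (y 1F) (y 2F)} (rows y))
    (trans (evalℚ-triangle A B C D E F (linear (y 0F) (y 1F) (y 2F)))
     (trans (diag (y 0F) (y 1F) (y 2F)) (collect d₀ d₁ d₂ (y 0F) (y 1F) (y 2F))))
 where
 M : Fin 3 → Fin 3 → ℚ
 M = triangle 0ℚ a b c d e f
 linear : ℚ → ℚ → ℚ → Fin 3 → ℚ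
 linear x y z = triple (a ℚ.* x ℚ.+ b ℚ.* y ℚ.+ c ℚ.* z) (d ℚ.* y ℚ.+ e ℚ.* z) (f ℚ.* z)
 r₀ : ∀ a b c x y z → a ℚ.* x ℚ.+ (b ℚ.* y ℚ.+ (c ℚ.* z ℚ.+ 0ℚ)) ≡ a ℚ.* x ℚ.+ b ℚ.* y ℚ.+ c ℚ.* z
 r₀ = RingSolver.solve-∀ ℚ-ring
 r₁ : ∀ d e x y z → 0ℚ ℚ.* x ℚ.+ (d ℚ.* y ℚ.+ (e ℚ.* z ℚ.+ 0ℚ)) ≡ d ℚ.* y ℚ.+ e ℚ.* z
 r₁ = RingSolver.solve-∀ ℚ-ring
 r₂ : ∀ f x y z → 0ℚ ℚ.* x ℚ.+ (0ℚ ℚ.* y ℚ.+ (f ℚ.* z ℚ.+ 0ℚ)) ≡ f ℚ.* z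
 r₂ = RingSolver.solve-∀ ℚ-ring
 rows : ∀ y i → sumℚ (λ k → M i k ℚ.* y k) ≡ linear (y 0F) (y 1F) (y 2F) i
 rows y 0F = r₀ a b c (y 0F) (y 1F) (y 2F)
 rows y 1F = r₁ d e (y 0F) (y 1F) (y 2F)
 rows y 2F = r₂ f (y 0F) (y 1F) (y 2F)
 collect : ∀ p q r x y z → p ℚ.* (x ℚ.* x) ℚ.+ q ℚ.* (y ℚ.* y) ℚ.+ r ℚ.* (z ℚ.* z) ≡ p ℚ.* (x ℚ.* x) ℚ.+ (q ℚ.* (y ℚ.* y) ℚ.+ (r ℚ.* (z ℚ.* z) ℚ.+ 0ℚ))
 collect = RingSolver.solve-∀ ℚ-ring

-- These are the coefficients of X² + y² + y z + K z² with X = p k + s (2y + z): the variable k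
-- parametrises the X allowed by the congruence modulo p.
definite-form : ℤ → ℤ → ℤ → QForm 3
definite-form p s K = triangle (+ 0) (p *z p) (+ 4 *z (p *z s)) (+ 2 *z (p *z s)) (+ 4 *z (s *z s) +z + 1) (+ 4 *z (s *z s) +z + 1) (s *z s +z K)

eval-definite : ∀ p s K x → eval (definite-form p s K) x ≡ Fz (+ 1) K (p *z x 0F +z s *z (+ 2 *z x 1F +z x 2F)) (x 1F) (x 2F)
eval-definite p s K x = trans (eval-triangle (p *z p) (+ 4 *z (p *z s)) (+ 2 *z (p *z s)) (+ 4 *z (s *z s) +z + 1) (+ 4 *z (s *z s) +z + 1) (s *z s +z K) x) (ringz125 p s K (x 0F) (x 1F) (x 2F))

square-/1>0 : ∀ n → 0 < n → 0ℚ ℚ.< ι (+ n) ℚ.* ι (+ n)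
square-/1>0 n n>0 = subst (0ℚ ℚ.<_) (trans (cong ι (ℤₚ.pos-* n n)) (ι-* (+ n) (+ n))) (positive-/1 (n * n) (pos-* n>0 n>0))

-- In the coordinates X = Pk + s(2y+z), 2y+z and z the form is X² + ((2y+z)² + ℓz²)/4.
InS-definite : ∀ P s K ℓ → 0 < P → 0 < ℓ → suc ℓ ≡ 4 * K → InS 3 0 (definite-form (+ P) s (+ K))
InS-definite P s K ℓ P>0 ℓ>0 4K = nondegenerate , signature (ι-inverse (P * 2) (pos-* {P} {2} P>0 z<s))
 where
 p = + P
 2ℚ = 1ℚ ℚ.+ 1ℚ
 4K-1 : + 4 *z + K +z ℤ.-[1+ 0 ] ≡ + ℓ
 4K-1 = trans (cong (_+z ℤ.-[1+ 0 ]) (trans (sym (ℤₚ.pos-* 4 K)) (cong +_ (sym 4K)))) refl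
 nondegenerate : Nondegenerate (definite-form p s (+ K))
 nondegenerate x h = λ { 0F → k≡0 ; 1F → y≡0 ; 2F → z≡0 }
  where
  k = x 0F
  y = x 1F
  z = x 2F
  X = p *z k +z s *z (+ 2 *z y +z z)
  absorb : ∀ c X t → X ≡ + 0 → c *z X +z t ≡ + 0 → t ≡ + 0
  absorb c X t refl eq = trans (sym (trans (cong (_+z t) (ℤₚ.*-zeroʳ c)) (ℤₚ.+-identityˡ t))) eq
  X≡0 : X ≡ + 0
  X≡0 = ℤ-cancel P X P>0 (ℤ-cancel 2 (p *z X) z<s (trans (sym (ringz64 p s (+ K) k y z)) (h 0F)))
  u≡0 : + 2 *z y +z z ≡ + 0
  u≡0 = absorb (+ 4 *z s) X (+ 2 *z y +z z) X≡0 (trans (sym (ringz65 p s (+ K) k y z)) (h 1F))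
  t≡0 : y +z + 2 *z + K *z z ≡ + 0
  t≡0 = absorb (+ 2 *z s) X (y +z + 2 *z + K *z z) X≡0 (trans (sym (ringz66 p s (+ K) k y z)) (h 2F))
  eliminate : ∀ K y z → (+ 4 *z K +z ℤ.-[1+ 0 ]) *z z ≡ + 2 *z (y +z + 2 *z K *z z) -z (+ 2 *z y +z z)
  eliminate = solve-∀z
  z≡0 : z ≡ + 0
  z≡0 = ℤ-cancel ℓ z ℓ>0 (trans (cong (_*z z) (sym 4K-1)) (trans (eliminate (+ K) y z) (cong₂ (λ t u → + 2 *z t -z u) t≡0 u≡0)))
  y≡0 : y ≡ + 0
  y≡0 = ℤ-cancel 2 y z<s (trans (sym (trans (cong (+ 2 *z y +z_) z≡0) (ℤₚ.+-identityʳ _))) u≡0)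
  k≡0 : k ≡ + 0
  k≡0 = ℤ-cancel P k P>0 (trans (sym (trans (cong (p *z k +z_) (trans (cong (s *z_) u≡0) (ℤₚ.*-zeroʳ s))) (ℤₚ.+-identityʳ _))) X≡0)
 signature : (∃ λ v → ι (+ (P * 2)) ℚ.* v ≡ 1ℚ) → HasSignature (definite-form p s (+ K)) 3 0
 -- The substitution k = x - 2s y', y = p y' - z', z = 2z' makes 2y + z = 2p y' and p k + s (2y + z)
 -- = p x, so the diagonal coefficients are p², p² and 4K - 1 = ℓ; its determinant is 2p.
 signature (v , Pv) = signature-3 {p *z p} {+ 4 *z (p *z s)} {+ 2 *z (p *z s)} {+ 4 *z (s *z s) +z + 1} {+ 4 *z (s *z s) +z + 1} {s *z s +z + K}
   {1ℚ} {ℚ.- (2ℚ ℚ.* ι s)} {0ℚ} {ι p} {ℚ.- 1ℚ} {2ℚ} v (ι p ℚ.* ι p) (ι p ℚ.* ι p) (2ℚ ℚ.* 2ℚ ℚ.* ι (+ K) ℚ.- 1ℚ) refl determinant positive (λ { 0F () ; 1F (s≤s ()) ; 2F (s≤s (s≤s ())) })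
   (λ x y z → trans (coefficients (1ℚ ℚ.* x ℚ.+ (ℚ.- (2ℚ ℚ.* ι s)) ℚ.* y ℚ.+ 0ℚ ℚ.* z) (ι p ℚ.* y ℚ.+ (ℚ.- 1ℚ) ℚ.* z) (2ℚ ℚ.* z)) (diagonal (ι p) (ι s) (ι (+ K)) x y z))
  where
  determinant : 1ℚ ℚ.* ι p ℚ.* 2ℚ ℚ.* v ≡ 1ℚ
  determinant = trans (cong (λ t → t ℚ.* 2ℚ ℚ.* v) (ℚₚ.*-identityˡ (ι p))) (trans (cong (ℚ._* v) (sym (trans (cong ι (ℤₚ.pos-* P 2)) (ι-* p (+ 2))))) Pv)
  d₂ : ι (+ ℓ) ≡ 2ℚ ℚ.* 2ℚ ℚ.* ι (+ K) ℚ.- 1ℚ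
  d₂ = trans (cong ι (sym 4K-1)) (trans (ι-+ (+ 4 *z + K) ℤ.-[1+ 0 ]) (cong (ℚ._+ ℚ.- 1ℚ) (ι-* (+ 4) (+ K))))
  positive : ∀ i → toℕ i < 3 → 0ℚ ℚ.< triple (ι p ℚ.* ι p) (ι p ℚ.* ι p) (2ℚ ℚ.* 2ℚ ℚ.* ι (+ K) ℚ.- 1ℚ) i
  positive 0F _ = square-/1>0 P P>0
  positive 1F _ = square-/1>0 P P>0
  positive 2F _ = subst (0ℚ ℚ.<_) d₂ (positive-/1 ℓ ℓ>0)
  coefficients : ∀ x y z → ternary (ι (p *z p)) (ι (+ 4 *z (p *z s))) (ι (+ 2 *z (p *z s))) (ι (+ 4 *z (s *z s) +z + 1)) (ι (+ 4 *z (s *z s) +z + 1)) (ι (s *z s +z + K)) x y z ≡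
   ternary (ι p ℚ.* ι p) (2ℚ ℚ.* 2ℚ ℚ.* (ι p ℚ.* ι s)) (2ℚ ℚ.* (ι p ℚ.* ι s)) (2ℚ ℚ.* 2ℚ ℚ.* (ι s ℚ.* ι s) ℚ.+ 1ℚ) (2ℚ ℚ.* 2ℚ ℚ.* (ι s ℚ.* ι s) ℚ.+ 1ℚ) (ι s ℚ.* ι s ℚ.+ ι (+ K)) x y z
  coefficients x y z = ternary-cong x y z (ι-* p p) (trans (ι-* (+ 4) (p *z s)) (cong (ι (+ 4) ℚ.*_) (ι-* p s))) (trans (ι-* (+ 2) (p *z s)) (cong (ι (+ 2) ℚ.*_) (ι-* p s))) dd dd (trans (ι-+ (s *z s) (+ K)) (cong (ℚ._+ ι (+ K)) (ι-* s s)))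
   where
   dd : ι (+ 4 *z (s *z s) +z + 1) ≡ 2ℚ ℚ.* 2ℚ ℚ.* (ι s ℚ.* ι s) ℚ.+ 1ℚ
   dd = trans (ι-+ (+ 4 *z (s *z s)) (+ 1)) (cong (ℚ._+ 1ℚ) (trans (ι-* (+ 4) (s *z s)) (cong (ι (+ 4) ℚ.*_) (ι-* s s))))
  diagonal : ∀ p s K x y z → let 2ℚ = 1ℚ ℚ.+ 1ℚ; 4s = 2ℚ ℚ.* 2ℚ ℚ.* (s ℚ.* s) ℚ.+ 1ℚ; X = 1ℚ ℚ.* x ℚ.+ (ℚ.- (2ℚ ℚ.* s)) ℚ.* y ℚ.+ 0ℚ ℚ.* z; Y = p ℚ.* y ℚ.+ (ℚ.- 1ℚ) ℚ.* z; Z = 2ℚ ℚ.* z in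
   p ℚ.* p ℚ.* (X ℚ.* X) ℚ.+ 2ℚ ℚ.* 2ℚ ℚ.* (p ℚ.* s) ℚ.* (X ℚ.* Y) ℚ.+ 2ℚ ℚ.* (p ℚ.* s) ℚ.* (X ℚ.* Z) ℚ.+ 4s ℚ.* (Y ℚ.* Y) ℚ.+ 4s ℚ.* (Y ℚ.* Z) ℚ.+ (s ℚ.* s ℚ.+ K) ℚ.* (Z ℚ.* Z)
   ≡ p ℚ.* p ℚ.* (x ℚ.* x) ℚ.+ p ℚ.* p ℚ.* (y ℚ.* y) ℚ.+ (2ℚ ℚ.* 2ℚ ℚ.* K ℚ.- 1ℚ) ℚ.* (z ℚ.* z)
  diagonal = RingSolver.solve-∀ ℚ-ring

indefinite-form : ℤ → ℤ → QForm 3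
indefinite-form w p = triangle (+ 0) w (+ 0) p (+ 1) (+ 0) (+ 0)

eval-indefinite : ∀ w p x → eval (indefinite-form w p) x ≡ x 0F *z (p *z x 2F +z w *z x 0F) +z x 1F *z x 1F
eval-indefinite w p x = trans (eval-triangle w (+ 0) p (+ 1) (+ 0) (+ 0) x) (ringz126 w p (x 0F) (x 1F) (x 2F))

InS-indefinite : ∀ P W → 0 < P → 0 < W → InS 2 1 (indefinite-form (+ W) (+ P))
InS-indefinite P W P>0 W>0 = nondegenerate , signature (ι-inverse (2 * W) (pos-* {2} {W} z<s W>0))
 where
 p = + P
 w = + W
 2ℚ = 1ℚ ℚ.+ 1ℚ
 nondegenerate : Nondegenerate (indefinite-form w p)
 nondegenerate x h = λ { 0F → y≡0 ; 1F → z≡0 ; 2F → k≡0 }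
  where
  y≡0 : x 0F ≡ + 0
  y≡0 = ℤ-cancel P (x 0F) P>0 (trans (sym (ringz69 p (x 0F) (x 1F) (x 2F))) (h 2F))
  z≡0 : x 1F ≡ + 0
  z≡0 = ℤ-cancel 2 (x 1F) z<s (trans (sym (ringz68 (x 0F) (x 1F) (x 2F))) (h 1F))
  k≡0 : x 2F ≡ + 0
  k≡0 = ℤ-cancel P (x 2F) P>0 (trans (sym (trans (cong (_+z p *z x 2F) (trans (cong (+ 2 *z w *z_) y≡0) (ℤₚ.*-zeroʳ (+ 2 *z w)))) (ℤₚ.+-identityˡ _))) (trans (sym (ringz67 w p (x 0F) (x 1F) (x 2F))) (h 0F)))
 signature : (∃ λ v → ι (+ (2 * W)) ℚ.* v ≡ 1ℚ) → HasSignature (indefinite-form w p) 2 1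
 -- With y = x - p t and k = 2w t, where t is the third new coordinate, the product y (p k + w y)
 -- becomes w (x - p t) (x + p t) = w x² - w p² t².
 signature (v , Wv) = signature-3 {w} {+ 0} {p} {+ 1} {+ 0} {+ 0} {1ℚ} {0ℚ} {ℚ.- ι p} {1ℚ} {0ℚ} {2ℚ ℚ.* ι w} v (ι w) 1ℚ (ℚ.- (ι w ℚ.* (ι p ℚ.* ι p))) refl determinant positive negative
   (λ x y z → diagonal (ι w) (ι p) x y z)
  where
  determinant : 1ℚ ℚ.* 1ℚ ℚ.* (2ℚ ℚ.* ι w) ℚ.* v ≡ 1ℚ
  determinant = trans (cong (ℚ._* v) (trans (ℚₚ.*-identityˡ (2ℚ ℚ.* ι w)) (sym (trans (cong ι (ℤₚ.pos-* 2 W)) (ι-* (+ 2) w))))) Wv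
  positive : ∀ i → toℕ i < 2 → 0ℚ ℚ.< triple (ι w) 1ℚ (ℚ.- (ι w ℚ.* (ι p ℚ.* ι p))) i
  positive 0F _ = positive-/1 W W>0
  positive 1F _ = positive-/1 1 z<s
  positive 2F (s≤s (s≤s ()))
  negative : ∀ i → 2 ≤ toℕ i → triple (ι w) 1ℚ (ℚ.- (ι w ℚ.* (ι p ℚ.* ι p))) i ℚ.< 0ℚ
  negative 1F (s≤s ())
  negative 2F _ = ℚₚ.neg-antimono-< (subst (0ℚ ℚ.<_) (trans (cong ι (trans (ℤₚ.pos-* W (P * P)) (cong (w *z_) (ℤₚ.pos-* P P)))) (trans (ι-* w (p *z p)) (cong (ι w ℚ.*_) (ι-* p p)))) (positive-/1 (W * (P * P)) (pos-* W>0 (pos-* P>0 P>0))))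
  diagonal : ∀ w p x y z → let 2ℚ = 1ℚ ℚ.+ 1ℚ; X = 1ℚ ℚ.* x ℚ.+ 0ℚ ℚ.* y ℚ.+ (ℚ.- p) ℚ.* z; Y = 1ℚ ℚ.* y ℚ.+ 0ℚ ℚ.* z; Z = 2ℚ ℚ.* w ℚ.* z in
   w ℚ.* (X ℚ.* X) ℚ.+ 0ℚ ℚ.* (X ℚ.* Y) ℚ.+ p ℚ.* (X ℚ.* Z) ℚ.+ 1ℚ ℚ.* (Y ℚ.* Y) ℚ.+ 0ℚ ℚ.* (Y ℚ.* Z) ℚ.+ 0ℚ ℚ.* (Z ℚ.* Z)
   ≡ w ℚ.* (x ℚ.* x) ℚ.+ 1ℚ ℚ.* (y ℚ.* y) ℚ.+ (ℚ.- (w ℚ.* (p ℚ.* p))) ℚ.* (z ℚ.* z)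
  diagonal = RingSolver.solve-∀ ℚ-ring

-- Forms with prescribed density

AlmostAll-exact : ∀ {C R : ℕ → Set} → (∀ m → C m → R m) → AlmostAll C R
AlmostAll-exact sub ν = 0 , λ N _ e _ h → ≤-trans (≤-reflexive (trans (cong (ν *_) (∑-zero N (λ m m<N → n≤0⇒n≡0 (≮⇒≥ (λ p → proj₂ (h m m<N p) (sub m (proj₁ (h m m<N p)))))))) (*-zeroʳ ν))) z≤n

square-abs : ∀ x → x *z x ≡ + (abs x * abs x)
square-abs (+ n) = sym (ℤₚ.pos-* n n)
square-abs ℤ.-[1+ n ] = refl

prepended : ∀ {n} → ℤ → (Fin n → ℤ) → Fin (suc n) → ℤ
prepended t x Fin.zero = t
prepended t x (Fin.suc i) = x i

module IndefiniteForms (P W : ℕ) (P>0 : 0 < P) (W>0 : 0 < W) (solve : ∀ m → Lset P (abs m) → Indefinite.Solution (+ W) P m) where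

 P² : ℤ
 P² = + (P * P)

 P²≡ : P² ≡ + P *z + P
 P²≡ = ℤₚ.pos-* P P

 Form : ℤ → ℤ → ℤ → ℤ → ℤ
 Form k y z r = y *z (+ P *z k +z + W *z y) +z z *z z +z + P *z + P *z r

 -- `lset` leaves the sign of the value open because `flip` negates the form while L depends only on
 -- the absolute value. The last witness collects the squares of the additional variables, with
 -- either sign, as the factor of P².
 record IndefiniteData (r s : ℕ) : Set where
  field
   {n} : ℕ
   qform : QForm n
   inS : InS r s qform
   hit : ∀ m → Lset P (abs m) → ∃ λ x → eval qform x ≡ m
   lset : ∀ x → Σ ℤ λ k → Σ ℤ λ y → Σ ℤ λ z → Σ ℤ λ t → eval qform x ≡ Form k y z t ⊎ -z eval qform x ≡ Form k y z t

 ternary-data : IndefiniteData 2 1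
 ternary-data = record
  { qform = indefinite-form (+ W) (+ P)
  ; inS = InS-indefinite P W P>0 W>0
  ; hit = λ m l → hit₃ m (solve m l)
  ; lset = λ x → x 2F , x 0F , x 1F , 0ℤ , inj₁ (shape₃ x) }
  where
  hit₃ : ∀ m → Indefinite.Solution (+ W) P m → ∃ λ x → eval (indefinite-form (+ W) (+ P)) x ≡ m
  hit₃ m (k , y , z , eq) = triple y z k , trans (eval-indefinite (+ W) (+ P) (triple y z k)) eq
  shape₃ : ∀ x → eval (indefinite-form (+ W) (+ P)) x ≡ Form (x 2F) (x 0F) (x 1F) 0ℤ
  shape₃ x = trans (eval-indefinite (+ W) (+ P) x) (ringz70 (x 0F *z (+ P *z x 2F +z + W *z x 0F) +z x 1F *z x 1F) (+ P))

 grow : ∀ {r s} → IndefiniteData r s → IndefiniteData (suc r) s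
 grow F = record
  { qform = prepend P² qform
  ; inS = InS-prepend (P * P) qform (pos-* P>0 P>0) inS
  ; hit = λ m l → let (x , eq) = hit m l in prepended (+ 0) x , trans (eval-prepend P² qform (prepended (+ 0) x)) (trans (cong₂ _+z_ (ℤₚ.*-zeroʳ P²) eq) (ℤₚ.+-identityˡ m))
  ; lset = λ x → shift x (lset (λ i → x (Fin.suc i))) }
  where
  open IndefiniteData F
  shift : ∀ x → (Σ ℤ λ k → Σ ℤ λ y → Σ ℤ λ z → Σ ℤ λ t → eval qform (λ i → x (Fin.suc i)) ≡ Form k y z t ⊎ -z eval qform (λ i → x (Fin.suc i)) ≡ Form k y z t) →
   Σ ℤ λ k → Σ ℤ λ y → Σ ℤ λ z → Σ ℤ λ t → eval (prepend P² qform) x ≡ Form k y z t ⊎ -z eval (prepend P² qform) x ≡ Form k y z t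
  shift x (k , y , z , t , inj₁ eq) = k , y , z , t +z x₀² , inj₁ (trans ev (trans (cong (+ P *z + P *z x₀² +z_) eq) (ringz71 (+ P) x₀² (y *z (+ P *z k +z + W *z y) +z z *z z) t)))
   where
   x₀² = x Fin.zero *z x Fin.zero
   ev : eval (prepend P² qform) x ≡ + P *z + P *z x₀² +z eval qform (λ i → x (Fin.suc i))
   ev = trans (eval-prepend P² qform x) (cong (λ v → v *z x₀² +z eval qform (λ i → x (Fin.suc i))) P²≡)
  shift x (k , y , z , t , inj₂ eq) = k , y , z , t -z x₀² , inj₂ (trans (cong -z_ ev) (trans (ringz72 (+ P) x₀² (eval qform (λ i → x (Fin.suc i))))
    (trans (cong (_-z + P *z + P *z x₀²) eq) (ringz73 (+ P) x₀² (y *z (+ P *z k +z + W *z y) +z z *z z) t))))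
   where
   x₀² = x Fin.zero *z x Fin.zero
   ev : eval (prepend P² qform) x ≡ + P *z + P *z x₀² +z eval qform (λ i → x (Fin.suc i))
   ev = trans (eval-prepend P² qform x) (cong (λ v → v *z x₀² +z eval qform (λ i → x (Fin.suc i))) P²≡)

 flip : ∀ {r s} → IndefiniteData r s → IndefiniteData s r
 flip F = record
  { qform = negate qform
  ; inS = InS-negate qform inS
  ; hit = λ m l → let (x , eq) = hit (-z m) (subst (Lset P) (sym (ℤₚ.∣-i∣≡∣i∣ m)) l) in x , trans (eval-negate qform x) (trans (cong -z_ eq) (ℤₚ.neg-involutive m))
  ; lset = λ x → swap x (lset x) }
  where
  open IndefiniteData F
  swap : ∀ x → (Σ ℤ λ k → Σ ℤ λ y → Σ ℤ λ z → Σ ℤ λ t → eval qform x ≡ Form k y z t ⊎ -z eval qform x ≡ Form k y z t) →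
   Σ ℤ λ k → Σ ℤ λ y → Σ ℤ λ z → Σ ℤ λ t → eval (negate qform) x ≡ Form k y z t ⊎ -z eval (negate qform) x ≡ Form k y z t
  swap x (k , y , z , t , inj₁ eq) = k , y , z , t , inj₂ (trans (cong -z_ (eval-negate qform x)) (trans (ℤₚ.neg-involutive (eval qform x)) eq))
  swap x (k , y , z , t , inj₂ eq) = k , y , z , t , inj₁ (trans (eval-negate qform x) eq)

 indefinite-data₁ : ∀ i → IndefiniteData (suc (suc i)) 1
 indefinite-data₁ zero = ternary-data
 indefinite-data₁ (suc i) = grow (indefinite-data₁ i)

 -- At least two negative squares: the signature (j + 2, 1) is negated to (1, j + 2), and positive
 -- variables are then added in front.
 indefinite-data₂ : ∀ i j → IndefiniteData (suc i) (suc (suc j))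
 indefinite-data₂ zero j = flip (indefinite-data₁ j)
 indefinite-data₂ (suc i) j = grow (indefinite-data₂ i j)

-- Values of the definite form and of its companion at ℓ

module Arithmetic (ℓ K : ℕ) (ℓ-prime : Prime ℓ) (ℓ%4 : ℓ % 4 ≡ 3) (4<ℓ : 4 < ℓ) (4K : suc ℓ ≡ 4 * K) where

 4Kz : + 4 *z + K ≡ + 1 +z + ℓ
 4Kz = trans (sym (cast-* 4 K)) (cong +_ (sym 4K))

 2<ℓ : 2 < ℓ
 2<ℓ = <-trans (n<1+n 2) (<-trans (n<1+n 3) 4<ℓ)

 -- If ℓ divides the value x² + (u² + ℓ z²)/4 with u = 2y + z, then x = ℓ x' and u = ℓ u', and the
 -- value divided by ℓ is ℓ x'² + (z² + ℓ u'²)/4. This is the ramified form, with the roles of u and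
 -- z exchanged: x² gets the coefficient ℓ, and the plane x ≡ s u turns into x ≡ s z, whence `lin`
 -- is 0.
 data Kind : Set where
  unramified ramified : Kind

 coef : Kind → ℕ
 coef unramified = 1
 coef ramified = ℓ

 lin : Kind → ℤ
 lin unramified = + 2
 lin ramified = 0ℤ

 Cond : Kind → ℕ → Set
 Cond unramified m = ¬ ℓ ∣ m
 Cond ramified m = ¬ ℓ ∣ m × ∃ λ t → + ℓ ∣z t *z t -z + 4 *z + m

 record Rep (κ : Kind) (P : ℕ) (s : ℤ) (m : ℕ) : Set where
  constructor rep
  field
   x y z : ℤ
   value : Fz (+ coef κ) (+ K) x y z ≡ + m
   plane : + P ∣z x -z s *z (lin κ *z y +z z)

 odd-coef : ∀ κ → + 4 ∣z + coef κ -z + 1 ⊎ + 4 ∣z + coef κ +z + 1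
 odd-coef unramified = inj₁ ∣z-0
 odd-coef ramified = inj₂ (∣⇒∣z (divides K (trans (+-comm ℓ 1) (trans 4K (*-comm 4 K)))))

 -- For z = 1 the value is A x² + y (y + 1) + K. Since A ≡ 1 or -1 modulo 4, taking x and y from {0,
 -- 1} reaches all four classes, and u = 2y + 1 is odd.
 local-4 : ∀ κ s m → Local (+ coef κ) (+ K) s (lin κ) m 4 1
 local-4 κ s m = pick (residue 4 (m -z + K)) (odd-coef κ)
  where
  A = + coef κ
  make : ∀ x y r → Coprime 4 (abs (+ 2 *z y +z + 1)) → + 4 ∣z A *z (x *z x) +z y *z y +z y -z r → + 4 ∣z m -z + K -z r → Local A (+ K) s (lin κ) m 4 1
  make x y r u d d' = local x y (+ 1) (∣z-resp (ringz74 A (+ K) m x y r) (∣z-- d d')) u (∣z-1 (x -z s *z (lin κ *z y +z + 1)))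
  c₁ : Coprime 4 1
  c₁ = Coprimality.gcd≡1⇒coprime refl
  c₃ : Coprime 4 3
  c₃ = Coprimality.gcd≡1⇒coprime refl
  pick : (∃ λ r → r < 4 × + 4 ∣z m -z + K -z + r) → + 4 ∣z A -z + 1 ⊎ + 4 ∣z A +z + 1 → Local A (+ K) s (lin κ) m 4 1
  pick (0 , _ , d) _ = make 0ℤ 0ℤ (+ 0) c₁ (∣z-resp (sym (ringz75 A)) ∣z-0) d
  pick (2 , _ , d) _ = make 0ℤ (+ 1) (+ 2) c₃ (∣z-resp (sym (ringz76 A)) ∣z-0) d
  pick (1 , _ , d) (inj₁ h) = make (+ 1) 0ℤ (+ 1) c₁ (∣z-resp (ringz77 A) h) d
  pick (1 , _ , d) (inj₂ h) = make (+ 1) (+ 1) (+ 1) c₃ (∣z-resp (ringz78 A) h) d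
  pick (3 , _ , d) (inj₁ h) = make (+ 1) (+ 1) (+ 3) c₃ (∣z-resp (ringz79 A) h) d
  pick (3 , _ , d) (inj₂ h) = make (+ 1) 0ℤ (+ 3) c₁ (∣z-resp (ringz80 A) (∣z-- h (dividesz (+ 1) refl))) d
  pick (suc (suc (suc (suc r))) , s≤s (s≤s (s≤s (s≤s ()))) , _) _

 ∤4m : ∀ {p} → Prime p → 2 < p → ∀ m → ¬ p ∣ m → ¬ + p ∣z + 4 *z + m
 ∤4m pp 2<p m p∤m = ∤-* pp (+ 4) (+ m) (∤-* pp (+ 2) (+ 2) n₂ n₂) (λ d → p∤m (∣z⇒∣ d))
  where n₂ = ∤-literal 2 z<s 2<p

 -- Modulo ℓ the term in z disappears from 4F. The unramified form leaves the conic u² + 4x² = 4m,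
 -- which has a point with u nonzero; the ramified one loses x as well and leaves u² = 4m, hence the
 -- square condition in `Cond`.
 local-ℓ : ∀ κ s m → Cond κ m → Local (+ coef κ) (+ K) s (lin κ) (+ m) ℓ 1
 local-ℓ unramified s m ℓ∤m = point (conic-x≢0 ℓ-prime 4<ℓ (+ 1) (+ 4) (+ 4 *z + m) (∤-literal 1 z<s (prime>1 ℓ-prime)) (∤-literal 4 z<s 4<ℓ) (∤4m ℓ-prime 2<ℓ m ℓ∤m))
  where
  point : (Σ ℤ λ u → Σ ℤ λ x → ¬ + ℓ ∣z u × + ℓ ∣z + 1 *z (u *z u) +z + 4 *z (x *z x) -z + 4 *z + m) → Local (+ 1) (+ K) s (+ 2) (+ m) ℓ 1
  point (u , x , nu , h) = let y , v , c , _ = local-odd ℓ-prime 2<ℓ (+ 1) (+ K) (+ ℓ) 4Kz (+ m) x u 0ℤ nu (∣z-resp (ringz81 u x (+ m) (+ ℓ)) h) in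
   local x y 0ℤ v c (∣z-1 (x -z s *z (+ 2 *z y +z 0ℤ)))
 local-ℓ ramified s m (ℓ∤m , t , h) = let y , v , c , _ = local-odd ℓ-prime 2<ℓ (+ ℓ) (+ K) (+ ℓ) 4Kz (+ m) 0ℤ t 0ℤ nt (∣z-resp (ringz82 t (+ m) (+ ℓ)) h) in
   local 0ℤ y 0ℤ v c (∣z-1 (0ℤ -z s *z (0ℤ *z y +z 0ℤ)))
  where
  nt : ¬ + ℓ ∣z t
  nt d = ∤4m ℓ-prime 2<ℓ m ℓ∤m (∣z-resp (ringz83 t (+ m)) (∣z-- (∣z-*ˡ t d) h))

 -- On the plane 4F becomes binary: x = s u gives (4s² + 1) u² + ℓ z², and x = s z gives u² + ℓ (4s²
 -- + 1) z². The case t = 0 of `Nonsplit` makes the coefficients units, so 4m is attained with u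
 -- nonzero.
 local-p : ∀ κ {p} → Prime p → 4 < p → ∀ s m → Nonsplit (+ ℓ) p s → ¬ p ∣ m → Local (+ coef κ) (+ K) s (lin κ) (+ m) p p
 local-p unramified {p} pp 4<p s m ns p∤m = point (conic-x≢0 pp 4<p (+ 4 *z (s *z s) +z + 1) (+ ℓ) (+ 4 *z + m) (Nonsplit⇒∤α (+ ℓ) s ns) (Nonsplit⇒∤ℓ (+ ℓ) s ns) (∤4m pp 2<p m p∤m))
  where
  2<p : 2 < p
  2<p = <-trans (n<1+n 2) (<-trans (n<1+n 3) 4<p)
  point : (Σ ℤ λ u → Σ ℤ λ z → ¬ + p ∣z u × + p ∣z (+ 4 *z (s *z s) +z + 1) *z (u *z u) +z + ℓ *z (z *z z) -z + 4 *z + m) → Local (+ 1) (+ K) s (+ 2) (+ m) p p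
  point (u , z , nu , h) = let y , v , c , du = local-odd pp 2<p (+ 1) (+ K) (+ ℓ) 4Kz (+ m) (s *z u) u z nu (∣z-resp (ringz84 s u z (+ m) (+ ℓ)) h) in
   local (s *z u) y z v c (∣z-resp (ringz85 s u y z) (∣z-*ˡ (-z s) du))
 local-p ramified {p} pp 4<p s m ns p∤m = point (conic-x≢0 pp 4<p (+ 1) (+ ℓ *z (+ 4 *z (s *z s) +z + 1)) (+ 4 *z + m) (∤-literal 1 z<s (prime>1 pp))
   (∤-* pp (+ ℓ) (+ 4 *z (s *z s) +z + 1) (Nonsplit⇒∤ℓ (+ ℓ) s ns) (Nonsplit⇒∤α (+ ℓ) s ns)) (∤4m pp 2<p m p∤m))
  where
  2<p : 2 < p
  2<p = <-trans (n<1+n 2) (<-trans (n<1+n 3) 4<p)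
  point : (Σ ℤ λ u → Σ ℤ λ z → ¬ + p ∣z u × + p ∣z + 1 *z (u *z u) +z + ℓ *z (+ 4 *z (s *z s) +z + 1) *z (z *z z) -z + 4 *z + m) → Local (+ ℓ) (+ K) s 0ℤ (+ m) p p
  point (u , z , nu , h) = let y , v , c , _ = local-odd pp 2<p (+ ℓ) (+ K) (+ ℓ) 4Kz (+ m) (s *z z) u z nu (∣z-resp (ringz86 s u z (+ m) (+ ℓ)) h) in
   local (s *z z) y z v c (∣z-resp (ringz87 s y z) ∣z-0)

 -- At the remaining primes u is set to 1, which settles the unit condition, and 4A x² + ℓ z² = 4m -
 -- 1 is a conic with unit coefficients.
 local-q : ∀ κ {q} → Prime q → 2 < q → ∀ s m → ¬ q ∣ ℓ → Local (+ coef κ) (+ K) s (lin κ) (+ m) q 1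
 local-q κ {q} qq 2<q s m q∤ℓ = start (odd-prime qq 2<q)
  where
  A = + coef κ
  n₂ = ∤-literal 2 z<s 2<q
  nℓ : ¬ + q ∣z + ℓ
  nℓ d = q∤ℓ (∣z⇒∣ d)
  nA : ∀ κ → ¬ + q ∣z + coef κ
  nA unramified = ∤-literal 1 z<s (prime>1 qq)
  nA ramified = nℓ
  point : (Σ ℤ λ x → Σ ℤ λ z → + q ∣z + 4 *z A *z (x *z x) +z + ℓ *z (z *z z) -z (+ 4 *z + m -z + 1)) → Local A (+ K) s (lin κ) (+ m) q 1
  point (x , z , h) = let y , v , c , _ = local-odd qq 2<q A (+ K) (+ ℓ) 4Kz (+ m) x (+ 1) z (∤-literal 1 z<s (prime>1 qq)) (∣z-resp (ringz88 A x z (+ m) (+ ℓ)) h) in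
   local x y z v c (∣z-1 (x -z s *z (lin κ *z y +z z)))
  start : (∃ λ h → q ≡ 1 + 2 * h) → Local A (+ K) s (lin κ) (+ m) q 1
  start (h , q≡) = point (conic h qq q≡ (+ 4 *z A) (+ ℓ) (+ 4 *z + m -z + 1) (∤-* qq (+ 4) A (∤-* qq (+ 2) (+ 2) n₂ n₂) (nA κ)) nℓ)

 module Modulus (P : ℕ) (P>0 : 0 < P) (sqf : Squarefree P) (large : ∀ p → Prime p → p ∣ P → ℓ < p)
         (s : ℤ) (nonsplit-s : ∀ p → Prime p → p ∣ P → Nonsplit (+ ℓ) p s) where

  -- A multiple of 2ℓP divisible by all primes up to q. A number joins only if it is coprime to
  -- everything collected before, and is then 1 or a prime by `new-prime`. So 2H is a product of 4,
  -- ℓ, the primes of P and further distinct primes, and solutions modulo these pairwise coprime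
  -- factors are glued by the Chinese remainder theorem.
  H : ℕ → ℕ
  H zero = 2 * ℓ * P
  H (suc q) with coprime? (suc q) (H q)
  ... | yes _ = suc q * H q
  ... | no _ = H q

  H-∣ : ∀ q → H q ∣ H (suc q)
  H-∣ q with coprime? (suc q) (H q)
  ... | yes _ = n∣m*n (suc q)
  ... | no _ = ∣-refl

  base∣H : ∀ q → 2 * ℓ * P ∣ H q
  base∣H zero = ∣-refl
  base∣H (suc q) = ∣-trans (base∣H q) (H-∣ q)

  H>0 : ∀ q → 0 < H q
  H>0 zero = pos-* (pos-* {2} z<s (<⇒≤ (prime>1 ℓ-prime))) P>0
  H>0 (suc q) with coprime? (suc q) (H q)
  ... | yes _ = pos-* {suc q} z<s (H>0 q)
  ... | no _ = H>0 q

  2∣H : ∀ q → 2 ∣ H q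
  2∣H q = ∣-trans (∣-trans (m∣m*n ℓ) (m∣m*n P)) (base∣H q)

  ℓ∣H : ∀ q → ℓ ∣ H q
  ℓ∣H q = ∣-trans (∣-trans (n∣m*n 2) (m∣m*n P)) (base∣H q)

  P∣H : ∀ q → P ∣ H q
  P∣H q = ∣-trans (n∣m*n (2 * ℓ)) (base∣H q)

  dense : ∀ Q q → 2 ≤ q → q ≤ Q → ¬ Coprime q (H Q)
  dense zero q 2≤q q≤0 c = contradiction (≤-trans 2≤q q≤0) λ ()
  dense (suc Q) q 2≤q q≤ c with m≤n⇒m<n∨m≡n q≤
  ... | inj₁ q< = dense Q q 2≤q (s≤s⁻¹ q<) (coprime-∣ʳ (H-∣ Q) c)
  ... | inj₂ refl with coprime? (suc Q) (H Q)
  ... | yes _ = contradiction (c (∣-refl , m∣m*n (H Q))) (>⇒≢ 2≤q)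
  ... | no ¬c = ¬c c

  new-prime : ∀ q → 1 < suc q → Coprime (suc q) (H q) → Prime (suc q)
  new-prime q 1<q c = irreducible⇒prime {{n>1⇒nonTrivial 1<q}} irr
   where
   irr : ∀ {d} → d ∣ suc q → d ≡ 1 ⊎ d ≡ suc q
   irr {zero} d∣ = contradiction (0∣⇒≡0 d∣) λ ()
   irr {suc zero} _ = inj₁ refl
   irr {d@(suc (suc _))} d∣ with m≤n⇒m<n∨m≡n (∣⇒≤ d∣)
   ... | inj₂ eq = inj₂ eq
   ... | inj₁ d< = ⊥-elim (dense q d (s≤s z<s) (s≤s⁻¹ d<) (coprime-∣ˡ d∣ c))

  odd-ℓ : Coprime 4 ℓ
  odd-ℓ = coprime-*ˡ {2} {2} {ℓ} c₂ c₂
   where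
   c₂ : Coprime 2 ℓ
   c₂ = Coprimality.sym (prime-coprime ℓ-prime (small-∤ z<s 2<ℓ))

  4ℓ⊥P : Coprime (4 * ℓ) P
  4ℓ⊥P {d} (d∣4ℓ , d∣P) with d ≟ 1
  ... | yes d≡1 = d≡1
  ... | no d≢1 with d ≟ 0
  ... | yes refl = contradiction (0∣⇒≡0 d∣P) (>⇒≢ P>0)
  ... | no d≢0 = let p , pp , p∣d = prime-divisor d (≤∧≢⇒< (n≢0⇒n>0 d≢0) (λ e → d≢1 (sym e))) in
           ⊥-elim (bad p pp (large p pp (∣-trans p∣d d∣P)) (euclidsLemma 4 ℓ pp (∣-trans p∣d d∣4ℓ)))
   where
   bad : ∀ p → Prime p → ℓ < p → p ∣ 4 ⊎ p ∣ ℓ → ⊥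
   bad p pp ℓ<p (inj₁ d) = small-∤ z<s (<-trans 4<ℓ ℓ<p) d
   bad p pp ℓ<p (inj₂ d) = small-∤ (<⇒≤ (prime>1 ℓ-prime)) ℓ<p d

  module _ (κ : Kind) (m : ℕ) (cond : Cond κ m) (m⊥P : Coprime m P) where

   local-P : Local (+ coef κ) (+ K) s (lin κ) (+ m) P P
   local-P = squarefree-induction P>0 sqf (λ e → Local (+ coef κ) (+ K) s (lin κ) (+ m) e e)
    (local 0ℤ 0ℤ 0ℤ (∣z-1 (Fz (+ coef κ) (+ K) 0ℤ 0ℤ 0ℤ -z + m)) (λ { (d∣1 , _) → ∣1⇒≡1 d∣1 }) (∣z-1 (0ℤ -z s *z (lin κ *z 0ℤ +z 0ℤ))))
    (λ p e pp pe∣P cop S → let p∣P = ∣-trans (m∣m*n e) pe∣P in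
     local-* cop ∣-refl ∣-refl (local-p κ pp (<-trans 4<ℓ (large p pp p∣P)) s m (nonsplit-s p pp p∣P)
      (λ p∣m → >⇒≢ (prime>1 pp) (m⊥P (p∣m , p∣P)))) S) P ∣-refl

   local-H : ∀ q → Local (+ coef κ) (+ K) s (lin κ) (+ m) (2 * H q) P
   local-H zero = subst₂ (Local (+ coef κ) (+ K) s (lin κ) (+ m)) (ring33 ℓ P) (*-identityˡ P)
    (local-* 4ℓ⊥P (1∣ _) ∣-refl (local-* odd-ℓ (1∣ _) (1∣ _) (local-4 κ s (+ m)) (local-ℓ κ s m cond)) local-P)
   local-H (suc q) with coprime? (suc q) (H q)
   ... | no _ = local-H q
   ... | yes c = next q c (local-H q)
    where
    next : ∀ q → Coprime (suc q) (H q) → Local (+ coef κ) (+ K) s (lin κ) (+ m) (2 * H q) P → Local (+ coef κ) (+ K) s (lin κ) (+ m) (2 * (suc q * H q)) P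
    next zero c S = subst (λ n → Local (+ coef κ) (+ K) s (lin κ) (+ m) (2 * n) P) (sym (*-identityˡ (H 0))) S
    next (suc q) c S = subst₂ (Local (+ coef κ) (+ K) s (lin κ) (+ m)) (ring34 (2 + q) (H (suc q))) (*-identityˡ P)
      (local-* (coprime-*ʳ c₂ c) (1∣ _) (∣-trans (P∣H (suc q)) (n∣m*n 2)) (local-q κ pp 2<q s m q∤ℓ) S)
     where
     pp : Prime (2 + q)
     pp = new-prime (suc q) (s≤s z<s) c
     c₂ : Coprime (2 + q) 2
     c₂ = coprime-∣ʳ (2∣H (suc q)) c
     2<q : 2 < 2 + q
     2<q = ≤∧≢⇒< (s≤s (s≤s z≤n)) (λ e → contradiction (c₂ (subst (2 ∣_) e ∣-refl , ∣-refl)) λ ())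
     q∤ℓ : ¬ 2 + q ∣ ℓ
     q∤ℓ d = contradiction (c (∣-refl , ∣-trans d (ℓ∣H (suc q)))) λ ()

  coef>0 : ∀ κ → 0 < coef κ
  coef>0 unramified = z<s
  coef>0 ramified = <⇒≤ (prime>1 ℓ-prime)

  coef∣H : ∀ κ q → coef κ ∣ H q
  coef∣H unramified q = 1∣ H q
  coef∣H ramified q = ℓ∣H q

  module _ (κ : Kind) (Q : ℕ) where
   private
    h : ℕ
    h = H Q
    M : ℕ
    M = 2 * h
    instance
     M≢0 : NonZero M
     M≢0 = >-nonZero (pos-* {2} z<s (H>0 Q))

   admissible : ∀ m → Cond κ m → Coprime m P →
    Σ ℕ λ x → Σ ℕ λ y → Σ ℕ λ z → Admissible (coef κ) K ℓ h Q x y z × + M ∣z Fz (+ coef κ) (+ K) (+ x) (+ y) (+ z) -z + m × + P ∣z + x -z s *z (lin κ *z + y +z + z)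
   admissible m cond m⊥P = reduce (local-H κ m cond m⊥P Q)
    where
    neg : ∀ a b → + M ∣z a -z b → + M ∣z b -z a
    neg a b d = ∣z-resp (ringz11 a b) (∣z-- ∣z-0 d)
    reduce : Local (+ coef κ) (+ K) s (lin κ) (+ m) M P → _
    reduce S = build (residue M (Local.x S)) (residue M (Local.y S)) (residue M (Local.z S))
     where
     build : (∃ λ x → x < M × + M ∣z Local.x S -z + x) → (∃ λ y → y < M × + M ∣z Local.y S -z + y) → (∃ λ z → z < M × + M ∣z Local.z S -z + z) →
      Σ ℕ λ x → Σ ℕ λ y → Σ ℕ λ z → Admissible (coef κ) K ℓ h Q x y z × + M ∣z Fz (+ coef κ) (+ K) (+ x) (+ y) (+ z) -z + m × + P ∣z + x -z s *z (lin κ *z + y +z + z)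
     build (x , x< , dx) (y , y< , dy) (z , z< , dz) = finish (local-transport (∣-trans (P∣H Q) (n∣m*n 2)) S (+ x) (+ y) (+ z) (neg (Local.x S) (+ x) dx) (neg (Local.y S) (+ y) dy) (neg (Local.z S) (+ z) dz))
      where
      finish : + M ∣z Fz (+ coef κ) (+ K) (+ x) (+ y) (+ z) -z + m × Coprime M (abs (+ 2 *z + y +z + z)) × + P ∣z + x -z s *z (lin κ *z + y +z + z) → _
      finish (v , u , p) = x , y , z , record
       { H>0 = H>0 Q ; A>0 = coef>0 κ ; 2∣H = 2∣H Q ; A∣H = coef∣H κ Q ; L∣H = ℓ∣H Q ; 4K = 4K
       ; cop = Coprimality.sym (coprime-∣ˡ {h} {M} (n∣m*n 2) (subst (λ v → Coprime M (abs (v +z + z))) (sym (cast-* 2 y)) u))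
       ; x₀≤ = <⇒≤ x< ; y₀≤ = <⇒≤ y< ; z₀≤ = <⇒≤ z< ; dense = dense Q } , v , p

   coord : ∀ c i → + M ∣z + (c + M * i) -z + c
   coord c i = dividesz (+ i) (trans (ringz12 (+ c) (+ (M * i))) (trans (cast-* M i) (ℤₚ.*-comm (+ M) (+ i))))

   sampled : ∀ {x y z m} → + M ∣z Fz (+ coef κ) (+ K) (+ x) (+ y) (+ z) -z + m → + P ∣z + x -z s *z (lin κ *z + y +z + z) → ∀ i j k →
    let v = form (coef κ) K (x + M * i) (y + M * j) (z + M * k) in v % M ≡ m % M × Rep κ P s v
   sampled {x} {y} {z} {m} value plane i j k = ∣z⇒%≡ M _ m cls , rep (+ (x + M * i)) (+ (y + M * j)) (+ (z + M * k)) (sym (cast-form (coef κ) K (x + M * i) (y + M * j) (z + M * k))) pl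
    where
    X = + (x + M * i)
    Y = + (y + M * j)
    Z = + (z + M * k)
    cls : + M ∣z + form (coef κ) K (x + M * i) (y + M * j) (z + M * k) -z + m
    cls = subst (λ v → + M ∣z v -z + m) (sym (cast-form (coef κ) K (x + M * i) (y + M * j) (z + M * k)))
     (∣z-resp (ringz13 (Fz (+ coef κ) (+ K) X Y Z) (Fz (+ coef κ) (+ K) (+ x) (+ y) (+ z)) (+ m))
      (∣z-+ (F-cong (+ coef κ) (+ K) X (+ x) Y (+ y) Z (+ z) (coord x i) (coord y j) (coord z k)) value))
    P∣M : + P ∣z + M
    P∣M = ∣⇒∣z (∣-trans (P∣H Q) (n∣m*n 2))
    pl : + P ∣z X -z s *z (lin κ *z Y +z Z)
    pl = ∣z-resp (ringz14 s (lin κ) X (+ x) Y (+ y) Z (+ z)) (∣z-+ (∣z-- (∣z-trans P∣M (coord x i)) (∣z-*ˡ s (∣z-+ (∣z-*ˡ (lin κ) (∣z-trans P∣M (coord y j))) (∣z-trans P∣M (coord z k))))) plane)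

   module _ (μ N : ℕ) (e : ℕ → ℕ) (e≤1 : ∀ m → e m ≤ 1)
        (supp : ∀ m → m < N → 0 < e m → (Cond κ m × Coprime m P) × ¬ Rep κ P s m)
        (near : ∀ {x y z} → Admissible (coef κ) K ℓ h Q x y z → ∀ γ → Represents (coef κ) K h x y z N γ → Near μ N (M * ∑ N γ)) where

    class-sum : ℕ → ℕ
    class-sum c = ∑[ m < N ] 𝟙 (m % M ≟ c) * e m

    -- An exceptional m in the class supplies an admissible residue of points whose values stay in
    -- the class of m. All of these below N avoid the exceptional set, so by sampling the
    -- nonexceptional members already number nearly N / M, and little room is left for exceptions. A
    -- class without exceptions satisfies the bound trivially.
    class-sum≤ : ∀ c → μ * (M * class-sum c) ≤ N + μ * M
    class-sum≤ c with class-sum c ≟ 0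
    ... | yes z = ≤-trans (≤-reflexive (trans (cong (λ v → μ * (M * v)) z) (trans (cong (μ *_) (*-zeroʳ M)) (*-zeroʳ μ)))) z≤n
    ... | no nz = witness (∑-pos N _ (n≢0⇒n>0 nz))
     where
     witness : (∃ λ m → m < N × 0 < 𝟙 (m % M ≟ c) * e m) → μ * (M * class-sum c) ≤ N + μ * M
     witness (m , m<N , h₀) = use (*-pos (𝟙 (m % M ≟ c)) (e m) h₀)
      where
      use : 0 < 𝟙 (m % M ≟ c) × 0 < e m → μ * (M * class-sum c) ≤ N + μ * M
      use (h₁ , h₂) = apply (supp m m<N h₂)
       where
       m≡c : m % M ≡ c
       m≡c = 𝟙-pos (m % M ≟ c) h₁
       γ : ℕ → ℕ
       γ n = 𝟙 (n % M ≟ c) * (1 ∸ e n)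
       split : ∑ N γ + class-sum c ≡ ∑[ n < N ] 𝟙 (n % M ≟ c)
       split = trans (sym (∑-+ N γ _)) (∑-cong N (λ n _ → trans (sym (*-distribˡ-+ (𝟙 (n % M ≟ c)) (1 ∸ e n) (e n))) (trans (cong (𝟙 (n % M ≟ c) *_) (m∸n+n≡m (e≤1 n))) (*-identityʳ _))))
       combine : Near μ N (M * ∑ N γ) → μ * (M * class-sum c) ≤ N + μ * M
       combine nr = +-cancelʳ-≤ (μ * (M * ∑ N γ)) _ _ (begin
        μ * (M * class-sum c) + μ * (M * ∑ N γ) ≡⟨ ring1 μ M (class-sum c) (∑ N γ) ⟩
        μ * (M * (∑ N γ + class-sum c)) ≡⟨ cong (λ v → μ * (M * v)) split ⟩
        μ * (M * (∑[ n < N ] 𝟙 (n % M ≟ c))) ≤⟨ *-monoʳ-≤ μ (class-count M c N) ⟩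
        μ * (N + M) ≡⟨ *-distribˡ-+ μ N M ⟩
        μ * N + μ * M ≤⟨ +-monoˡ-≤ (μ * M) nr ⟩
        μ * (M * ∑ N γ) + N + μ * M ≡⟨ ring2 (μ * (M * ∑ N γ)) N (μ * M) ⟩
        N + μ * M + μ * (M * ∑ N γ) ∎)
        where
        open ≤-Reasoning
       apply : (Cond κ m × Coprime m P) × ¬ Rep κ P s m → μ * (M * class-sum c) ≤ N + μ * M
       apply ((cond , m⊥P) , _) = go (admissible m cond m⊥P)
        where
        go : (Σ ℕ λ x → Σ ℕ λ y → Σ ℕ λ z → Admissible (coef κ) K ℓ h Q x y z × + M ∣z Fz (+ coef κ) (+ K) (+ x) (+ y) (+ z) -z + m × + P ∣z + x -z s *z (lin κ *z + y +z + z)) → μ * (M * class-sum c) ≤ N + μ * M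
        go (x , y , z , adm , value , plane) = combine (near adm γ represents)
         where
         represents : Represents (coef κ) K h x y z N γ
         represents i j k v<N = ≤-reflexive (sym (cong₂ _*_ (𝟙-yes (_ ≟ c) (trans (proj₁ sp) m≡c)) (cong (1 ∸_) e≡0)))
          where
          sp = sampled value plane i j k
          e≡0 : e (form (coef κ) K (x + M * i) (y + M * j) (z + M * k)) ≡ 0
          e≡0 = n≤0⇒n≡0 (≮⇒≥ (λ h → proj₂ (supp _ v<N h) (proj₂ sp)))

    total≤ : μ * ∑ N e ≤ N + μ * M
    total≤ = *-cancelˡ-≤ M (begin
     M * (μ * ∑ N e) ≡⟨ cong (λ v → M * (μ * v)) (∑-classes M N e) ⟩
     M * (μ * (∑[ c < M ] class-sum c)) ≡⟨ trans (ring13 M μ (∑ M class-sum)) (sym (∑-*ˡ M (μ * M) class-sum)) ⟩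
     ∑[ c < M ] μ * M * class-sum c ≤⟨ ∑-mono M (λ c _ → ≤-trans (≤-reflexive (*-assoc μ M (class-sum c))) (class-sum≤ c)) ⟩
     ∑[ c < M ] (N + μ * M) ≡⟨ ∑-const M (N + μ * M) ⟩
     M * (N + μ * M) ∎)
     where
     open ≤-Reasoning

  almost-all : ∀ κ → AlmostAll (λ m → Cond κ m × Coprime m P) (Rep κ P s)
  almost-all κ ν = from (2 * suc ν) (320 * (2 * (2 * (2 * suc ν))) * (11 + 4 * K)) refl ≤-refl
   where
   open ≤-Reasoning
   Goal : Set
   Goal = ∃ λ N₀ → ∀ N → N₀ ≤ N → ∀ e → (∀ m → e m ≤ 1) → (∀ m → m < N → 0 < e m → (Cond κ m × Coprime m P) × ¬ Rep κ P s m) → ν * ∑ N e ≤ N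
   conclude : ∀ μ Q → (∃ λ N₀ → ∀ N → N₀ ≤ N → ∀ {x₀ y₀ z₀} → Admissible (coef κ) K ℓ (H Q) Q x₀ y₀ z₀ → (γ : ℕ → ℕ) →
    Represents (coef κ) K (H Q) x₀ y₀ z₀ N γ → Near μ N (2 * H Q * ∑ N γ)) → μ ≡ 2 * suc ν → Goal
   conclude μ Q (N₁ , near) μ≡ = N₁ + μ * (2 * H Q) , λ N N₀≤N e e≤1 supp → begin
     ν * ∑ N e ≤⟨ *-monoˡ-≤ (∑ N e) (n≤1+n ν) ⟩
     suc ν * ∑ N e ≤⟨ *-cancelˡ-≤ 2 (begin
       2 * (suc ν * ∑ N e) ≡⟨ trans (sym (*-assoc 2 (suc ν) (∑ N e))) (cong (_* ∑ N e) (sym μ≡)) ⟩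
       μ * ∑ N e ≤⟨ total≤ κ Q μ N e e≤1 supp (λ adm → near N (≤-trans (m≤m+n N₁ _) N₀≤N) adm) ⟩
       N + μ * (2 * H Q) ≤⟨ +-monoʳ-≤ N (≤-trans (m≤n+m _ N₁) N₀≤N) ⟩
       N + N ≡⟨ cong (_+_ N) (sym (+-identityʳ N)) ⟩
       2 * N ∎) ⟩
     N ∎
   from : ∀ μ Q → μ ≡ 2 * suc ν → 320 * (2 * (2 * μ)) * (11 + 4 * K) ≤ Q → Goal
   from μ Q μ≡ hQ = conclude μ Q (sampling (coef κ) K ℓ (H Q) Q μ (coef>0 κ) (H>0 Q) (subst (0 <_) (sym μ≡) z<s) hQ) μ≡

 -- Division of the values by ℓ and by ℓ²

 ℓ≡ : + ℓ ≡ + 4 *z + K -z + 1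
 ℓ≡ = trans (ringz89 (+ ℓ)) (cong (_-z + 1) (sym 4Kz))

 Rep-scale : ∀ κ {P P' s m} t → P ∣ t * P' → Rep κ P' s m → Rep κ P s (t * t * m)
 Rep-scale κ {P} {P'} {s} {m} t h (rep x y z value plane) = rep (+ t *z x) (+ t *z y) (+ t *z z)
  (trans (ringz90 (+ t) (+ coef κ) (+ K) x y z) (trans (cong (+ t *z + t *z_) value) (sym (trans (cast-* (t * t) m) (cong (_*z + m) (cast-* t t))))))
  (∣z-trans (∣⇒∣z h) (scaled plane))
  where
  scaled : + P' ∣z x -z s *z (lin κ *z y +z z) → + (t * P') ∣z + t *z x -z s *z (lin κ *z (+ t *z y) +z + t *z z)
  scaled (dividesz q eq) = dividesz q (trans (ringz91 (+ t) s (lin κ) x y z) (trans (cong (+ t *z_) eq) (trans (ringz92 (+ t) q (+ P')) (cong (q *z_) (sym (cast-* t P'))))))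

 -- Multiplication by √-ℓ on the binary part: in terms of u = 2y + z the new point has u' = ℓ z and
 -- z' = u, so that u'² + ℓ z'² = ℓ (u² + ℓ z²), while x is multiplied by ℓ. The coefficient 2K - 1
 -- of z comes from 4K - 1 = ℓ.
 Rep-ramified : ∀ {P s m} → Rep ramified P s m → Rep unramified P s (ℓ * m)
 Rep-ramified {P} {s} {m} (rep x y z value plane) = rep (+ ℓ *z x) ((+ 2 *z + K -z + 1) *z z -z y) (+ 2 *z y +z z)
  (trans (cong (λ l → Fz (+ 1) (+ K) (l *z x) ((+ 2 *z + K -z + 1) *z z -z y) (+ 2 *z y +z z)) ℓ≡)
   (trans (ringz93 (+ K) x y z) (trans (cong (λ l → l *z Fz l (+ K) x y z) (sym ℓ≡)) (trans (cong (+ ℓ *z_) value) (sym (cast-* ℓ m))))))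
  (∣z-resp (sym (trans (cong (λ l → l *z x -z s *z (+ 2 *z ((+ 2 *z + K -z + 1) *z z -z y) +z (+ 2 *z y +z z))) ℓ≡) (ringz94 (+ K) s x y z))) (∣z-*ˡ (+ 4 *z + K -z + 1) plane))

 four-m : ∀ x y z {m} → Fz (+ 1) (+ K) x y z ≡ + m →
  + 4 *z + m ≡ + 4 *z (+ 1 *z (x *z x)) +z (+ 2 *z y +z z) *z (+ 2 *z y +z z) +z + ℓ *z (z *z z)
 four-m x y z value = trans (cong (+ 4 *z_) (sym value)) (four-F (+ 1) (+ K) (+ ℓ) 4Kz x y z)

 -- If ℓ divides m = F(x, y, z) then it divides x and u = 2y + z, because −1 is not a square modulo ℓ.
 Rep-ℓ∣ : ∀ {P s} → Coprime P ℓ → ∀ m₁ → Rep unramified P s (ℓ * m₁) →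
  (∃ λ t → + ℓ ∣z t *z t -z + 4 *z + m₁) × (∀ m₂ → m₁ ≡ ℓ * m₂ → Rep unramified P s m₂)
 Rep-ℓ∣ {P} {s} P⊥ℓ m₁ (rep x y z value plane) = strip (sum-of-squares ℓ-prime ℓ%4 (+ 2 *z x) (+ 2 *z y +z z) ℓ∣sum)
  where
  n₂ : ¬ + ℓ ∣z + 2
  n₂ = ∤-literal 2 z<s 2<ℓ
  nzℓ : NonZero ℓ
  nzℓ = prime⇒nonZero ℓ-prime
  ℓ∣ℓ : ∀ a → + ℓ ∣z + ℓ *z a
  ℓ∣ℓ a = dividesz a (ℤₚ.*-comm (+ ℓ) a)
  ℓ∣4m : + ℓ ∣z + 4 *z + (ℓ * m₁)
  ℓ∣4m = ∣z-*ˡ (+ 4) (∣⇒∣z (m∣m*n m₁))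
  ℓ∣sum : + ℓ ∣z (+ 2 *z x) *z (+ 2 *z x) +z (+ 2 *z y +z z) *z (+ 2 *z y +z z)
  ℓ∣sum = ∣z-resp (ringz95 x (+ 2 *z y +z z) z (+ ℓ)) (∣z-- (∣z-resp (four-m x y z value) ℓ∣4m) (ℓ∣ℓ (z *z z)))
  cancel2 : ∀ a → + ℓ ∣z + 2 *z a → + ℓ ∣z a
  cancel2 a d with euclid ℓ-prime (+ 2) a d
  ... | inj₁ e = contradiction e n₂
  ... | inj₂ e = e
  strip : + ℓ ∣z + 2 *z x × + ℓ ∣z + 2 *z y +z z → (∃ λ t → + ℓ ∣z t *z t -z + 4 *z + m₁) × (∀ m₂ → m₁ ≡ ℓ * m₂ → Rep unramified P s m₂)
  strip (d₂ₓ , dᵤ) = core (cancel2 x d₂ₓ) dᵤ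
   where
   core : + ℓ ∣z x → + ℓ ∣z + 2 *z y +z z → (∃ λ t → + ℓ ∣z t *z t -z + 4 *z + m₁) × (∀ m₂ → m₁ ≡ ℓ * m₂ → Rep unramified P s m₂)
   core (dividesz x' x≡) (dividesz u' u≡) = (z , ∣z-resp (sym square) (ℓ∣ℓ (-z (+ 4 *z (x' *z x') +z u' *z u')))) , descend
    where
    four-m₁ : + 4 *z + m₁ ≡ + ℓ *z (+ 4 *z (x' *z x') +z u' *z u') +z z *z z
    four-m₁ = ℤₚ.*-cancelˡ-≡ (+ ℓ) (+ 4 *z + m₁) (+ ℓ *z (+ 4 *z (x' *z x') +z u' *z u') +z z *z z) {{nzℓ}} (begin
     + ℓ *z (+ 4 *z + m₁) ≡⟨ sym (ringz16 (+ ℓ) (+ m₁)) ⟩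
     + 4 *z (+ ℓ *z + m₁) ≡⟨ cong (+ 4 *z_) (sym (cast-* ℓ m₁)) ⟩
     + 4 *z + (ℓ * m₁) ≡⟨ four-m x y z value ⟩
     + 4 *z (+ 1 *z (x *z x)) +z (+ 2 *z y +z z) *z (+ 2 *z y +z z) +z + ℓ *z (z *z z)
      ≡⟨ cong₂ (λ a b → + 4 *z (+ 1 *z (a *z a)) +z b *z b +z + ℓ *z (z *z z)) x≡ u≡ ⟩
     + 4 *z (+ 1 *z ((x' *z + ℓ) *z (x' *z + ℓ))) +z (u' *z + ℓ) *z (u' *z + ℓ) +z + ℓ *z (z *z z) ≡⟨ ringz15 x' u' z (+ ℓ) ⟩
     + ℓ *z (+ ℓ *z (+ 4 *z (x' *z x') +z u' *z u') +z z *z z) ∎)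
     where open ≡-Reasoning
    square : z *z z -z + 4 *z + m₁ ≡ + ℓ *z (-z (+ 4 *z (x' *z x') +z u' *z u'))
    square = trans (cong (λ v → z *z z -z v) four-m₁) (ringz17 z (+ 4 *z (x' *z x') +z u' *z u') (+ ℓ))
    descend : ∀ m₂ → m₁ ≡ ℓ * m₂ → Rep unramified P s m₂
    descend m₂ m₁≡ = zero-case (euclid ℓ-prime z z ℓ∣z²)
     where
     ℓ∣z² : + ℓ ∣z z *z z
     ℓ∣z² = ∣z-resp (ringz6 (+ 4 *z (x' *z x') +z u' *z u') (z *z z) (+ ℓ)) (∣z-- (∣z-resp four-m₁ (∣z-*ˡ (+ 4) (∣⇒∣z (divides m₂ (trans m₁≡ (*-comm ℓ m₂)))))) (ℓ∣ℓ (+ 4 *z (x' *z x') +z u' *z u')))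
     final : + ℓ ∣z z → + ℓ ∣z y → Rep unramified P s m₂
     final (dividesz z' z≡) (dividesz y' y≡) = rep x' y' z'
       (ℤₚ.*-cancelˡ-≡ (+ ℓ *z + ℓ) (Fz (+ 1) (+ K) x' y' z') (+ m₂) {{subst ℤ.NonZero (cast-* ℓ ℓ) (m*n≢0 ℓ ℓ {{nzℓ}} {{nzℓ}})}} (begin
        + ℓ *z + ℓ *z Fz (+ 1) (+ K) x' y' z' ≡⟨ ringz2 (+ ℓ) (+ K) x' y' z' ⟩
        Fz (+ 1) (+ K) (x' *z + ℓ) (y' *z + ℓ) (z' *z + ℓ) ≡⟨ sym (cong₃ x≡ y≡ z≡) ⟩
        Fz (+ 1) (+ K) x y z ≡⟨ value ⟩
        + (ℓ * m₁) ≡⟨ cong (λ v → + (ℓ * v)) m₁≡ ⟩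
        + (ℓ * (ℓ * m₂)) ≡⟨ trans (cong +_ (sym (*-assoc ℓ ℓ m₂))) (trans (cast-* (ℓ * ℓ) m₂) (cong (_*z + m₂) (cast-* ℓ ℓ))) ⟩
        + ℓ *z + ℓ *z + m₂ ∎))
       (coprime-divisorz (+ ℓ) (x' -z s *z (+ 2 *z y' +z z')) P⊥ℓ (∣z-resp (trans (cong₄ x≡ y≡ z≡) (ringz3 (+ ℓ) s x' y' z')) plane))
      where
      open ≡-Reasoning
      cong₃ : ∀ {x x″ y y″ z z″} → x ≡ x″ → y ≡ y″ → z ≡ z″ → Fz (+ 1) (+ K) x y z ≡ Fz (+ 1) (+ K) x″ y″ z″
      cong₃ refl refl refl = refl
      cong₄ : ∀ {x x″ y y″ z z″} → x ≡ x″ → y ≡ y″ → z ≡ z″ → x -z s *z (+ 2 *z y +z z) ≡ x″ -z s *z (+ 2 *z y″ +z z″)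
      cong₄ refl refl refl = refl
     zero-case : + ℓ ∣z z ⊎ + ℓ ∣z z → Rep unramified P s m₂
     zero-case (inj₁ d) = final d (cancel2 y (∣z-resp (ringz7 y z) (∣z-- dᵤ d)))
     zero-case (inj₂ d) = final d (cancel2 y (∣z-resp (ringz7 y z) (∣z-- dᵤ d)))

 -- A divisor e of P dividing m divides x, u and z, because the plane x ≡ s u is anisotropic modulo e.
 Rep⇒Lset : ∀ {P s m} → Coprime P 4 → (∀ e → e ∣ P → Anisotropic (+ 4 *z (s *z s) +z + 1) (+ ℓ) e) →
  (Σ ℤ λ x → Σ ℤ λ y → Σ ℤ λ z → Σ ℤ λ r → Fz (+ 1) (+ K) x y z +z + P *z + P *z r ≡ + m × + P ∣z x -z s *z (+ 2 *z y +z z)) → Lset P m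
 Rep⇒Lset {P} {s} {m} P⊥4 ani (x , y , z , r , value , plane) = go (ani e e∣P u z e∣plane)
  where
  e = gcd m P
  u = + 2 *z y +z z
  e∣P : e ∣ P
  e∣P = gcd[m,n]∣n m P
  four : + 4 *z + m ≡ + 4 *z (+ 1 *z (x *z x)) +z u *z u +z + ℓ *z (z *z z) +z + 4 *z (+ P *z + P *z r)
  four = trans (cong (+ 4 *z_) (sym value)) (trans (ℤₚ.*-distribˡ-+ (+ 4) (Fz (+ 1) (+ K) x y z) (+ P *z + P *z r)) (cong (_+z + 4 *z (+ P *z + P *z r)) (four-F (+ 1) (+ K) (+ ℓ) 4Kz x y z)))
  e∣zP : + e ∣z + P
  e∣zP = ∣⇒∣z e∣P
  e∣plane : + e ∣z (+ 4 *z (s *z s) +z + 1) *z (u *z u) +z + ℓ *z (z *z z)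
  e∣plane = ∣z-resp (ringz96 s x u z (+ ℓ) (+ 4 *z (+ P *z + P *z r)))
   (∣z-- (∣z-- (∣z-resp four (∣z-*ˡ (+ 4) (∣⇒∣z (gcd[m,n]∣m m P)))) (∣z-*ˡ (+ 4) (∣z-*ʳ r (∣z-*ˡ (+ P) e∣zP)))) (∣z-*ˡ (+ 4) (square-diff x (s *z u) (∣z-trans e∣zP plane))))
  go : + e ∣z u × + e ∣z z → Lset P m
  go (eu , ez) = coprime-divisor {e * e} {4} {m} (coprime-*ˡ e⊥4 e⊥4) (∣z⇒∣ (∣z-resp (sym (cast-* 4 m)) (∣z-resp (sym four)
    (∣z-+ (∣z-+ (∣z-+ (∣z-*ˡ (+ 4) (∣z-*ˡ (+ 1) (sq x ex))) (sq u eu)) (∣z-*ˡ (+ ℓ) (sq z ez))) (∣z-*ˡ (+ 4) (∣z-*ʳ r (sq (+ P) e∣zP)))))))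
   where
   e⊥4 : Coprime e 4
   e⊥4 = coprime-∣ˡ e∣P P⊥4
   ex : + e ∣z x
   ex = ∣z-resp (ringz24 x (s *z u)) (∣z-+ (∣z-trans e∣zP plane) (∣z-*ˡ s eu))
   sq : ∀ a → + e ∣z a → + (e * e) ∣z a *z a
   sq a (dividesz q eq) = dividesz (q *z q) (trans (cong₂ _*z_ eq eq) (trans (ringz36 q (+ e)) (cong (q *z q *z_) (sym (cast-* e e)))))

 Cond? : ∀ κ m → Dec (Cond κ m)
 Cond? unramified m = ¬? (ℓ ∣? m)
 Cond? ramified m = ¬? (ℓ ∣? m) ×-dec map′ found search (Finₚ.any? (λ t → + ℓ ℤ∣.∣? (+ toℕ {ℓ} t *z + toℕ {ℓ} t -z + 4 *z + m)))
  where
  instance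
   ℓ≢0 : NonZero ℓ
   ℓ≢0 = prime⇒nonZero ℓ-prime
  found : (Σ (Fin ℓ) λ t → + ℓ ∣z + toℕ t *z + toℕ t -z + 4 *z + m) → ∃ λ t → + ℓ ∣z t *z t -z + 4 *z + m
  found (t , d) = + toℕ t , d
  search : (∃ λ t → + ℓ ∣z t *z t -z + 4 *z + m) → Σ (Fin ℓ) λ t → + ℓ ∣z + toℕ t *z + toℕ t -z + 4 *z + m
  search (t , d) = let r , r< , dr = residue ℓ t in fromℕ< r< , subst (λ v → + ℓ ∣z + v *z + v -z + 4 *z + m) (sym (Finₚ.toℕ-fromℕ< r<))
   (∣z-resp (ringz97 (t *z t) (+ r *z + r) (+ 4 *z + m)) (∣z-- d (square-diff t (+ r) dr)))

 Cond-divide : ∀ κ e n → Coprime e ℓ → Cond κ (e * e * n) → Cond κ n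
 Cond-divide unramified e n _ h d = h (∣n⇒∣m*n (e * e) d)
 Cond-divide ramified e n e⊥ℓ (h , t , d) = (λ d → h (∣n⇒∣m*n (e * e) d)) , root (inverse ℓ (+ e) e⊥ℓ)
  where
  cast₃ : + (e * e * n) ≡ + e *z + e *z + n
  cast₃ = trans (cast-* (e * e) n) (cong (_*z + n) (cast-* e e))
  root : (∃ λ v → + ℓ ∣z + e *z v -z + 1) → ∃ λ t → + ℓ ∣z t *z t -z + 4 *z + n
  root (v , dv) = t *z v , ∣z-resp (ringz98 t (+ e) v (+ n)) (∣z-+ (∣z-*ˡ (v *z v) (∣z-resp (cong (λ w → t *z t -z + 4 *z w) cast₃) d)) (∣z-*ˡ (+ 4 *z + n) (square-diff (+ e *z v) (+ 1) dv)))

 module Definite (P : ℕ) (P>0 : 0 < P) (sqf : Squarefree P) (large : ∀ p → Prime p → p ∣ P → ℓ < p)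
   (s : ℤ) (nonsplit-s : ∀ p → Prime p → p ∣ P → Nonsplit (+ ℓ) p s) where

  ℓ>0 : 0 < ℓ
  ℓ>0 = <⇒≤ (prime>1 ℓ-prime)

  ℓ⊥P : Coprime ℓ P
  ℓ⊥P = coprime-∣ˡ (n∣m*n 4) (Modulus.4ℓ⊥P P P>0 sqf large s nonsplit-s)

  P⊥4 : Coprime P 4
  P⊥4 = Coprimality.sym (coprime-∣ˡ (m∣m*n ℓ) (Modulus.4ℓ⊥P P P>0 sqf large s nonsplit-s))

  anisotropic : ∀ e → e ∣ P → Anisotropic (+ 4 *z (s *z s) +z + 1) (+ ℓ) e
  anisotropic = anisotropic-all P>0 sqf (+ 4 *z (s *z s) +z + 1) (+ ℓ) (λ p pp p∣P →
   anisotropic-prime pp (+ 4 *z (s *z s) +z + 1) (+ ℓ) (Nonsplit⇒∤ℓ (+ ℓ) s (nonsplit-s p pp p∣P)) (nonsplit-s p pp p∣P))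

  Rep-necessary : ∀ m → Rep unramified P s m → Lset P m
  Rep-necessary m (rep x y z value plane) = Rep⇒Lset {P} {s} {m} P⊥4 anisotropic (x , y , z , 0ℤ , trans (ringz37 (Fz (+ 1) (+ K) x y z) (+ P)) value , plane)

  -- Sorted by e = gcd(m, P): with m = e² n and P = e P' the claim reduces to n prime to P', and
  -- representations of n on the plane modulo P' become representations of m on the plane modulo P
  -- when multiplied by e. One s serves all P'.
  almost-all-L : ∀ κ → AlmostAll (λ m → Cond κ m × Lset P m) (Rep κ P s)
  almost-all-L κ = AlmostAll-⊆ (λ m c → s≤s (∣⇒≤ {{>-nonZero P>0}} (gcd[m,n]∣n m P)) , c) (λ m r → r)
   (AlmostAll-partition (λ m → gcd m P) (suc P) (λ e _ → piece e))
   where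
   piece : ∀ e → AlmostAll (λ m → gcd m P ≡ e × Cond κ m × Lset P m) (Rep κ P s)
   piece e with e ∣? P
   ... | no e∤P = AlmostAll-∅ (λ m → λ { (refl , _) → e∤P (gcd[m,n]∣n m P) })
   ... | yes (divides P' P≡) = AlmostAll-affine {C₁ = λ n → Cond κ n × Coprime n P'} {R₁ = Rep κ P' s} (e * e) 0 (pos-* e>0 e>0) down
       (λ n r → subst (Rep κ P s) (sym (+-identityʳ (e * e * n))) (Rep-scale κ e (∣-reflexive (trans P≡ (*-comm P' e))) r))
       (Modulus.almost-all P' P'>0 (squarefree-∣ P'∣P sqf) (λ p pp p∣ → large p pp (∣-trans p∣ P'∣P)) s (λ p pp p∣ → nonsplit-s p pp (∣-trans p∣ P'∣P)) κ)
    where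
    P'∣P : P' ∣ P
    P'∣P = divides e (trans P≡ (*-comm P' e))
    P'>0 : 0 < P'
    P'>0 = n≢0⇒n>0 (λ { refl → >⇒≢ P>0 P≡ })
    e>0 : 0 < e
    e>0 = n≢0⇒n>0 (λ { refl → >⇒≢ P>0 (trans P≡ (*-zeroʳ P')) })
    e⊥ℓ : Coprime e ℓ
    e⊥ℓ = coprime-∣ˡ (divides P' P≡) (Coprimality.sym ℓ⊥P)
    down : ∀ m → gcd m P ≡ e × Cond κ m × Lset P m → ∃ λ n → m ≡ e * e * n + 0 × Cond κ n × Coprime n P'
    down m (refl , cond , l) with Lset-split P>0 sqf m l
    ... | P″ , n , P≡″ , m≡ , cop = n , trans m≡ (sym (+-identityʳ _)) , Cond-divide κ e n e⊥ℓ (subst (Cond κ) m≡ cond) ,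
        subst (Coprime n) (*-cancelˡ-≡ P″ P' e {{>-nonZero e>0}} (trans (sym P≡″) (trans P≡ (*-comm P' e)))) cop

  base : ℕ → Kind → ℕ
  base t unramified = ℓ ^ t * ℓ ^ t
  base t ramified = ℓ ^ t * ℓ ^ t * ℓ

  ℓ^>0 : ∀ t → 0 < ℓ ^ t
  ℓ^>0 t = m^n>0 ℓ {{>-nonZero ℓ>0}} t

  base>0 : ∀ t κ → 0 < base t κ
  base>0 t unramified = pos-* (ℓ^>0 t) (ℓ^>0 t)
  base>0 t ramified = pos-* (pos-* (ℓ^>0 t) (ℓ^>0 t)) ℓ>0

  -- The level records the exact ℓ-adic valuation, 2t for the unramified and 2t + 1 for the ramified
  -- kind. For odd valuation the cofactor is moreover confined to the classes m₁ modulo ℓ for which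
  -- 4 m₁ is a square.
  Level : ℕ → Kind → ℕ → Set
  Level t κ m = ∃ λ m₁ → m ≡ base t κ * m₁ × Cond κ m₁ × Lset P m₁

  Level? : ∀ t κ m → Dec (Level t κ m)
  Level? t κ m with base t κ ∣? m
  ... | no ¬d = no (λ { (m₁ , eq , _) → ¬d (divides m₁ (trans eq (*-comm (base t κ) m₁))) })
  ... | yes (divides q eq) = map′ (λ c → q , trans eq (*-comm q (base t κ)) , c)
      (λ { (m₁ , eq' , c) → subst (λ v → Cond κ v × Lset P v) (*-cancelˡ-≡ m₁ q (base t κ) {{>-nonZero (base>0 t κ)}} (trans (sym eq') (trans eq (*-comm q (base t κ))))) c })
      (Cond? κ q ×-dec Lset? P q)

  Level-almost-all : ∀ t κ → AlmostAll (Level t κ) (Rep unramified P s)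
  Level-almost-all t κ = AlmostAll-affine (base t κ) 0 (base>0 t κ) (λ m → λ { (m₁ , eq , c) → m₁ , trans eq (sym (+-identityʳ _)) , c })
    (λ m₁ r → subst (Rep unramified P s) (sym (+-identityʳ _)) (up κ m₁ r)) (almost-all-L κ)
   where
   up : ∀ κ m₁ → Rep κ P s m₁ → Rep unramified P s (base t κ * m₁)
   up unramified m₁ r = Rep-scale unramified (ℓ ^ t) (n∣m*n (ℓ ^ t)) r
   up ramified m₁ r = subst (Rep unramified P s) (sym (*-assoc (ℓ ^ t * ℓ ^ t) ℓ m₁)) (Rep-scale unramified (ℓ ^ t) (n∣m*n (ℓ ^ t)) (Rep-ramified r))

  Levels : ℕ → ℕ → Set
  Levels zero m = ⊥
  Levels (suc k) m = Levels k m ⊎ (Level k unramified m ⊎ Level k ramified m)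

  Levels? : ∀ k m → Dec (Levels k m)
  Levels? zero m = no (λ ())
  Levels? (suc k) m = Levels? k m ⊎-dec (Level? k unramified m ⊎-dec Level? k ramified m)

  Levels-almost-all : ∀ k → AlmostAll (Levels k) (Rep unramified P s)
  Levels-almost-all zero = AlmostAll-∅ (λ m ())
  Levels-almost-all (suc k) = AlmostAll-⊎ (Levels? k) (Levels-almost-all k) (AlmostAll-⊎ (Level? k unramified) (Level-almost-all k unramified) (Level-almost-all k ramified))

  ℓ∣-periodic : ∀ m → (ℓ ∣ m → ℓ ∣ m + ℓ) × (ℓ ∣ m + ℓ → ℓ ∣ m)
  ℓ∣-periodic m = (λ d → ∣m∣n⇒∣m+n d ∣-refl) , (λ d → ∣m+n∣m⇒∣n (subst (ℓ ∣_) (+-comm m ℓ) d) ∣-refl)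

  Cond-periodic : ∀ κ → Periodic ℓ (Cond κ)
  Cond-periodic unramified m = (λ c d → c (proj₂ (ℓ∣-periodic m) d)) , (λ c d → c (proj₁ (ℓ∣-periodic m) d))
  Cond-periodic ramified m = (λ { (c , t , d) → (λ d → c (proj₂ (ℓ∣-periodic m) d)) , t , ∣z-resp (ringz38 (t *z t) (+ m) (+ ℓ)) (∣z-- d (∣z-*ˡ (+ 4) ℓ∣ℓ)) }) ,
                 (λ { (c , t , d) → (λ d → c (proj₁ (ℓ∣-periodic m) d)) , t , ∣z-resp (ringz39 (t *z t) (+ m) (+ ℓ)) (∣z-+ d (∣z-*ˡ (+ 4) ℓ∣ℓ)) })
   where
   ℓ∣ℓ : + ℓ ∣z + ℓ
   ℓ∣ℓ = ∣⇒∣z ∣-refl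

  period : ℕ → ℕ
  period k = ℓ ^ k * ℓ ^ k * (ℓ * (P * P))

  ^-step : ∀ k → ℓ ^ suc k * ℓ ^ suc k ≡ ℓ * ℓ * (ℓ ^ k * ℓ ^ k)
  ^-step k = ring74 ℓ (ℓ ^ k)

  base∣ : ∀ k κ → base k κ ∣ ℓ ^ suc k * ℓ ^ suc k
  base∣ k unramified = subst (base k unramified ∣_) (sym (^-step k)) (n∣m*n (ℓ * ℓ))
  base∣ k ramified = divides ℓ (trans (^-step k) (ring75 ℓ (ℓ ^ k * ℓ ^ k)))

  Level-periodic : ∀ k κ → Periodic (period (suc k)) (Level k κ)
  Level-periodic k κ = Periodic-∣ (*-pres-∣ (base∣ k κ) ∣-refl)
   (Periodic-scale (base k κ) (base>0 k κ) (Periodic-× (Periodic-∣ (m∣m*n (P * P)) (Cond-periodic κ)) (Periodic-∣ (n∣m*n ℓ) (Lset-periodic P))))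

  Levels-periodic : ∀ k → Periodic (period k) (Levels k)
  Levels-periodic zero m = (λ ()) , (λ ())
  Levels-periodic (suc k) = Periodic-⊎ (Periodic-∣ (*-pres-∣ (subst (ℓ ^ k * ℓ ^ k ∣_) (sym (^-step k)) (n∣m*n (ℓ * ℓ))) ∣-refl) (Levels-periodic k))
   (Periodic-⊎ (Level-periodic k unramified) (Level-periodic k ramified))

  -- Each step either stops at the exact valuation of m or, by `Rep-ℓ∣`, divides the value by ℓ² and
  -- keeps it represented. What escapes k levels is thus divisible by ℓ^(2k), which is the d of the
  -- certificate.
  cover : ∀ k m → Rep unramified P s m → Levels k m ⊎ (∃ λ m₁ → m ≡ ℓ ^ k * ℓ ^ k * m₁ × Rep unramified P s m₁)
  cover zero m r = inj₂ (m , sym (*-identityˡ m) , r)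
  cover (suc k) m r with cover k m r
  ... | inj₁ l = inj₁ (inj₁ l)
  ... | inj₂ (m₁ , m≡ , r₁) with ℓ ∣? m₁
  ... | no ℓ∤m₁ = inj₁ (inj₂ (inj₁ (m₁ , m≡ , ℓ∤m₁ , Rep-necessary m₁ r₁)))
  ... | yes (divides m₂ m₁≡) = next (Rep-ℓ∣ (Coprimality.sym ℓ⊥P) m₂ (subst (Rep unramified P s) m₁≡' r₁)) (ℓ ∣? m₂)
   where
   m₁≡' : m₁ ≡ ℓ * m₂
   m₁≡' = trans m₁≡ (*-comm m₂ ℓ)
   next : (∃ λ t → + ℓ ∣z t *z t -z + 4 *z + m₂) × (∀ m₃ → m₂ ≡ ℓ * m₃ → Rep unramified P s m₃) → Dec (ℓ ∣ m₂) →
    Levels (suc k) m ⊎ (∃ λ m₁ → m ≡ ℓ ^ suc k * ℓ ^ suc k * m₁ × Rep unramified P s m₁)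
   next (root , _) (no ℓ∤m₂) = inj₁ (inj₂ (inj₂ (m₂ , trans m≡ (trans (cong (ℓ ^ k * ℓ ^ k *_) m₁≡') (sym (*-assoc (ℓ ^ k * ℓ ^ k) ℓ m₂))) ,
    (ℓ∤m₂ , root) , Lset-coprime-* ℓ m₂ P ℓ⊥P (subst (Lset P) m₁≡' (Rep-necessary m₁ r₁)))))
   next (_ , descend) (yes (divides m₃ m₂≡)) = inj₂ (m₃ , trans m≡ (trans (cong (ℓ ^ k * ℓ ^ k *_) (trans m₁≡' (cong (ℓ *_) m₂≡))) (trans (ring35 ℓ (ℓ ^ k * ℓ ^ k) m₃) (cong (_* m₃) (sym (^-step k))))) ,
     descend m₃ (trans m₂≡ (*-comm m₃ ℓ)))

  k≤ℓ^k : ∀ k → k ≤ ℓ ^ k * ℓ ^ k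
  k≤ℓ^k k = ≤-trans (n≤2^n k) (≤-trans (^-monoˡ-≤ k (prime>1 ℓ-prime)) (m≤m*n (ℓ ^ k) (ℓ ^ k) {{>-nonZero (ℓ^>0 k)}}))

  certificate-3 : Certificate ℓ P (Rep unramified P s)
  certificate-3 = record
   { necessary = Rep-necessary
   ; generic = almost-all-L unramified
   ; exhausted = λ k → Levels k , Levels? k , (period k , pos-* (pos-* (ℓ^>0 k) (ℓ^>0 k)) (pos-* ℓ>0 (pos-* P>0 P>0)) , Levels-periodic k) , Levels-almost-all k ,
     ℓ ^ k * ℓ ^ k , k≤ℓ^k k , λ m r → reshape k m (cover k m r) }
   where
   reshape : ∀ k m → Levels k m ⊎ (∃ λ m₁ → m ≡ ℓ ^ k * ℓ ^ k * m₁ × Rep unramified P s m₁) → Levels k m ⊎ ℓ ^ k * ℓ ^ k ∣ m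
   reshape k m (inj₁ l) = inj₁ l
   reshape k m (inj₂ (m₁ , eq , _)) = inj₂ (divides m₁ (trans eq (*-comm (ℓ ^ k * ℓ ^ k) m₁)))

  -- With a further variable of coefficient P², the multiples m of ℓ are reached through m − P².
  certificate-4 : ∀ {R} → (∀ m → Rep unramified P s m → R m) → (∀ m → Rep unramified P s m → R (m + P * P)) → (∀ m → R m → Lset P m) → Certificate ℓ P R
  certificate-4 {R} sub shift nec = record
   { necessary = nec
   ; generic = generic₄
   ; exhausted = λ k → Lset P , Lset? P , (P * P , pos-* P>0 P>0 , Lset-periodic P) , all-L , k , ≤-refl , λ m r → inj₁ (nec m r) }
   where
   generic₄ : AlmostAll (λ m → ¬ ℓ ∣ m × Lset P m) R
   generic₄ = AlmostAll-⊆ (λ m c → c) sub (almost-all-L unramified)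
   shifted : ∀ m → ¬ m < P * P × (ℓ ∣ m × Lset P m) → ∃ λ m₁ → m ≡ 1 * m₁ + P * P × ¬ ℓ ∣ m₁ × Lset P m₁
   shifted m (m≮ , ℓ∣m , l) = m ∸ P * P , trans (sym m≡) (cong (_+ P * P) (sym (*-identityˡ _))) ,
     (λ d → contradiction (ℓ⊥P (∣-refl , ℓ∣P (∣m+n∣m⇒∣n (subst (ℓ ∣_) (sym m≡) ℓ∣m) d))) (>⇒≢ (prime>1 ℓ-prime))) ,
     proj₂ (Lset-periodic P (m ∸ P * P)) (subst (Lset P) (sym m≡) l)
    where
    m≡ : m ∸ P * P + P * P ≡ m
    m≡ = m∸n+n≡m (≮⇒≥ m≮)
    ℓ∣P : ℓ ∣ P * P → ℓ ∣ P
    ℓ∣P d with euclidsLemma P P ℓ-prime d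
    ... | inj₁ e = e
    ... | inj₂ e = e
   all-L : AlmostAll (Lset P) R
   all-L = AlmostAll-split (λ m → ℓ ∣? m)
    (AlmostAll-split (λ m → m <? P * P) (AlmostAll-bounded (P * P) (λ m → proj₁))
     (AlmostAll-affine 1 (P * P) z<s shifted (λ m₁ r → subst (λ v → R (v + P * P)) (sym (*-identityˡ m₁)) (shift m₁ r)) (almost-all-L unramified)))
    generic₄

  module Selected (a b : ℚ) (D' A' B' : ℕ) (D'>0 : 0 < D') (data-ab : Dense-data a b D' A' B')
    (above : A' * (P * P) * ℓ + D' * (P * P) < D' * L-count P * ℓ) (below : D' * L-count P < B' * (P * P)) where

   limit : ∀ {R} → Certificate ℓ P R → LimitIn (Ratio R) a b
   limit cert = certificate⇒limit {a = a} {b = b} cert ℓ>0 P>0 D'>0 data-ab above below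

   P² : ℤ
   P² = + (P * P)

   P²≡ : P² ≡ + P *z + P
   P²≡ = ℤₚ.pos-* P P

   Shape₊ : ∀ {n} → QForm n → Set
   Shape₊ f = ∀ x → Σ ℤ λ X → Σ ℤ λ y → Σ ℤ λ z → Σ ℕ λ r → (eval f x ≡ Fz (+ 1) (+ K) X y z +z P² *z + r) × (+ P ∣z X -z s *z (+ 2 *z y +z z))

   Attains : ∀ {n} → QForm n → ℕ → Set
   Attains f m = ∃ λ x → eval f x ≡ + m

   nonnegative : ∀ X y z r m → m ≡ Fz (+ 1) (+ K) X y z +z P² *z + r → ¬ m ℤ.< + 0
   nonnegative X y z r m eq m<0 = refute m m<0 four
    where
    t : ℕ
    t = 4 * (1 * (abs X * abs X)) + abs (+ 2 *z y +z z) * abs (+ 2 *z y +z z) + ℓ * (abs z * abs z) + 4 * (P * P * r)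
    four : + 4 *z m ≡ + t
    four = trans (cong (+ 4 *z_) eq) (trans (ringz18 (Fz (+ 1) (+ K) X y z) P² (+ r)) (cong₂ _+z_
     (trans (four-F (+ 1) (+ K) (+ ℓ) 4Kz X y z) (cong₂ _+z_ (cong₂ _+z_
      (trans (cong (λ v → + 4 *z (+ 1 *z v)) (square-abs X)) (trans (cong (+ 4 *z_) (sym (ℤₚ.pos-* 1 (abs X * abs X)))) (sym (ℤₚ.pos-* 4 (1 * (abs X * abs X))))))
      (square-abs (+ 2 *z y +z z))) (trans (cong (+ ℓ *z_) (square-abs z)) (sym (ℤₚ.pos-* ℓ (abs z * abs z))))))
     (trans (cong (+ 4 *z_) (sym (ℤₚ.pos-* (P * P) r))) (sym (ℤₚ.pos-* 4 (P * P * r))))))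
    refute : ∀ m → m ℤ.< + 0 → + 4 *z m ≡ + t → ⊥
    refute (+ n) (ℤ.+<+ ()) _
    refute ℤ.-[1+ n ] _ ()

   positive-density : ∀ {n} (f : QForm n) {R} → Shape₊ f → Certificate ℓ P R → (∀ i → Attains f (suc i) → R (suc i)) → (∀ i → R (suc i) → Attains f (suc i)) → DensityIn (D f) a b
   positive-density f {R} shape cert to from = inj₁ ((λ { m (_ , x , refl) → let (X , y , z , r , eq , _) = shape x in nonnegative X y z r (eval f x) eq }) ,
    LimitIn-⊆ {Ratio R} {PosRatio (D f)} {a} {b} (PosRatio⇒Ratio {D f} {R} (λ i d → to i (proj₂ d)) (λ i r → (λ ()) , from i r)) (limit cert))

   negative-density : ∀ {n} (f : QForm n) {R} → Shape₊ f → Certificate ℓ P R → (∀ i → Attains f (suc i) → R (suc i)) → (∀ i → R (suc i) → Attains f (suc i)) → DensityIn (D (negate f)) a b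
   negative-density f {R} shape cert to from = inj₂ (inj₁ ((λ { m (_ , x , refl) 0<m → let (X , y , z , r , eq , _) = shape x in
      nonnegative X y z r (eval f x) eq (subst (ℤ._< + 0) (trans (cong -z_ (eval-negate f x)) (ℤₚ.neg-involutive (eval f x))) (ℤₚ.neg-mono-< 0<m)) }) ,
    LimitIn-⊆ {Ratio R} {NegRatio (D (negate f))} {a} {b} (NegRatio⇒Ratio {D (negate f)} {R}
     (λ i d → to i (proj₁ (proj₂ d) , ℤₚ.neg-injective (trans (sym (eval-negate f (proj₁ (proj₂ d)))) (proj₂ (proj₂ d)))))
     (λ i r → (λ ()) , proj₁ (from i r) , trans (eval-negate f (proj₁ (from i r))) (cong -z_ (proj₂ (from i r))))) (limit cert)))

   record DefiniteData (j : ℕ) : Set₁ where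
    field
     qform : QForm (j + 3)
     inS : InS (j + 3) 0 qform
     shape : Shape₊ qform
     R : ℕ → Set
     certificate : Certificate ℓ P R
     to : ∀ m → Attains qform m → R m
     from : ∀ m → R m → Attains qform m

   f₃ : QForm 3
   f₃ = definite-form (+ P) s (+ K)

   shape₃ : Shape₊ f₃
   shape₃ x = + P *z x 0F +z s *z (+ 2 *z x 1F +z x 2F) , x 1F , x 2F , 0 ,
     trans (eval-definite (+ P) s (+ K) x) (sym (trans (cong (Fz (+ 1) (+ K) (+ P *z x 0F +z s *z (+ 2 *z x 1F +z x 2F)) (x 1F) (x 2F) +z_) (ℤₚ.*-zeroʳ P²)) (ℤₚ.+-identityʳ _))) ,
     dividesz (x 0F) (ringz19 (+ P) (x 0F) (s *z (+ 2 *z x 1F +z x 2F)))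

   Attains⇒Rep : ∀ m → Attains f₃ m → Rep unramified P s m
   Attains⇒Rep m (x , eq) = rep (+ P *z x 0F +z s *z (+ 2 *z x 1F +z x 2F)) (x 1F) (x 2F) (trans (sym (eval-definite (+ P) s (+ K) x)) eq)
    (proj₂ (proj₂ (proj₂ (proj₂ (proj₂ (shape₃ x))))))

   Rep⇒Attains : ∀ m → Rep unramified P s m → Attains f₃ m
   Rep⇒Attains m (rep x y z value (dividesz k eq)) = triple k y z ,
     trans (eval-definite (+ P) s (+ K) (triple k y z)) (trans (cong (λ v → Fz (+ 1) (+ K) v y z) (trans (cong (_+z s *z (+ 2 *z y +z z)) (trans (ℤₚ.*-comm (+ P) k) (sym eq))) (ringz20 x (s *z (+ 2 *z y +z z))))) value)

   f₊ : ∀ j → QForm (j + 3)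
   f₊ zero = f₃
   f₊ (suc j) = prepend P² (f₊ j)

   f₊-InS : ∀ j → InS (j + 3) 0 (f₊ j)
   f₊-InS zero = InS-definite P s K ℓ P>0 ℓ>0 4K
   f₊-InS (suc j) = InS-prepend (P * P) (f₊ j) (pos-* P>0 P>0) (f₊-InS j)

   f₊-shape : ∀ j → Shape₊ (f₊ j)
   f₊-shape zero = shape₃
   f₊-shape (suc j) x = add (f₊-shape j (λ i → x (Fin.suc i)))
    where
    t = x Fin.zero
    add : _ → _
    add (X , y , z , r , eq , plane) = X , y , z , abs t * abs t + r ,
     trans (eval-prepend P² (f₊ j) x) (trans (cong₂ (λ u v → P² *z u +z v) (square-abs t) eq) (ringz21 P² (+ (abs t * abs t)) (Fz (+ 1) (+ K) X y z) (+ r))) , plane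

   f₊-attains : ∀ j m → Rep unramified P s m → Attains (f₊ j) m
   f₊-attains zero m r = Rep⇒Attains m r
   f₊-attains (suc j) m r = let (x , eq) = f₊-attains j m r in prepended (+ 0) x ,
    trans (eval-prepend P² (f₊ j) (prepended (+ 0) x)) (trans (cong₂ _+z_ (ℤₚ.*-zeroʳ P²) eq) (ℤₚ.+-identityˡ (+ m)))

   f₊-shifted : ∀ j m → Rep unramified P s m → Attains (f₊ (suc j)) (m + P * P)
   f₊-shifted j m r = let (x , eq) = f₊-attains j m r in prepended (+ 1) x ,
    trans (eval-prepend P² (f₊ j) (prepended (+ 1) x)) (trans (cong₂ _+z_ (ℤₚ.*-identityʳ P²) eq) (ℤₚ.+-comm P² (+ m)))

   f₊-Lset : ∀ j m → Attains (f₊ j) m → Lset P m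
   f₊-Lset j m (x , eq) = from (f₊-shape j x)
    where
    from : _ → Lset P m
    from (X , y , z , r , eq' , plane) = Rep⇒Lset {P} {s} {m} P⊥4 anisotropic (X , y , z , + r , trans (cong (λ v → Fz (+ 1) (+ K) X y z +z v *z + r) (sym P²≡)) (trans (sym eq') eq) , plane)

   definite-data : ∀ j → DefiniteData j
   definite-data zero = record { qform = f₃ ; inS = f₊-InS 0 ; shape = shape₃ ; R = Rep unramified P s ; certificate = certificate-3 ; to = Attains⇒Rep ; from = Rep⇒Attains }
   definite-data (suc j) = record { qform = f₊ (suc j) ; inS = f₊-InS (suc j) ; shape = f₊-shape (suc j) ; R = Attains (f₊ (suc j))
    ; certificate = certificate-4 (f₊-attains (suc j)) (f₊-shifted j) (f₊-Lset (suc j)) ; to = λ m h → h ; from = λ m h → h }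

   -- With this w the expression t² + w is the discriminant `disc` at s, so the s found for the
   -- definite form also makes w y² + z² anisotropic at every p ∣ P.
   W : ℕ
   W = ℓ * (4 * (abs s * abs s) + 1)

   W≡ : + ℓ *z (+ 4 *z (s *z s) +z + 1) ≡ + W
   W≡ = trans (cong (λ v → + ℓ *z (v +z + 1)) (trans (cong (+ 4 *z_) (square-abs s)) (sym (ℤₚ.pos-* 4 (abs s * abs s))))) (sym (ℤₚ.pos-* ℓ (4 * (abs s * abs s) + 1)))

   unit-at : ∀ p → Prime p → p ∣ P → ∀ t → ¬ + p ∣z t *z t +z + 1 *z + W
   unit-at p pp p∣P t d = nonsplit-s p pp p∣P t (∣z-resp (cong (t *z t +z_) (trans (ℤₚ.*-identityˡ (+ W)) (sym W≡))) d)

   p∤W : ∀ p → Prime p → p ∣ P → 4 < p × ¬ + p ∣z + W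
   p∤W p pp p∣P = <-trans 4<ℓ (large p pp p∣P) , λ d → unit-at p pp p∣P 0ℤ (∣z-resp (sym (trans (ℤₚ.+-identityˡ (+ 1 *z + W)) (ℤₚ.*-identityˡ (+ W)))) d)

   anisotropic-W : ∀ e → e ∣ P → Anisotropic (+ W) (+ 1) e
   anisotropic-W = anisotropic-all P>0 sqf (+ W) (+ 1) (λ p pp p∣P → anisotropic-prime pp (+ W) (+ 1) (λ d → >⇒≢ (prime>1 pp) (∣1⇒≡1 (∣z⇒∣ d))) (unit-at p pp p∣P))

   open IndefiniteForms P W P>0 (pos-* ℓ>0 (m≤n+m 1 (4 * (abs s * abs s)))) (Indefinite.Lset⇒Solution (+ W) P>0 sqf p∤W) using (Form; IndefiniteData; module IndefiniteData; indefinite-data₁; indefinite-data₂)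

   indefinite-density : ∀ {r s} (F : IndefiniteData r s) → DensityIn (D (IndefiniteData.qform F)) a b
   indefinite-density F = inj₂ (inj₂ ((not-positive , not-negative) , LimitIn-⊆ {Ratio (Lset P)} {IndRatio (D qform)} {a} {b}
     (IndRatio⇒Ratio {D qform} {Lset P} (Lset? P) (λ { m (m≢0 , x , refl) → n≢0⇒n>0 (λ z → m≢0 (ℤₚ.∣i∣≡0⇒i≡0 z)) , value x (lset x) })
      (λ m m>0 l → (λ z → >⇒≢ m>0 (cong abs z)) , hit m l)) (limit certificate)))
    where
    open IndefiniteData F
    value : ∀ x → (Σ ℤ λ k → Σ ℤ λ y → Σ ℤ λ z → Σ ℤ λ t → eval qform x ≡ Form k y z t ⊎ -z eval qform x ≡ Form k y z t) → Lset P (abs (eval qform x))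
    value x (k , y , z , t , inj₁ eq) = Indefinite.Solution⇒Lset (+ W) {P} anisotropic-W (eval qform x) k y z t (sym eq)
    value x (k , y , z , t , inj₂ eq) = subst (Lset P) (ℤₚ.∣-i∣≡∣i∣ (eval qform x)) (Indefinite.Solution⇒Lset (+ W) {P} anisotropic-W (-z eval qform x) k y z t (sym eq))
    certificate : Certificate ℓ P (Lset P)
    certificate = record { necessary = λ m l → l ; generic = AlmostAll-exact (λ m → proj₂)
     ; exhausted = λ k → Lset P , Lset? P , (P * P , pos-* P>0 P>0 , Lset-periodic P) , AlmostAll-exact (λ m l → l) , k , ≤-refl , λ m l → inj₁ l }
    1∈L : Lset P 1
    1∈L = subst (λ g → g * g ∣ 1) (sym (∣1⇒≡1 (gcd[m,n]∣m 1 P))) ∣-refl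
    not-positive : ¬ Positive (D qform)
    not-positive h = h ℤ.-[1+ 0 ] ((λ ()) , hit ℤ.-[1+ 0 ] 1∈L) ℤ.-<+
    not-negative : ¬ Negative (D qform)
    not-negative h = h (+ 1) ((λ ()) , hit (+ 1) 1∈L) (ℤ.+<+ z<s)

   Goal : ℕ → ℕ → ℕ → Set
   Goal n r s = Σ (QForm n) λ f → InS r s f × DensityIn (D f) a b

   definite-goal : ∀ j → Goal (j + 3) (j + 3) 0 × Goal (j + 3) 0 (j + 3)
   definite-goal j = (qform , inS , positive-density qform shape certificate (λ i → to (suc i)) (λ i → from (suc i))) ,
            (negate qform , InS-negate qform inS , negative-density qform shape certificate (λ i → to (suc i)) (λ i → from (suc i)))
    where open DefiniteData (definite-data j)

   indefinite-goal : ∀ {n r s} → r + s ≡ n → IndefiniteData r s → Goal n r s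
   indefinite-goal {r = r} {s} eq F = subst (λ n → Goal n r s) (trans (sym (proj₁ (proj₂ inS))) eq) (qform , inS , indefinite-density F)
    where open IndefiniteData F

   goal : ∀ {n} r s → 3 ≤ n → r + s ≡ n → Goal n r s
   goal {n} r zero n≥3 eq = subst₂ (λ n r → Goal n r 0) n≡ (trans n≡ (trans (sym eq) (+-identityʳ r))) (proj₁ (definite-goal (n ∸ 3)))
    where
    n≡ : n ∸ 3 + 3 ≡ n
    n≡ = m∸n+n≡m n≥3
   goal {n} zero s@(suc _) n≥3 eq = subst₂ (λ n s → Goal n 0 s) n≡ (trans n≡ (sym eq)) (proj₂ (definite-goal (n ∸ 3)))
    where
    n≡ : n ∸ 3 + 3 ≡ n
    n≡ = m∸n+n≡m n≥3
   goal (suc i) (suc (suc j)) n≥3 eq = indefinite-goal eq (indefinite-data₂ i j)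
   goal (suc (suc i)) (suc zero) n≥3 eq = indefinite-goal eq (indefinite-data₁ i)
   goal (suc zero) (suc zero) n≥3 refl = contradiction n≥3 (λ { (s≤s (s≤s ())) })

fractions : ∀ a b → 0ℚ ℚ.≤ a → a ℚ.< b → b ℚ.≤ 1ℚ → Σ ℕ λ D' → Σ ℕ λ A' → Σ ℕ λ B' → 0 < D' × Dense-data a b D' A' B' × A' < B' × B' ≤ D'
fractions a b 0≤a a<b b≤1 = from (numerator a 0≤a) (numerator b (ℚₚ.≤-trans 0≤a (ℚₚ.<⇒≤ a<b)))
 where
 cross-< : ∀ {α β} → ℚ.↥ a ≡ + α → ℚ.↥ b ≡ + β → α * ℚ.↧ₙ b < β * ℚ.↧ₙ a
 cross-< {α} {β} ↥a ↥b = ℤₚ.drop‿+<+ (subst₂ ℤ._<_ (trans (cong (_*z ℚ.↧ b) ↥a) (sym (ℤₚ.pos-* α (ℚ.↧ₙ b)))) (trans (cong (_*z ℚ.↧ a) ↥b) (sym (ℤₚ.pos-* β (ℚ.↧ₙ a)))) (ℚₚ.drop-*<* a<b))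
 unit : ∀ {β} → ℚ.↥ b ≡ + β → β ≤ ℚ.↧ₙ b
 unit {β} ↥b = ℤₚ.drop‿+≤+ (subst₂ ℤ._≤_ (trans (ℤₚ.*-identityʳ (ℚ.↥ b)) ↥b) (ℤₚ.*-identityˡ (ℚ.↧ b)) (ℚₚ.drop-*≤* b≤1))
 from : (∃ λ α → ℚ.↥ a ≡ + α) → (∃ λ β → ℚ.↥ b ≡ + β) → Σ ℕ λ D' → Σ ℕ λ A' → Σ ℕ λ B' → 0 < D' × Dense-data a b D' A' B' × A' < B' × B' ≤ D'
 from (α , ↥a) (β , ↥b) = ℚ.↧ₙ a * ℚ.↧ₙ b , α * ℚ.↧ₙ b , β * ℚ.↧ₙ a , z<s , (α , β , ↥a , ↥b , refl , refl , refl) , cross-< ↥a ↥b ,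
  ≤-trans (*-monoˡ-≤ (ℚ.↧ₙ a) (unit ↥b)) (≤-reflexive (*-comm (ℚ.↧ₙ b) (ℚ.↧ₙ a)))

theorem1p13 : (n r s : ℕ) → 3 ≤ n → r + s ≡ n →
  (a b : ℚ) → 0ℚ ℚ.≤ a → a ℚ.< b → b ℚ.≤ 1ℚ →
  Σ (QForm n) λ f → InS r s f × DensityIn (D f) a b
theorem1p13 n r s n≥3 r+s≡n a b 0≤a a<b b≤1 = with-fractions (fractions a b 0≤a a<b b≤1)
 where
 with-fractions : (Σ ℕ λ D' → Σ ℕ λ A' → Σ ℕ λ B' → 0 < D' × Dense-data a b D' A' B' × A' < B' × B' ≤ D') → Σ (QForm n) λ f → InS r s f × DensityIn (D f) a b
 -- ℓ > 2D' makes the interval, of length at least 1/D', longer than 2/ℓ as `choose` requires; ℓ > 4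
 -- is used for the conics modulo ℓ and modulo the primes of P.
 with-fractions (D' , A' , B' , D'>0 , data-ab , A'<B' , B'≤D') = with-ℓ (primes-3mod4 (4 + 2 * D'))
  where
  with-ℓ : (∃ λ p → Prime p × p % 4 ≡ 3 × 4 + 2 * D' < p) → Σ (QForm n) λ f → InS r s f × DensityIn (D f) a b
  with-ℓ (ℓ , ℓ-prime , ℓ%4 , ℓ>) = with-n (choose D' A' B' (≤-<-trans (m≤n+m (2 * D') 4) ℓ>) A'<B' B'≤D')
   where
   open PrimeProduct ℓ
   4K : suc ℓ ≡ 4 * suc (ℓ / 4)
   4K = trans (cong suc (trans (m≡m%n+[m/n]*n ℓ 4) (cong (_+ ℓ / 4 * 4) ℓ%4))) (ring36 (ℓ / 4))
   4<ℓ : 4 < ℓ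
   4<ℓ = ≤-<-trans (m≤m+n 4 (2 * D')) ℓ>
   with-n : (∃ λ m → D' * c m < B' * q m × A' * q m * ℓ + D' * q m < D' * c m * ℓ) → Σ (QForm n) λ f → InS r s f × DensityIn (D f) a b
   with-n (m , below , above) = with-σ (nonsplit-all (P>0 m) (squarefree m) (+ ℓ) admissible)
    where
    large : ∀ p → Prime p → p ∣ P m → ℓ < p
    large p pp p∣P = proj₁ (divisors m p pp p∣P)
    admissible : ∀ p → Prime p → p ∣ P m → 2 < p × ¬ + p ∣z + ℓ
    admissible p pp p∣P = <-trans (<-trans (n<1+n 2) (<-trans (n<1+n 3) 4<ℓ)) (large p pp p∣P) ,
     λ d → <⇒≱ (large p pp p∣P) (∣⇒≤ {{prime⇒nonZero ℓ-prime}} (∣z⇒∣ d))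
    with-σ : (∃ λ σ → ∀ p → Prime p → p ∣ P m → Nonsplit (+ ℓ) p σ) → Σ (QForm n) λ f → InS r s f × DensityIn (D f) a b
    with-σ (σ , nonsplit-σ) = Arithmetic.Definite.Selected.goal ℓ (suc (ℓ / 4)) ℓ-prime ℓ%4 4<ℓ 4K (P m) (P>0 m) (squarefree m) large σ nonsplit-σ
     a b D' A' B' D'>0 data-ab above below r s n≥3 r+s≡n
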